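{- For every natural number $n \ge 6$, the determinantal complexity over $\mathbb{C}$ of the polynomial $\sum_{i=1}^n x_i^n \in \mathbb{C}[x_1,\ldots,x_n]$ is at least $1.5n - 3$. That is, if $m \in \mathbb{N}$ and $M \in \mathbb{C}[x_1,\ldots,x_n]^{m\times m}$ is a matrix each of whose entries is a polynomial of degree at most one (an affine function) such that $\mathsf{Det}(M) = \sum_{i=1}^n x_i^n$, then $m \ge 1.5n - 3$.
   Context: $\mathsf{Det}$ denotes the determinant of a square matrix. The determinantal complexity of a polynomial $P \in \mathbb{F}[x_1,\ldots,x_n]$ is the minimum $m \in \mathbb{N}$ such that there is an $m\times m$ matrix $M$ with entries in $\mathbb{F}[x_1,\ldots,x_n]$, each of degree at most one, with $P = \mathsf{Det}(M)$. -}

module Defs where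

open import Level using (Level; _⊔_)
open import Algebra.Bundles using (CommutativeRing)
open import Data.Nat using (ℕ; zero; suc; _∸_; _≤_)
open import Data.Nat as ℕ using ()
open import Data.Fin using (Fin; zero; suc; _≟_)
open import Data.Vec using (Vec; []; _∷_)
open import Data.List using (List; []; _∷_; _++_; map; concatMap; upTo)
open import Data.Product using (_×_; _,_; ∃; Σ)
open import Relation.Nullary using (¬_; yes; no)

module _ {c ℓ : Level} (R : CommutativeRing c ℓ) where
  open CommutativeRing R hiding (zero)

  natCast : ℕ → Carrier
  natCast zero = 0#
  natCast (suc k) = 1# + natCast k

  pow : Carrier → ℕ → Carrier
  pow x zero = 1#
  pow x (suc k) = x * pow x k

  evalMonic : List Carrier → Carrier → Carrier
  evalMonic cs x = go 0 cs
    where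
    go : ℕ → List Carrier → Carrier
    go i [] = pow x i
    go i (a ∷ as) = a * pow x i + go (suc i) as

  record IsAlgClosedFieldChar0 : Set (c ⊔ ℓ) where
    field
      nontrivial   : ¬ (1# ≈ 0#)
      inverse      : ∀ x → ¬ (x ≈ 0#) → ∃ λ y → x * y ≈ 1#
      char0        : ∀ k → ¬ (natCast (suc k) ≈ 0#)
      algClosed    : ∀ (a : Carrier) (cs : List Carrier) → ∃ λ x → evalMonic (a ∷ cs) x ≈ 0#

  -- The polynomial ring K[x_1,...,x_n], represented by coefficient
  -- functions on exponent vectors (monomials); equality is coefficientwise.
  -- Multiplication is the (finite) Cauchy convolution.  Sums and products
  -- of polynomials (finite support) are again polynomials, so this
  -- represents C[x_1..x_n] faithfully (as a subring of formal power series).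

  Mono : ℕ → Set
  Mono n = Vec ℕ n

  Poly : ℕ → Set c
  Poly n = Mono n → Carrier

  _≈P_ : ∀ {n} → Poly n → Poly n → Set ℓ
  p ≈P q = ∀ α → p α ≈ q α

  splits : ∀ {n} → Mono n → List (Mono n × Mono n)
  splits [] = ([] , []) ∷ []
  splits (a ∷ α) =
    concatMap (λ k → map (λ { (β , γ) → (k ∷ β , (a ∸ k) ∷ γ) }) (splits α))
              (upTo (suc a))

  sumL : List Carrier → Carrier
  sumL [] = 0#
  sumL (a ∷ as) = a + sumL as

  0P : ∀ {n} → Poly n
  0P _ = 0#

  totalDeg : ∀ {n} → Mono n → ℕ
  totalDeg [] = 0
  totalDeg (a ∷ α) = a ℕ.+ totalDeg α

  1P : ∀ {n} → Poly n
  1P α with totalDeg α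
  ... | zero = 1#
  ... | suc _ = 0#

  _+P_ : ∀ {n} → Poly n → Poly n → Poly n
  (p +P q) α = p α + q α

  -P_ : ∀ {n} → Poly n → Poly n
  (-P p) α = - (p α)

  _*P_ : ∀ {n} → Poly n → Poly n → Poly n
  (p *P q) α = sumL (map (λ { (β , γ) → p β * q γ }) (splits α))

  unitMono : ∀ {n} → Fin n → Mono n
  unitMono {suc n} zero = 1 ∷ Data.Vec.replicate n 0
  unitMono (suc i) = 0 ∷ unitMono i

  var : ∀ {n} → Fin n → Poly n
  var {suc n} zero (a ∷ α) with a | totalDeg α
  ... | 1 | zero = 1#
  ... | _ | _    = 0#
  var (suc i) (a ∷ α) with a
  ... | zero  = var i α
  ... | suc _ = 0#

  powP : ∀ {n} → Poly n → ℕ → Poly n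
  powP p zero = 1P
  powP p (suc k) = p *P powP p k

  sumFin : ∀ {n} k → (Fin k → Poly n) → Poly n
  sumFin zero f = 0P
  sumFin (suc k) f = f zero +P sumFin k (λ i → f (suc i))

  powerSum : (n : ℕ) → Poly n
  powerSum n = sumFin n (λ i → powP (var i) n)

  DegLe1 : ∀ {n} → Poly n → Set ℓ
  DegLe1 p = ∀ α → 2 ≤ totalDeg α → p α ≈ 0#

  Matrix : ℕ → ℕ → Set c
  Matrix n m = Fin m → Fin m → Poly n

  signed : ∀ {n} → ℕ → Poly n → Poly n
  signed zero p = p
  signed (suc k) p = -P (signed k p)

  Det : ∀ {n m} → Matrix n m → Poly n
  Det {n} {zero} M = 1P
  Det {n} {suc m} M =
    sumFin (suc m) (λ j →
      signed (Data.Fin.toℕ j)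
        (M zero j *P Det {n} {m} (λ r s → M (suc r) (Data.Fin.punchIn j s))))

-- Suppose 2m + 7 ≤ 3n. If M(0) had corank at least two, then for a generic perturbation of M the
-- singular points of det M, at first just the origin, would be cut out by four equations, impossible for n > 4.
-- So after a change of bases M = [[l, u], [v, I + N]] with l, u, v, N linear forms, and comparing degrees in
-- det M(s x) gives u N^k v = 0 for k < n - 2, while u N^(n-2) v is a nonzero multiple of the power sum P.
-- If at some x ≠ 0 both u N^α depends on the earlier u N^i and N^γ v on the earlier N^i v, with α + γ ≤ n - 2,
-- then along every line through x the value of P is a product of two quantities vanishing at x, so the gradient
-- of P vanishes at x, a contradiction. The locus where u, ..., u N^(m-n) are dependent is a determinantal locus
-- of small codimension, hence contains some x₁ ≠ 0, and similarly some x₂ for v. Near x₁ the rows are orthogonal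
-- to independent vectors N^i v, which lowers the codimension of the first locus to m - n + 1, and the same holds for
-- the second near x₂. Since 2(m - n + 1) < n, the two cones meet outside the origin: a contradiction.
-- Codimension is bounded by counting dimensions in power series rings over K, and all existence statements are made
-- up to double negation.
module Submission where

-- Two dimension statements carry the proof: a homogeneous system without nonzero common zeros
-- generates all forms of some degree, and a family cut out near the origin by fewer than n
-- equations for general t cannot specialise at t = 0 to such a system. "After inverting t" is
-- rendered as "after multiplication by a power of t, modulo a high power of (x)". The exponent of t
-- may grow with that precision in an uncontrolled way; the count survives because both of its sides
-- are proportional to the length of the window of t-degrees. Determinants have to be evaluated in
-- series rings and their quotients, so the given identity is first transported to all commutative
-- K-algebras, and a polynomial becomes a rule that can be evaluated in each of them. To bring the
-- two cones to a common point, one is translated by t x₁ and the other by t x₂; at t = 0 both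
-- translations disappear and the original cones return. Independence of vectors is witnessed by a
-- dual system, because such a witness, unlike the absence of relations, carries over to rings with
-- nilpotents.

module RS where
  open import Algebra.Bundles using (CommutativeRing)
  open import Data.Nat as ℕ using (ℕ; zero; suc)
  open import Data.Integer as ℤ using (ℤ; +_; -[1+_]; _⊖_)
  import Data.Integer.Properties as ℤP
  open import Data.Maybe using (Maybe; just; nothing)
  open import Data.Sign as Sign using (Sign)
  import Relation.Binary.PropositionalEquality as ≡
  open import Relation.Nullary using (yes; no)
  open import Algebra.Solver.Ring.AlmostCommutativeRing
    using (AlmostCommutativeRing; fromCommutativeRing; _-Raw-AlmostCommutative⟶_)

  -- Ring solving with integer coefficients

  module IntegerSolver {c ℓ} (R : CommutativeRing c ℓ) where
    open CommutativeRing R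
    open import Algebra.Properties.Ring ring using (-‿distribˡ-*; -‿distribʳ-*)
    open import Algebra.Properties.AbelianGroup +-abelianGroup
      using (⁻¹-∙-comm; ε⁻¹≈ε; ⁻¹-involutive)
    open import Algebra.Properties.Semiring.Mult.TCOptimised semiring
      using (×-homo-+; ×1-homo-*) renaming (_×_ to _×′_)
    open import Algebra.Properties.Monoid.Mult.TCOptimised +-monoid using (1+×)
    open import Relation.Binary.Reasoning.Setoid setoid

    private
      -- The optimised multiple makes `nat 1` reduce to `1#`, so the solver constant for one denotes
      -- `1#` on the nose and the unit law of the morphism is `refl`.
      nat : ℕ → Carrier
      nat n = n ×′ 1#

      int : ℤ → Carrier
      int (+ n) = nat n
      int (-[1+ n ]) = - nat (suc n)

      int-⊖ : ∀ m n → int (m ⊖ n) ≈ nat m - nat n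
      int-⊖ m zero = sym (trans (+-congˡ ε⁻¹≈ε) (+-identityʳ _))
      int-⊖ zero (suc n) = sym (+-identityˡ _)
      int-⊖ (suc m) (suc n) = begin
        int (suc m ⊖ suc n) ≡⟨ ≡.cong int (ℤP.[1+m]⊖[1+n]≡m⊖n m n) ⟩
        int (m ⊖ n) ≈⟨ int-⊖ m n ⟩
        nat m - nat n ≈⟨ +-congʳ (sym (+-identityˡ _)) ⟩
        0# + nat m - nat n ≈⟨ +-congʳ (+-congʳ (sym (-‿inverseʳ 1#))) ⟩
        1# - 1# + nat m - nat n ≈⟨ +-congʳ (trans (+-assoc _ _ _) (+-congˡ (+-comm _ _))) ⟩
        1# + (nat m - 1#) - nat n ≈⟨ +-congʳ (sym (+-assoc _ _ _)) ⟩
        1# + nat m - 1# - nat n ≈⟨ +-assoc _ _ _ ⟩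
        1# + nat m + (- 1# - nat n) ≈⟨ +-cong (sym (1+× m 1#)) (trans (⁻¹-∙-comm _ _) (-‿cong (sym (1+× n 1#)))) ⟩
        nat (suc m) - nat (suc n) ∎

      int-+ : ∀ i j → int (i ℤ.+ j) ≈ int i + int j
      int-+ (+ m) (+ n) = ×-homo-+ 1# m n
      int-+ (+ m) (-[1+ n ]) = int-⊖ m (suc n)
      int-+ (-[1+ m ]) (+ n) = trans (int-⊖ n (suc m)) (+-comm _ _)
      int-+ (-[1+ m ]) (-[1+ n ]) = begin
        - nat (suc (suc (m ℕ.+ n))) ≡⟨ ≡.cong (λ k → - nat (suc k)) (≡.sym (ℕ-suc m n)) ⟩
        - nat (suc m ℕ.+ suc n) ≈⟨ -‿cong (×-homo-+ 1# (suc m) (suc n)) ⟩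
        - (nat (suc m) + nat (suc n)) ≈⟨ sym (⁻¹-∙-comm _ _) ⟩
        - nat (suc m) - nat (suc n) ∎
        where
        ℕ-suc : ∀ m n → m ℕ.+ suc n ≡.≡ suc (m ℕ.+ n)
        ℕ-suc zero n = ≡.refl
        ℕ-suc (suc m) n = ≡.cong suc (ℕ-suc m n)

      int-neg : ∀ i → int (ℤ.- i) ≈ - int i
      int-neg (+ zero) = sym ε⁻¹≈ε
      int-neg (+ suc n) = refl
      int-neg (-[1+ n ]) = sym (⁻¹-involutive _)

      int-◃ : ∀ n → int (Sign.- ℤ.◃ n) ≈ - nat n
      int-◃ zero = sym ε⁻¹≈ε
      int-◃ (suc n) = refl

      int-◃⁺ : ∀ n → int (Sign.+ ℤ.◃ n) ≈ nat n
      int-◃⁺ zero = refl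
      int-◃⁺ (suc n) = refl

      int-* : ∀ i j → int (i ℤ.* j) ≈ int i * int j
      int-* (+ m) (+ n) = trans (int-◃⁺ (m ℕ.* n)) (×1-homo-* m n)
      int-* (+ m) (-[1+ n ]) = trans (int-◃ (m ℕ.* suc n)) (trans (-‿cong (×1-homo-* m (suc n))) (-‿distribʳ-* _ _))
      int-* (-[1+ m ]) (+ n) = trans (int-◃ (suc m ℕ.* n)) (trans (-‿cong (×1-homo-* (suc m) n)) (-‿distribˡ-* _ _))
      int-* (-[1+ m ]) (-[1+ n ]) = begin
        nat (suc m ℕ.* suc n) ≈⟨ ×1-homo-* (suc m) (suc n) ⟩
        nat (suc m) * nat (suc n) ≈⟨ sym (⁻¹-involutive _) ⟩
        - - (nat (suc m) * nat (suc n)) ≈⟨ -‿cong (-‿distribˡ-* _ _) ⟩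
        - (- nat (suc m) * nat (suc n)) ≈⟨ -‿distribʳ-* _ _ ⟩
        - nat (suc m) * - nat (suc n) ∎

      morphism : ℤ.+-*-rawRing -Raw-AlmostCommutative⟶ fromCommutativeRing R
      morphism = record
        { ⟦_⟧ = int ; +-homo = int-+ ; *-homo = int-* ; -‿homo = int-neg
        ; 0-homo = refl ; 1-homo = refl }

      _≟ℤ_ : ∀ i j → Maybe (int i ≈ int j)
      i ≟ℤ j with i ℤ.≟ j
      ... | yes ≡.refl = just refl
      ... | no _ = nothing

    open import Algebra.Solver.Ring ℤ.+-*-rawRing (fromCommutativeRing R) morphism _≟ℤ_ public
      using (solve; _:=_; _:+_; _:*_; _:-_; :-_; con; Polynomial)

    :1 : ∀ {m} → Polynomial m
    :1 = con (+ 1)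
    :0 : ∀ {m} → Polynomial m
    :0 = con (+ 0)

-- Vectors, alternating forms and determinants over a commutative ring

module Lin where
  open RS
  open import Level using (Level; _⊔_)
  open import Algebra.Bundles using (CommutativeRing)
  open import Data.Nat as ℕ using (ℕ; zero; suc; _<_; s≤s)
  open import Data.Fin using (Fin; zero; suc)
  open import Data.Vec using (Vec; []; _∷_; map; lookup)
  open import Data.Vec.Properties using (map-∘)
  open import Data.Unit using (⊤; tt)
  import Relation.Binary.PropositionalEquality as ≡

  module Vectors {c ℓ} (A : CommutativeRing c ℓ) where
    open CommutativeRing A using (Carrier; _≈_; _+_; _*_; -_; _-_; 0#; 1#; refl; sym; trans; setoid; +-cong; +-congˡ; *-cong; *-congˡ; *-congʳ; +-identityˡ; +-identityʳ; *-assoc; *-comm; *-identityˡ; zeroˡ; zeroʳ; distribˡ; distribʳ)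
    open IntegerSolver A using (solve; _:=_; _:+_; _:-_; :-_; :0)
    open import Relation.Binary.Reasoning.Setoid setoid using (begin_; _∎; step-≈-⟩)

    V : ℕ → Set c
    V m = Fin m → Carrier

    -- Sealed so that sums are compared as wholes and not by unfolding; elsewhere they compute only
    -- through lemmas such as `Σ-[]` and `Σ-∷`.
    opaque
      Σ : ∀ {m} → V m → Carrier
      Σ {zero} f = 0#
      Σ {suc m} f = f zero + Σ (λ i → f (suc i))

    infix 4 _≈v_
    infixl 6 _+v_
    infixr 7 _•_
    infixl 8 _·_
    _≈v_ : ∀ {m} → V m → V m → Set ℓ
    u ≈v v = ∀ i → u i ≈ v i
    _+v_ : ∀ {m} → V m → V m → V m
    (u +v v) i = u i + v i
    _•_ : ∀ {m} → Carrier → V m → V m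
    (a • v) i = a * v i
    0v : ∀ {m} → V m
    0v _ = 0#
    _·_ : ∀ {m} → V m → V m → Carrier
    u · v = Σ (λ i → u i * v i)

    δ : ∀ {m} → Fin m → V m
    δ zero zero = 1#
    δ zero (suc j) = 0#
    δ (suc i) zero = 0#
    δ (suc i) (suc j) = δ i j

    δ-sym : ∀ {m} (i j : Fin m) → δ i j ≈ δ j i
    δ-sym zero zero = refl
    δ-sym zero (suc j) = refl
    δ-sym (suc i) zero = refl
    δ-sym (suc i) (suc j) = δ-sym i j

    opaque
      unfolding Σ
      Σ-[] : ∀ (f : V 0) → Σ f ≈ 0#
      Σ-[] f = refl

      Σ-∷ : ∀ {m} (f : V (suc m)) → Σ f ≈ f zero + Σ (λ i → f (suc i))
      Σ-∷ f = refl

      Σ-cong : ∀ {m} {f g : V m} → f ≈v g → Σ f ≈ Σ g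
      Σ-cong {zero} h = refl
      Σ-cong {suc m} h = +-cong (h zero) (Σ-cong (λ i → h (suc i)))

      Σ-0 : ∀ {m} {f : V m} → f ≈v 0v → Σ f ≈ 0#
      Σ-0 {zero} h = refl
      Σ-0 {suc m} h = trans (+-cong (h zero) (Σ-0 (λ i → h (suc i)))) (+-identityˡ 0#)

      Σ-neg : ∀ {m} (f : V m) → Σ (λ i → - f i) ≈ - Σ f
      Σ-neg {zero} f = solve 0 (:0 := :- :0) refl
      Σ-neg {suc m} f = trans (+-congˡ (Σ-neg (λ i → f (suc i)))) (solve 2 (λ a b → :- a :+ :- b := :- (a :+ b)) refl _ _)

      Σ-+ : ∀ {m} (f g : V m) → Σ (λ i → f i + g i) ≈ Σ f + Σ g
      Σ-+ {zero} f g = sym (+-identityˡ 0#)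
      Σ-+ {suc m} f g = trans (+-congˡ (Σ-+ (λ i → f (suc i)) (λ i → g (suc i))))
        (solve 4 (λ a b c d → (a :+ b) :+ (c :+ d) := (a :+ c) :+ (b :+ d)) refl _ _ _ _)

      Σ-*ˡ : ∀ {m} x (f : V m) → x * Σ f ≈ Σ (λ i → x * f i)
      Σ-*ˡ {zero} x f = zeroʳ x
      Σ-*ˡ {suc m} x f = trans (distribˡ x _ _) (+-congˡ (Σ-*ˡ x (λ i → f (suc i))))

      Σ-*ʳ : ∀ {m} x (f : V m) → Σ f * x ≈ Σ (λ i → f i * x)
      Σ-*ʳ {zero} x f = zeroˡ x
      Σ-*ʳ {suc m} x f = trans (distribʳ x _ _) (+-congˡ (Σ-*ʳ x (λ i → f (suc i))))

      Σ-comm : ∀ {k m} (f : Fin k → Fin m → Carrier) →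
               Σ (λ i → Σ (λ j → f i j)) ≈ Σ (λ j → Σ (λ i → f i j))
      Σ-comm {zero} f = sym (Σ-0 {f = λ j → Σ (λ i → f i j)} (λ j → refl))
      Σ-comm {suc k} f = trans (+-congˡ (Σ-comm (λ i → f (suc i)))) (sym (Σ-+ (f zero) (λ j → Σ (λ i → f (suc i) j))))

    ·-cong : ∀ {m} {u u′ v v′ : V m} → u ≈v u′ → v ≈v v′ → u · v ≈ u′ · v′
    ·-cong p q = Σ-cong (λ i → *-cong (p i) (q i))

    ·-comm : ∀ {m} (u v : V m) → u · v ≈ v · u
    ·-comm u v = Σ-cong (λ i → *-comm _ _)

    δ-· : ∀ {m} (j : Fin m) (u : V m) → δ j · u ≈ u j
    δ-· zero u = trans (Σ-∷ _) (trans (+-cong (*-identityˡ _) (Σ-0 (λ i → zeroˡ _))) (+-identityʳ _))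
    δ-· (suc j) u = trans (Σ-∷ _) (trans (+-cong (zeroˡ _) (δ-· j (λ i → u (suc i)))) (+-identityˡ _))

    ·-δ : ∀ {m} (u : V m) (j : Fin m) → u · δ j ≈ u j
    ·-δ u j = trans (·-comm u (δ j)) (δ-· j u)

    ·-+ˡ : ∀ {m} (u v w : V m) → (u +v v) · w ≈ u · w + v · w
    ·-+ˡ u v w = trans (Σ-cong (λ i → distribʳ _ _ _)) (Σ-+ _ _)
    ·-+ʳ : ∀ {m} (u v w : V m) → u · (v +v w) ≈ u · v + u · w
    ·-+ʳ u v w = trans (Σ-cong (λ i → distribˡ _ _ _)) (Σ-+ _ _)
    ·-•ˡ : ∀ {m} a (u v : V m) → (a • u) · v ≈ a * (u · v)
    ·-•ˡ a u v = trans (Σ-cong (λ i → *-assoc _ _ _)) (sym (Σ-*ˡ a _))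
    ·-•ʳ : ∀ {m} a (u v : V m) → u · (a • v) ≈ a * (u · v)
    ·-•ʳ a u v = trans (·-comm u _) (trans (·-•ˡ a v u) (*-congˡ (·-comm v u)))
    ·-0ˡ : ∀ {m} {u : V m} (v : V m) → u ≈v 0v → u · v ≈ 0#
    ·-0ˡ v h = Σ-0 (λ i → trans (*-congʳ (h i)) (zeroˡ _))
    ·-0ʳ : ∀ {m} (u : V m) {v : V m} → v ≈v 0v → u · v ≈ 0#
    ·-0ʳ u h = Σ-0 (λ i → trans (*-congˡ (h i)) (zeroʳ _))

    comb : ∀ {k m} → V k → (Fin k → V m) → V m
    comb z y j = Σ (λ l → z l * y l j)

    comb-· : ∀ {k m} (z : V k) (y : Fin k → V m) (w : V m) → comb z y · w ≈ z · (λ l → y l · w)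
    comb-· z y w = begin
      Σ (λ j → Σ (λ l → z l * y l j) * w j) ≈⟨ Σ-cong (λ j → Σ-*ʳ (w j) _) ⟩
      Σ (λ j → Σ (λ l → z l * y l j * w j)) ≈⟨ Σ-comm _ ⟩
      Σ (λ l → Σ (λ j → z l * y l j * w j)) ≈⟨ Σ-cong (λ l → trans (Σ-cong (λ j → *-assoc _ _ _)) (sym (Σ-*ˡ (z l) _))) ⟩
      Σ (λ l → z l * (y l · w)) ∎

    ·-comb : ∀ {k m} (w : V m) (z : V k) (y : Fin k → V m) → w · comb z y ≈ z · (λ l → w · y l)
    ·-comb w z y = trans (·-comm w _) (trans (comb-· z y w) (Σ-cong (λ l → *-congˡ (·-comm (y l) w))))

  module Alternating {c ℓ} (A : CommutativeRing c ℓ) where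
    open CommutativeRing A using (Carrier; _≈_; _+_; _*_; -_; _-_; 0#; 1#; refl; sym; trans; setoid; +-cong; +-congˡ; +-congʳ; *-congˡ; *-congʳ; -‿cong; +-comm; +-identityˡ; +-identityʳ; *-assoc; *-comm; *-identityˡ; *-identityʳ; zeroˡ; zeroʳ; distribˡ; distribʳ)
    open IntegerSolver A using (solve; _:=_; _:+_; _:*_; _:-_; :-_; :1; :0)
    open Vectors A using (V; _≈v_; _+v_; _•_; 0v; _·_; δ; Σ-[]; Σ-∷; ·-0ʳ; comb)
    open import Relation.Binary.Reasoning.Setoid setoid using (begin_; _∎; step-≈-⟩; step-≡-⟩)

    Form : ℕ → ℕ → Set c
    Form m k = Vec (V m) k → Carrier

    Adjacent : ∀ {m} k → Form m (suc k) → Set (c ⊔ ℓ)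
    Adjacent zero f = Level.Lift _ ⊤
    Adjacent {m} (suc k) f = ∀ (a : V m) (cs : Vec (V m) k) → f (a ∷ a ∷ cs) ≈ 0#

    -- Vanishing is required only when the first two arguments agree; the clause for the tails
    -- supplies every other adjacent pair. Congruence is a field because a form is a bare function
    -- on vectors, which are compared pointwise.
    data Alt {m} : ∀ k → Form m k → Set (c ⊔ ℓ) where
      nil : ∀ {f} → Alt zero f
      cons : ∀ {k f} →
             (∀ {a b} cs → a ≈v b → f (a ∷ cs) ≈ f (b ∷ cs)) →
             (∀ a b cs → f ((a +v b) ∷ cs) ≈ f (a ∷ cs) + f (b ∷ cs)) →
             (∀ t a cs → f ((t • a) ∷ cs) ≈ t * f (a ∷ cs)) →
             (∀ a → Alt k (λ cs → f (a ∷ cs))) →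
             Adjacent k f → Alt (suc k) f

    module _ {m k} {f : Form m (suc k)} where
      head-cong : Alt (suc k) f → ∀ {a b} cs → a ≈v b → f (a ∷ cs) ≈ f (b ∷ cs)
      head-cong (cons p _ _ _ _) = p
      head-+ : Alt (suc k) f → ∀ a b cs → f ((a +v b) ∷ cs) ≈ f (a ∷ cs) + f (b ∷ cs)
      head-+ (cons _ p _ _ _) = p
      head-• : Alt (suc k) f → ∀ t a cs → f ((t • a) ∷ cs) ≈ t * f (a ∷ cs)
      head-• (cons _ _ p _ _) = p
      tail-alt : Alt (suc k) f → ∀ a → Alt k (λ cs → f (a ∷ cs))
      tail-alt (cons _ _ _ p _) = p

    adjacent : ∀ {m k} {f : Form m (suc (suc k))} → Alt (suc (suc k)) f → ∀ a cs → f (a ∷ a ∷ cs) ≈ 0#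
    adjacent (cons _ _ _ _ p) = p

    head-0 : ∀ {m k} {f : Form m (suc k)} → Alt (suc k) f → ∀ {a} cs → a ≈v 0v → f (a ∷ cs) ≈ 0#
    head-0 {f = f} alt {a} cs h = begin
      f (a ∷ cs) ≈⟨ head-cong alt cs (λ i → trans (h i) (sym (zeroˡ _))) ⟩
      f ((0# • a) ∷ cs) ≈⟨ head-• alt 0# a cs ⟩
      0# * f (a ∷ cs) ≈⟨ zeroˡ _ ⟩
      0# ∎

    -- Expanding `f` with `a +v b` in both of the first two slots leaves only the two mixed terms,
    -- and their sum vanishes.
    swap : ∀ {m k} {f : Form m (suc (suc k))} → Alt (suc (suc k)) f →
           ∀ a b cs → f (a ∷ b ∷ cs) ≈ - f (b ∷ a ∷ cs)
    swap {f = f} alt a b cs = begin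
      f (a ∷ b ∷ cs) ≈⟨ solve 2 (λ x y → x := (:0 :+ x) :+ (y :+ :0) :- y) refl _ _ ⟩
      (0# + f (a ∷ b ∷ cs)) + (f (b ∷ a ∷ cs) + 0#) - f (b ∷ a ∷ cs)
        ≈⟨ +-congʳ (+-cong (+-congʳ (sym (adjacent alt a cs))) (+-congˡ (sym (adjacent alt b cs)))) ⟩
      (f (a ∷ a ∷ cs) + f (a ∷ b ∷ cs)) + (f (b ∷ a ∷ cs) + f (b ∷ b ∷ cs)) - f (b ∷ a ∷ cs)
        ≈⟨ +-congʳ (+-cong (sym (head-+ (tail-alt alt a) a b cs)) (sym (head-+ (tail-alt alt b) a b cs))) ⟩
      f (a ∷ (a +v b) ∷ cs) + f (b ∷ (a +v b) ∷ cs) - f (b ∷ a ∷ cs)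
        ≈⟨ +-congʳ (trans (sym (head-+ alt a b _)) (adjacent alt _ cs)) ⟩
      0# - f (b ∷ a ∷ cs) ≈⟨ +-identityˡ _ ⟩
      - f (b ∷ a ∷ cs) ∎

    head-Σ : ∀ {m k l} {f : Form m (suc k)} → Alt (suc k) f → ∀ (z : V l) (y : Fin l → V m) cs →
             f (comb z y ∷ cs) ≈ z · (λ i → f (y i ∷ cs))
    head-Σ {l = zero} alt z y cs = trans (head-0 alt cs (λ _ → Σ-[] _)) (sym (Σ-[] _))
    head-Σ {l = suc l} alt z y cs =
      trans (head-cong alt cs (λ _ → Σ-∷ _))
        (trans (head-+ alt (z zero • y zero) (comb (λ i → z (suc i)) (λ i → y (suc i))) cs)
          (trans (+-cong (head-• alt _ _ cs) (head-Σ alt (λ i → z (suc i)) (λ i → y (suc i)) cs)) (sym (Σ-∷ _))))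

    -- Transpositions carry the first argument past the intermediate ones until the two copies are
    -- adjacent.
    repeated : ∀ {m k} {f : Form m (suc k)} → Alt (suc k) f → ∀ cs i → f (lookup cs i ∷ cs) ≈ 0#
    repeated alt (c ∷ cs) zero = adjacent alt c cs
    repeated {f = f} alt (c ∷ cs) (suc i) = begin
      f (lookup cs i ∷ c ∷ cs) ≈⟨ swap alt _ c cs ⟩
      - f (c ∷ lookup cs i ∷ cs) ≈⟨ -‿cong (repeated (tail-alt alt c) cs i) ⟩
      - 0# ≈⟨ solve 0 (:- :0 := :0) refl ⟩
      0# ∎

    -- The column operation: the added multiples of later columns contribute only values with a
    -- repeated argument.
    add-tail : ∀ {m k} {f : Form m (suc k)} → Alt (suc k) f → ∀ a (z : V k) cs →
               f ((a +v comb z (lookup cs)) ∷ cs) ≈ f (a ∷ cs)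
    add-tail {f = f} alt a z cs = begin
      f ((a +v comb z (lookup cs)) ∷ cs) ≈⟨ head-+ alt a _ cs ⟩
      f (a ∷ cs) + f (comb z (lookup cs) ∷ cs) ≈⟨ +-congˡ (head-Σ alt z (lookup cs) cs) ⟩
      f (a ∷ cs) + z · (λ i → f (lookup cs i ∷ cs)) ≈⟨ +-congˡ (·-0ʳ z (repeated alt cs)) ⟩
      f (a ∷ cs) + 0# ≈⟨ +-identityʳ _ ⟩
      f (a ∷ cs) ∎

    record Linear {m p} (π : V m → V p) : Set (c ⊔ ℓ) where
      field
        l-cong : ∀ {a b} → a ≈v b → π a ≈v π b
        l-+ : ∀ a b → π (a +v b) ≈v π a +v π b
        l-• : ∀ t a → π (t • a) ≈v t • π a
    open Linear public

    alt-map : ∀ {m p k} {π : V m → V p} {f : Form p k} → Linear π → Alt k f → Alt k (λ cs → f (map π cs))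
    alt-map lin nil = nil
    alt-map {π = π} lin (cons {k} p q r s t) = cons
      (λ cs h → p _ (l-cong lin h))
      (λ a b cs → trans (p _ (l-+ lin a b)) (q _ _ _))
      (λ x a cs → trans (p _ (l-• lin x a)) (r _ _ _))
      (λ a → alt-map lin (s (π a)))
      (adj k t)
      where
      adj : ∀ k {f} → Adjacent k f → Adjacent k (λ cs → f (map π cs))
      adj zero _ = Level.lift tt
      adj (suc k) h a cs = h (π a) (map π cs)

    alt-scale : ∀ {m k} t {f : Form m k} → Alt k f → Alt k (λ cs → t * f cs)
    alt-scale t nil = nil
    alt-scale t (cons {k} p q r s u) = cons
      (λ cs h → *-congˡ (p cs h))
      (λ a b cs → trans (*-congˡ (q a b cs)) (distribˡ _ _ _))
      (λ x a cs → trans (*-congˡ (r x a cs)) (solve 3 (λ t x y → t :* (x :* y) := x :* (t :* y)) refl _ _ _))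
      (λ a → alt-scale t (s a))
      (adj k u)
      where
      adj : ∀ k {f} → Adjacent k f → Adjacent k (λ cs → t * f cs)
      adj zero _ = Level.lift tt
      adj (suc k) h a cs = trans (*-congˡ (h a cs)) (zeroʳ t)

    -- The exterior product of a linear functional with an alternating form (Laplace expansion).
    wedge : ∀ {m k} → (V m → Carrier) → Form m k → Form m (suc k)
    wedge {k = zero} φ h (c ∷ []) = φ c * h []
    wedge {k = suc k} φ h (c ∷ cs) = φ c * h cs - wedge φ (λ ds → h (c ∷ ds)) cs

    module _ {m} (φ : V m → Carrier) where
      wedge-cong : ∀ {k} {h h′ : Form m k} → (∀ cs → h cs ≈ h′ cs) → ∀ cs → wedge φ h cs ≈ wedge φ h′ cs
      wedge-cong {zero} p (c ∷ []) = *-congˡ (p [])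
      wedge-cong {suc k} p (c ∷ cs) = +-cong (*-congˡ (p cs)) (-‿cong (wedge-cong (λ ds → p (c ∷ ds)) cs))

      wedge-+ : ∀ {k} (h h′ : Form m k) cs → wedge φ (λ ds → h ds + h′ ds) cs ≈ wedge φ h cs + wedge φ h′ cs
      wedge-+ {zero} h h′ (c ∷ []) = distribˡ _ _ _
      wedge-+ {suc k} h h′ (c ∷ cs) = trans (+-congˡ (-‿cong (wedge-+ _ _ cs)))
        (solve 5 (λ p x y a b → p :* (x :+ y) :- (a :+ b) := (p :* x :- a) :+ (p :* y :- b)) refl _ _ _ _ _)

      wedge-• : ∀ {k} t (h : Form m k) cs → wedge φ (λ ds → t * h ds) cs ≈ t * wedge φ h cs
      wedge-• {zero} t h (c ∷ []) = solve 3 (λ p t x → p :* (t :* x) := t :* (p :* x)) refl _ _ _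
      wedge-• {suc k} t h (c ∷ cs) = trans (+-congˡ (-‿cong (wedge-• t _ cs)))
        (solve 4 (λ p t x a → p :* (t :* x) :- t :* a := t :* (p :* x :- a)) refl _ _ _ _)

      wedge-0 : ∀ {k} {h : Form m k} → (∀ cs → h cs ≈ 0#) → ∀ cs → wedge φ h cs ≈ 0#
      wedge-0 {h = h} p cs = begin
        wedge φ h cs ≈⟨ wedge-cong (λ ds → trans (p ds) (sym (zeroˡ _))) cs ⟩
        wedge φ (λ ds → 0# * h ds) cs ≈⟨ wedge-• 0# h cs ⟩
        0# * wedge φ h cs ≈⟨ zeroˡ _ ⟩
        0# ∎

      -- For two equal leading arguments the first two terms of the expansion cancel, and the third
      -- is the wedge of a form that has already received the equal pair.
      alt-wedge : ∀ {k} {h : Form m k} → (∀ {a b} → a ≈v b → φ a ≈ φ b) → (∀ a b → φ (a +v b) ≈ φ a + φ b) →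
                  (∀ t a → φ (t • a) ≈ t * φ a) → Alt k h → Alt (suc k) (wedge φ h)
      alt-wedge {zero} {h} φc φ+ φ• nil = cons
        (λ { [] p → *-congʳ (φc p) })
        (λ { a b [] → trans (*-congʳ (φ+ a b)) (distribʳ _ _ _) })
        (λ { t a [] → trans (*-congʳ (φ• t a)) (*-assoc _ _ _) })
        (λ _ → nil) (Level.lift tt)
      alt-wedge {suc k} {h} φc φ+ φ• alt = cons
        (λ cs p → +-cong (*-congʳ (φc p)) (-‿cong (wedge-cong (λ ds → head-cong alt ds p) cs)))
        (λ a b cs → trans (+-cong (*-congʳ (φ+ a b))
                      (-‿cong (trans (wedge-cong (λ ds → head-+ alt a b ds) cs) (wedge-+ _ _ cs))))
           (solve 5 (λ p q x a b → (p :+ q) :* x :- (a :+ b) := (p :* x :- a) :+ (q :* x :- b)) refl _ _ _ _ _))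
        (λ t a cs → trans (+-cong (*-congʳ (φ• t a))
                      (-‿cong (trans (wedge-cong (λ ds → head-• alt t a ds) cs) (wedge-• t _ cs))))
           (solve 4 (λ p t x a → t :* p :* x :- t :* a := t :* (p :* x :- a)) refl _ _ _ _))
        (λ a → alt-minus (φ a) alt (alt-wedge φc φ+ φ• (tail-alt alt a)))
        (adj k alt)
        where
        alt-minus : ∀ {k} x {f g : Form m k} → Alt k f → Alt k g → Alt k (λ cs → x * f cs - g cs)
        alt-minus x nil nil = nil
        alt-minus x (cons {k} {f} p q r s t) (cons {f = g} p′ q′ r′ s′ t′) = cons
          (λ cs e → +-cong (*-congˡ (p cs e)) (-‿cong (p′ cs e)))
          (λ a b cs → trans (+-cong (*-congˡ (q a b cs)) (-‿cong (q′ a b cs)))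
            (solve 5 (λ p x y a b → p :* (x :+ y) :- (a :+ b) := (p :* x :- a) :+ (p :* y :- b)) refl _ _ _ _ _))
          (λ w a cs → trans (+-cong (*-congˡ (r w a cs)) (-‿cong (r′ w a cs)))
            (solve 4 (λ p t x a → p :* (t :* x) :- t :* a := t :* (p :* x :- a)) refl _ _ _ _))
          (λ a → alt-minus x (s a) (s′ a))
          (adj₂ k t t′)
          where
          adj₂ : ∀ k {f g} → Adjacent k f → Adjacent k g → Adjacent k (λ cs → x * f cs - g cs)
          adj₂ zero _ _ = Level.lift tt
          adj₂ (suc k) h h′ a cs = trans (+-cong (*-congˡ (h a cs)) (-‿cong (h′ a cs)))
            (solve 1 (λ x → x :* :0 :- :0 := :0) refl _)
        adj : ∀ k {h : Form m (suc k)} → Alt (suc k) h → Adjacent (suc k) (wedge φ h)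
        adj zero {h} alt a [] = solve 2 (λ p x → p :* x :- p :* x := :0) refl _ _
        adj (suc k) {h} alt a cs = begin
          φ a * h (a ∷ cs) - (φ a * h (a ∷ cs) - wedge φ (λ ds → h (a ∷ a ∷ ds)) cs)
            ≈⟨ +-congˡ (-‿cong (+-congˡ (-‿cong (wedge-0 (λ ds → adjacent alt a ds) cs)))) ⟩
          φ a * h (a ∷ cs) - (φ a * h (a ∷ cs) - 0#) ≈⟨ solve 1 (λ x → x :- (x :- :0) := :0) refl _ ⟩
          0# ∎

    drop : ∀ {m} → V (suc m) → V m
    drop v i = v (suc i)
    pad : ∀ {m} → V m → V (suc m)
    pad v zero = 0#
    pad v (suc i) = v i

    -- The vectors are the columns. The expansion runs along coordinate zero, which `drop` removes;
    -- this matches the first-row expansion of `Det`.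
    det : ∀ {m} → Form m m
    det {zero} [] = 1#
    det {suc m} cs = wedge (λ v → v zero) (λ ds → det (map drop ds)) cs

    I : ∀ m → Vec (V m) m
    I zero = []
    I (suc m) = δ zero ∷ map pad (I m)

    drop-linear : ∀ {m} → Linear (drop {m})
    drop-linear = record { l-cong = λ h i → h (suc i) ; l-+ = λ _ _ _ → refl ; l-• = λ _ _ _ → refl }

    pad-linear : ∀ {m} → Linear (pad {m})
    pad-linear = record
      { l-cong = λ { h zero → refl ; h (suc i) → h i }
      ; l-+ = λ { a b zero → sym (+-identityˡ _) ; a b (suc i) → refl }
      ; l-• = λ { t a zero → sym (zeroʳ _) ; t a (suc i) → refl } }

    det-alt : ∀ {m} → Alt m (det {m})
    det-alt {zero} = nil
    det-alt {suc m} = alt-wedge _ (λ h → h zero) (λ _ _ → refl) (λ _ _ → refl) (alt-map drop-linear det-alt)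

    private
      split-head : ∀ {m k} {f : Form (suc m) (suc k)} → Alt (suc k) f → ∀ c cs →
                   f (c ∷ cs) ≈ c zero * f (δ zero ∷ cs) + f (pad (drop c) ∷ cs)
      split-head {f = f} alt c cs = begin
        f (c ∷ cs) ≈⟨ head-cong alt cs (λ { zero → sym (trans (+-identityʳ _) (*-identityʳ _))
                                          ; (suc i) → sym (trans (+-congʳ (zeroʳ _)) (+-identityˡ _)) }) ⟩
        f (((c zero • δ zero) +v pad (drop c)) ∷ cs) ≈⟨ head-+ alt _ _ cs ⟩
        f ((c zero • δ zero) ∷ cs) + f (pad (drop c) ∷ cs) ≈⟨ +-congʳ (head-• alt _ _ cs) ⟩
        c zero * f (δ zero ∷ cs) + f (pad (drop c) ∷ cs) ∎

    -- Each argument is split into its component along `δ zero` and the rest. Terms with two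
    -- components along `δ zero` vanish, and those with exactly one assemble into a wedge.
    expand : ∀ {m k} {f : Form (suc m) (suc k)} → Alt (suc k) f → ∀ cs →
             f cs ≈ f (map pad (map drop cs)) + wedge (λ v → v zero) (λ ds → f (δ zero ∷ map pad (map drop ds))) cs
    expand {k = zero} alt (c ∷ []) = trans (split-head alt c []) (+-comm _ _)
    expand {k = suc k} {f} alt (c ∷ cs) = begin
      f (c ∷ cs) ≈⟨ split-head alt c cs ⟩
      c zero * f (δ zero ∷ cs) + f (pc ∷ cs)
        ≈⟨ +-cong (*-congˡ (trans (expand (tail-alt alt _) cs)
                     (trans (+-congˡ (wedge-0 _ (λ ds → adjacent alt _ _) cs)) (+-identityʳ _))))
             (trans (expand (tail-alt alt pc) cs)
               (+-congˡ (trans (wedge-cong _ (λ ds → trans (swap alt _ _ _) (solve 1 (λ x → :- x := (:- :1) :* x) refl _)) cs)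
                               (wedge-• _ (- 1#) _ cs)))) ⟩
      c zero * f (δ zero ∷ cs′) + (f (pc ∷ cs′) + (- 1#) * wedge _ (λ ds → f (δ zero ∷ pc ∷ map pad (map drop ds))) cs)
        ≈⟨ solve 3 (λ x y z → x :+ (y :+ (:- :1) :* z) := y :+ (x :- z)) refl _ _ _ ⟩
      f (pc ∷ cs′) + (c zero * f (δ zero ∷ cs′) - wedge _ (λ ds → f (δ zero ∷ pc ∷ map pad (map drop ds))) cs) ∎
      where
      pc = pad (drop c)
      cs′ = map pad (map drop cs)

    -- Induction on the dimension: both summands of `expand` are forms on a space of one dimension
    -- less that still take too many arguments.
    too-many : ∀ {m k} {f : Form m k} → m < k → Alt k f → ∀ cs → f cs ≈ 0#
    too-many {zero} {suc k} _ alt (c ∷ cs) = head-0 alt cs (λ ())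
    too-many {suc m} {suc k} {f} (s≤s m<k) alt cs = trans (expand alt cs)
      (trans (+-cong
        (too-many (ℕ.s≤s (<⇒≤ m<k)) (alt-map pad-linear alt) (map drop cs))
        (wedge-0 _ (λ ds → too-many m<k (alt-map pad-linear (tail-alt alt (δ zero))) (map drop ds)) cs))
        (+-identityˡ 0#))
      where open import Data.Nat.Properties using (<⇒≤)

    -- In `expand` the part without `δ zero` has too many arguments for its space, and what remains
    -- repeats the recursion of `det`. Multiplicativity of the determinant will be drawn from this
    -- uniqueness.
    det-unique : ∀ {m} {f : Form m m} → Alt m f → ∀ cs → f cs ≈ det cs * f (I m)
    det-unique {zero} alt [] = sym (*-identityˡ _)
    det-unique {suc m} {f} alt cs = begin
      f cs ≈⟨ expand alt cs ⟩
      f (map pad (map drop cs)) + wedge _ (λ ds → f (δ zero ∷ map pad (map drop ds))) cs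
        ≈⟨ +-cong (too-many (ℕ.s≤s ≤-refl) (alt-map pad-linear alt) (map drop cs))
            (wedge-cong _ (λ ds → trans (det-unique (alt-map pad-linear (tail-alt alt (δ zero))) (map drop ds)) (*-comm _ _)) cs) ⟩
      0# + wedge _ (λ ds → f (I (suc m)) * det (map drop ds)) cs ≈⟨ trans (+-identityˡ _) (wedge-• _ _ _ cs) ⟩
      f (I (suc m)) * det cs ≈⟨ *-comm _ _ ⟩
      det cs * f (I (suc m)) ∎
      where open import Data.Nat.Properties using (≤-refl)

    alt-cong : ∀ {m k} {f : Form m k} → Alt k f → ∀ {cs ds} → (∀ i → lookup cs i ≈v lookup ds i) → f cs ≈ f ds
    alt-cong nil {[]} {[]} h = refl
    alt-cong alt@(cons _ _ _ _ _) {c ∷ cs} {d ∷ ds} h =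
      trans (head-cong alt cs (h zero)) (alt-cong (tail-alt alt d) (λ i → h (suc i)))

    det-I : ∀ m → det (I m) ≈ 1#
    det-I zero = refl
    det-I (suc m) = begin
      wedge _ (λ ds → det (map drop ds)) (δ zero ∷ map pad (I m)) ≈⟨ lemma {h = det} (I m) ⟩
      det (I m) ≈⟨ det-I m ⟩
      1# ∎
      where
      wedge-pad : ∀ {k} (h : Form (suc m) k) (cs : Vec (V m) (suc k)) → wedge (λ v → v zero) h (map pad cs) ≈ 0#
      wedge-pad {zero} h (c ∷ []) = zeroˡ _
      wedge-pad {suc k} h (c ∷ cs) = trans (+-cong (zeroˡ _) (-‿cong (wedge-pad _ cs))) (solve 0 (:0 :- :0 := :0) refl)
      lemma : ∀ {k} {h : Form m k} (cs : Vec (V m) k) →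
              wedge (λ v → v zero) (λ ds → h (map drop ds)) (δ zero ∷ map pad cs) ≈ h cs
      lemma {zero} {h} [] = *-identityˡ _
      lemma {suc k} {h} cs = begin
        1# * h (map drop (map pad cs)) - wedge _ _ (map pad cs) ≈⟨ +-cong (*-identityˡ _) (-‿cong (wedge-pad _ cs)) ⟩
        h (map drop (map pad cs)) - 0# ≈⟨ trans (+-congˡ (solve 0 (:- :0 := :0) refl)) (+-identityʳ _) ⟩
        h (map drop (map pad cs)) ≡⟨ ≡.cong h (≡.sym (map-∘ drop pad cs)) ⟩
        h (map (λ v → drop (pad v)) cs) ≡⟨ ≡.cong h (Data.Vec.Properties.map-id cs) ⟩
        h cs ∎

-- Linear algebra over a field with stable equality

module LA where
  open RS
  open Lin
  open import Level using (_⊔_)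
  open import Algebra.Bundles using (CommutativeRing)
  open import Data.Nat as ℕ using (ℕ; zero; suc; _<_; _≤_; s≤s)
  import Data.Nat.Properties as ℕP
  open import Data.Fin using (Fin; zero; suc; punchIn)
  open import Data.Vec using (Vec; []; _∷_; lookup; _++_)
  open import Data.List as List using (List; []; _∷_; length)
  open import Data.List.Relation.Unary.All using (All; []; _∷_)
  open import Data.Sum using (_⊎_; inj₁; inj₂)
  open import Data.Product using (_×_; _,_; ∃; ∃₂)
  open import Data.Empty using (⊥)
  open import Relation.Nullary using (¬_)
  import Relation.Binary.PropositionalEquality as ≡

  -- Equality is not decidable here, only stable under double negation, so a case distinction on it
  -- is available when the goal is negated or stable.
  record StableField {c κ} (K : CommutativeRing c κ) : Set (c ⊔ κ) where
    open CommutativeRing K using (_≈_; _*_; 0#; 1#)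
    field
      ¬¬-elim : ∀ {x y} → ¬ ¬ (x ≈ y) → x ≈ y
      1≉0 : ¬ (1# ≈ 0#)
      inverse : ∀ x → ¬ (x ≈ 0#) → ∃ λ y → x * y ≈ 1#

  module LinearAlgebra {c κ} (K : CommutativeRing c κ) (F : StableField K) where
    open CommutativeRing K using (Carrier; _≈_; _+_; _*_; -_; _-_; 0#; 1#; refl; sym; trans; reflexive; setoid; +-cong; +-congˡ; +-congʳ; *-congˡ; *-congʳ; -‿cong; +-identityˡ; +-identityʳ; *-assoc; *-comm; *-identityˡ; zeroˡ; zeroʳ; -‿inverseˡ)
    open StableField F
    open IntegerSolver K using (solve; _:=_; _:+_; _:*_; _:-_; :-_; :1; :0)
    open Vectors K using (V; _≈v_; _+v_; _•_; 0v; _·_; δ; δ-sym; Σ-∷; Σ-cong; ·-cong; ·-comm; δ-·; ·-δ; ·-+ˡ; ·-+ʳ; ·-•ˡ; ·-•ʳ; ·-0ˡ; ·-0ʳ; comb; comb-·; ·-comb)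
    open import Relation.Binary.Reasoning.Setoid setoid using (begin_; _∎; step-≈-⟩)

    x-0 : ∀ {x y} → x - y ≈ 0# → x ≈ y
    x-0 h = trans (solve 2 (λ x y → x := (x :- y) :+ y) refl _ _) (trans (+-congʳ h) (+-identityˡ _))

    nonzero-* : ∀ {x y} → ¬ (x ≈ 0#) → ¬ (y ≈ 0#) → ¬ (x * y ≈ 0#)
    nonzero-* {x} {y} p q h with inverse x p
    ... | x′ , e = q (trans (sym (*-identityˡ y)) (trans (*-congʳ (trans (sym e) (*-comm _ _)))
                     (trans (*-assoc _ _ _) (trans (*-congˡ h) (zeroʳ _)))))

    all-or-some : ∀ {m} (v : V m) → ¬ ¬ ((v ≈v 0v) ⊎ ∃ λ i → ¬ (v i ≈ 0#))
    all-or-some v n = n (inj₁ (λ i → ¬¬-elim (λ h → n (inj₂ (i , h)))))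

    insert : ∀ {m} → Fin (suc m) → Carrier → V m → V (suc m)
    insert zero a v zero = a
    insert zero a v (suc j) = v j
    insert {suc m} (suc i) a v zero = v zero
    insert {suc m} (suc i) a v (suc j) = insert i a (λ l → v (suc l)) j

    insert-punchIn : ∀ {m} (i : Fin (suc m)) a (v : V m) j → insert i a v (punchIn i j) ≈ v j
    insert-punchIn zero a v j = refl
    insert-punchIn (suc i) a v zero = refl
    insert-punchIn (suc i) a v (suc j) = insert-punchIn i a (λ l → v (suc l)) j

    ·-insert : ∀ {m} (i : Fin (suc m)) a (v : V m) s → s · insert i a v ≈ s i * a + (λ j → s (punchIn i j)) · v
    ·-insert zero a v s = Σ-∷ _
    ·-insert {suc m} (suc i) a v s = trans (Σ-∷ _) (trans (+-congˡ (·-insert i a (λ l → v (suc l)) (λ j → s (suc j))))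
      (trans (solve 3 (λ x y z → x :+ (y :+ z) := y :+ (x :+ z)) refl _ _ _) (+-congˡ (sym (Σ-∷ _)))))

    private
     -- Gaussian elimination: a zero row is dropped, a row with a nonzero entry `i` removes unknown
     -- `i` from the other rows, and `a v` restores that unknown by back substitution. The bound `q`
     -- on the number of rows carries the recursion, since the rows themselves are rewritten.
     solve-rows : ∀ q {L} (rows : List (V L)) → length rows ≤ q → q < L →
      ¬ ¬ (∃ λ (v : V L) → (∃ λ i → ¬ (v i ≈ 0#)) × All (λ r → r · v ≈ 0#) rows)
     solve-rows q {suc L} [] _ _ n = n (δ zero , (zero , 1≉0) , [])
     solve-rows (suc q) {suc L} (r ∷ rs) (s≤s le) (s≤s lt) n = all-or-some r λ
      { (inj₁ z) → solve-rows q rs le (ℕP.m≤n⇒m≤1+n lt) λ { (v , nz , al) → n (v , nz , ·-0ˡ v z ∷ al) }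
      ; (inj₂ (i , ri)) → pivot i ri (inverse (r i) ri) }
      where
      pivot : ∀ i → ¬ (r i ≈ 0#) → (∃ λ y → r i * y ≈ 1#) → ⊥
      pivot i _ (y , e) = solve-rows q (List.map red rs) (ℕP.≤-trans (ℕP.≤-reflexive (length-map red rs)) le) lt
        λ { (v , (j , vj) , al) → n (insert i (a v) v , (punchIn i j , λ h → vj (trans (sym (insert-punchIn i _ v j)) h)) , own v ∷ others v rs al) }
        where
        open import Data.List.Properties using (length-map)
        r′ : V L
        r′ j = r (punchIn i j)
        red : V (suc L) → V L
        red s = (λ j → s (punchIn i j)) +v (- (s i * y) • r′)
        a : V L → Carrier
        a v = - (y * (r′ · v))
        own : ∀ v → r · insert i (a v) v ≈ 0#
        own v = begin
          r · insert i (a v) v ≈⟨ ·-insert i (a v) v r ⟩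
          r i * - (y * (r′ · v)) + r′ · v ≈⟨ solve 3 (λ r y z → r :* (:- (y :* z)) :+ z := (:- (r :* y) :+ :1) :* z) refl _ _ _ ⟩
          (- (r i * y) + 1#) * (r′ · v) ≈⟨ *-congʳ (trans (+-congʳ (-‿cong e)) (-‿inverseˡ _)) ⟩
          0# * (r′ · v) ≈⟨ zeroˡ _ ⟩
          0# ∎
        other : ∀ v s → red s · v ≈ 0# → s · insert i (a v) v ≈ 0#
        other v s h = begin
          s · insert i (a v) v ≈⟨ ·-insert i (a v) v s ⟩
          s i * - (y * (r′ · v)) + (λ j → s (punchIn i j)) · v
            ≈⟨ solve 4 (λ s y r x → s :* (:- (y :* r)) :+ x := x :+ (:- (s :* y)) :* r) refl _ _ _ _ ⟩
          (λ j → s (punchIn i j)) · v + (- (s i * y)) * (r′ · v) ≈⟨ +-congˡ (sym (·-•ˡ _ r′ v)) ⟩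
          (λ j → s (punchIn i j)) · v + (- (s i * y) • r′) · v ≈⟨ sym (·-+ˡ _ _ v) ⟩
          red s · v ≈⟨ h ⟩
          0# ∎
        others : ∀ v ss → All (λ s → s · v ≈ 0#) (List.map red ss) → All (λ s → s · insert i (a v) v ≈ 0#) ss
        others v [] [] = []
        others v (s ∷ ss) (h ∷ hs) = other v s h ∷ others v ss hs

    underdetermined : ∀ {L} (rows : List (V L)) → length rows < L →
      ¬ ¬ (∃ λ (v : V L) → (∃ λ i → ¬ (v i ≈ 0#)) × All (λ r → r · v ≈ 0#) rows)
    underdetermined rows = solve-rows (length rows) rows ℕP.≤-refl

    module Pairing {m p} (M : Fin m → V p) where
      β : V m → V p → Carrier
      β λ′ y = λ′ · (λ s → M s · y)

      β-congˡ : ∀ {a b} y → a ≈v b → β a y ≈ β b y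
      β-congˡ y h = ·-cong h (λ _ → refl)
      β-combˡ : ∀ {l} (z : V l) (a : Fin l → V m) y → β (comb z a) y ≈ z · (λ i → β (a i) y)
      β-combˡ z a y = comb-· z a _
      β-combʳ : ∀ {l} a (z : V l) (y : Fin l → V p) → β a (comb z y) ≈ z · (λ i → β a (y i))
      β-combʳ a z y = trans (·-cong (λ _ → refl) (λ s → ·-comb (M s) z y))
        (trans (·-cong (λ _ → refl) (λ s → Σ-cong (λ i → *-congˡ refl))) (trans (·-cong (λ _ → refl) (λ s → refl)) (·-comb a z (λ i s → M s · y i))))
      β-+ˡ : ∀ a b y → β (a +v b) y ≈ β a y + β b y
      β-+ˡ a b y = ·-+ˡ a b _
      β-+ʳ : ∀ a x y → β a (x +v y) ≈ β a x + β a y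
      β-+ʳ a x y = trans (·-cong (λ _ → refl) (λ s → ·-+ʳ (M s) x y)) (·-+ʳ a _ _)
      β-•ˡ : ∀ t a y → β (t • a) y ≈ t * β a y
      β-•ˡ t a y = ·-•ˡ t a _
      β-•ʳ : ∀ t a y → β a (t • y) ≈ t * β a y
      β-•ʳ t a y = trans (·-cong (λ _ → refl) (λ s → ·-•ʳ t (M s) y)) (·-•ʳ t a _)

      Dual : ∀ {k} → Vec (V m) k → Vec (V p) k → Set κ
      Dual Λ Y = ∀ i j → β (lookup Λ i) (lookup Y j) ≈ δ i j

      -- With `k > m` the vectors `Λ` satisfy a nontrivial relation; pairing it with each `Y j`
      -- shows that all of its coefficients vanish.
      dual-size : ∀ {k} {Λ : Vec (V m) k} {Y} → Dual Λ Y → k ≤ m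
      dual-size {k} {Λ} {Y} D = ℕP.≮⇒≥ λ lt →
        underdetermined (List.tabulate {n = m} (λ s i → lookup Λ i s))
          (ℕP.≤-trans (ℕP.≤-reflexive (≡.cong suc (length-tabulate {n = m} _))) lt)
          λ { (v , (j , vj) , al) → vj (begin
                v j ≈⟨ sym (·-δ v j) ⟩
                v · δ j ≈⟨ ·-cong (λ _ → refl) (λ i → trans (δ-sym j i) (sym (D i j))) ⟩
                v · (λ i → β (lookup Λ i) (lookup Y j)) ≈⟨ sym (β-combˡ v (lookup Λ) _) ⟩
                β (comb v (lookup Λ)) (lookup Y j) ≈⟨ β-congˡ _ (λ s → trans (·-comm v _) (All-lookup al s)) ⟩
                β 0v (lookup Y j) ≈⟨ ·-0ˡ _ (λ _ → refl) ⟩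
                0# ∎) }
        where
        open import Data.List.Properties using (length-tabulate)
        All-lookup : ∀ {q} {f : Fin q → V k} {v} → All (λ r → r · v ≈ 0#) (List.tabulate f) → ∀ s → f s · v ≈ 0#
        All-lookup (h ∷ _) zero = h
        All-lookup (_ ∷ hs) (suc s) = All-lookup hs s

      -- The Schur complement: what is left of `M` after removing the part of rank `k` seen by the
      -- dual system.
      residual : ∀ {k} → Vec (V m) k → Vec (V p) k → Fin m → V p
      residual Λ Y s t = β (δ s) (δ t) - (λ l → β (δ s) (lookup Y l)) · (λ l → β (lookup Λ l) (δ t))

      -- Projecting `δ s` and `δ t` away from the dual system gives two vectors whose pairing is
      -- exactly the residual entry; if that is nonzero, it can be scaled to one.
      extend-dual : ∀ {k} {Λ : Vec (V m) k} {Y} → Dual Λ Y → ∀ s t → ¬ (residual Λ Y s t ≈ 0#) →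
                    ∃₂ λ a y → Dual (a ∷ Λ) (y ∷ Y)
      extend-dual {Λ = Λ} {Y} D s t nz with inverse _ nz
      ... | ρ , e = a , ρ • y , λ
        { zero zero → trans (β-•ʳ ρ a y) (trans (*-comm _ _) (trans (*-congʳ ay) e))
        ; zero (suc j) → aY j
        ; (suc i) zero → trans (β-•ʳ ρ _ y) (trans (*-congˡ (Λy i)) (zeroʳ _))
        ; (suc i) (suc j) → D i j }
        where
        za = λ l → β (δ s) (lookup Y l)
        zy = λ l → β (lookup Λ l) (δ t)
        a = δ s +v (- 1# • comb za (lookup Λ))
        y = δ t +v (- 1# • comb zy (lookup Y))
        minus : ∀ {x y} → x ≈ y → x + (- 1#) * y ≈ 0#
        minus h = trans (+-congʳ h) (solve 1 (λ x → x :+ (:- :1) :* x := :0) refl _)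
        aY : ∀ j → β a (lookup Y j) ≈ 0#
        aY j = trans (β-+ˡ _ _ _) (trans (+-congˡ (trans (β-•ˡ _ _ _) (*-congˡ
          (trans (β-combˡ za (lookup Λ) _) (trans (·-cong (λ _ → refl) (λ i → trans (D i j) (δ-sym i j))) (·-δ za j)))))) (minus refl))
        Λy : ∀ i → β (lookup Λ i) y ≈ 0#
        Λy i = trans (β-+ʳ _ _ _) (trans (+-congˡ (trans (β-•ʳ _ _ _) (*-congˡ
          (trans (β-combʳ _ zy (lookup Y)) (trans (·-cong (λ _ → refl) (λ j → D i j)) (·-δ zy i)))))) (minus refl))
        ay : β a y ≈ residual Λ Y s t
        ay = trans (β-+ʳ a _ _) (trans (+-cong
          (trans (β-+ˡ _ _ _) (+-congˡ (trans (β-•ˡ _ _ _) (*-congˡ (β-combˡ za (lookup Λ) _)))))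
          (trans (β-•ʳ _ _ _) (*-congˡ (trans (β-combʳ a zy (lookup Y)) (·-0ʳ zy aY)))))
          (solve 2 (λ x w → (x :+ (:- :1) :* w) :+ (:- :1) :* :0 := x :- w) refl _ _))

      Maximal : ∀ {k} → Vec (V m) k → Vec (V p) k → Set (c ⊔ κ)
      Maximal Λ Y = ∃ λ c → ∃₂ λ (Λ⁺ : Vec (V m) c) (Y⁺ : Vec (V p) c) → Dual (Λ⁺ ++ Λ) (Y⁺ ++ Y) ×
             (∀ s t → residual (Λ⁺ ++ Λ) (Y⁺ ++ Y) s t ≈ 0#)

      maximal-dual : ∀ {k} {Λ : Vec (V m) k} {Y} → Dual Λ Y → ¬ ¬ Maximal Λ Y
      -- By `dual-size` a dual system has at most `m` members, so `suc m` steps of fuel cannot be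
      -- exhausted.
      maximal-dual {k} {Λ} {Y} D = go (suc m) [] [] D (ℕP.m≤n+m (suc m) _)
        where
        go : ∀ fuel {c} (Λ⁺ : Vec (V m) c) (Y⁺ : Vec (V p) c) → Dual (Λ⁺ ++ Λ) (Y⁺ ++ Y) → m < (c ℕ.+ k) ℕ.+ fuel → ¬ ¬ Maximal Λ Y
        go zero Λ⁺ Y⁺ D lt n = ℕP.<⇒≱ lt (ℕP.≤-trans (ℕP.≤-reflexive (ℕP.+-identityʳ _)) (dual-size {Λ = Λ⁺ ++ Λ} {Y = Y⁺ ++ Y} D))
        go (suc fuel) {c} Λ⁺ Y⁺ D lt n = n (c , Λ⁺ , Y⁺ , D , λ s t → ¬¬-elim λ h → step (extend-dual {Λ = Λ⁺ ++ Λ} {Y = Y⁺ ++ Y} D s t h))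
          where
          step : (∃₂ λ a y → Dual (a ∷ Λ⁺ ++ Λ) (y ∷ Y⁺ ++ Y)) → ⊥
          step (a , y , D′) = go fuel (a ∷ Λ⁺) (y ∷ Y⁺) D′ (ℕP.≤-trans lt (ℕP.≤-reflexive (ℕP.+-suc _ _))) n

      -- A rank factorisation: with vanishing residual, `M` is the product of the columns `M Y` with
      -- the rows `Λ M`.
      residual-0 : ∀ {k} {Λ : Vec (V m) k} {Y} → (∀ s t → residual Λ Y s t ≈ 0#) →
                   ∀ s t → M s t ≈ (λ l → M s · lookup Y l) · (λ l → β (lookup Λ l) (δ t))
      residual-0 h s t = trans (sym (trans (δ-· s _) (·-δ (M s) t))) (trans (x-0 (h s t)) (·-cong (λ l → δ-· s _) (λ _ → refl)))

    module Dot m = Pairing {m} {m} δ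

    β≈· : ∀ {m} (a b : V m) → Dot.β m a b ≈ a · b
    β≈· a b = ·-cong (λ _ → refl) (λ s → δ-· s b)

    Dual : ∀ {m k} → Vec (V m) k → Vec (V m) k → Set κ
    Dual Λ Y = ∀ i j → lookup Λ i · lookup Y j ≈ δ i j

    -- A pair of dual bases; `complete` is the resolution of the identity and says that nothing is
    -- missing.
    record Frame {m k} (Λ Y : Vec (V m) k) : Set (c ⊔ κ) where
      field
        dual : Dual Λ Y
        complete : ∀ s t → δ s t ≈ (λ l → lookup Y l s) · (λ l → lookup Λ l t)

    -- For the identity matrix, the vanishing residual of a maximal dual system is precisely the
    -- completeness relation.
    complete-frame : ∀ {m k} {Λ Y : Vec (V m) k} → Dual Λ Y →
      ¬ ¬ (∃ λ c → ∃₂ λ (Λ⁺ Y⁺ : Vec (V m) c) → Frame (Λ⁺ ++ Λ) (Y⁺ ++ Y))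
    complete-frame {m} {Λ = Λ} {Y} D n = Dot.maximal-dual m {Λ = Λ} {Y} (λ i j → trans (β≈· _ _) (D i j)) λ
      { (c , Λ⁺ , Y⁺ , D′ , r) → n (c , Λ⁺ , Y⁺ , record
          { dual = λ i j → trans (sym (β≈· _ _)) (D′ i j)
          ; complete = λ s t → trans (Dot.residual-0 m {Λ = Λ⁺ ++ Λ} {Y⁺ ++ Y} r s t)
              (·-cong (λ l → δ-· s _) (λ l → trans (β≈· _ _) (·-δ _ t))) }) }

    dual-size : ∀ {m k} {Λ Y : Vec (V m) k} → Dual Λ Y → k ≤ m
    dual-size {m} {Λ = Λ} {Y} D = Dot.dual-size m {Λ = Λ} {Y} (λ i j → trans (β≈· _ _) (D i j))

    -- Completeness makes the transposed lists of coordinates dual as well, so the size bound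
    -- applies in both directions.
    frame-size : ∀ {m k} {Λ Y : Vec (V m) k} → Frame Λ Y → k ≡.≡ m
    frame-size {m} {k} {Λ} {Y} Fr = ℕP.≤-antisym (dual-size {Λ = Λ} {Y} dual)
      (dual-size {Λ = Data.Vec.tabulate (λ s l → lookup Y l s)} {Data.Vec.tabulate (λ t l → lookup Λ l t)}
        (λ s t → trans (·-cong (λ l → reflexive (≡.cong (λ (v : V k) → v l) (lookup∘tabulate (λ s l → lookup Y l s) s)))
                               (λ l → reflexive (≡.cong (λ (v : V k) → v l) (lookup∘tabulate (λ t l → lookup Λ l t) t)))) (sym (complete s t))))
      where
      open Frame Fr
      open import Data.Vec.Properties using (lookup∘tabulate)

    -- `ω` is `w` minus its expansion through the dual system. A nonzero entry of `ω` furnishes a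
    -- dual vector for `w`; without one, the expansion is the desired combination.
    grow : ∀ {m k} {Z C : Vec (V m) k} → Dual Z C → ∀ w →
           ¬ ¬ ((∃ λ C′ → Dual (w ∷ Z) C′) ⊎ (w ≈v comb (λ l → w · lookup C l) (lookup Z)))
    grow {m} {Z = Z} {C} D w n = n (inj₂ λ s → ¬¬-elim λ h → n (inj₁ (new s (λ e → h (x-0 e)))))
      where
      z = λ l → w · lookup C l
      ω : V m
      ω s = w s - comb z (lookup Z) s
      new : ∀ s → ¬ (ω s ≈ 0#) → ∃ λ C′ → Dual (w ∷ Z) C′
      new s nz with inverse _ nz
      ... | ρ , e = (ρ • d) ∷ Data.Vec.map (λ v → v +v (- (w · v) • (ρ • d))) C , λ
        { zero zero → wd
        ; zero (suc j) → trans (·-cong (λ _ → refl) (λ t → reflexive (≡.cong (λ (v : V m) → v t) (lookup-map j _ C))))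
            (trans (·-+ʳ w _ _) (trans (+-congˡ (trans (·-•ʳ _ w _) (*-congˡ wd))) (solve 1 (λ x → x :+ (:- x) :* :1 := :0) refl _)))
        ; (suc i) zero → Zd i
        ; (suc i) (suc j) → trans (·-cong (λ _ → refl) (λ t → reflexive (≡.cong (λ (v : V m) → v t) (lookup-map j _ C))))
            (trans (·-+ʳ _ _ _) (trans (+-cong (D i j) (trans (·-•ʳ _ _ _) (trans (*-congˡ (Zd i)) (zeroʳ _)))) (+-identityʳ _))) }
        where
        open import Data.Vec.Properties using (lookup-map)
        d = δ s +v (- 1# • comb (λ l → lookup Z l s) (lookup C))
        minus : ∀ {x y} → x ≈ y → x + (- 1#) * y ≈ 0#
        minus h = trans (+-congʳ h) (solve 1 (λ x → x :+ (:- :1) :* x := :0) refl _)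
        Zd : ∀ i → lookup Z i · (ρ • d) ≈ 0#
        Zd i = trans (·-•ʳ ρ _ d) (trans (*-congˡ (trans (·-+ʳ _ _ _) (trans (+-cong (·-δ _ s) (trans (·-•ʳ _ _ _)
          (*-congˡ (trans (·-comb _ _ (lookup C)) (trans (·-cong (λ _ → refl) (λ j → D i j)) (·-δ _ i)))))) (minus refl)))) (zeroʳ _))
        wd : w · (ρ • d) ≈ 1#
        wd = begin
          w · (ρ • d) ≈⟨ ·-•ʳ ρ w d ⟩
          ρ * (w · d) ≈⟨ *-congˡ (trans (·-+ʳ w _ _) (+-cong (·-δ w s) (trans (·-•ʳ _ w _) (*-congˡ (trans (·-comb w _ (lookup C)) (·-comm _ z)))))) ⟩
          ρ * (w s + (- 1#) * (z · (λ l → lookup Z l s))) ≈⟨ solve 3 (λ ρ w x → ρ :* (w :+ (:- :1) :* x) := (w :- x) :* ρ) refl _ _ _ ⟩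
          ω s * ρ ≈⟨ e ⟩
          1# ∎

-- Power series, quotients and commutative algebras over K

module KAlg where
  open RS
  open import Level using (_⊔_) renaming (suc to lsuc)
  open import Algebra.Bundles using (CommutativeRing)
  open import Data.Nat using (ℕ; zero; suc)
  open import Data.Fin using (Fin; zero; suc)
  open import Data.Product using (_×_; _,_; ∃)
  open import Relation.Binary using (IsEquivalence)
  open import Algebra.Structures using (IsCommutativeRing)

  mkIsCommutativeRing : ∀ {c ℓ} {C : Set c} (_≈_ : C → C → Set ℓ) (_+_ _*_ : C → C → C) (-_ : C → C) (0# 1# : C) →
    IsEquivalence _≈_ →
    (∀ {x x′ y y′} → x ≈ x′ → y ≈ y′ → (x + y) ≈ (x′ + y′)) →
    (∀ x y z → ((x + y) + z) ≈ (x + (y + z))) →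
    (∀ x y → (x + y) ≈ (y + x)) →
    (∀ x → (0# + x) ≈ x) →
    (∀ {x x′} → x ≈ x′ → (- x) ≈ (- x′)) →
    (∀ x → ((- x) + x) ≈ 0#) →
    (∀ {x x′ y y′} → x ≈ x′ → y ≈ y′ → (x * y) ≈ (x′ * y′)) →
    (∀ x y z → ((x * y) * z) ≈ (x * (y * z))) →
    (∀ x y → (x * y) ≈ (y * x)) →
    (∀ x → (1# * x) ≈ x) →
    (∀ x y z → (x * (y + z)) ≈ ((x * y) + (x * z))) →
    IsCommutativeRing _≈_ _+_ _*_ -_ 0# 1#
  mkIsCommutativeRing _≈_ _+_ _*_ -_ 0# 1# eq +c +a +m +i -c -i *c *a *m *i d = record
    { isRing = record
      { +-isAbelianGroup = record
        { isGroup = record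
          { isMonoid = record
            { isSemigroup = record { isMagma = record { isEquivalence = eq ; ∙-cong = +c } ; assoc = +a }
            ; identity = +i , λ x → E.trans (+m _ _) (+i x) }
          ; inverse = -i , λ x → E.trans (+m _ _) (-i x)
          ; ⁻¹-cong = -c }
        ; comm = +m }
      ; *-cong = *c ; *-assoc = *a
      ; *-identity = *i , λ x → E.trans (*m _ _) (*i x)
      ; distrib = d , λ x y z → E.trans (*m _ _) (E.trans (d x y z) (+c (*m _ _) (*m _ _))) }
    ; *-comm = *m }
    where module E = IsEquivalence eq

  module PowerSeries {c ℓ} (A : CommutativeRing c ℓ) where
    open CommutativeRing A using (Carrier; _≈_; _+_; _*_; -_; _-_; 0#; 1#; refl; sym; trans; +-cong; +-congˡ; *-cong; *-congʳ; -‿cong; +-assoc; +-comm; +-identityˡ; +-identityʳ; *-assoc; *-comm; *-identityˡ; zeroˡ; zeroʳ; distribˡ; distribʳ; -‿inverseˡ; isCommutativeRing)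
    open IntegerSolver A using (solve; _:=_; _:+_; _:*_)

    Series : Set c
    Series = ℕ → Carrier

    infix 4 _≈s_
    _≈s_ : Series → Series → Set ℓ
    p ≈s q = ∀ k → p k ≈ q k

    tl : Series → Series
    tl p k = p (suc k)

    conv : Series → Series → Series
    conv p q zero = p 0 * q 0
    conv p q (suc k) = p 0 * q (suc k) + conv (tl p) q k

    cst : Carrier → Series
    cst a zero = a
    cst a (suc k) = 0#

    X : Series
    X zero = 0#
    X (suc k) = cst 1# k

    conv-cong : ∀ {p p′ q q′} → p ≈s p′ → q ≈s q′ → conv p q ≈s conv p′ q′
    conv-cong h g zero = *-cong (h 0) (g 0)
    conv-cong h g (suc k) = +-cong (*-cong (h 0) (g (suc k))) (conv-cong (λ j → h (suc j)) g k)

    conv-+ˡ : ∀ p q r → conv (λ k → p k + q k) r ≈s (λ k → conv p r k + conv q r k)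
    conv-+ˡ p q r zero = distribʳ _ _ _
    conv-+ˡ p q r (suc k) = trans (+-congˡ (conv-+ˡ (tl p) (tl q) r k))
      (solve 5 (λ a b x y z → (a :+ b) :* x :+ (y :+ z) := (a :* x :+ y) :+ (b :* x :+ z)) refl _ _ _ _ _)

    conv-+ʳ : ∀ p q r → conv p (λ k → q k + r k) ≈s (λ k → conv p q k + conv p r k)
    conv-+ʳ p q r zero = distribˡ _ _ _
    conv-+ʳ p q r (suc k) = trans (+-congˡ (conv-+ʳ (tl p) q r k))
      (solve 5 (λ a x y z w → a :* (x :+ y) :+ (z :+ w) := (a :* x :+ z) :+ (a :* y :+ w)) refl _ _ _ _ _)

    conv-• : ∀ a p q → conv (λ k → a * p k) q ≈s (λ k → a * conv p q k)
    conv-• a p q zero = *-assoc _ _ _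
    conv-• a p q (suc k) = trans (+-congˡ (conv-• a (tl p) q k))
      (solve 4 (λ a x y z → a :* x :* y :+ a :* z := a :* (x :* y :+ z)) refl _ _ _ _)

    conv-0 : ∀ {p} q → (∀ k → p k ≈ 0#) → ∀ k → conv p q k ≈ 0#
    conv-0 q h zero = trans (*-congʳ (h 0)) (zeroˡ _)
    conv-0 q h (suc k) = trans (+-cong (trans (*-congʳ (h 0)) (zeroˡ _)) (conv-0 q (λ j → h (suc j)) k)) (+-identityˡ _)

    conv-cst : ∀ a q → conv (cst a) q ≈s (λ k → a * q k)
    conv-cst a q zero = refl
    conv-cst a q (suc k) = trans (+-congˡ (conv-0 q (λ _ → refl) k)) (+-identityʳ _)

    conv-X-zero : ∀ q → conv X q 0 ≈ 0#
    conv-X-zero q = zeroˡ _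

    conv-X-suc : ∀ q k → conv X q (suc k) ≈ q k
    conv-X-suc q k = trans (+-cong (zeroˡ _) (trans (conv-cst 1# q k) (*-identityˡ _))) (+-identityˡ _)

    conv-sucʳ : ∀ p q k → conv p q (suc k) ≈ conv p (tl q) k + p (suc k) * q 0
    conv-sucʳ p q zero = refl
    conv-sucʳ p q (suc k) = trans (+-congˡ (conv-sucʳ (tl p) q k)) (sym (+-assoc _ _ _))

    conv-comm : ∀ p q → conv p q ≈s conv q p
    conv-comm p q zero = *-comm _ _
    conv-comm p q (suc k) = trans (+-congˡ (conv-comm (tl p) q k))
      (trans (solve 3 (λ a b x → a :* b :+ x := x :+ b :* a) refl _ _ _) (sym (conv-sucʳ q p k)))

    conv-assoc : ∀ p q r → conv (conv p q) r ≈s conv p (conv q r)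
    conv-assoc p q r zero = *-assoc _ _ _
    conv-assoc p q r (suc k) = trans
      (+-congˡ (trans (conv-+ˡ (λ j → p 0 * q (suc j)) (conv (tl p) q) r k)
        (+-cong (conv-• (p 0) (tl q) r k) (conv-assoc (tl p) q r k))))
      (solve 5 (λ p q r x y → p :* q :* r :+ (p :* x :+ y) := p :* (q :* r :+ x) :+ y) refl _ _ _ _ _)

    opaque
     series-isCommutativeRing : IsCommutativeRing _≈s_ (λ p q k → p k + q k) conv (λ p k → - p k) (λ _ → 0#) (cst 1#)
     series-isCommutativeRing = mkIsCommutativeRing _≈s_ (λ p q k → p k + q k) conv (λ p k → - p k) (λ _ → 0#) (cst 1#)
      (record { refl = λ _ → refl ; sym = λ h k → sym (h k) ; trans = λ h g k → trans (h k) (g k) })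
      (λ h g k → +-cong (h k) (g k)) (λ _ _ _ _ → +-assoc _ _ _) (λ _ _ _ → +-comm _ _) (λ _ _ → +-identityˡ _)
      (λ h k → -‿cong (h k)) (λ _ _ → -‿inverseˡ _)
      conv-cong conv-assoc conv-comm (λ q k → trans (conv-cst 1# q k) (*-identityˡ _)) conv-+ʳ

    seriesRing : CommutativeRing c ℓ
    seriesRing = record { isCommutativeRing = series-isCommutativeRing }

    cst-+ : ∀ a b → cst (a + b) ≈s (λ k → cst a k + cst b k)
    cst-+ a b zero = refl
    cst-+ a b (suc k) = sym (+-identityˡ _)

    cst-* : ∀ a b → cst (a * b) ≈s conv (cst a) (cst b)
    cst-* a b zero = refl
    cst-* a b (suc k) = sym (trans (conv-cst a (cst b) (suc k)) (zeroʳ _))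

    cst-cong : ∀ {a b} → a ≈ b → cst a ≈s cst b
    cst-cong h zero = h
    cst-cong h (suc k) = refl

    decompose : ∀ p → p ≈s (λ k → cst (p 0) k + conv X (tl p) k)
    decompose p zero = sym (trans (+-congˡ (conv-X-zero (tl p))) (+-identityʳ _))
    decompose p (suc k) = sym (trans (+-congˡ (conv-X-suc (tl p) k)) (+-identityˡ _))

  record Ideal {c ℓ} (A : CommutativeRing c ℓ) ℓ′ : Set (c ⊔ ℓ ⊔ lsuc ℓ′) where
    open CommutativeRing A using (Carrier; _≈_; _+_; _*_; 0#)
    field
      Mem : Carrier → Set ℓ′
      resp : ∀ {x y} → x ≈ y → Mem x → Mem y
      zeroM : Mem 0#
      addM : ∀ {x y} → Mem x → Mem y → Mem (x + y)
      mulM : ∀ {x} y → Mem x → Mem (y * x)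

  module Quotient {c ℓ} (A : CommutativeRing c ℓ) {ℓ′} (J : Ideal A ℓ′) where
    open CommutativeRing A using (Carrier; _≈_; _+_; _*_; -_; _-_; 0#; 1#; refl; sym; trans; +-congʳ; +-assoc; +-comm; +-identityˡ; *-assoc; *-comm; *-identityˡ; distribˡ; -‿inverseˡ; -‿inverseʳ; isCommutativeRing)
    open IntegerSolver A using (solve; _:=_; _:+_; _:*_; _:-_; :-_; :1; :0)
    open Ideal J

    infix 4 _~_
    -- The quotient keeps the carrier and coarsens the equality, so elements pass to it unchanged.
    -- The wrapper keeps both sides visible to unification.
    record _~_ (x y : Carrier) : Set ℓ′ where
      constructor modulo
      field difference : Mem (x - y)
    open _~_ public

    ≈⇒~ : ∀ {x y} → x ≈ y → x ~ y
    ≈⇒~ {x} {y} h = modulo (resp (trans (sym (-‿inverseʳ y)) (+-congʳ (sym h))) zeroM)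

    private
      ~-sym : ∀ {x y} → x ~ y → y ~ x
      ~-sym (modulo h) = modulo (resp (solve 2 (λ x y → (:- :1) :* (x :- y) := y :- x) refl _ _) (mulM (- 1#) h))
      ~-trans : ∀ {x y z} → x ~ y → y ~ z → x ~ z
      ~-trans (modulo h) (modulo g) = modulo (resp (solve 3 (λ x y z → (x :- y) :+ (y :- z) := x :- z) refl _ _ _) (addM h g))
      ~-+ : ∀ {x x′ y y′} → x ~ x′ → y ~ y′ → x + y ~ x′ + y′
      ~-+ (modulo h) (modulo g) = modulo (resp (solve 4 (λ x x′ y y′ → (x :- x′) :+ (y :- y′) := (x :+ y) :- (x′ :+ y′)) refl _ _ _ _) (addM h g))
      ~-neg : ∀ {x x′} → x ~ x′ → - x ~ - x′
      ~-neg (modulo h) = modulo (resp (solve 2 (λ x y → (:- :1) :* (x :- y) := :- x :- :- y) refl _ _) (mulM (- 1#) h))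
      ~-* : ∀ {x x′ y y′} → x ~ x′ → y ~ y′ → x * y ~ x′ * y′
      ~-* {x} {x′} {y} {y′} (modulo h) (modulo g) = modulo (resp
        (solve 4 (λ x x′ y y′ → y :* (x :- x′) :+ x′ :* (y :- y′) := x :* y :- x′ :* y′) refl x x′ y y′) (addM (mulM y h) (mulM x′ g)))

    opaque
     quotient-isCommutativeRing : IsCommutativeRing _~_ _+_ _*_ -_ 0# 1#
     quotient-isCommutativeRing = mkIsCommutativeRing _~_ _+_ _*_ -_ 0# 1#
      (record { refl = ≈⇒~ refl ; sym = ~-sym ; trans = ~-trans })
      ~-+ (λ _ _ _ → ≈⇒~ (+-assoc _ _ _)) (λ _ _ → ≈⇒~ (+-comm _ _)) (λ _ → ≈⇒~ (+-identityˡ _))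
      ~-neg (λ _ → ≈⇒~ (-‿inverseˡ _))
      ~-* (λ _ _ _ → ≈⇒~ (*-assoc _ _ _)) (λ _ _ → ≈⇒~ (*-comm _ _)) (λ _ → ≈⇒~ (*-identityˡ _))
      (λ _ _ _ → ≈⇒~ (distribˡ _ _ _))

    quotientRing : CommutativeRing c ℓ′
    quotientRing = record { isCommutativeRing = quotient-isCommutativeRing }

    mem⇒~0 : ∀ {x} → Mem x → x ~ 0#
    mem⇒~0 h = modulo (resp (solve 1 (λ x → x := x :- :0) refl _) h)

    ~0⇒mem : ∀ {x} → x ~ 0# → Mem x
    ~0⇒mem (modulo h) = resp (solve 1 (λ x → x :- :0 := x) refl _) h

  module IdealConstructions {c ℓ} (A : CommutativeRing c ℓ) {ℓ′} (I : Ideal A ℓ′) where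
    open CommutativeRing A using (Carrier; _≈_; _+_; _*_; -_; _-_; 0#; 1#; refl; sym; trans; +-congˡ; +-congʳ)
    open IntegerSolver A using (solve; _:=_; _:+_; _:*_; _:-_; :-_; :1; :0)
    open Ideal I

    adjoin : Carrier → Ideal A (c ⊔ ℓ′)
    adjoin t = record
      { Mem = λ x → ∃ λ ρ → Mem (x - t * ρ)
      ; resp = λ { e (ρ , h) → ρ , resp (+-congʳ e) h }
      ; zeroM = 0# , resp (solve 1 (λ t → :0 := :0 :- t :* :0) refl t) zeroM
      ; addM = λ { (ρ , h) (σ , g) → ρ + σ , resp (solve 5 (λ x y t ρ σ → (x :- t :* ρ) :+ (y :- t :* σ) := (x :+ y) :- t :* (ρ :+ σ)) refl _ _ t ρ σ) (addM h g) }
      ; mulM = λ { y (ρ , h) → y * ρ , resp (solve 4 (λ x y t ρ → y :* (x :- t :* ρ) := y :* x :- t :* (y :* ρ)) refl _ y t ρ) (mulM y h) } }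

    split-adjoin : ∀ a b t ρ y → a + t * y ≈ (b + ((a - b) - t * ρ)) + t * (ρ + y)
    split-adjoin = solve 5 (λ a b t ρ y → a :+ t :* y := (b :+ ((a :- b) :- t :* ρ)) :+ t :* (ρ :+ y)) refl

    split-adjoin′ : ∀ f a b c t ρ y → f ≈ a + t * y → c ≈ a - b → f ≈ (b + (c - t * ρ)) + t * (ρ + y)
    split-adjoin′ f a b c t ρ y h e = trans h (trans (split-adjoin a b t ρ y) (+-congʳ (+-congˡ (+-congʳ (sym e)))))

    adjust : ∀ f g p a x y b → (f - (g + p * (a + x * y))) + p * (a - b) ≈ f - ((g + p * b) + (x * p) * y)
    adjust = solve 7 (λ f g p a x y b → (f :- (g :+ p :* (a :+ x :* y))) :+ p :* (a :- b) := f :- ((g :+ p :* b) :+ (x :* p) :* y)) refl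

    adjust-end : ∀ f g p x → (f - (g + p * x)) + x * p ≈ f - g
    adjust-end = solve 4 (λ f g p x → (f :- (g :+ p :* x)) :+ x :* p := f :- g) refl

    adjust-start : ∀ f → 0# ≈ f - (0# + 1# * f)
    adjust-start = solve 1 (λ f → :0 := f :- (:0 :+ :1 :* f)) refl

    module _ {ℓ″} (J : Ideal A ℓ″) where
      open Quotient A J
      private module Q = CommutativeRing quotientRing

      image : Ideal quotientRing (c ⊔ ℓ′ ⊔ ℓ″)
      image = record
        { Mem = λ x → ∃ λ y → Mem y × x ~ y
        ; resp = λ { e (y , my , h) → y , my , Q.trans (Q.sym e) h }
        ; zeroM = 0# , zeroM , Q.refl
        ; addM = λ { (y , my , h) (z , mz , g) → y + z , addM my mz , Q.+-cong h g }
        ; mulM = λ { x (y , my , h) → x * y , mulM x my , Q.*-congˡ h } }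

  module Algebras {c k} (K : CommutativeRing c k) where
    private module K = CommutativeRing K

    record Alg ℓ : Set (lsuc c ⊔ k ⊔ lsuc ℓ) where
      field
        comRing : CommutativeRing c ℓ
      open CommutativeRing comRing public hiding (zero)
      field
        ι : K.Carrier → Carrier
        ι-cong : ∀ {a b} → a K.≈ b → ι a ≈ ι b
        ι-+ : ∀ a b → ι (a K.+ b) ≈ ι a + ι b
        ι-* : ∀ a b → ι (a K.* b) ≈ ι a * ι b
        ι-1 : ι K.1# ≈ 1#

    record Hom {ℓ ℓ′} (A : Alg ℓ) (B : Alg ℓ′) : Set (c ⊔ ℓ ⊔ ℓ′) where
      private
        module A = Alg A
        module B = Alg B
      field
        ⟦_⟧ : A.Carrier → B.Carrier
        ⟦⟧-cong : ∀ {a b} → a A.≈ b → ⟦ a ⟧ B.≈ ⟦ b ⟧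
        ⟦⟧-+ : ∀ a b → ⟦ a A.+ b ⟧ B.≈ ⟦ a ⟧ B.+ ⟦ b ⟧
        ⟦⟧-* : ∀ a b → ⟦ a A.* b ⟧ B.≈ ⟦ a ⟧ B.* ⟦ b ⟧
        ⟦⟧-ι : ∀ a → ⟦ A.ι a ⟧ B.≈ B.ι a

      open IntegerSolver B.comRing using (solve; _:=_; _:+_; _:-_; :-_)
      ⟦⟧-1 : ⟦ A.1# ⟧ B.≈ B.1#
      ⟦⟧-1 = B.trans (⟦⟧-cong (A.sym A.ι-1)) (B.trans (⟦⟧-ι _) B.ι-1)

      ⟦⟧-0 : ⟦ A.0# ⟧ B.≈ B.0#
      ⟦⟧-0 = B.trans (solve 1 (λ x → x := (x :+ x) :- x) B.refl _)
        (B.trans (B.+-congʳ (B.trans (B.sym (⟦⟧-+ _ _)) (⟦⟧-cong (A.+-identityˡ _)))) (B.-‿inverseʳ _))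

      ⟦⟧-neg : ∀ a → ⟦ A.- a ⟧ B.≈ B.- ⟦ a ⟧
      ⟦⟧-neg a = B.trans (solve 2 (λ x y → x := (x :+ y) :- y) B.refl _ _)
        (B.trans (B.+-congʳ (B.trans (B.sym (⟦⟧-+ _ _)) (B.trans (⟦⟧-cong (A.-‿inverseˡ _)) ⟦⟧-0))) (B.+-identityˡ _))

      ⟦⟧-minus : ∀ a b → ⟦ a A.- b ⟧ B.≈ ⟦ a ⟧ B.- ⟦ b ⟧
      ⟦⟧-minus a b = B.trans (⟦⟧-+ a (A.- b)) (B.+-congˡ (⟦⟧-neg b))

    base : Alg k
    base = record { comRing = K ; ι = λ a → a ; ι-cong = λ h → h ; ι-+ = λ _ _ → K.refl ; ι-* = λ _ _ → K.refl ; ι-1 = K.refl }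

    ιHom : ∀ {ℓ} (A : Alg ℓ) → Hom base A
    ιHom A = record { ⟦_⟧ = ι ; ⟦⟧-cong = ι-cong ; ⟦⟧-+ = ι-+ ; ⟦⟧-* = ι-* ; ⟦⟧-ι = λ _ → refl }
      where open Alg A

    PS : ∀ {ℓ} → Alg ℓ → Alg ℓ
    PS A = record
      { comRing = seriesRing ; ι = λ a → cst (ι a) ; ι-cong = λ h → cst-cong (ι-cong h)
      ; ι-+ = λ a b k → trans (cst-cong (ι-+ a b) k) (cst-+ _ _ k)
      ; ι-* = λ a b k → trans (cst-cong (ι-* a b) k) (cst-* _ _ k)
      ; ι-1 = cst-cong ι-1 }
      where
      open Alg A using (comRing; ι; ι-cong; ι-+; ι-*; ι-1; trans)
      open PowerSeries comRing using (cst; seriesRing; cst-+; cst-*; cst-cong)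

    cstHom : ∀ {ℓ} (A : Alg ℓ) → Hom A (PS A)
    cstHom A = record { ⟦_⟧ = cst ; ⟦⟧-cong = cst-cong ; ⟦⟧-+ = cst-+ ; ⟦⟧-* = cst-* ; ⟦⟧-ι = λ _ _ → refl }
      where
      open Alg A using (comRing; refl)
      open PowerSeries comRing using (cst; cst-+; cst-*; cst-cong)

    headHom : ∀ {ℓ} (A : Alg ℓ) → Hom (PS A) A
    headHom A = record { ⟦_⟧ = λ p → p 0 ; ⟦⟧-cong = λ h → h 0 ; ⟦⟧-+ = λ _ _ → refl ; ⟦⟧-* = λ _ _ → refl ; ⟦⟧-ι = λ _ → refl }
      where open Alg A

    Quot : ∀ {ℓ ℓ′} (A : Alg ℓ) → Ideal (Alg.comRing A) ℓ′ → Alg ℓ′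
    Quot A J = record
      { comRing = quotientRing ; ι = ι ; ι-cong = λ h → ≈⇒~ (ι-cong h) ; ι-+ = λ _ _ → ≈⇒~ (ι-+ _ _)
      ; ι-* = λ _ _ → ≈⇒~ (ι-* _ _) ; ι-1 = ≈⇒~ ι-1 }
      where
      open Alg A using (comRing; ι; ι-cong; ι-+; ι-*; ι-1)
      open Quotient comRing J using (≈⇒~; quotientRing)

    quotHom : ∀ {ℓ ℓ′} (A : Alg ℓ) (J : Ideal (Alg.comRing A) ℓ′) → Hom A (Quot A J)
    quotHom A J = record { ⟦_⟧ = λ a → a ; ⟦⟧-cong = ≈⇒~ ; ⟦⟧-+ = λ _ _ → ≈⇒~ refl ; ⟦⟧-* = λ _ _ → ≈⇒~ refl ; ⟦⟧-ι = λ _ → ≈⇒~ refl }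
      where
      open Alg A using (comRing; refl)
      open Quotient comRing J using (≈⇒~)

    data Exp (n : ℕ) : Set c where
      con : K.Carrier → Exp n
      var : Fin n → Exp n
      _⊕_ _⊗_ : Exp n → Exp n → Exp n

    module _ {ℓ} (A : Alg ℓ) where
      open Alg A using (ι; Carrier; _≈_; _+_; _*_; refl; +-cong; *-cong)
      ev : ∀ {n} → Exp n → (Fin n → Carrier) → Carrier
      ev (con a) x = ι a
      ev (var i) x = x i
      ev (d ⊕ e) x = ev d x + ev e x
      ev (d ⊗ e) x = ev d x * ev e x

      ev-cong : ∀ {n} (e : Exp n) {x y} → (∀ i → x i ≈ y i) → ev e x ≈ ev e y
      ev-cong (con a) h = refl
      ev-cong (var i) h = h i
      ev-cong (d ⊕ e) h = +-cong (ev-cong d h) (ev-cong e h)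
      ev-cong (d ⊗ e) h = *-cong (ev-cong d h) (ev-cong e h)

    -- Two expressions are identified when they agree under every evaluation.
    Free : ∀ ℓ → ℕ → Alg (lsuc c ⊔ k ⊔ lsuc ℓ)
    Free ℓ n = record
      { comRing = record { isCommutativeRing = mkIsCommutativeRing {C = Exp n} (λ d e → ∀ (A : Alg ℓ) x → Alg._≈_ A (ev A d x) (ev A e x)) _⊕_ _⊗_ (con (K.- K.1#) ⊗_) (con K.0#) (con K.1#)
          (record { refl = λ A _ → refl A ; sym = λ h A x → sym A (h A x) ; trans = λ h g A x → trans A (h A x) (g A x) })
          (λ h g A x → +-cong A (h A x) (g A x)) (λ _ _ _ A _ → +-assoc A _ _ _) (λ _ _ A _ → +-comm A _ _)
          (λ _ A _ → trans A (+-congʳ A (Hom.⟦⟧-0 (ιHom A))) (+-identityˡ A _))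
          (λ h A x → *-congˡ A (h A x))
          (λ _ A _ → trans A (+-congʳ A (*-congʳ A (trans A (Hom.⟦⟧-neg (ιHom A) _) (-‿cong A (ι-1 A))))) (trans A (lem A _) (sym A (Hom.⟦⟧-0 (ιHom A)))))
          (λ h g A x → *-cong A (h A x) (g A x)) (λ _ _ _ A _ → *-assoc A _ _ _) (λ _ _ A _ → *-comm A _ _)
          (λ _ A _ → trans A (*-congʳ A (ι-1 A)) (*-identityˡ A _)) (λ _ _ _ A _ → distribˡ A _ _ _) }
      ; ι = con ; ι-cong = λ h A _ → ι-cong A h ; ι-+ = λ _ _ A _ → ι-+ A _ _ ; ι-* = λ _ _ A _ → ι-* A _ _ ; ι-1 = λ A _ → refl A }
      where
      open Alg
      lem : ∀ (A : Alg ℓ) x → Alg._≈_ A (_+_ A (_*_ A (-_ A (1# A)) x) x) (0# A)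
      lem A = solve 1 (λ x → (:- :1) :* x :+ x := :0) (refl A)
        where open IntegerSolver (comRing A)

    evHom : ∀ {ℓ} (A : Alg ℓ) {n} (x : Fin n → Alg.Carrier A) → Hom (Free ℓ n) A
    evHom A x = record { ⟦_⟧ = λ e → ev A e x ; ⟦⟧-cong = λ h → h A x ; ⟦⟧-+ = λ _ _ → refl ; ⟦⟧-* = λ _ _ → refl ; ⟦⟧-ι = λ _ → refl }
      where open Alg A

    -- The ring K[[x_1, ..., x_n]] as iterated power series. Its variables `Xs` serve as the generic
    -- point at which polynomial identities are tested.
    B : ℕ → Alg k
    B zero = base
    B (suc n) = PS (B n)

    Xs : ∀ {n} → Fin n → Alg.Carrier (B n)
    Xs {suc n} zero = PowerSeries.X (Alg.comRing (B n))
    Xs {suc n} (suc i) = PowerSeries.cst (Alg.comRing (B n)) (Xs i)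

    private
      infixr 5 _∷_
      -- Dense recursive normal forms: polynomials in the first variable whose coefficients are
      -- polynomials in the others. They need not be reduced, since only their values are compared.
      data P : ℕ → Set c where
        coef : K.Carrier → P 0
        [] : ∀ {n} → P (suc n)
        _∷_ : ∀ {n} → P n → P (suc n) → P (suc n)

      module _ {ℓ} (A : Alg ℓ) where
        open Alg A using (ι; Carrier; _+_; _*_; 0#)
        evP : ∀ {n} → P n → (Fin n → Carrier) → Carrier
        evP (coef a) x = ι a
        evP [] x = 0#
        evP (a ∷ as) x = evP a (λ i → x (suc i)) + x zero * evP as x

      0P : ∀ n → P n
      0P zero = coef K.0#
      0P (suc n) = []

      conP : ∀ n → K.Carrier → P n
      conP zero a = coef a
      conP (suc n) a = conP n a ∷ []

      varP : ∀ {n} → Fin n → P n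
      varP {suc n} zero = 0P n ∷ conP n K.1# ∷ []
      varP {suc n} (suc i) = varP i ∷ []

      addP mulP : ∀ {n} → P n → P n → P n
      mapP : ∀ {n} → P n → P (suc n) → P (suc n)
      addP (coef a) (coef b) = coef (a K.+ b)
      addP [] q = q
      addP (a ∷ p) [] = a ∷ p
      addP (a ∷ p) (b ∷ q) = addP a b ∷ addP p q
      mulP (coef a) (coef b) = coef (a K.* b)
      mulP [] q = []
      mulP (a ∷ p) q = addP (mapP a q) (0P _ ∷ mulP p q)
      mapP a [] = []
      mapP a (b ∷ q) = mulP a b ∷ mapP a q

      normal : ∀ {n} → Exp n → P n
      normal (con a) = conP _ a
      normal (var i) = varP i
      normal (d ⊕ e) = addP (normal d) (normal e)
      normal (d ⊗ e) = mulP (normal d) (normal e)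

      module _ {ℓ} (A : Alg ℓ) where
        open Alg A using (comRing; ι; ι-+; ι-*; ι-1; _≈_; _+_; _*_; 0#; refl; sym; trans; +-cong; *-cong; *-congˡ; +-identityˡ; +-identityʳ; zeroˡ; zeroʳ)
        open IntegerSolver comRing using (solve; _:=_; _:+_; _:*_; :1; :0)
        evP-0 : ∀ n x → evP A (0P n) x ≈ 0#
        evP-0 zero x = Hom.⟦⟧-0 (ιHom A)
        evP-0 (suc n) x = refl

        evP-con : ∀ n a x → evP A (conP n a) x ≈ ι a
        evP-con zero a x = refl
        evP-con (suc n) a x = trans (+-cong (evP-con n a _) (zeroʳ _)) (+-identityʳ _)

        evP-var : ∀ {n} (i : Fin n) x → evP A (varP i) x ≈ x i
        evP-var {suc n} zero x = trans (+-cong (evP-0 n _) (*-congˡ (trans (+-cong (trans (evP-con n _ _) ι-1) (zeroʳ _)) (+-identityʳ _))))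
          (solve 1 (λ x → :0 :+ x :* :1 := x) refl _)
        evP-var {suc n} (suc i) x = trans (+-cong (evP-var i _) (zeroʳ _)) (+-identityʳ _)

        evP-+ : ∀ {n} (p q : P n) x → evP A (addP p q) x ≈ evP A p x + evP A q x
        evP-+ (coef p) (coef q) x = ι-+ p q
        evP-+ [] q x = sym (+-identityˡ _)
        evP-+ (a ∷ p) [] x = sym (+-identityʳ _)
        evP-+ (a ∷ p) (b ∷ q) x = trans (+-cong (evP-+ a b _) (*-congˡ (evP-+ p q x)))
          (solve 5 (λ a b x p q → (a :+ b) :+ x :* (p :+ q) := (a :+ x :* p) :+ (b :+ x :* q)) refl _ _ _ _ _)

        evP-* : ∀ {n} (p q : P n) x → evP A (mulP p q) x ≈ evP A p x * evP A q x
        evP-map : ∀ {n} (a : P n) (q : P (suc n)) x → evP A (mapP a q) x ≈ evP A a (λ i → x (suc i)) * evP A q x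
        evP-* (coef p) (coef q) x = ι-* p q
        evP-* [] q x = sym (zeroˡ _)
        evP-* {suc n} (a ∷ p) q x = trans (evP-+ (mapP a q) (0P n ∷ mulP p q) x)
          (trans (+-cong (evP-map a q x) (+-cong (evP-0 n _) (*-congˡ (evP-* p q x))))
            (solve 4 (λ a p q x → a :* q :+ (:0 :+ x :* (p :* q)) := (a :+ x :* p) :* q) refl _ _ _ _))
        evP-map a [] x = sym (zeroʳ _)
        evP-map a (b ∷ q) x = trans (+-cong (evP-* a b _) (*-congˡ (evP-map a q x)))
          (solve 4 (λ a b q x → a :* b :+ x :* (a :* q) := a :* (b :+ x :* q)) refl _ _ _ _)

        evP-normal : ∀ {n} (e : Exp n) x → evP A (normal e) x ≈ ev A e x
        evP-normal (con a) x = evP-con _ a x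
        evP-normal (var i) x = evP-var i x
        evP-normal (d ⊕ e) x = trans (evP-+ (normal d) _ x) (+-cong (evP-normal d x) (evP-normal e x))
        evP-normal (d ⊗ e) x = trans (evP-* (normal d) _ x) (*-cong (evP-normal d x) (evP-normal e x))

      evP-hom : ∀ {ℓ ℓ′} {A : Alg ℓ} {C : Alg ℓ′} (φ : Hom A C) {n} (p : P n) x →
                Alg._≈_ C (Hom.⟦_⟧ φ (evP A p x)) (evP C p (λ i → Hom.⟦_⟧ φ (x i)))
      evP-hom φ (coef a) x = Hom.⟦⟧-ι φ a
      evP-hom φ [] x = Hom.⟦⟧-0 φ
      evP-hom {C = C} φ (a ∷ p) x = trans (⟦⟧-+ _ _) (+-cong (evP-hom φ a _) (trans (⟦⟧-* _ _) (*-congˡ (evP-hom φ p x))))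
        where
        open Alg C using (trans; +-cong; *-congˡ)
        open Hom φ using (⟦⟧-+; ⟦⟧-*)

      -- At the generic point `a + X p` vanishes only if the constant term `a` and every coefficient
      -- of `p` do; the recursion ends at the coefficients in K.
      detect : ∀ {n} (p : P n) → Alg._≈_ (B n) (evP (B n) p Xs) (Alg.0# (B n)) →
               ∀ {ℓ} (A : Alg ℓ) x → Alg._≈_ A (evP A p x) (Alg.0# A)
      detect (coef a) h A x = Alg.trans A (Alg.ι-cong A h) (Hom.⟦⟧-0 (ιHom A))
      detect [] h A x = Alg.refl A
      detect {suc n} (a ∷ p) h A x =
        Alg.trans A (Alg.+-cong A (detect a head≈0 A _) (Alg.*-congˡ A (detect p tail≈0 A x)))
          (Alg.trans A (Alg.+-congˡ A (Alg.zeroʳ A _)) (Alg.+-identityˡ A _))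
        where
        open Alg (B n) using (comRing; _≈_; 0#; sym; trans; +-cong; +-identityˡ; +-identityʳ)
        open PowerSeries comRing using (conv-X-zero; conv-X-suc)
        const : ∀ j → evP (B (suc n)) a (λ i → Xs (suc i)) j ≈ PowerSeries.cst comRing (evP (B n) a Xs) j
        const j = sym (evP-hom (cstHom (B n)) a Xs j)
        head≈0 : evP (B n) a Xs ≈ 0#
        head≈0 = trans (sym (trans (+-cong (const 0) (conv-X-zero (evP (B (suc n)) p Xs))) (+-identityʳ _))) (h 0)
        tail≈0 : ∀ j → evP (B (suc n)) p Xs j ≈ 0#
        tail≈0 j = trans (sym (trans (+-cong (const (suc j)) (conv-X-suc (evP (B (suc n)) p Xs) j)) (+-identityˡ _))) (h (suc j))

    -- The variables of the power series ring satisfy no polynomial relation, so an identity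
    -- verified there holds at all points of all algebras. This turns an equality of coefficients
    -- into an equality of values.
    generic : ∀ {n} (d e : Exp n) → Alg._≈_ (B n) (ev (B n) d Xs) (ev (B n) e Xs) →
              ∀ {ℓ} (A : Alg ℓ) x → Alg._≈_ A (ev A d x) (ev A e x)
    generic {n} d e h A x = begin
      ev A d x ≈⟨ solve 2 (λ d e → d := (d :+ (:- :1) :* e) :+ e) refl _ _ ⟩
      (ev A d x + (- 1#) * ev A e x) + ev A e x ≈⟨ +-congʳ (trans (+-congˡ (*-congʳ (sym (minus A)))) (sym (evP-normal A diff x))) ⟩
      evP A (normal diff) x + ev A e x ≈⟨ +-congʳ (detect (normal diff) vanish A x) ⟩
      0# + ev A e x ≈⟨ +-identityˡ _ ⟩
      ev A e x ∎
      where
      open Alg A using (comRing; _+_; _*_; -_; _-_; 0#; 1#; refl; sym; trans; setoid; +-congˡ; +-congʳ; *-congʳ; +-identityˡ)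
      open IntegerSolver comRing using (solve; _:=_; _:+_; _:*_; _:-_; :-_; :1)
      open import Relation.Binary.Reasoning.Setoid setoid using (begin_; _∎; step-≈-⟩)
      diff = d ⊕ (con (K.- K.1#) ⊗ e)
      minus : ∀ {ℓ} (A : Alg ℓ) → Alg._≈_ A (Alg.ι A (K.- K.1#)) (Alg.-_ A (Alg.1# A))
      minus A = Alg.trans A (Hom.⟦⟧-neg (ιHom A) _) (Alg.-‿cong A (Alg.ι-1 A))
      vanish : Alg._≈_ (B n) (evP (B n) (normal diff) Xs) (Alg.0# (B n))
      vanish = B.trans (evP-normal (B n) diff Xs)
        (B.trans (B.+-cong h (B.*-congʳ (minus (B n)))) (S.solve 1 (λ x → x S.:+ (S.:- S.:1) S.:* x S.:= S.:0) B.refl _))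
        where
        module B = Alg (B n)
        module S = IntegerSolver (Alg.comRing (B n))

-- From coefficient functions to identities valid in every algebra

module Link where
  open RS
  open Lin
  open KAlg
  open import Defs hiding (var)
  import Defs
  open import Level using (_⊔_; Lift; lift; lower)
  open import Algebra.Bundles using (CommutativeRing)
  open import Data.Nat using (ℕ; zero; suc; _∸_; _≤_; s≤s; z≤n)
  open import Data.Fin using (Fin; zero; suc; toℕ; punchIn)
  open import Data.Vec using (Vec; []; _∷_; tabulate; replicate)
  open import Data.Vec.Properties using (tabulate-∘)
  import Data.Vec as Vec
  open import Data.List as List using ([]; _∷_; _++_; map; concatMap; applyUpTo; upTo)
  open import Data.Product using (_,_)
  open import Relation.Nullary using (¬_)
  open import Function using (_∘_; id)
  import Relation.Binary.PropositionalEquality as ≡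

  -- Since x ≈ y is only used negatively, it may be weakened to its double negation.
  stable : ∀ {c ℓ} → CommutativeRing c ℓ → CommutativeRing c (c ⊔ ℓ)
  stable {c} {ℓ} K = record { isCommutativeRing = mkIsCommutativeRing (λ x y → Lift (c ⊔ ℓ) (¬ ¬ (x ≈ y))) _+_ _*_ -_ 0# 1#
    (record { refl = η refl ; sym = λ h → lift (λ n → lower h (λ e → n (sym e)))
            ; trans = λ h g → lift (λ n → lower h (λ e → lower g (λ e′ → n (trans e e′)))) })
    (λ h g → lift (λ n → lower h (λ e → lower g (λ e′ → n (+-cong e e′)))))
    (λ _ _ _ → η (+-assoc _ _ _)) (λ _ _ → η (+-comm _ _)) (λ _ → η (+-identityˡ _))
    (λ h → lift (λ n → lower h (λ e → n (-‿cong e)))) (λ _ → η (-‿inverseˡ _))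
    (λ h g → lift (λ n → lower h (λ e → lower g (λ e′ → n (*-cong e e′)))))
    (λ _ _ _ → η (*-assoc _ _ _)) (λ _ _ → η (*-comm _ _)) (λ _ → η (*-identityˡ _)) (λ _ _ _ → η (distribˡ _ _ _)) }
    where
    open CommutativeRing K using (_≈_; _+_; _*_; -_; 0#; 1#; refl; sym; trans; +-cong; *-cong; -‿cong; +-assoc; +-comm; +-identityˡ; *-assoc; *-comm; *-identityˡ; distribˡ; -‿inverseˡ; isCommutativeRing)
    η : ∀ {x y} → x ≈ y → Lift (c ⊔ ℓ) (¬ ¬ (x ≈ y))
    η e = lift (λ n → n e)

  module Naturality {c k} (K : CommutativeRing c k) where
    open Algebras K
    module _ {ℓ ℓ′} {A : Alg ℓ} {B : Alg ℓ′} (φ : Hom A B) where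
      private
        module A = Alg A using (comRing; Carrier)
        module VA = Vectors A.comRing using (V; Σ; _·_; δ; Σ-[]; Σ-∷)
        module VB = Vectors (Alg.comRing B) using (V; Σ; _·_; δ; Σ-[]; Σ-∷; Σ-cong)
        module DA = Alternating A.comRing using (Form; wedge; drop; det)
        module DB = Alternating (Alg.comRing B) using (Form; wedge; drop; det)
      open Alg B using (comRing; Carrier; _≈_; refl; sym; trans; reflexive; +-cong; +-congˡ; *-cong; *-congˡ; -‿cong)
      open Hom φ using (⟦_⟧; ⟦⟧-cong; ⟦⟧-+; ⟦⟧-*; ⟦⟧-1; ⟦⟧-0; ⟦⟧-neg)

      infixr 8 φ[_]
      φ[_] : ∀ {m} → VA.V m → VB.V m
      φ[ v ] i = ⟦ v i ⟧

      hom-Σ : ∀ {m} (f : VA.V m) → ⟦ VA.Σ f ⟧ ≈ VB.Σ φ[ f ]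
      hom-Σ {zero} f = trans (⟦⟧-cong (VA.Σ-[] f)) (trans ⟦⟧-0 (sym (VB.Σ-[] _)))
      hom-Σ {suc m} f = trans (⟦⟧-cong (VA.Σ-∷ f)) (trans (⟦⟧-+ _ _) (trans (+-congˡ (hom-Σ (λ i → f (suc i)))) (sym (VB.Σ-∷ _))))

      hom-· : ∀ {m} (u v : VA.V m) → ⟦ u VA.· v ⟧ ≈ φ[ u ] VB.· φ[ v ]
      hom-· u v = trans (hom-Σ _) (VB.Σ-cong (λ i → ⟦⟧-* _ _))

      hom-δ : ∀ {m} (i j : Fin m) → ⟦ VA.δ i j ⟧ ≈ VB.δ i j
      hom-δ zero zero = ⟦⟧-1
      hom-δ zero (suc j) = ⟦⟧-0
      hom-δ (suc i) zero = ⟦⟧-0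
      hom-δ (suc i) (suc j) = hom-δ i j

      hom-pow : ∀ a j → ⟦ pow A.comRing a j ⟧ ≈ pow comRing ⟦ a ⟧ j
      hom-pow a zero = ⟦⟧-1
      hom-pow a (suc j) = trans (⟦⟧-* _ _) (*-congˡ (hom-pow a j))

      hom-wedge : ∀ {m k} {f : VA.V m → A.Carrier} {g : VB.V m → Carrier} {h : DA.Form m k} {h′ : DB.Form m k} →
                  (∀ v → ⟦ f v ⟧ ≈ g φ[ v ]) → (∀ cs → ⟦ h cs ⟧ ≈ h′ (Vec.map φ[_] cs)) →
                  ∀ cs → ⟦ DA.wedge f h cs ⟧ ≈ DB.wedge g h′ (Vec.map φ[_] cs)
      hom-wedge {k = zero} p q (c ∷ []) = trans (⟦⟧-* _ _) (*-cong (p c) (q []))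
      hom-wedge {k = suc k} p q (c ∷ cs) = trans (⟦⟧-+ _ _) (+-cong (trans (⟦⟧-* _ _) (*-cong (p c) (q cs)))
        (trans (⟦⟧-neg _) (-‿cong (hom-wedge p (λ ds → q (c ∷ ds)) cs))))

      hom-det : ∀ {m} (cs : Vec (VA.V m) m) → ⟦ DA.det cs ⟧ ≈ DB.det (Vec.map φ[_] cs)
      hom-det {zero} [] = ⟦⟧-1
      hom-det {suc m} cs = hom-wedge {h = λ ds → DA.det (Vec.map DA.drop ds)} (λ v → refl)
        (λ ds → trans (hom-det (Vec.map DA.drop ds)) (reflexive (≡.cong DB.det (map-swap ds)))) cs
        where
        map-swap : ∀ {k} (ds : Vec (VA.V (suc m)) k) → Vec.map φ[_] (Vec.map DA.drop ds) ≡.≡ Vec.map DB.drop (Vec.map φ[_] ds)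
        map-swap [] = ≡.refl
        map-swap (d ∷ ds) = ≡.cong (_ ∷_) (map-swap ds)

  module Link {c ℓ} (K₀ : CommutativeRing c ℓ) where
    K = stable K₀
    private
      module K₀ = CommutativeRing K₀ using (_≈_; trans; +-identityʳ)
      module K = CommutativeRing K using (_≈_; 0#; refl; sym; trans; reflexive; +-congˡ; +-identityʳ)
    open Algebras K
    open Naturality K

    embed : ∀ {x y} → x K₀.≈ y → x K.≈ y
    embed e = lift (λ n → n e)

    private
      infix 4 _≈₁_
      _≈₁_ : ∀ {n} → Poly K₀ n → Poly K₀ n → Set _
      p ≈₁ q = ∀ α → p α K.≈ q α

      -- Currying the exponent vector makes a coefficient function an iterated power series; the
      -- Cauchy product over `splits` becomes `conv` in each variable.
      cur : ∀ {n} → Poly K₀ n → Alg.Carrier (B n)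
      cur {zero} p = p []
      cur {suc n} p = λ k → cur (λ α → p (k ∷ α))

      cur-cong : ∀ {n} {p q : Poly K₀ n} → p ≈₁ q → Alg._≈_ (B n) (cur p) (cur q)
      cur-cong {zero} h = h []
      cur-cong {suc n} h k = cur-cong (λ α → h (k ∷ α))

      cur-+ : ∀ {n} (p q : Poly K₀ n) → Alg._≈_ (B n) (cur (_+P_ K₀ p q)) (Alg._+_ (B n) (cur p) (cur q))
      cur-+ {zero} p q = K.refl
      cur-+ {suc n} p q k = cur-+ (λ α → p (k ∷ α)) (λ α → q (k ∷ α))

      cur-neg : ∀ {n} (p : Poly K₀ n) → Alg._≈_ (B n) (cur (-P_ K₀ p)) (Alg.-_ (B n) (cur p))
      cur-neg {zero} p = K.refl
      cur-neg {suc n} p k = cur-neg (λ α → p (k ∷ α))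

      cur-0 : ∀ {n} → Alg._≈_ (B n) (cur {n} (0P K₀)) (Alg.0# (B n))
      cur-0 {zero} = K.refl
      cur-0 {suc n} k = cur-0 {n}

      1P-0∷ : ∀ {n} (α : Mono K₀ n) → 1P K₀ (0 ∷ α) ≡.≡ 1P K₀ α
      1P-0∷ α with totalDeg K₀ α
      ... | zero = ≡.refl
      ... | suc _ = ≡.refl

      cur-1 : ∀ {n} → Alg._≈_ (B n) (cur {n} (1P K₀)) (Alg.1# (B n))
      cur-1 {zero} = K.refl
      cur-1 {suc n} zero = Alg.trans (B n) (cur-cong {n} (λ α → K.reflexive (1P-0∷ α))) (cur-1 {n})
      cur-1 {suc n} (suc k) = cur-0 {n}

      module _ {a b} (R : CommutativeRing a b) where
        open CommutativeRing R using (Carrier; _≈_; _+_; _*_; 0#; refl; sym; trans; reflexive; +-cong; +-congˡ; +-assoc; +-identityˡ; +-identityʳ)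
        sumUp : (ℕ → Carrier) → ℕ → Carrier
        sumUp h zero = 0#
        sumUp h (suc m) = h 0 + sumUp (λ j → h (suc j)) m

        conv-sumUp : ∀ p q k → PowerSeries.conv R p q k ≈ sumUp (λ j → p j * q (k ∸ j)) (suc k)
        conv-sumUp p q zero = sym (+-identityʳ _)
        conv-sumUp p q (suc k) = +-congˡ (conv-sumUp (λ j → p (suc j)) q k)

        sumUp-cong : ∀ {h g} → (∀ j → h j ≈ g j) → ∀ m → sumUp h m ≈ sumUp g m
        sumUp-cong e zero = refl
        sumUp-cong e (suc m) = +-cong (e 0) (sumUp-cong (λ j → e (suc j)) m)

        sumL-applyUpTo : ∀ (h : ℕ → Carrier) (f : ℕ → ℕ) m → sumL R (map h (applyUpTo f m)) ≈ sumUp (λ j → h (f j)) m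
        sumL-applyUpTo h f zero = refl
        sumL-applyUpTo h f (suc m) = +-congˡ (sumL-applyUpTo h (f ∘ suc) m)

        sumL-++ : ∀ xs ys → sumL R (xs ++ ys) ≈ sumL R xs + sumL R ys
        sumL-++ [] ys = sym (+-identityˡ _)
        sumL-++ (x ∷ xs) ys = trans (+-congˡ (sumL-++ xs ys)) (sym (+-assoc _ _ _))

        sumL-concatMap : ∀ {x y} {S : Set x} {T : Set y} (f : T → Carrier) (g : ℕ → S → T) (h : ℕ → S → Carrier) →
          (∀ j s → f (g j s) ≡.≡ h j s) → ∀ xs js →
          sumL R (map f (concatMap (λ j → map (g j) xs) js)) ≈ sumL R (map (λ j → sumL R (map (h j) xs)) js)
        sumL-concatMap f g h e xs [] = refl
        sumL-concatMap {S = S} f g h e xs (j ∷ js) = trans (reflexive (≡.cong (sumL R) (map-++ f (map (g j) xs) _)))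
          (trans (sumL-++ (map f (map (g j) xs)) _) (+-cong (reflexive (≡.cong (sumL R) (eq xs))) (sumL-concatMap f g h e xs js)))
          where
          open import Data.List.Properties using (map-++)
          eq : ∀ xs → map f (map (g j) xs) ≡.≡ map (h j) xs
          eq [] = ≡.refl
          eq (x ∷ xs) = ≡.cong₂ _∷_ (e j x) (eq xs)

      cur-sumUp : ∀ {n} (r : ℕ → Poly K₀ n) m → Alg._≈_ (B n) (cur (λ α → sumUp K₀ (λ j → r j α) m)) (sumUp (Alg.comRing (B n)) (λ j → cur (r j)) m)
      cur-sumUp {n} r zero = cur-0 {n}
      cur-sumUp {n} r (suc m) = Alg.trans (B n) (cur-+ (r 0) _) (Alg.+-congˡ (B n) (cur-sumUp (λ j → r (suc j)) m))

      cur-* : ∀ {n} (p q : Poly K₀ n) → Alg._≈_ (B n) (cur (_*P_ K₀ p q)) (Alg._*_ (B n) (cur p) (cur q))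
      cur-* {zero} p q = embed (K₀.+-identityʳ _)
      cur-* {suc n} p q k = begin
        cur (λ α → _*P_ K₀ p q (k ∷ α)) ≈⟨ cur-cong (λ α → embed (split α)) ⟩
        cur (λ α → sumUp K₀ (λ j → _*P_ K₀ (p′ j) (q′ (k ∸ j)) α) (suc k)) ≈⟨ cur-sumUp (λ j → _*P_ K₀ (p′ j) (q′ (k ∸ j))) (suc k) ⟩
        sumUp comRing (λ j → cur (_*P_ K₀ (p′ j) (q′ (k ∸ j)))) (suc k) ≈⟨ sumUp-cong comRing (λ j → cur-* (p′ j) (q′ (k ∸ j))) (suc k) ⟩
        sumUp comRing (λ j → cur (p′ j) * cur (q′ (k ∸ j))) (suc k) ≈⟨ sym (conv-sumUp comRing (λ j → cur (p′ j)) (λ j → cur (q′ j)) k) ⟩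
        PowerSeries.conv comRing (cur p) (cur q) k ∎
        where
        open Alg (B n) using (comRing; _*_; sym; setoid)
        open import Relation.Binary.Reasoning.Setoid setoid using (begin_; _∎; step-≈-⟩)
        p′ q′ : ℕ → Poly K₀ n
        p′ j α = p (j ∷ α)
        q′ j α = q (j ∷ α)
        split : ∀ α → _*P_ K₀ p q (k ∷ α) K₀.≈ sumUp K₀ (λ j → _*P_ K₀ (p′ j) (q′ (k ∸ j)) α) (suc k)
        split α = K₀.trans (sumL-concatMap K₀ _ _ _ (λ { j (β , γ) → ≡.refl }) (splits K₀ α) (upTo (suc k)))
          (sumL-applyUpTo K₀ (λ j → _*P_ K₀ (p′ j) (q′ (k ∸ j)) α) id (suc k))

      cur-var : ∀ {n} (i : Fin n) → Alg._≈_ (B n) (cur (Defs.var K₀ i)) (Xs i)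
      cur-var {suc n} zero zero = cur-0 {n}
      cur-var {suc n} zero (suc zero) = Alg.trans (B n) (cur-cong {n} (λ α → K.reflexive (one α))) (cur-1 {n})
        where
        one : ∀ α → Defs.var K₀ zero (1 ∷ α) ≡.≡ 1P K₀ α
        one α with totalDeg K₀ α
        ... | zero = ≡.refl
        ... | suc _ = ≡.refl
      cur-var {suc n} zero (suc (suc k)) = cur-0 {n}
      cur-var {suc n} (suc i) zero = cur-var i
      cur-var {suc n} (suc i) (suc k) = cur-0 {n}

      cur-pow : ∀ {n} (p : Poly K₀ n) j → Alg._≈_ (B n) (cur (powP K₀ p j)) (pow (Alg.comRing (B n)) (cur p) j)
      cur-pow {n} p zero = cur-1 {n}
      cur-pow {n} p (suc j) = Alg.trans (B n) (cur-* p _) (Alg.*-congˡ (B n) (cur-pow p j))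

      module _ {n : ℕ} where
        open Alg (B n) using (comRing; Carrier; _≈_; _*_; -_; _-_; sym; trans; reflexive; setoid; +-cong; +-congˡ; *-congˡ; -‿cong; +-identityʳ)
        open IntegerSolver comRing using ()
        open Vectors comRing using (V; Σ; Σ-[]; Σ-∷; Σ-cong; Σ-neg)
        open Alternating comRing using (Form; wedge; drop; det)

        cur-sumFin : ∀ m (f : Fin m → Poly K₀ n) → cur (sumFin K₀ m f) ≈ Σ (λ i → cur (f i))
        cur-sumFin zero f = trans (cur-0 {n}) (sym (Σ-[] _))
        cur-sumFin (suc m) f = trans (cur-+ (f zero) _) (trans (+-congˡ (cur-sumFin m (λ i → f (suc i)))) (sym (Σ-∷ _)))

        -- The explicit signs by column number become the nested differences of `wedge`: the terms
        -- of the later columns share one extra sign, which is moved out of their sum.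
        laplace : ∀ {m k} (φ : V m → Carrier) (h : Form m k) (v : Fin (suc k) → V m) (F : Fin (suc k) → Poly K₀ n) →
          (∀ j → cur (F j) ≈ φ (v j) * h (tabulate (λ s → v (punchIn j s)))) →
          cur (sumFin K₀ (suc k) (λ j → signed K₀ (toℕ j) (F j))) ≈ wedge φ h (tabulate v)
        laplace {k = zero} φ h v F e = trans (cur-+ (F zero) _) (trans (+-cong (e zero) (cur-0 {n})) (+-identityʳ _))
        laplace {k = suc k} φ h v F e = trans (cur-+ (F zero) _) (+-cong (e zero) (begin
            cur (sumFin K₀ (suc k) (λ j → -P_ K₀ (signed K₀ (toℕ j) (F (suc j))))) ≈⟨ cur-sumFin (suc k) _ ⟩
            Σ (λ j → cur (-P_ K₀ (signed K₀ (toℕ j) (F (suc j))))) ≈⟨ Σ-cong (λ j → cur-neg (signed K₀ (toℕ j) (F (suc j)))) ⟩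
            Σ (λ j → - cur (signed K₀ (toℕ j) (F (suc j)))) ≈⟨ Σ-neg _ ⟩
            - Σ (λ j → cur (signed K₀ (toℕ j) (F (suc j)))) ≈⟨ -‿cong (sym (cur-sumFin (suc k) _)) ⟩
            - cur (sumFin K₀ (suc k) (λ j → signed K₀ (toℕ j) (F (suc j))))
              ≈⟨ -‿cong (laplace φ (λ ds → h (v zero ∷ ds)) (λ j → v (suc j)) (λ j → F (suc j)) (λ j → e (suc j))) ⟩
            - wedge φ (λ ds → h (v zero ∷ ds)) (tabulate (λ j → v (suc j))) ∎))
          where open import Relation.Binary.Reasoning.Setoid setoid

        -- `Det` expands along row zero and `det` along coordinate zero of a list of columns, hence
        -- the transposed indexing.
        cur-Det : ∀ {m} (M : Matrix K₀ n m) → cur (Det K₀ M) ≈ det (tabulate (λ j i → cur (M i j)))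
        cur-Det {zero} M = cur-1 {n}
        cur-Det {suc m} M = laplace (λ v → v zero) (λ ds → det (Vec.map drop ds)) (λ j i → cur (M i j)) _
          (λ j → trans (cur-* (M zero j) _) (*-congˡ (trans (cur-Det (λ r s → M (suc r) (punchIn j s)))
            (reflexive (≡.cong det (tabulate-∘ drop (λ s i → cur (M i (punchIn j s)))))))))

    zeroMono : ∀ n → Mono K₀ n
    zeroMono n = replicate n 0

    private
      totalDeg-0 : ∀ {n} (α : Mono K₀ n) → totalDeg K₀ α ≡.≡ 0 → α ≡.≡ zeroMono n
      totalDeg-0 [] e = ≡.refl
      totalDeg-0 (zero ∷ α) e = ≡.cong (0 ∷_) (totalDeg-0 α e)

    module _ {ℓ′} (A : Alg ℓ′) where
      open Alg A using (comRing; ι; Carrier; _+_)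
      open Vectors comRing using (V; _·_)

      affine : ∀ {n} → Poly K₀ n → V n → Carrier
      affine p x = ι (p (zeroMono _)) + (λ k → ι (p (unitMono K₀ k))) · x

    private
      cur-affine : ∀ {n} (p : Poly K₀ n) → DegLe1 K₀ p → Alg._≈_ (B n) (cur p) (affine (B n) p Xs)
      cur-affine {zero} p d = K.trans (K.sym (K.+-identityʳ _)) (K.+-congˡ (K.sym (Vectors.Σ-[] K _)))
      cur-affine {suc n} p d = λ
        { zero → trans (cur-affine (λ α → p (0 ∷ α)) (λ α h → d (0 ∷ α) h)) (sym (trans (split 0)
            (trans (+-congˡ (trans (+-congʳ (trans (conv-cst (ι (p (1 ∷ zeroMono n))) X 0) (zeroʳ _))) (+-identityˡ _))) refl)))
        ; (suc zero) → trans (const (λ α → p (1 ∷ α)) (λ α h → embed (d (1 ∷ α) (s≤s h))))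
            (sym (trans (split 1) (trans (+-identityˡ _) (trans (+-identityʳ _) (trans (conv-cst (ι (p (1 ∷ zeroMono n))) X 1) (*-identityʳ _))))))
        ; (suc (suc k)) → trans (trans (cur-cong (λ α → embed (d (suc (suc k) ∷ α) (s≤s (s≤s z≤n))))) (cur-0 {n}))
            (sym (trans (split (suc (suc k))) (trans (+-identityˡ _) (trans (+-identityʳ _) (trans (conv-cst (ι (p (1 ∷ zeroMono n))) X (suc (suc k))) (zeroʳ _)))))) }
        where
        open Alg (B n) using (comRing; ι; _≈_; _+_; refl; sym; trans; +-congˡ; +-congʳ; +-identityˡ; +-identityʳ; *-identityʳ; zeroʳ)
        open PowerSeries comRing using (conv; cst; X; conv-cst)
        module P = Alg (B (suc n)) using (comRing; ι; _*_)
        module VP = Vectors P.comRing using (Σ-∷)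
        open Vectors comRing using (V; _·_)
        q : V n
        q k = ι (p (0 ∷ unitMono K₀ k))
        split : ∀ j → affine (B (suc n)) p Xs j ≈ P.ι (p (zeroMono (suc n))) j + (conv (P.ι (p (1 ∷ zeroMono n))) X j + cst (q · Xs) j)
        split j = +-congˡ (trans (VP.Σ-∷ (λ i → P._*_ (P.ι (p (unitMono K₀ i))) (Xs i)) j)
          (+-congˡ (sym (hom-· (cstHom (B n)) q Xs j))))
        const : ∀ {n} (r : Poly K₀ n) → (∀ α → 1 ≤ totalDeg K₀ α → r α K.≈ K.0#) → Alg._≈_ (B n) (cur r) (Alg.ι (B n) (r (zeroMono n)))
        const {zero} r h = K.refl
        const {suc n} r h zero = const (λ α → r (0 ∷ α)) (λ α g → h (0 ∷ α) g)
        const {suc n} r h (suc k) = Alg.trans (B n) (cur-cong (λ α → h (suc k ∷ α) (s≤s z≤n))) (cur-0 {n})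

    module _ {ℓ′} (A : Alg ℓ′) where
      open Alg A using (comRing)
      open Vectors comRing using (V)
      open Alternating comRing using ()
      columns : ∀ {n m} → Matrix K₀ n m → V n → Vec (V m) m
      columns M x = tabulate (λ j i → affine A (M i j) x)

    -- Both sides are values of expressions in `Free`, because `det` and `Σ` commute with
    -- evaluation. By `generic` it then suffices to compare them in the power series ring, where the
    -- hypothesis on coefficients applies.
    det-columns : ∀ {n m} (M : Matrix K₀ n m) → (∀ i j → DegLe1 K₀ (M i j)) → _≈P_ K₀ (Det K₀ M) (powerSum K₀ n) →
      ∀ (A : Alg (c ⊔ ℓ)) x → Alg._≈_ A (Alternating.det (Alg.comRing A) (columns A M x)) (Vectors.Σ (Alg.comRing A) (λ i → pow (Alg.comRing A) (x i) n))
    det-columns {n} {m} M d e A x = Alg.trans A (Alg.sym A (lhs A x)) (Alg.trans A (generic e₁ e₂ inB A x) (rhs A x))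
      where
      F : Alg _
      F = Free (c ⊔ ℓ) n
      e₁ e₂ : Exp n
      e₁ = Alternating.det (Alg.comRing F) (columns F M var)
      e₂ = Vectors.Σ (Alg.comRing F) (λ i → pow (Alg.comRing F) (var i) n)
      lhs : ∀ (A : Alg (c ⊔ ℓ)) x → Alg._≈_ A (ev A e₁ x) (Alternating.det (Alg.comRing A) (columns A M x))
      lhs A x = trans (hom-det (evHom A x) (columns F M var))
        (alt-cong det-alt (λ j i → trans (reflexive (≡.cong (λ (v : V m) → v i) (≡.trans (lookup-map j _ (columns F M var)) (≡.cong (λ (v : Fin m → Exp n) i → ev A (v i) x) (lookup∘tabulate (λ j i → affine F (M i j) var) j)))))
          (trans (+-congˡ (hom-· (evHom A x) (λ k → con (M i j (unitMono K₀ k))) var)) (reflexive (≡.cong (λ v → v i) (≡.sym (lookup∘tabulate (λ j i → affine A (M i j) x) j)))))))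
        where
        open Alg A using (comRing; trans; reflexive; +-congˡ)
        open Vectors comRing using (V)
        open Alternating comRing using (det-alt; alt-cong)
        open import Data.Vec.Properties using (lookup-map; lookup∘tabulate)
      rhs : ∀ (A : Alg (c ⊔ ℓ)) x → Alg._≈_ A (ev A e₂ x) (Vectors.Σ (Alg.comRing A) (λ i → pow (Alg.comRing A) (x i) n))
      rhs A x = trans (hom-Σ (evHom A x) _) (Vectors.Σ-cong comRing (λ i → hom-pow (evHom A x) (var i) n))
        where open Alg A
      inB : Alg._≈_ (B n) (ev (B n) e₁ Xs) (ev (B n) e₂ Xs)
      inB = begin
        ev (B n) e₁ Xs ≈⟨ lhs (B n) Xs ⟩
        det (columns (B n) M Xs)
          ≈⟨ alt-cong det-alt (λ j i → trans (reflexive (≡.cong (λ v → v i) (lookup∘tabulate (λ j i → affine (B n) (M i j) Xs) j)))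
               (trans (sym (cur-affine (M i j) (d i j))) (reflexive (≡.cong (λ v → v i) (≡.sym (lookup∘tabulate (λ j i → cur (M i j)) j)))))) ⟩
        det (tabulate (λ j i → cur (M i j))) ≈⟨ sym (cur-Det M) ⟩
        cur (Det K₀ M) ≈⟨ cur-cong (λ α → embed (e α)) ⟩
        cur (powerSum K₀ n) ≈⟨ cur-sumFin {n} n _ ⟩
        Vectors.Σ comRing (λ i → cur (powP K₀ (Defs.var K₀ i) n))
          ≈⟨ Vectors.Σ-cong comRing (λ i → trans (cur-pow (Defs.var K₀ i) n) (pow-cong n (cur-var i))) ⟩
        Vectors.Σ comRing (λ i → pow comRing (Xs i) n) ≈⟨ sym (rhs (B n) Xs) ⟩
        ev (B n) e₂ Xs ∎
        where
        open Alg (B n) using (comRing; _≈_; refl; sym; trans; reflexive; setoid; *-cong)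
        open Alternating comRing using (det; det-alt; alt-cong)
        open import Data.Vec.Properties using (lookup∘tabulate)
        open import Relation.Binary.Reasoning.Setoid setoid using (begin_; _∎; step-≈-⟩)
        pow-cong : ∀ j {x y} → x ≈ y → pow comRing x j ≈ pow comRing y j
        pow-cong zero h = refl
        pow-cong (suc j) h = *-cong h (pow-cong j h)

-- Spans over K and a bound for spanning sets

module Span where
  open RS
  open KAlg
  open import Defs using (pow)
  open import Level using (_⊔_; Lift; lift)
  open import Algebra.Bundles using (CommutativeRing)
  open import Data.Nat as ℕ using (ℕ; zero; suc)
  import Data.Nat.Properties as ℕP
  open import Data.Fin using (zero; suc)
  open import Data.List using (List; []; _∷_; _++_; map; length)
  open import Data.List.Properties using (length-map; length-++)
  open import Data.List.Relation.Unary.All as All using (All; []; _∷_)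
  open import Data.Product using (_×_; _,_; ∃; ∃₂)
  open import Data.Sum using (inj₁; inj₂)
  import Data.List.Relation.Unary.All.Properties as AllP
  import Relation.Binary.PropositionalEquality as ≡

  module Powers {c ℓ} (A : CommutativeRing c ℓ) where
    open CommutativeRing A using (_≈_; _+_; _*_; -_; _-_; 0#; 1#; refl; sym; trans; *-cong; *-congˡ; *-congʳ; *-assoc; *-identityˡ; zeroˡ)
    open IntegerSolver A using (solve; _:=_; _:+_; _:*_; _:-_; :-_; :0)
    pow-cong : ∀ j {x y} → x ≈ y → pow A x j ≈ pow A y j
    pow-cong zero h = refl
    pow-cong (suc j) h = *-cong h (pow-cong j h)
    pow-+ : ∀ x i j → pow A x (i ℕ.+ j) ≈ pow A x i * pow A x j
    pow-+ x zero j = sym (*-identityˡ _)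
    pow-+ x (suc i) j = trans (*-congˡ (pow-+ x i j)) (sym (*-assoc _ _ _))
    pow-* : ∀ x i j → pow A (pow A x i) j ≈ pow A x (j ℕ.* i)
    pow-* x i zero = refl
    pow-* x i (suc j) = trans (*-congˡ (pow-* x i j)) (sym (pow-+ x i _))
    pow-1 : ∀ j → pow A 1# j ≈ 1#
    pow-1 zero = refl
    pow-1 (suc j) = trans (*-identityˡ _) (pow-1 j)
    pow-distrib : ∀ x y j → pow A (x * y) j ≈ pow A x j * pow A y j
    pow-distrib x y zero = sym (*-identityˡ _)
    pow-distrib x y (suc j) = trans (*-congˡ (pow-distrib x y j))
      (solve 4 (λ x y a b → x :* y :* (a :* b) := x :* a :* (y :* b)) refl _ _ _ _)
    minus-plus : ∀ x y → x ≈ (x - y) + y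
    minus-plus = solve 2 (λ x y → x := (x :- y) :+ y) refl

  module Spans {c κ} (K : CommutativeRing c κ) where
    private module K = CommutativeRing K using (_+_; _*_; 0#; 1#)
    open Algebras K

    module _ {ℓ} (A : Alg ℓ) where
      open Alg A using (comRing; ι; ι-+; ι-*; ι-1; Carrier; _≈_; _+_; _*_; 0#; 1#; refl; sym; trans; +-cong; +-congʳ; *-congˡ; *-congʳ; +-identityˡ; +-identityʳ; *-assoc; *-identityˡ; zeroˡ; zeroʳ)
      open IntegerSolver comRing using (solve; _:=_; _:+_; _:*_; :1; :0)
      open Powers comRing using ()

      -- Membership in the K-span of a list. The length of the list later serves as an upper bound
      -- for a dimension.
      Sp : List Carrier → Carrier → Set (c ⊔ ℓ)
      Sp [] r = Lift (c ⊔ ℓ) (r ≈ 0#)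
      Sp (g ∷ gs) r = ∃₂ λ a r′ → Sp gs r′ × r ≈ ι a * g + r′

      sp-resp : ∀ gs {r s} → r ≈ s → Sp gs r → Sp gs s
      sp-resp [] e (lift h) = lift (trans (sym e) h)
      sp-resp (g ∷ gs) e (a , r′ , h , eq) = a , r′ , h , trans (sym e) eq

      ι0 : ι K.0# ≈ 0#
      ι0 = Hom.⟦⟧-0 (ιHom A)

      sp-skip : ∀ {g} gs {r} → Sp gs r → Sp (g ∷ gs) r
      sp-skip gs {r} h = K.0# , r , h , sym (trans (+-congʳ (trans (*-congʳ ι0) (zeroˡ _))) (+-identityˡ _))

      sp-0 : ∀ gs → Sp gs 0#
      sp-0 [] = lift refl
      sp-0 (g ∷ gs) = sp-skip gs (sp-0 gs)

      sp-here : ∀ g gs → Sp (g ∷ gs) g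
      sp-here g gs = K.1# , 0# , sp-0 gs , sym (trans (+-identityʳ _) (trans (*-congʳ ι-1) (*-identityˡ _)))

      sp-+ : ∀ gs {r s} → Sp gs r → Sp gs s → Sp gs (r + s)
      sp-+ [] (lift h) (lift g) = lift (trans (+-cong h g) (+-identityˡ _))
      sp-+ (g ∷ gs) (a , r′ , h , e) (b , s′ , h′ , e′) = a K.+ b , r′ + s′ , sp-+ gs h h′ ,
        trans (+-cong e e′) (trans (solve 5 (λ a b g r s → (a :* g :+ r) :+ (b :* g :+ s) := (a :+ b) :* g :+ (r :+ s)) refl _ _ _ _ _)
          (+-congʳ (*-congʳ (sym (ι-+ a b)))))

      sp-scale : ∀ gs b {r} → Sp gs r → Sp gs (ι b * r)
      sp-scale [] b (lift h) = lift (trans (*-congˡ h) (zeroʳ _))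
      sp-scale (g ∷ gs) b (a , r′ , h , e) = b K.* a , ι b * r′ , sp-scale gs b h ,
        trans (*-congˡ e) (trans (solve 4 (λ b a g r → b :* (a :* g :+ r) := (b :* a) :* g :+ b :* r) refl _ _ _ _)
          (+-congʳ (*-congʳ (sym (ι-* b a)))))

      sp-++ˡ : ∀ gs hs {r} → Sp gs r → Sp (gs ++ hs) r
      sp-++ˡ [] hs (lift h) = sp-resp hs (sym h) (sp-0 hs)
      sp-++ˡ (g ∷ gs) hs (a , r′ , h , e) = a , r′ , sp-++ˡ gs hs h , e

      sp-++ʳ : ∀ gs hs {r} → Sp hs r → Sp (gs ++ hs) r
      sp-++ʳ [] hs h = h
      sp-++ʳ (g ∷ gs) hs h = sp-skip (gs ++ hs) (sp-++ʳ gs hs h)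

      sp-mul : ∀ z gs hs → All (λ g → Sp hs (z * g)) gs → ∀ {r} → Sp gs r → Sp hs (z * r)
      sp-mul z [] hs [] (lift h) = sp-resp hs (sym (trans (*-congˡ h) (zeroʳ _))) (sp-0 hs)
      sp-mul z (g ∷ gs) hs (p ∷ ps) (a , r′ , h , e) = sp-resp hs
        (sym (trans (*-congˡ e) (solve 4 (λ z a g r → z :* (a :* g :+ r) := a :* (z :* g) :+ z :* r) refl _ _ _ _)))
        (sp-+ hs (sp-scale hs a p) (sp-mul z gs hs ps h))

      all-gens : ∀ gs → All (Sp gs) gs
      all-gens [] = []
      all-gens (g ∷ gs) = sp-here g gs ∷ All.map (sp-skip gs) (all-gens gs)

      sp-map : ∀ z gs {r} → Sp gs r → Sp (map (z *_) gs) (z * r)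
      sp-map z [] (lift h) = lift (trans (*-congˡ h) (zeroʳ _))
      sp-map z (g ∷ gs) (a , r′ , h , e) = a , z * r′ , sp-map z gs h ,
        trans (*-congˡ e) (solve 4 (λ z a g r → z :* (a :* g :+ r) := a :* (z :* g) :+ z :* r) refl _ _ _ _)

      powers : Carrier → ℕ → List Carrier → List Carrier
      powers y zero gs = []
      powers y (suc j) gs = powers y j gs ++ map (pow comRing y j *_) gs

      length-powers : ∀ y j gs → length (powers y j gs) ≡.≡ j ℕ.* length gs
      length-powers y zero gs = ≡.refl
      length-powers y (suc j) gs = ≡.trans (length-++ (powers y j gs))
        (≡.trans (≡.cong₂ ℕ._+_ (length-powers y j gs) (length-map _ gs)) (ℕP.+-comm (j ℕ.* length gs) _))

      sp-power : ∀ y j i gs {r} → i ℕ.< j → Sp gs r → Sp (powers y j gs) (pow comRing y i * r)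
      sp-power y (suc j) i gs lt h with ℕP.m≤n⇒m<n∨m≡n (ℕP.≤-pred lt)
      ... | inj₁ i<j = sp-++ˡ (powers y j gs) _ (sp-power y j i gs i<j h)
      ... | inj₂ ≡.refl = sp-++ʳ (powers y j gs) _ (sp-map _ gs h)

      Stable : Carrier → List Carrier → Set (c ⊔ ℓ)
      Stable z gs = ∀ r → Sp gs r → Sp gs (z * r)

      private
        all-powers : ∀ {p} {P : Carrier → Set p} y j gs → (∀ i → i ℕ.< j → All (λ g → P (pow comRing y i * g)) gs) → All P (powers y j gs)
        all-powers y zero gs h = []
        all-powers y (suc j) gs h = AllP.++⁺ (all-powers y j gs (λ i lt → h i (ℕP.m≤n⇒m≤1+n lt))) (AllP.map⁺ (h j ℕP.≤-refl))

      stable-powers : ∀ z y j gs → Stable z gs → Stable z (powers y j gs)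
      stable-powers z y j gs st _ = sp-mul z (powers y j gs) (powers y j gs)
        (all-powers y j gs (λ i lt → All.map (λ h → sp-resp (powers y j gs)
            (solve 3 (λ z p g → p :* (z :* g) := z :* (p :* g)) refl _ _ _) (sp-power y j i gs lt (st _ h))) (all-gens gs)))

      -- Multiplication by `y` moves each block `y^i gs` to the next one and the last block to zero.
      nilpotent-stable : ∀ y j gs → pow comRing y j ≈ 0# → Stable y (powers y j gs)
      nilpotent-stable y j gs nil _ = sp-mul y (powers y j gs) (powers y j gs) (all-powers y j gs block)
        where
        block : ∀ i → i ℕ.< j → All (λ g → Sp (powers y j gs) (y * (pow comRing y i * g))) gs
        block i lt with ℕP.m≤n⇒m<n∨m≡n lt
        ... | inj₁ lt′ = All.map (λ h → sp-resp (powers y j gs) (*-assoc _ _ _) (sp-power y j (suc i) gs lt′ h)) (all-gens gs)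
        ... | inj₂ ≡.refl = All.map (λ {g} _ → sp-resp (powers y j gs)
                (sym (trans (sym (*-assoc _ _ g)) (trans (*-congʳ nil) (zeroˡ _)))) (sp-0 (powers y j gs))) (all-gens gs)

      sp-powers : ∀ y j gs {r} → 0 ℕ.< j → Sp gs r → Sp (powers y j gs) r
      sp-powers y j gs lt h = sp-resp (powers y j gs) (*-identityˡ _) (sp-power y j 0 gs lt h)

      InGen : List Carrier → Carrier → Set (c ⊔ ℓ)
      InGen [] r = Lift (c ⊔ ℓ) (r ≈ 0#)
      InGen (h ∷ hs) r = ∃₂ λ a r′ → InGen hs r′ × r ≈ h * a + r′

      gen-resp : ∀ hs {r s} → r ≈ s → InGen hs r → InGen hs s
      gen-resp [] e (lift h) = lift (trans (sym e) h)
      gen-resp (g ∷ gs) e (a , r′ , h , eq) = a , r′ , h , trans (sym e) eq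

      gen-0 : ∀ hs → InGen hs 0#
      gen-0 [] = lift refl
      gen-0 (h ∷ hs) = 0# , 0# , gen-0 hs , solve 1 (λ h → :0 := h :* :0 :+ :0) refl h

      gen-+ : ∀ hs {r s} → InGen hs r → InGen hs s → InGen hs (r + s)
      gen-+ [] (lift h) (lift g) = lift (trans (+-cong h g) (+-identityˡ _))
      gen-+ (g ∷ gs) (a , r′ , h , e) (b , s′ , h′ , e′) = a + b , r′ + s′ , gen-+ gs h h′ ,
        trans (+-cong e e′) (solve 5 (λ a b g r s → (g :* a :+ r) :+ (g :* b :+ s) := g :* (a :+ b) :+ (r :+ s)) refl _ _ _ _ _)

      gen-* : ∀ hs b {r} → InGen hs r → InGen hs (b * r)
      gen-* [] b (lift h) = lift (trans (*-congˡ h) (zeroʳ _))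
      gen-* (g ∷ gs) b (a , r′ , h , e) = b * a , b * r′ , gen-* gs b h ,
        trans (*-congˡ e) (solve 4 (λ b a g r → b :* (g :* a :+ r) := g :* (b :* a) :+ b :* r) refl _ _ _ _)

      gen-here : ∀ h hs → InGen (h ∷ hs) h
      gen-here h hs = 1# , 0# , gen-0 hs , solve 1 (λ h → h := h :* :1 :+ :0) refl h

      gen-skip : ∀ h hs {r} → InGen hs r → InGen (h ∷ hs) r
      gen-skip h hs {r} p = 0# , r , p , solve 2 (λ h r → r := h :* :0 :+ r) refl h r

      genIdeal : List Carrier → Ideal comRing (c ⊔ ℓ)
      genIdeal hs = record { Mem = InGen hs ; resp = gen-resp hs ; zeroM = gen-0 hs ; addM = gen-+ hs ; mulM = λ y → gen-* hs y }

    sp-hom : ∀ {ℓ ℓ′} {A : Alg ℓ} {A′ : Alg ℓ′} (φ : Hom A A′) gs {r} → Sp A gs r → Sp A′ (map (Hom.⟦_⟧ φ) gs) (Hom.⟦_⟧ φ r)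
    sp-hom {A′ = A′} φ [] (lift h) = lift (Alg.trans A′ (Hom.⟦⟧-cong φ h) (Hom.⟦⟧-0 φ))
    sp-hom {A′ = A′} φ (g ∷ gs) (a , r′ , h , e) = a , Hom.⟦_⟧ φ r′ , sp-hom φ gs h ,
      trans (⟦⟧-cong e) (trans (⟦⟧-+ _ _) (+-congʳ (trans (⟦⟧-* _ _) (*-congʳ (⟦⟧-ι a)))))
      where
      open Alg A′ using (trans; +-congʳ; *-congʳ)
      open Hom φ using (⟦⟧-cong; ⟦⟧-+; ⟦⟧-*; ⟦⟧-ι)

    gen-hom : ∀ {ℓ ℓ′} {A : Alg ℓ} {A′ : Alg ℓ′} (φ : Hom A A′) gs {r} → InGen A gs r → InGen A′ (map (Hom.⟦_⟧ φ) gs) (Hom.⟦_⟧ φ r)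
    gen-hom {A′ = A′} φ [] (lift h) = lift (Alg.trans A′ (Hom.⟦⟧-cong φ h) (Hom.⟦⟧-0 φ))
    gen-hom {A′ = A′} φ (g ∷ gs) (a , r′ , h , e) = Hom.⟦_⟧ φ a , Hom.⟦_⟧ φ r′ , gen-hom φ gs h ,
      trans (⟦⟧-cong e) (trans (⟦⟧-+ _ _) (+-congʳ (⟦⟧-* _ _)))
      where
      open Alg A′ using (trans; +-congʳ)
      open Hom φ using (⟦⟧-cong; ⟦⟧-+; ⟦⟧-*)

    module _ {ℓ ℓ₁ ℓ₂} (A : Alg ℓ) (J₁ : Ideal (Alg.comRing A) ℓ₁) (J₂ : Ideal (Alg.comRing A) ℓ₂)
             (J₁⊆J₂ : ∀ {x} → Ideal.Mem J₁ x → Ideal.Mem J₂ x) where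
      open Alg A using (comRing; _*_)
      private
        ~⇒~ : ∀ {x y} → Quotient._~_ comRing J₁ x y → Quotient._~_ comRing J₂ x y
        ~⇒~ (Quotient.modulo h) = Quotient.modulo (J₁⊆J₂ h)

      gen-weaken : ∀ hs {r} → InGen (Quot A J₁) hs r → InGen (Quot A J₂) hs r
      gen-weaken [] (lift h) = lift (~⇒~ h)
      gen-weaken (g ∷ gs) (a , r′ , h , e) = a , r′ , gen-weaken gs h , ~⇒~ e

      gen-image : ∀ {ℓ′} (I : Ideal comRing ℓ′) hs T → (∀ {f} → Ideal.Mem I f → InGen (Quot A J₁) hs (T * f)) →
                  ∀ {i} → Ideal.Mem (IdealConstructions.image comRing I J₂) i → InGen (Quot A J₂) hs (T * i)
      gen-image I hs T h (y , my , e) = gen-resp (Quot A J₂) hs (Q.*-congˡ (Q.sym e)) (gen-weaken hs (h my))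
        where module Q = Alg (Quot A J₂)

    -- If t^E = 0, the h are nilpotent, everything is congruent to the span of G modulo I + (t), and
    -- T maps I into (h), then iterating these two congruences expresses T^k f through t, h and G.
    module Iterate {ℓ ℓ′ ℓ″} (A : Alg ℓ) (I : Ideal (Alg.comRing A) ℓ′) (t T : Alg.Carrier A) (e E k : ℕ) (G hs : List (Alg.Carrier A))
      (T≈ : Alg._≈_ A T (pow (Alg.comRing A) t e))
      (0<E : 0 ℕ.< E) (0<k : 0 ℕ.< k)
      (t-nil : Alg._≈_ A (pow (Alg.comRing A) t E) (Alg.0# A))
      (h-nil : All (λ h → Alg._≈_ A (pow (Alg.comRing A) h k) (Alg.0# A)) hs)
      (reduce : ∀ f → ∃₂ λ g i → ∃ λ f′ → Sp A G g × Ideal.Mem I i × Alg._≈_ A f (Alg._+_ A (Alg._+_ A g i) (Alg._*_ A t f′)))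
      (into : ∀ {i} → Ideal.Mem I i → InGen A hs (Alg._*_ A T i))
      (M : ℕ → Alg.Carrier A → Set ℓ″)
      (M-resp : ∀ l {x y} → Alg._≈_ A x y → M l x → M l y)
      (M-0 : ∀ x → M 0 x) (M-zero : ∀ l → M l (Alg.0# A))
      (M-+ : ∀ l {x y} → M l x → M l y → M l (Alg._+_ A x y))
      (M-h : All (λ h → ∀ l {x} → M l x → M (suc l) (Alg._*_ A h x)) hs)
      (M-nil : ∀ {x} → M k x → Alg._≈_ A x (Alg.0# A))
      where
      open Alg A using (comRing; Carrier; _≈_; _+_; _*_; 0#; refl; sym; trans; +-cong; +-congˡ; *-congˡ; *-congʳ; +-assoc; +-identityʳ; *-assoc; *-identityˡ; zeroˡ)
      open IntegerSolver comRing using (solve; _:=_; _:+_; _:*_; :1; :0)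
      open Powers comRing using ()
      open Ideal I using (Mem; addM; mulM; zeroM)

      tG : List Carrier
      tG = powers A t E G

      -- All products of powers of the `hs` with exponents below `k`, a power of `t` below `E`, and
      -- a member of `G`.
      allPowers : List Carrier → List Carrier
      allPowers [] = tG
      allPowers (h ∷ hs) = powers A h k (allPowers hs)

      W : List Carrier
      W = allPowers hs

      length-W : length W ≡.≡ k ℕ.^ length hs ℕ.* (E ℕ.* length G)
      length-W = go hs
        where
        go : ∀ hs → length (allPowers hs) ≡.≡ k ℕ.^ length hs ℕ.* (E ℕ.* length G)
        go [] = ≡.trans (length-powers A t E G) (≡.sym (ℕP.*-identityˡ _))
        go (h ∷ hs) = ≡.trans (length-powers A h k (allPowers hs))
          (≡.trans (≡.cong (k ℕ.*_) (go hs)) (≡.sym (ℕP.*-assoc k (k ℕ.^ length hs) _)))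

      private
        t-tG : Stable A t tG
        t-tG = nilpotent-stable A t E G t-nil

        stable-above : ∀ z hs → Stable A z tG → Stable A z (allPowers hs)
        stable-above z [] st = st
        stable-above z (h ∷ hs) st = stable-powers A z h k (allPowers hs) (stable-above z hs st)

        sp-above : ∀ hs {r} → Sp A tG r → Sp A (allPowers hs) r
        sp-above [] s = s
        sp-above (h ∷ hs) s = sp-powers A h k (allPowers hs) 0<k (sp-above hs s)

        h-stable : ∀ hs → All (λ h → pow comRing h k ≈ 0#) hs → All (λ h → Stable A h (allPowers hs)) hs
        h-stable [] [] = []
        h-stable (h ∷ hs) (p ∷ ps) = nilpotent-stable A h k (allPowers hs) p ∷
          All.map (λ {z} st → stable-powers A z h k (allPowers hs) st) (h-stable hs ps)

        pow-stable : ∀ j → Stable A (pow comRing t j) W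
        pow-stable zero _ s = sp-resp A W (sym (*-identityˡ _)) s
        pow-stable (suc j) _ s = sp-resp A W (sym (*-assoc _ _ _)) (stable-above t hs t-tG _ (pow-stable j _ s))

        T-stable : Stable A T W
        T-stable _ s = sp-resp A W (*-congʳ (sym T≈)) (pow-stable e _ s)

        Tl-stable : ∀ l → Stable A (pow comRing T l) W
        Tl-stable zero _ s = sp-resp A W (sym (*-identityˡ _)) s
        Tl-stable (suc l) _ s = sp-resp A W (sym (*-assoc _ _ _)) (T-stable _ (Tl-stable l _ s))

        -- The congruence is substituted `l` times into its own cofactor of `t`; for `l = E` the
        -- cofactor term disappears by nilpotence.
        reduce-t : ∀ l f → ∃₂ λ g i → ∃ λ f′ → Sp A tG g × Mem i × f ≈ (g + i) + pow comRing t l * f′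
        reduce-t zero f = 0# , 0# , f , sp-0 A tG , zeroM , solve 1 (λ f → f := (:0 :+ :0) :+ :1 :* f) refl f
        reduce-t (suc l) f with reduce f
        ... | g , i , f₁ , sg , mi , e₁ with reduce-t l f₁
        ... | g′ , i′ , f₂ , sg′ , mi′ , e₂ = g + t * g′ , i + t * i′ , f₂ ,
          sp-+ A tG (sp-powers A t E G 0<E sg) (t-tG _ sg′) , addM mi (mulM t mi′) ,
          trans e₁ (trans (+-congˡ (*-congˡ e₂))
            (solve 7 (λ g i t g′ i′ p f → (g :+ i) :+ t :* ((g′ :+ i′) :+ p :* f) := ((g :+ t :* g′) :+ (i :+ t :* i′)) :+ t :* p :* f) refl _ _ _ _ _ _ _))

        reduce-all : ∀ f → ∃₂ λ g i → Sp A tG g × Mem i × f ≈ g + i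
        reduce-all f with reduce-t E f
        ... | g , i , f′ , sg , mi , eq = g , i , sg , mi ,
          trans eq (trans (+-congˡ (trans (*-congʳ t-nil) (zeroˡ _))) (+-identityʳ _))

        Good : ℕ → Carrier → Set _
        Good l x = ∃₂ λ w m → Sp A W w × M l m × x ≈ w + m

      -- `M l` stands for the elements of order at least `l`. A step writes `f = g + i`, pushes
      -- `T i` into the ideal of the `hs`, and treats the cofactors recursively; each factor `h`
      -- raises the order by one, and by `M-nil` nothing of order `k` is left.
      expand : ∀ l f → Good l (pow comRing T l * f)
      expand zero f = 0# , f , sp-0 A W , M-0 f , solve 1 (λ f → :1 :* f := :0 :+ f) refl f
      expand (suc l) f with reduce-all f
      ... | g , i , sg , mi , e₁ with gens hs M-h (h-stable hs h-nil) (into mi)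
        where
        gens : ∀ gs → All (λ h → ∀ l {x} → M l x → M (suc l) (h * x)) gs → All (λ h → Stable A h W) gs →
               ∀ {r} → InGen A gs r → Good (suc l) (pow comRing T l * r)
        gens [] [] [] (lift z) = 0# , 0# , sp-0 A W , M-zero _ , trans (*-congˡ z) (solve 1 (λ x → x :* :0 := :0 :+ :0) refl _)
        gens (h ∷ gs) (p ∷ ps) (q ∷ qs) (a , r′ , ir , eq) with expand l a | gens gs ps qs ir
        ... | w , m , sw , mm , e₁ | w′ , m′ , sw′ , mm′ , e₂ = h * w + w′ , h * m + m′ , sp-+ A W (q _ sw) sw′ , M-+ (suc l) (p l mm) mm′ ,
          trans (*-congˡ eq) (trans (solve 4 (λ T h a r → T :* (h :* a :+ r) := h :* (T :* a) :+ T :* r) refl _ _ _ _)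
            (trans (+-cong (*-congˡ e₁) e₂) (solve 5 (λ h w m w′ m′ → h :* (w :+ m) :+ (w′ :+ m′) := (h :* w :+ w′) :+ (h :* m :+ m′)) refl _ _ _ _ _)))
      ... | w , m , sw , mm , e₂ = pow comRing T (suc l) * g + w , m , sp-+ A W (Tl-stable (suc l) _ (sp-above hs sg)) sw , mm ,
        trans (*-congˡ e₁) (trans (solve 4 (λ T p g i → T :* p :* (g :+ i) := T :* p :* g :+ p :* (T :* i)) refl _ _ _ _)
          (trans (+-congˡ e₂) (sym (+-assoc _ _ _))))

      spanned : ∀ f → Sp A W (pow comRing T k * f)
      spanned f with expand k f
      ... | w , m , sw , mm , eq = sp-resp A W (sym (trans eq (trans (+-congˡ (M-nil mm)) (+-identityʳ _)))) sw

-- Order filtration, truncation and coefficient windows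

module Order where
  open Lin
  open KAlg
  open Span
  open Link using (module Naturality)
  open import Defs using (pow)
  open import Level using (Lift; lift)
  open import Algebra.Bundles using (CommutativeRing)
  open import Data.Nat as ℕ using (ℕ; zero; suc; _∸_; _<_; _≤_; s≤s; z≤n; _^_)
  import Data.Nat.Properties as ℕP
  open import Data.Fin using (Fin; zero; suc; toℕ; combine; quotient; remainder)
  import Data.Fin.Properties as FinP
  open import Data.List using (List; []; _∷_; map; length)
  open import Data.List.Properties using (length-map)
  open import Data.List.Relation.Unary.All using ([]; _∷_)
  open import Data.Product using (_×_; _,_; ∃; ∃₂)
  open import Data.Unit using (⊤; tt)
  import Relation.Binary.PropositionalEquality as ≡

  module OrderFiltration {c κ} (K : CommutativeRing c κ) where
    private module K = CommutativeRing K using (_≈_; _+_; _*_; 0#; 1#; refl; sym; trans; reflexive; +-cong; *-congˡ; *-congʳ; +-identityˡ; +-identityʳ; *-identityʳ; zeroˡ; zeroʳ; -‿inverseʳ)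
    open Algebras K
    open Spans K
    open Naturality K
    open Vectors K using (V)

    -- Ord k p: every monomial occurring in p has degree at least k.
    Ord : ∀ n → ℕ → Alg.Carrier (B n) → Set κ
    Ord zero zero a = Lift κ ⊤
    Ord zero (suc k) a = a K.≈ K.0#
    Ord (suc n) k p = ∀ i → Ord n (k ∸ i) (p i)

    ord-resp : ∀ n k {p q} → Alg._≈_ (B n) p q → Ord n k p → Ord n k q
    ord-resp zero zero e h = h
    ord-resp zero (suc k) e h = K.trans (K.sym e) h
    ord-resp (suc n) k e h i = ord-resp n (k ∸ i) (e i) (h i)

    ord-mono : ∀ n {k l} p → l ≤ k → Ord n k p → Ord n l p
    ord-mono zero {l = zero} p _ h = lift tt
    ord-mono zero {suc k} {suc l} p _ h = h
    ord-mono (suc n) p le h i = ord-mono n (p i) (ℕP.∸-monoˡ-≤ i le) (h i)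

    ord-0 : ∀ n p → Ord n 0 p
    ord-0 zero p = lift tt
    ord-0 (suc n) p i rewrite ℕP.0∸n≡0 i = ord-0 n (p i)

    ord-zero : ∀ n k → Ord n k (Alg.0# (B n))
    ord-zero zero zero = lift tt
    ord-zero zero (suc k) = K.refl
    ord-zero (suc n) k i = ord-zero n (k ∸ i)

    ord-+ : ∀ n k {p q} → Ord n k p → Ord n k q → Ord n k (Alg._+_ (B n) p q)
    ord-+ zero zero _ _ = lift tt
    ord-+ zero (suc k) h g = K.trans (K.+-cong h g) (K.+-identityˡ _)
    ord-+ (suc n) k h g i = ord-+ n (k ∸ i) (h i) (g i)

    ord-* : ∀ n a b {p q} → Ord n a p → Ord n b q → Ord n (a ℕ.+ b) (Alg._*_ (B n) p q)
    ord-* zero zero zero _ _ = lift tt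
    ord-* zero zero (suc b) _ g = K.trans (K.*-congˡ g) (K.zeroʳ _)
    ord-* zero (suc a) b h _ = K.trans (K.*-congʳ h) (K.zeroˡ _)
    ord-* (suc n) a b {p} {q} h g i = go i a p h
      where
      open PowerSeries (Alg.comRing (B n)) using (tl; conv)
      ∸-+-≥ : ∀ a b i → (a ℕ.+ b) ∸ i ≤ a ℕ.+ (b ∸ i)
      ∸-+-≥ a b zero = ℕP.≤-refl
      ∸-+-≥ a zero (suc i) = ℕP.≤-trans (ℕP.m∸n≤m (a ℕ.+ 0) (suc i)) (ℕP.+-monoʳ-≤ a z≤n)
      ∸-+-≥ a (suc b) (suc i) rewrite ℕP.+-suc a b = ∸-+-≥ a b i
      pred-+ : ∀ a b → (a ℕ.+ b) ∸ 1 ≤ (a ∸ 1) ℕ.+ b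
      pred-+ zero b = ℕP.m∸n≤m b 1
      pred-+ (suc a) b = ℕP.≤-refl
      go : ∀ i a p → (∀ j → Ord n (a ∸ j) (p j)) → Ord n ((a ℕ.+ b) ∸ i) (conv p q i)
      go zero a p h = ord-* n a b (h 0) (g 0)
      go (suc i) a p h = ord-+ n _
        (ord-mono n _ (∸-+-≥ a b (suc i)) (ord-* n a (b ∸ suc i) (h 0) (g (suc i))))
        (ord-mono n _ (ℕP.≤-trans (ℕP.≤-reflexive (≡.sym (ℕP.∸-+-assoc (a ℕ.+ b) 1 i))) (ℕP.∸-monoˡ-≤ i (pred-+ a b)))
          (go i (a ∸ 1) (tl p) (λ j → ≡.subst (λ l → Ord n l (p (suc j))) (≡.sym (ℕP.∸-+-assoc a 1 j)) (h (suc j)))))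

    ord-cst : ∀ n k {a} → Ord n k a → Ord (suc n) k (PowerSeries.cst (Alg.comRing (B n)) a)
    ord-cst n k h zero = h
    ord-cst n k h (suc i) = ord-zero n _

    ord-X : ∀ n → Ord (suc n) 1 (Xs {suc n} zero)
    ord-X n zero = ord-zero n 1
    ord-X n (suc i) rewrite ℕP.0∸n≡0 i = ord-0 n (Xs {suc n} zero (suc i))

    ord-Xs : ∀ n i → Ord n 1 (Xs {n} i)
    ord-Xs (suc n) zero = ord-X n
    ord-Xs (suc n) (suc i) = ord-cst n 1 (ord-Xs n i)

    R : ℕ → Alg κ
    R n = PS (B n)

    -- The outer variable t of R n = K[[x]][[t]] has weight zero.
    OrdR : ∀ n → ℕ → Alg.Carrier (R n) → Set κ
    OrdR n k r = ∀ j → Ord n k (r j)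

    private
      ord-conv : ∀ n a b {p q} → (∀ j → Ord n a (p j)) → ∀ E → (∀ j → j < E → Ord n b (q j)) → ∀ j → j < E →
                 Ord n (a ℕ.+ b) (PowerSeries.conv (Alg.comRing (B n)) p q j)
      ord-conv n a b h E g zero lt = ord-* n a b (h 0) (g 0 lt)
      ord-conv n a b h E g (suc j) lt = ord-+ n (a ℕ.+ b) (ord-* n a b (h 0) (g (suc j) lt))
        (ord-conv n a b (λ i → h (suc i)) E g j (ℕP.<-trans (ℕP.n<1+n j) lt))

    ordR-* : ∀ n a b {p q} → OrdR n a p → OrdR n b q → OrdR n (a ℕ.+ b) (Alg._*_ (R n) p q)
    ordR-* n a b h g j = ord-conv n a b h (suc j) (λ i _ → g i) j ℕP.≤-refl

    ordIdeal : ∀ n → ℕ → Ideal (Alg.comRing (R n)) κ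
    ordIdeal n k = record
      { Mem = OrdR n k ; resp = λ e h j → ord-resp n k (e j) (h j) ; zeroM = λ j → ord-zero n k
      ; addM = λ h g j → ord-+ n k (h j) (g j) ; mulM = λ y h → ordR-* n 0 k (λ j → ord-0 n (y j)) h }

    -- The ideal `(x)^k + (t^E)`, described through coefficients. Modulo it both the variables and
    -- `t` are nilpotent.
    truncIdeal : ∀ n → ℕ → ℕ → Ideal (Alg.comRing (R n)) κ
    truncIdeal n k E = record
      { Mem = λ r → ∀ j → j < E → Ord n k (r j) ; resp = λ e h j lt → ord-resp n k (e j) (h j lt)
      ; zeroM = λ j _ → ord-zero n k ; addM = λ h g j lt → ord-+ n k (h j lt) (g j lt)
      ; mulM = λ y h → ord-conv n 0 k (λ j → ord-0 n (y j)) E h }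

    at : ∀ {x} {X : Set x} {q} → (Fin q → X) → X → ℕ → X
    at {q = zero} f d j = d
    at {q = suc q} f d zero = f zero
    at {q = suc q} f d (suc j) = at (λ i → f (suc i)) d j

    at-toℕ : ∀ {x} {X : Set x} {q} (f : Fin q → X) d a → at f d (toℕ a) ≡.≡ f a
    at-toℕ f d zero = ≡.refl
    at-toℕ f d (suc a) = at-toℕ (λ i → f (suc i)) d a

    -- Coefficients at the monomials all of whose exponents are below q.
    coeffs : ∀ n q → Alg.Carrier (B n) → V (q ^ n)
    coeffs zero q a _ = a
    coeffs (suc n) q p i = coeffs n q (p (toℕ (quotient {q} (q ^ n) i))) (remainder {q} (q ^ n) i)

    build : ∀ n q → V (q ^ n) → Alg.Carrier (B n)
    build zero q w = w zero
    build (suc n) q w = at (λ a → build n q (λ r → w (combine {q} a r))) (Alg.0# (B n))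

    coeffs-cong : ∀ n q {p p′} → Alg._≈_ (B n) p p′ → ∀ i → coeffs n q p i K.≈ coeffs n q p′ i
    coeffs-cong zero q e i = e
    coeffs-cong (suc n) q e i = coeffs-cong n q (e _) _

    coeffs-+ : ∀ n q p p′ i → coeffs n q (Alg._+_ (B n) p p′) i K.≈ coeffs n q p i K.+ coeffs n q p′ i
    coeffs-+ zero q p p′ i = K.refl
    coeffs-+ (suc n) q p p′ i = coeffs-+ n q _ _ _

    coeffs-ι : ∀ n q a p i → coeffs n q (Alg._*_ (B n) (Alg.ι (B n) a) p) i K.≈ a K.* coeffs n q p i
    coeffs-ι zero q a p i = K.refl
    coeffs-ι (suc n) q a p i = K.trans (coeffs-cong n q (PowerSeries.conv-cst (Alg.comRing (B n)) _ p _) _) (coeffs-ι n q a _ _)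

    coeffs-build : ∀ n q w i → coeffs n q (build n q w) i K.≈ w i
    coeffs-build zero q w zero = K.refl
    coeffs-build (suc n) q w i = K.trans
      (K.reflexive (≡.cong (λ p → coeffs n q p (remainder {q} (q ^ n) i)) (at-toℕ (λ a → build n q (λ r → w (combine {q} a r))) (Alg.0# (B n)) (quotient {q} (q ^ n) i))))
      (K.trans (coeffs-build n q _ _) (K.reflexive (≡.cong w (FinP.combine-remQuot {q} (q ^ n) i))))

    -- A monomial whose `n` exponents are below `q` has degree less than `k` as soon as `n q < k`.
    coeffs-ord : ∀ n q k {p} → n ℕ.* q < k → Ord n k p → ∀ i → coeffs n q p i K.≈ K.0#
    coeffs-ord zero q (suc k) lt h i = h
    coeffs-ord (suc n) q k lt h i = coeffs-ord n q (k ∸ toℕ a) (ℕP.+-cancelʳ-< (toℕ a) (n ℕ.* q) (k ∸ toℕ a) lt′) (h (toℕ a)) _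
      where
      a = quotient {q} (q ^ n) i
      a<q = FinP.toℕ<n a
      lt′ : n ℕ.* q ℕ.+ toℕ a < (k ∸ toℕ a) ℕ.+ toℕ a
      lt′ = ℕP.≤-trans (s≤s (ℕP.≤-trans (ℕP.+-monoʳ-≤ (n ℕ.* q) (ℕP.<⇒≤ a<q)) (ℕP.≤-reflexive (ℕP.+-comm (n ℕ.* q) q))))
        (ℕP.≤-trans lt (ℕP.≤-reflexive (≡.sym (ℕP.m∸n+n≡m {k} {toℕ a}
          (ℕP.≤-trans (ℕP.<⇒≤ a<q) (ℕP.≤-trans (ℕP.m≤m+n q (n ℕ.* q)) (ℕP.<⇒≤ lt)))))))

    X-shift : ∀ {ℓ} (A : Alg ℓ) m f j → Alg._≈_ A (Alg._*_ (PS A) (pow (Alg.comRing (PS A)) (PowerSeries.X (Alg.comRing A)) m) f (m ℕ.+ j)) (f j)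
    X-shift A zero f j = Alg.*-identityˡ (PS A) f j
    X-shift A (suc m) f j = trans (Alg.*-assoc (PS A) X _ f (suc (m ℕ.+ j))) (trans (conv-X-suc _ (m ℕ.+ j)) (X-shift A m f j))
      where
      open Alg A using (comRing; trans)
      open PowerSeries comRing using (X; conv-X-suc)

    X-low : ∀ {ℓ} (A : Alg ℓ) m j → j < m → Alg._≈_ A (pow (Alg.comRing (PS A)) (PowerSeries.X (Alg.comRing A)) m j) (Alg.0# A)
    X-low A (suc m) zero lt = PowerSeries.conv-X-zero (Alg.comRing A) (pow (Alg.comRing (PS A)) (PowerSeries.X (Alg.comRing A)) m)
    X-low A (suc m) (suc j) (s≤s lt) = Alg.trans A (PowerSeries.conv-X-suc (Alg.comRing A) (pow (Alg.comRing (PS A)) (PowerSeries.X (Alg.comRing A)) m) j) (X-low A m j lt)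

    -- The `N ^ n` monomials with all exponents below `N`.
    box : ∀ n → ℕ → List (Alg.Carrier (B n))
    box zero N = K.1# ∷ []
    box (suc n) N = powers (PS (B n)) (PowerSeries.X (Alg.comRing (B n))) N (map (PowerSeries.cst (Alg.comRing (B n))) (box n N))

    length-box : ∀ n N → length (box n N) ≡.≡ N ^ n
    length-box zero N = ≡.refl
    length-box (suc n) N = ≡.trans (length-powers (PS (B n)) _ N _) (≡.cong (N ℕ.*_) (≡.trans (length-map _ (box n N)) (length-box n N)))

    contract : ∀ {ℓ ℓ₂ ℓ′} {A : Alg ℓ} {A′ : Alg ℓ₂} → Hom A A′ → Ideal (Alg.comRing A′) ℓ′ → Ideal (Alg.comRing A) ℓ′
    contract {A′ = A′} φ 𝔞 = record
      { Mem = λ x → Mem ⟦ x ⟧ ; resp = λ e → resp (⟦⟧-cong e) ; zeroM = resp (Alg.sym A′ ⟦⟧-0) zeroM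
      ; addM = λ h g → resp (Alg.sym A′ (⟦⟧-+ _ _)) (addM h g) ; mulM = λ y h → resp (Alg.sym A′ (⟦⟧-* _ _)) (mulM ⟦ y ⟧ h) }
      where
      open Hom φ using (⟦_⟧; ⟦⟧-cong; ⟦⟧-+; ⟦⟧-*; ⟦⟧-0)
      open Ideal 𝔞

    -- The first `N` coefficients in the outer variable are reduced one after another, modulo the
    -- contraction of the ideal to the inner ring. The rest is a multiple of `X^N`, hence in the
    -- ideal.
    box-reduce : ∀ n N {ℓ′} (𝔞 : Ideal (Alg.comRing (B n)) ℓ′) → (∀ i → Ideal.Mem 𝔞 (pow (Alg.comRing (B n)) (Xs {n} i) N)) →
      ∀ f → ∃ λ g → Sp (B n) (box n N) g × Ideal.Mem 𝔞 (Alg._-_ (B n) f g)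
    box-reduce zero N 𝔞 h f = f , (f , K.0# , lift K.refl , K.sym (K.trans (K.+-identityʳ _) (K.*-identityʳ _))) ,
      Ideal.resp 𝔞 (K.sym (K.-‿inverseʳ f)) (Ideal.zeroM 𝔞)
    box-reduce (suc n) N 𝔞 h f with go N f
      where
      open Alg (PS (B n)) using (comRing; _+_; _*_; -_; _-_; 0#; sym; trans; +-congˡ; +-congʳ; *-congˡ; -‿cong)
      open PowerSeries (Alg.comRing (B n)) using (X; cst; tl; decompose; cst-+)
      open Ideal 𝔞
      G = map cst (box n N)
      go : ∀ j f → ∃₂ λ g f′ → Sp (PS (B n)) (powers (PS (B n)) X j G) g × Mem (f - (g + pow comRing X j * f′))
      go zero f = 0# , f , sp-0 (PS (B n)) [] , resp (IdealConstructions.adjust-start comRing 𝔞 f) zeroM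
      go (suc j) f with go j f
      ... | g , f′ , sg , m with box-reduce n N (contract (cstHom (B n)) 𝔞)
              (λ i → resp (sym (hom-pow (cstHom (B n)) (Xs {n} i) N)) (h (suc i))) (f′ 0)
      ... | b , sb , mb = g + pow comRing X j * cst b , tl f′ ,
        sp-+ (PS (B n)) (powers (PS (B n)) X (suc j) G) (sp-++ˡ (PS (B n)) (powers (PS (B n)) X j G) _ sg)
          (sp-++ʳ (PS (B n)) (powers (PS (B n)) X j G) _ (sp-map (PS (B n)) _ G (sp-hom (cstHom (B n)) (box n N) sb))) ,
        resp (trans (+-congˡ (*-congˡ (trans (Hom.⟦⟧-+ (cstHom (B n)) _ _) (+-congˡ (Hom.⟦⟧-neg (cstHom (B n)) b)))))
               (trans (+-congʳ (+-congˡ (-‿cong (+-congˡ (*-congˡ (decompose f′))))))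
                 (IdealConstructions.adjust comRing 𝔞 f g (pow comRing X j) (cst (f′ 0)) X (tl f′) (cst b))))
          (addM m (mulM (pow comRing X j) mb))
    ... | g , f′ , sg , m = g , sg ,
      resp (IdealConstructions.adjust-end comRing 𝔞 f g _ f′) (addM m (mulM f′ (h zero)))
      where
      open Alg (PS (B n)) using (comRing)
      open Ideal 𝔞

-- Semicontinuity of dimension by counting

module Engine where
  open Lin
  open LA
  open KAlg
  open Span
  open Link using (module Naturality)
  open import Defs using (pow)
  open import Level using (_⊔_; lift)
  open import Algebra.Bundles using (CommutativeRing)
  open import Data.Nat as ℕ using (ℕ; zero; suc; _<_; _≤_; s≤s; z≤n; _^_)
  import Data.Nat.Properties as ℕP
  import Data.Nat.Solver
  open import Data.Fin using (zero; suc; toℕ; combine; quotient; remainder)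
  import Data.Fin.Properties as FinP
  open import Data.List using (List; []; _∷_; map; length)
  open import Data.List.Properties using (length-map)
  open import Data.List.Relation.Unary.All as All using (All; []; _∷_)
  import Data.List.Relation.Unary.All.Properties as AllP
  open import Data.Product using (_×_; _,_; ∃; ∃₂; proj₁; proj₂)
  open import Data.Empty using (⊥)
  open import Relation.Nullary using (¬_)
  import Relation.Binary.PropositionalEquality as ≡
  open Order

  module HeightEngine {c κ} (K : CommutativeRing c κ) (F : StableField K) where
    private module K = CommutativeRing K using (_≈_; _+_; _*_; 0#; refl; sym; trans; reflexive; +-cong; +-congʳ; *-congˡ; +-identityˡ; zeroˡ; zeroʳ)
    open Algebras K
    open Spans K
    open Naturality K
    open OrderFiltration K
    open LinearAlgebra K F using (underdetermined)
    open Vectors K using (V; _·_; ·-cong; ·-δ; ·-+ʳ; ·-•ʳ; ·-0ʳ; δ)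

    -- With fewer generators than coordinates, a nonzero functional kills the images of all
    -- generators. It then kills every `δ i`, each of which is the image of an element of the span.
    sp-independent : ∀ {ℓ} (A : Alg ℓ) gs {L} (χ : Alg.Carrier A → V L) →
      (∀ {x y} → Alg._≈_ A x y → ∀ i → χ x i K.≈ χ y i) → (∀ x y i → χ (Alg._+_ A x y) i K.≈ χ x i K.+ χ y i) →
      (∀ a x i → χ (Alg._*_ A (Alg.ι A a) x) i K.≈ a K.* χ x i) → (∀ w → ∃ λ x → Sp A gs x × (∀ i → χ x i K.≈ w i)) →
      L ≤ length gs
    sp-independent A gs {L} χ χ-cong χ-+ χ-ι onto = ℕP.≮⇒≥ λ lt →
      underdetermined (map χ gs) (ℕP.≤-trans (ℕP.≤-reflexive (≡.cong suc (length-map χ gs))) lt)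
        λ { (v , (i , vi) , al) → vi (K.trans (K.sym (·-δ v i)) (K.trans (·-cong (λ _ → K.refl) (λ j → K.sym (proj₂ (proj₂ (onto (δ i))) j)))
              (annihilates gs v (AllP.map⁻ al) (proj₁ (proj₂ (onto (δ i))))))) }
      where
      module A = Alg A using (0#; sym; trans; *-congʳ; zeroˡ)
      χ-0 : ∀ i → χ A.0# i K.≈ K.0#
      χ-0 i = K.trans (χ-cong (A.sym (A.trans (A.*-congʳ (Hom.⟦⟧-0 (ιHom A))) (A.zeroˡ A.0#))) i) (K.trans (χ-ι K.0# A.0# i) (K.zeroˡ _))
      annihilates : ∀ gs v → All (λ g → χ g · v K.≈ K.0#) gs → ∀ {x} → Sp A gs x → v · χ x K.≈ K.0#
      annihilates [] v [] (lift h) = ·-0ʳ v (λ i → K.trans (χ-cong h i) (χ-0 i))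
      annihilates (g ∷ gs) v (p ∷ ps) {x} (a , r , s , e) = K.trans
        (·-cong (λ _ → K.refl) (λ i → K.trans (χ-cong e i) (K.trans (χ-+ _ r i) (K.+-congʳ (χ-ι a g i)))))
        (K.trans (·-+ʳ v _ (χ r)) (K.trans (K.+-cong (K.trans (·-•ʳ a v (χ g)) (K.trans (K.*-congˡ (K.trans (Vectors.·-comm K v (χ g)) p)) (K.zeroʳ _)))
          (annihilates gs v ps s)) (K.+-identityˡ _)))

    -- For general `t` the ideal lies in one generated by `r` elements of `(x)`, so its zero set has
    -- codimension at most `r` at the origin. The factor `t^e` replaces inverting `t`, and `e` may
    -- depend on the precision `k`.
    Deformed : ∀ {ℓ′} n r → Ideal (Alg.comRing (R n)) ℓ′ → Set _
    Deformed n r I = ∀ k → 0 < k → ∃₂ λ e hs → 0 < e × length hs ≡.≡ r × All (OrdR n 1) hs ×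
      (∀ {f} → Ideal.Mem I f → InGen (Quot (R n) (ordIdeal n k)) hs (Alg._*_ (R n) (pow (Alg.comRing (R n)) (Xs {suc n} zero) e) f))

    -- The specialisation at `t = 0` defines the origin only: it contains a power of every variable.
    PowersAtZero : ∀ {ℓ′} n → Ideal (Alg.comRing (R n)) ℓ′ → ℕ → Set _
    PowersAtZero n I N = ∀ i → ∃ λ ρ → Ideal.Mem I (Alg._-_ (R n) (pow (Alg.comRing (R n)) (Xs {suc n} (suc i)) N) (Alg._*_ (R n) (Xs {suc n} zero) ρ))

    private
     -- The multiples of `t^(k e)` modulo `(x)^k + (t^(2 k e))` lie in the span produced by
     -- `Iterate`, yet they realise arbitrary values in `k e q^n` coefficients, those of t-degree at
     -- least `k e` and x-exponents below `q`.
     dimension-count : ∀ {n r} (I : Ideal (Alg.comRing (R n)) (c ⊔ κ)) N → PowersAtZero n I N → ∀ q k e hs → n ℕ.* q < k →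
      0 < e → length hs ≡.≡ r → All (OrdR n 1) hs → ∀ T → Alg._≈_ (R n) T (pow (Alg.comRing (R n)) (Xs {suc n} zero) e) →
      (∀ {f} → Ideal.Mem I f → InGen (Quot (R n) (ordIdeal n k)) hs (Alg._*_ (R n) T f)) →
      k ℕ.* e ℕ.* q ^ n ≤ k ^ r ℕ.* ((k ℕ.* e ℕ.+ k ℕ.* e) ℕ.* N ^ n)
     dimension-count {n} {r} I N contains q k e hs nq<k 0<e len h1 T T≈ intoR = ℕP.≤-trans counted (ℕP.≤-reflexive lenW)
      where
      0<k : 0 < k
      0<k = ℕP.≤-trans (s≤s z≤n) nq<k
      module R = Alg (R n) using (comRing; Carrier; _+_; _*_; -_; _-_; sym; trans)
      m E : ℕ
      m = k ℕ.* e
      -- The t-degrees below `m` are lost to the factor `T^k = t^m`; the following `m` degrees form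
      -- the window in which `χ` reads coefficients.
      E = m ℕ.+ m
      t : R.Carrier
      t = Xs {suc n} zero
      A : Alg κ
      A = Quot (R n) (truncIdeal n k E)
      π : Hom (R n) A
      π = quotHom (R n) (truncIdeal n k E)
      module A = Alg A using (comRing; Carrier; _≈_; _+_; _*_; 0#; refl; sym; trans; +-cong; *-congˡ; *-congʳ)
      0<m : 0 < m
      0<m = ℕP.*-mono-≤ {1} {k} {1} {e} 0<k 0<e
      0<E : 0 < E
      0<E = ℕP.≤-trans 0<m (ℕP.m≤m+n m m)
      I′ : Ideal A.comRing (c ⊔ κ)
      I′ = IdealConstructions.image R.comRing I (truncIdeal n k E)
      It : Ideal R.comRing (c ⊔ κ)
      It = IdealConstructions.adjoin R.comRing I t
      φ : Hom (B n) A
      φ = record { ⟦_⟧ = PowerSeries.cst (Alg.comRing (B n)) ; ⟦⟧-cong = λ h → Hom.⟦⟧-cong π (Hom.⟦⟧-cong (cstHom (B n)) h)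
        ; ⟦⟧-+ = λ a b → Hom.⟦⟧-cong π (Hom.⟦⟧-+ (cstHom (B n)) a b) ; ⟦⟧-* = λ a b → Hom.⟦⟧-cong π (Hom.⟦⟧-* (cstHom (B n)) a b) ; ⟦⟧-ι = λ _ → A.refl }
      G : List A.Carrier
      G = map (PowerSeries.cst (Alg.comRing (B n))) (box n N)
      reduce : ∀ f → ∃₂ λ g i → ∃ λ f′ → Sp A G g × Ideal.Mem I′ i × f A.≈ (g A.+ i) A.+ t A.* f′
      reduce f = assemble (box-reduce n N (contract (cstHom (B n)) It)
        (λ i → Ideal.resp It (R.sym (hom-pow (cstHom (B n)) (Xs {n} i) N)) (contains i)) f₀)
        where
        open Alg (B n) using (_-_)
        open PowerSeries (Alg.comRing (B n)) using (cst; tl; decompose)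
        f₀ = f 0
        assemble : (∃ λ g → Sp (B n) (box n N) g × Ideal.Mem (contract (cstHom (B n)) It) (f₀ - g)) →
                   ∃₂ λ g i → ∃ λ f′ → Sp A G g × Ideal.Mem I′ i × f A.≈ (g A.+ i) A.+ t A.* f′
        assemble (g , sg , ρ , mem) = cst g , cst (f₀ - g) R.- t R.* ρ , ρ R.+ tl f , sp-hom φ (box n N) sg , (_ , mem , A.refl) ,
          Hom.⟦⟧-cong π (IdealConstructions.split-adjoin′ R.comRing I f (cst f₀) (cst g) (cst (f₀ - g)) t ρ (tl f)
            (decompose f) (Hom.⟦⟧-minus (cstHom (B n)) f₀ g))
      into : ∀ {i} → Ideal.Mem I′ i → InGen A hs (T A.* i)
      into = gen-image (R n) (ordIdeal n k) (truncIdeal n k E) (λ h j _ → h j) I hs T intoR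
      ord-pow : ∀ h → OrdR n 1 h → ∀ j → OrdR n j (pow R.comRing h j)
      ord-pow h o zero = λ j → ord-0 n _
      ord-pow h o (suc j) = ordR-* n 1 j o (ord-pow h o j)
      vanish : ∀ {x} → OrdR n k x → x A.≈ A.0#
      vanish o = Quotient.mem⇒~0 R.comRing (truncIdeal n k E) (λ j _ → o j)
      t-nil : pow R.comRing t E A.≈ A.0#
      t-nil = Quotient.mem⇒~0 R.comRing (truncIdeal n k E) (λ j lt → ord-resp n k (Alg.sym (B n) (X-low (B n) E j lt)) (ord-zero n k))
      Near : ℕ → A.Carrier → Set _
      Near l x = ∃ λ y → x A.≈ y × OrdR n l y
      near-resp : ∀ l {x y} → x A.≈ y → Near l x → Near l y
      near-resp l e (y , h , o) = y , A.trans (A.sym e) h , o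
      near-0 : ∀ x → Near 0 x
      near-0 x = x , A.refl , λ j → ord-0 n _
      near-zero : ∀ l → Near l A.0#
      near-zero l = A.0# , A.refl , λ j → ord-zero n l
      near-+ : ∀ l {x y} → Near l x → Near l y → Near l (x A.+ y)
      near-+ l (y , h , o) (z , g , p) = y A.+ z , A.+-cong h g , λ j → ord-+ n l (o j) (p j)
      near-* : All (λ h → ∀ l {x} → Near l x → Near (suc l) (h A.* x)) hs
      near-* = All.map (λ {h} oh l → λ { (y , e , o) → h A.* y , A.*-congˡ e , ordR-* n 1 l oh o }) h1
      near-nil : ∀ {x} → Near k x → x A.≈ A.0#
      near-nil (y , e , o) = A.trans e (vanish o)
      module It = Iterate A I′ t T e E k G hs (A.trans (Hom.⟦⟧-cong π T≈) (hom-pow π t e)) 0<E 0<k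
        (A.trans (A.sym (hom-pow π t E)) t-nil)
        (All.map (λ {h} o → A.trans (A.sym (hom-pow π h k)) (vanish (ord-pow h o k))) h1)
        reduce into
        Near near-resp near-0 near-zero near-+ near-* near-nil
      χ : A.Carrier → V (m ℕ.* q ^ n)
      χ x i = coeffs n q (x (m ℕ.+ toℕ (quotient {m} (q ^ n) i))) (remainder {m} (q ^ n) i)
      lenW : length It.W ≡.≡ k ^ r ℕ.* (E ℕ.* N ^ n)
      lenW = ≡.trans It.length-W (≡.cong₂ (λ a b → k ^ a ℕ.* (E ℕ.* b)) len (≡.trans (length-map _ (box n N)) (length-box n N)))
      χ-cong : ∀ {x y} → x A.≈ y → ∀ i → χ x i K.≈ χ y i
      χ-cong {x} {y} (Quotient.modulo h) i = K.trans (coeffs-cong n q (Powers.minus-plus comRing (x j) (y j)) i′)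
        (K.trans (coeffs-+ n q _ _ i′) (K.trans (K.+-congʳ (coeffs-ord n q k nq<k (h j (ℕP.+-monoʳ-< m (FinP.toℕ<n a))) i′)) (K.+-identityˡ _)))
        where
        open Alg (B n) using (comRing)
        a = quotient {m} (q ^ n) i
        j = m ℕ.+ toℕ a
        i′ = remainder {m} (q ^ n) i
      onto : ∀ w → ∃ λ x → Sp A It.W x × (∀ i → χ x i K.≈ w i)
      onto w = pow A.comRing T k A.* f , It.spanned f , λ i → K.trans (χ-cong shifted i)
        (K.trans (coeffs-cong n q (X-shift (B n) m f (toℕ (quotient {m} (q ^ n) i))) _)
          (K.trans (K.reflexive (≡.cong (λ p → coeffs n q p (remainder {m} (q ^ n) i)) (at-toℕ (λ a → build n q (λ r → w (combine {m} a r))) (Alg.0# (B n)) (quotient {m} (q ^ n) i))))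
            (K.trans (coeffs-build n q _ _) (K.reflexive (≡.cong w (FinP.combine-remQuot {m} (q ^ n) i))))))
        where
        f : R.Carrier
        f = at (λ a → build n q (λ r → w (combine {m} a r))) (Alg.0# (B n))
        shifted : pow A.comRing T k A.* f A.≈ pow R.comRing t m R.* f
        shifted = A.*-congʳ (A.trans (A.sym (hom-pow π T k)) (Hom.⟦⟧-cong π (R.trans (Powers.pow-cong R.comRing k T≈) (Powers.pow-* R.comRing t e k))))
      counted : m ℕ.* q ^ n ≤ length It.W
      counted = sp-independent A It.W χ χ-cong (λ x y i → coeffs-+ n q _ _ _)
        (λ a x i → K.trans (coeffs-cong n q (PowerSeries.conv-cst (Alg.comRing (B n)) _ x _) _) (coeffs-ι n q a _ _))
        onto

    -- Dimension does not drop under specialisation to t = 0; the proof compares dimension counts modulo powers of (x).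
    height-bound : ∀ {n r} → r < n → (I : Ideal (Alg.comRing (R n)) (c ⊔ κ)) → ∀ N → PowersAtZero n I N → ¬ Deformed n r I
    height-bound {n} {r} r<n I N contains deformed = contradict _ ≡.refl
      where
      -- For `k = (n+1) q` the factor `m` cancels from the count, which becomes
      -- `q^n ≤ 2 N^n (n+1)^r q^r`. Since `r < n`, this fails as soon as `q` exceeds
      -- `2 N^n (n+1)^r`.
      q₀ = (N ^ n ℕ.+ N ^ n) ℕ.* suc n ^ r
      contradict : ∀ q → q ≡.≡ suc q₀ → ⊥
      contradict q qe = bound (deformed k 0<k)
        where
        k = suc n ℕ.* q
        nq<k : n ℕ.* q < k
        nq<k rewrite qe = ℕP.≤-trans (ℕP.m≤n+m (suc (n ℕ.* suc q₀)) q₀) (ℕP.≤-reflexive (ℕP.+-suc _ _))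
        0<k : 0 < k
        0<k = ℕP.≤-trans (s≤s z≤n) nq<k
        instance
          q≢0 : ℕ.NonZero q
          q≢0 rewrite qe = _
        bound : _ → ⊥
        bound (e , hs , 0<e , len , h1 , into) = ℕP.<⇒≱ small (dimension-count {r = r} I N contains q k e hs nq<k 0<e len h1 _ (Alg.refl (R n)) into)
          where
          m = k ℕ.* e
          0<m : 0 < m
          0<m = ℕP.*-mono-≤ {1} {k} {1} {e} 0<k 0<e
          small : k ^ r ℕ.* ((m ℕ.+ m) ℕ.* N ^ n) < m ℕ.* q ^ n
          small = begin-strict
            k ^ r ℕ.* ((m ℕ.+ m) ℕ.* N ^ n) ≡⟨ ≡.cong (ℕ._* ((m ℕ.+ m) ℕ.* N ^ n)) (^-distribʳ-* r) ⟩
            suc n ^ r ℕ.* q ^ r ℕ.* ((m ℕ.+ m) ℕ.* N ^ n)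
              ≡⟨ NS.solve 4 (λ d p m w → d NS.:* p NS.:* ((m NS.:+ m) NS.:* w) NS.:= m NS.:* ((w NS.:+ w) NS.:* d NS.:* p)) ≡.refl (suc n ^ r) (q ^ r) m (N ^ n) ⟩
            m ℕ.* ((N ^ n ℕ.+ N ^ n) ℕ.* suc n ^ r ℕ.* q ^ r)
              <⟨ ℕP.*-monoʳ-< m {{ℕ.>-nonZero 0<m}} (ℕP.*-monoˡ-< (q ^ r) {{ℕP.m^n≢0 q r}} (ℕP.≤-reflexive (≡.sym qe))) ⟩
            m ℕ.* q ^ suc r ≤⟨ ℕP.*-monoʳ-≤ m (ℕP.^-monoʳ-≤ q r<n) ⟩
            m ℕ.* q ^ n ∎
            where
            open ℕP.≤-Reasoning
            module NS = Data.Nat.Solver.+-*-Solver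
            ^-distribʳ-* : ∀ j → (suc n ℕ.* q) ^ j ≡.≡ suc n ^ j ℕ.* q ^ j
            ^-distribʳ-* zero = ≡.refl
            ^-distribʳ-* (suc j) = ≡.trans (≡.cong (suc n ℕ.* q ℕ.*_) (^-distribʳ-* j))
              (NS.solve 4 (λ d q x y → d NS.:* q NS.:* (x NS.:* y) NS.:= d NS.:* x NS.:* (q NS.:* y)) ≡.refl (suc n) q (suc n ^ j) (q ^ j))

-- Homogeneous forms and homogeneous ideals

module Forms where
  open RS
  open Lin
  open KAlg
  open Link using (module Naturality)
  open import Defs using (pow)
  open import Level using (_⊔_) renaming (suc to lsuc)
  open import Algebra.Bundles using (CommutativeRing)
  open import Data.Nat as ℕ using (ℕ; zero; suc; _^_)
  import Data.Nat.Properties as ℕP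
  open import Data.Fin using (Fin; zero; suc; quotient; remainder; combine)
  import Data.Fin.Properties as FinP
  open import Data.List using (List; []; _∷_; _++_; map)
  open import Data.Product using (_×_; _,_; ∃; proj₁; proj₂)
  open import Relation.Nullary using (¬_)
  import Relation.Binary.PropositionalEquality as ≡

  module HomogeneousForms {c κ} (K : CommutativeRing c κ) where
    private module K = CommutativeRing K using (Carrier; _≈_; _+_; _*_; -_; _-_; 0#; 1#; trans; reflexive; *-congˡ)
    open Algebras K

    -- A polynomial function given by its values in all algebras at once. Naturality is not part of
    -- the notion; where it matters, `Form` provides an explicit polynomial with these values.
    Law : ℕ → Set (lsuc c ⊔ lsuc κ)
    Law n = ∀ (A : Alg κ) → (Fin n → Alg.Carrier A) → Alg.Carrier A

    infix 4 _≋_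
    _≋_ : ∀ {n} → Law n → Law n → Set (lsuc c ⊔ lsuc κ)
    φ ≋ ψ = ∀ A x → Alg._≈_ A (φ A x) (ψ A x)

    infixl 6 _⊞_ _⊟_
    infixl 7 _⊠_
    _⊞_ _⊟_ _⊠_ : ∀ {n} → Law n → Law n → Law n
    (φ ⊞ ψ) A x = Alg._+_ A (φ A x) (ψ A x)
    (φ ⊟ ψ) A x = Alg._-_ A (φ A x) (ψ A x)
    (φ ⊠ ψ) A x = Alg._*_ A (φ A x) (ψ A x)
    const : ∀ {n} → K.Carrier → Law n
    const a A x = Alg.ι A a
    coord : ∀ {n} → Fin n → Law n
    coord i A x = x i
    ΣL : ∀ {n m} → (Fin m → Law n) → Law n
    ΣL φ A x = Vectors.Σ (Alg.comRing A) (λ i → φ i A x)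
    powL : ∀ {n} → Law n → ℕ → Law n
    powL φ j A x = pow (Alg.comRing A) (φ A x) j
    infixl 9 _∘L_
    _∘L_ : ∀ {n m} → Law n → (Fin n → Law m) → Law m
    (φ ∘L σ) A x = φ A (λ i → σ i A x)

    -- Homogeneous forms are written as noncommutative polynomials: coefficients indexed by words.
    Words : ℕ → Set c
    Words n = List (Fin n) → K.Carrier

    ∂ : ∀ {n} → Fin n → Words n → Words n
    ∂ i p w = p (i ∷ w)

    form : ∀ {n} → ℕ → Words n → Law n
    form zero p A x = Alg.ι A (p [])
    form (suc d) p A x = Vectors.Σ (Alg.comRing A) (λ i → Alg._*_ A (x i) (form d (∂ i p) A x))

    record Form {n} (d : ℕ) (φ : Law n) : Set (lsuc c ⊔ lsuc κ) where
      constructor _via_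
      field
        words : Words n
        agrees : φ ≋ form d words

    form-cong : ∀ {n} d (p : Words n) A {x y} → (∀ i → Alg._≈_ A (x i) (y i)) → Alg._≈_ A (form d p A x) (form d p A y)
    form-cong zero p A h = Alg.refl A
    form-cong (suc d) p A h = Vectors.Σ-cong (Alg.comRing A) (λ i → Alg.*-cong A (h i) (form-cong d (∂ i p) A h))

    law-cong : ∀ {n d} {φ : Law n} → Form d φ → ∀ A {x y} → (∀ i → Alg._≈_ A (x i) (y i)) → Alg._≈_ A (φ A x) (φ A y)
    law-cong {d = d} (p via e) A h = Alg.trans A (e A _) (Alg.trans A (form-cong d p A h) (Alg.sym A (e A _)))

    form-resp : ∀ {n d} {φ ψ : Law n} → φ ≋ ψ → Form d φ → Form d ψ
    form-resp h (p via e) = p via λ A x → Alg.trans A (Alg.sym A (h A x)) (e A x)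

    form-≡ : ∀ {n d d′} {φ : Law n} → d ≡.≡ d′ → Form d φ → Form d′ φ
    form-≡ ≡.refl f = f

    form-zero : ∀ {n} d → Form {n} d (λ A x → Alg.0# A)
    form-zero d = (λ _ → K.0#) via λ A x → Alg.sym A (go d A x)
      where
      go : ∀ {n} d A (x : Fin n → _) → Alg._≈_ A (form d (λ _ → K.0#) A x) (Alg.0# A)
      go zero A x = Hom.⟦⟧-0 (ιHom A)
      go (suc d) A x = Vectors.Σ-0 (Alg.comRing A) (λ i → Alg.trans A (Alg.*-congˡ A (go d A x)) (Alg.zeroʳ A _))

    form-const : ∀ {n} a → Form {n} 0 (const a)
    form-const a = (λ _ → a) via λ A x → Alg.refl A

    form-+ : ∀ {n d} {φ ψ : Law n} → Form d φ → Form d ψ → Form d (φ ⊞ ψ)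
    form-+ {d = d} (p via e) (q via e′) = (λ w → p w K.+ q w) via λ A x → Alg.trans A (Alg.+-cong A (e A x) (e′ A x)) (Alg.sym A (go d p q A x))
      where
      go : ∀ {n} d (p q : Words n) → form d (λ w → p w K.+ q w) ≋ form d p ⊞ form d q
      go zero p q A x = Alg.ι-+ A _ _
      go (suc d) p q A x = trans (Σ-cong (λ i → trans (*-congˡ (go d (∂ i p) (∂ i q) A x)) (distribˡ _ _ _))) (Σ-+ _ _)
        where
        open Alg A using (comRing; trans; *-congˡ; distribˡ)
        open Vectors comRing using (Σ-cong; Σ-+)

    form-scale : ∀ {n d} a {φ : Law n} → Form d φ → Form d (const a ⊠ φ)
    form-scale {d = d} a (p via e) = (λ w → a K.* p w) via λ A x → Alg.trans A (Alg.*-congˡ A (e A x)) (Alg.sym A (go d p A x))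
      where
      go : ∀ {n} d (p : Words n) → form d (λ w → a K.* p w) ≋ const a ⊠ form d p
      go zero p A x = Alg.ι-* A _ _
      go (suc d) p A x = trans (Σ-cong (λ i → trans (*-congˡ (go d (∂ i p) A x)) (solve 3 (λ x a y → x :* (a :* y) := a :* (x :* y)) refl _ _ _)))
          (sym (Σ-*ˡ _ _))
        where
        open Alg A using (comRing; refl; sym; trans; *-congˡ)
        open IntegerSolver comRing using (solve; _:=_; _:*_)
        open Vectors comRing using (Σ-cong; Σ-*ˡ)

    minus-one : ∀ (A : Alg κ) → Alg._≈_ A (Alg.ι A (K.- K.1#)) (Alg.-_ A (Alg.1# A))
    minus-one A = Alg.trans A (Hom.⟦⟧-neg (ιHom A) _) (Alg.-‿cong A (Alg.ι-1 A))

    form-minus : ∀ {n d} {φ ψ : Law n} → Form d φ → Form d ψ → Form d (φ ⊟ ψ)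
    form-minus f g = form-resp (λ A x → neg A _ _) (form-+ f (form-scale (K.- K.1#) g))
      where
      neg : ∀ A a b → Alg._≈_ A (Alg._+_ A a (Alg._*_ A (Alg.ι A (K.- K.1#)) b)) (Alg._-_ A a b)
      neg A a b = trans (+-congˡ (*-congʳ (minus-one A))) (solve 2 (λ a b → a :+ (:- :1) :* b := a :- b) refl a b)
        where
        open Alg A using (comRing; refl; trans; +-congˡ; *-congʳ)
        open IntegerSolver comRing using (solve; _:=_; _:+_; _:*_; _:-_; :-_; :1)

    form-Σ : ∀ {n d m} {φ : Fin m → Law n} → (∀ i → Form d (φ i)) → Form d (ΣL φ)
    form-Σ {d = d} {zero} f = form-resp (λ A x → Alg.sym A (Vectors.Σ-[] (Alg.comRing A) _)) (form-zero d)
    form-Σ {m = suc m} f = form-resp (λ A x → Alg.sym A (Vectors.Σ-∷ (Alg.comRing A) _)) (form-+ (f zero) (form-Σ (λ i → f (suc i))))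

    form-* : ∀ {n a b} {φ ψ : Law n} → Form a φ → Form b ψ → Form (a ℕ.+ b) (φ ⊠ ψ)
    form-* {a = a} {b} (p via e) (q via e′) = product a p via λ A x → Alg.trans A (Alg.*-cong A (e A x) (e′ A x)) (Alg.sym A (go a p A x))
      where
      product : ℕ → Words _ → Words _
      product zero p w = p [] K.* q w
      product (suc a) p [] = K.0#
      product (suc a) p (i ∷ w) = product a (∂ i p) w
      go : ∀ a p → form (a ℕ.+ b) (product a p) ≋ form a p ⊠ form b q
      go zero p A x = Alg.sym A (Form.agrees (form-scale {d = b} (p []) (q via λ A x → Alg.refl A)) A x)
      go (suc a) p A x = trans (Σ-cong (λ i → trans (*-congˡ (go a (∂ i p) A x)) (sym (*-assoc _ _ _)))) (sym (Σ-*ʳ _ _))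
        where
        open Alg A using (comRing; sym; trans; *-congˡ; *-assoc)
        open Vectors comRing using (Σ-cong; Σ-*ʳ)

    form-linear : ∀ {n} (s : Fin n → K.Carrier) → Form 1 (λ A x → Vectors._·_ (Alg.comRing A) x (λ j → Alg.ι A (s j)))
    form-linear s = (λ { [] → K.0# ; (j ∷ _) → s j }) via λ A x → Alg.refl A

    form-coord : ∀ {n} (i : Fin n) → Form 1 (coord i)
    form-coord i = form-resp (λ A x → lemma A x) (form-linear (Vectors.δ K i))
      where
      lemma : ∀ A x → Alg._≈_ A (Vectors._·_ (Alg.comRing A) x (λ j → Alg.ι A (Vectors.δ K i j))) (x i)
      lemma A x = trans (·-cong (λ _ → refl) (Naturality.hom-δ K (ιHom A) i)) (·-δ x i)
        where
        open Alg A using (comRing; refl; trans)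
        open Vectors comRing using (·-cong; ·-δ)

    form-pow : ∀ {n a} {φ : Law n} → Form a φ → ∀ j → Form (j ℕ.* a) (powL φ j)
    form-pow f zero = form-resp (λ A x → Alg.ι-1 A) (form-const K.1#)
    form-pow f (suc j) = form-* f (form-pow f j)

    form-subst : ∀ {n m d} {φ : Law n} {σ : Fin n → Law m} → Form d φ → (∀ i → Form 1 (σ i)) → Form d (φ ∘L σ)
    form-subst {d = d} {σ = σ} (p via e) f = form-resp (λ A x → Alg.sym A (e A _)) (go d p)
      where
      go : ∀ d p → Form d (form d p ∘L σ)
      go zero p = form-const (p [])
      go (suc d) p = form-Σ (λ i → form-* (f i) (go d (∂ i p)))

    -- From `x = π(x) + z e` a form differs from its restriction along `π` by a multiple of `z`; the
    -- quotient is built by replacing one letter of a word at a time.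
    divide : ∀ {n} (π : Fin n → Law n) (z : Law n) (e : Fin n → K.Carrier) → (∀ i → Form 1 (π i)) → Form 1 z →
      (∀ i → coord i ≋ π i ⊞ z ⊠ const (e i)) →
      ∀ d {φ : Law n} → Form (suc d) φ → ∃ λ q → Form d q × φ ≋ φ ∘L π ⊞ z ⊠ q
    divide {n} π z e fπ fz split d {φ} (p via eq) = proj₁ (go d p) , proj₁ (proj₂ (go d p)) , λ A x →
      Alg.trans A (eq A x) (Alg.trans A (proj₂ (proj₂ (go d p)) A x) (Alg.+-congʳ A (Alg.sym A (eq A _))))
      where
      go : ∀ d p → ∃ λ q → Form d q × form (suc d) p ≋ form (suc d) p ∘L π ⊞ z ⊠ q
      go zero p = ΣL (λ i → const (e i) ⊠ const (p (i ∷ []))) ,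
        form-Σ (λ i → form-* (form-const _) (form-const _)) , λ A x → eq₀ A x
        where
        eq₀ : form 1 p ≋ form 1 p ∘L π ⊞ z ⊠ ΣL (λ i → const (e i) ⊠ const (p (i ∷ [])))
        eq₀ A x = trans (Σ-cong (λ i → trans (*-congʳ (split i A x)) (solve 4 (λ a z e y → (a :+ z :* e) :* y := a :* y :+ z :* (e :* y)) refl _ _ _ _)))
            (trans (Σ-+ _ _) (+-congˡ (sym (Σ-*ˡ _ _))))
          where
          open Alg A using (comRing; refl; sym; trans; +-congˡ; *-congʳ)
          open IntegerSolver comRing using (solve; _:=_; _:+_; _:*_)
          open Vectors comRing using (Σ-cong; Σ-+; Σ-*ˡ)
      go (suc d) p = ΣL (λ i → π i ⊠ q i ⊞ const (e i) ⊠ form (suc d) (∂ i p)) ,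
        form-Σ (λ i → form-+ (form-* (fπ i) (proj₁ (proj₂ (go d (∂ i p))))) (form-scale (e i) (∂ i p via λ A x → Alg.refl A))) , eq₁
        where
        q : Fin n → Law n
        q i = proj₁ (go d (∂ i p))
        eq₁ : form (suc (suc d)) p ≋ form (suc (suc d)) p ∘L π ⊞ z ⊠ ΣL (λ i → π i ⊠ q i ⊞ const (e i) ⊠ form (suc d) (∂ i p))
        eq₁ A x = trans (Σ-cong (λ i → begin
              x i * form (suc d) (∂ i p) A x ≈⟨ *-congʳ (split i A x) ⟩
              (π i A x + z A x * ι (e i)) * form (suc d) (∂ i p) A x ≈⟨ distribʳ _ _ _ ⟩
              π i A x * form (suc d) (∂ i p) A x + z A x * ι (e i) * form (suc d) (∂ i p) A x
                ≈⟨ +-congʳ (*-congˡ (proj₂ (proj₂ (go d (∂ i p))) A x)) ⟩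
              π i A x * (form (suc d) (∂ i p) A (λ j → π j A x) + z A x * q i A x) + z A x * ι (e i) * form (suc d) (∂ i p) A x
                ≈⟨ solve 6 (λ a f z q e y → a :* (f :+ z :* q) :+ z :* e :* y := a :* f :+ z :* (a :* q :+ e :* y)) refl _ _ _ _ _ _ ⟩
              π i A x * form (suc d) (∂ i p) A (λ j → π j A x) + z A x * (π i A x * q i A x + ι (e i) * form (suc d) (∂ i p) A x) ∎))
            (trans (Σ-+ _ _) (+-congˡ (sym (Σ-*ˡ _ _))))
          where
          open Alg A using (comRing; ι; _+_; _*_; refl; sym; trans; setoid; +-congˡ; +-congʳ; *-congˡ; *-congʳ; distribʳ)
          open IntegerSolver comRing using (solve; _:=_; _:+_; _:*_)
          open Vectors comRing using (Σ-cong; Σ-+; Σ-*ˡ)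
          open import Relation.Binary.Reasoning.Setoid setoid using (begin_; _∎; step-≈-⟩)

    word-vector : ∀ {n} d → Words n → Vectors.V K (n ^ d)
    word-vector zero p _ = p []
    word-vector {n} (suc d) p i = word-vector d (∂ (quotient {n} (n ^ d) i) p) (remainder {n} (n ^ d) i)

    -- Equality of coefficients word by word is stronger than equality of forms, but it suffices
    -- here: it makes `n ^ d` an upper bound for the dimension of the forms of degree `d`.
    word-vector-0 : ∀ {n J} d (p : Fin J → Words n) (v : Vectors.V K J) →
      (∀ s → Vectors._·_ K v (λ j → word-vector d (p j) s) K.≈ K.0#) →
      ΣL (λ j → const (v j) ⊠ form d (p j)) ≋ (λ A x → Alg.0# A)
    word-vector-0 zero p v h A x = trans (Σ-cong (λ j → sym (ι-* _ _))) (trans (sym (Naturality.hom-Σ K (ιHom A) _)) (trans (ι-cong (h zero)) (Hom.⟦⟧-0 (ιHom A))))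
      where
      open Alg A using (comRing; ι-cong; ι-*; sym; trans)
      open Vectors comRing using (Σ-cong)
    word-vector-0 {n} (suc d) p v h A x = begin
      Σ (λ j → ι (v j) * Σ (λ i → x i * form d (∂ i (p j)) A x)) ≈⟨ Σ-cong (λ j → trans (Σ-*ˡ _ _) (Σ-cong (λ i → solve 3 (λ v x f → v :* (x :* f) := x :* (v :* f)) refl _ _ _))) ⟩
      Σ (λ j → Σ (λ i → x i * (ι (v j) * form d (∂ i (p j)) A x))) ≈⟨ Σ-comm _ ⟩
      Σ (λ i → Σ (λ j → x i * (ι (v j) * form d (∂ i (p j)) A x))) ≈⟨ Σ-0 (λ i → trans (sym (Σ-*ˡ _ _)) (trans (*-congˡ (word-vector-0 d (λ j → ∂ i (p j)) v
            (λ s → K.trans (Vectors.Σ-cong K (λ j → K.*-congˡ (K.reflexive (≡.sym (at-combine i s j))))) (h (combine i s))) A x)) (zeroʳ _))) ⟩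
      0# ∎
      where
      open Alg A using (comRing; ι; _*_; 0#; refl; sym; trans; setoid; *-congˡ; zeroʳ)
      open IntegerSolver comRing using (solve; _:=_; _:*_)
      open Vectors comRing using (Σ; Σ-cong; Σ-0; Σ-*ˡ; Σ-comm)
      open import Relation.Binary.Reasoning.Setoid setoid using (begin_; _∎; step-≈-⟩)
      at-combine : ∀ i s j → word-vector (suc d) (p j) (combine i s) ≡.≡ word-vector d (∂ i (p j)) s
      at-combine i s j = ≡.cong (λ { (a , r) → word-vector d (∂ a (p j)) r }) (FinP.remQuot-combine {n} i s)

    module Family {ℓi} {n} {Idx : Set ℓi} (deg : Idx → ℕ) (f : Idx → Law n) where
      -- The generator `f k` has degree `suc (deg k)`, so generators of degree zero are excluded by
      -- the encoding.
      record Term (D : ℕ) : Set (lsuc c ⊔ lsuc κ ⊔ ℓi) where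
        constructor term
        field
          index : Idx
          {codegree} : ℕ
          {cofactor} : Law n
          isForm : Form codegree cofactor
          degree-eq : codegree ℕ.+ suc (deg index) ≡.≡ D

      total : ∀ {D} → List (Term D) → Law n
      total [] A x = Alg.0# A
      total (t ∷ ts) = Term.cofactor t ⊠ f (Term.index t) ⊞ total ts

      -- Membership in the degree D part of the homogeneous ideal generated by the family.
      InI : ℕ → Law n → Set (lsuc c ⊔ lsuc κ ⊔ ℓi)
      InI D φ = ∃ λ (ts : List (Term D)) → φ ≋ total ts

      in-resp : ∀ {D φ ψ} → φ ≋ ψ → InI D φ → InI D ψ
      in-resp h (ts , e) = ts , λ A x → Alg.trans A (Alg.sym A (h A x)) (e A x)

      in-≡ : ∀ {D D′ φ} → D ≡.≡ D′ → InI D φ → InI D′ φ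
      in-≡ ≡.refl i = i

      in-0 : ∀ D → InI D (λ A x → Alg.0# A)
      in-0 D = [] , λ A x → Alg.refl A

      in-+ : ∀ {D φ ψ} → InI D φ → InI D ψ → InI D (φ ⊞ ψ)
      in-+ (ts , e) (us , e′) = ts ++ us , λ A x → Alg.trans A (Alg.+-cong A (e A x) (e′ A x)) (go ts A x)
        where
        go : ∀ ts → total ts ⊞ total us ≋ total (ts ++ us)
        go [] A x = Alg.+-identityˡ A _
        go (t ∷ ts) A x = Alg.trans A (Alg.+-assoc A _ _ _) (Alg.+-congˡ A (go ts A x))

      in-* : ∀ {D φ a g} → Form a g → InI D φ → InI (a ℕ.+ D) (g ⊠ φ)
      in-* {D} {a = a} {g} fg (ts , e) = map scale ts , λ A x → Alg.trans A (Alg.*-congˡ A (e A x)) (go ts A x)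
        where
        scale : Term D → Term (a ℕ.+ D)
        scale (term k fh eq) = term k (form-* fg fh) (≡.trans (ℕP.+-assoc a _ _) (≡.cong (a ℕ.+_) eq))
        go : ∀ ts → g ⊠ total ts ≋ total (map scale ts)
        go [] A x = Alg.zeroʳ A _
        go (t ∷ ts) A x = Alg.trans A (Alg.distribˡ A _ _ _) (Alg.+-cong A (Alg.sym A (Alg.*-assoc A _ _ _)) (go ts A x))

      in-scale : ∀ {D φ} a → InI D φ → InI D (const a ⊠ φ)
      in-scale a = in-* (form-const a)

      in-Σ : ∀ {D m} {φ : Fin m → Law n} → (∀ i → InI D (φ i)) → InI D (ΣL φ)
      in-Σ {D} {zero} h = in-resp (λ A x → Alg.sym A (Vectors.Σ-[] (Alg.comRing A) _)) (in-0 D)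
      in-Σ {m = suc m} h = in-resp (λ A x → Alg.sym A (Vectors.Σ-∷ (Alg.comRing A) _)) (in-+ (h zero) (in-Σ (λ i → h (suc i))))

      in-generator : ∀ k → InI (suc (deg k)) (f k)
      in-generator k = term k (form-const K.1#) ≡.refl ∷ [] , λ A x →
        Alg.sym A (Alg.trans A (Alg.+-identityʳ A _) (Alg.trans A (Alg.*-congʳ A (Alg.ι-1 A)) (Alg.*-identityˡ A _)))

      Full : ℕ → Set (lsuc c ⊔ lsuc κ ⊔ ℓi)
      Full N = ∀ {φ} → Form N φ → InI N φ

      NoZeros : Set (c ⊔ κ ⊔ ℓi)
      NoZeros = ∀ (x : Fin n → K.Carrier) → ¬ (∀ i → x i K.≈ K.0#) → ¬ (∀ k → f k base x K.≈ K.0#)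

-- The homogeneous Nullstellensatz by induction on the number of variables

module NS where
  open RS
  open Lin
  open LA
  open KAlg
  open Forms
  open Span
  open import Defs using (pow)
  import Data.Nat.Solver as ℕSolver
  open import Agda.Primitive using (Setω)
  open import Level using (_⊔_) renaming (suc to lsuc)
  open import Algebra.Bundles using (CommutativeRing)
  open import Data.Nat as ℕ using (ℕ; zero; suc; s≤s; _^_)
  import Data.Nat.Properties as ℕP
  open import Data.Fin using (Fin; zero; suc; inject₁; fromℕ)
  open import Data.List as List using (List; []; _∷_; length)
  open import Data.List.Relation.Unary.All using (All; []; _∷_)
  open import Data.Product using (_×_; _,_; ∃; ∃₂; proj₁; proj₂)
  open import Data.Empty using (⊥)
  open import Relation.Nullary using (¬_)
  import Relation.Binary.PropositionalEquality as ≡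

  module Monic {c κ} (K : CommutativeRing c κ) where
    private module K = CommutativeRing K using (Carrier; _≈_; _+_; _*_; 0#; 1#; refl; sym; trans; +-congˡ; *-congˡ; *-congʳ; *-assoc; *-identityˡ)
    open Algebras K
    module _ {ℓ} (A : Alg ℓ) where
      open Alg A using (comRing; ι; Carrier; _≈_; _+_; _*_; 1#; refl; +-cong; *-cong; *-congˡ)
      open Powers comRing using (pow-cong)
      -- A binary form `y^d + ... + a x^d` in Horner shape, monic in `y`; the list starts with the
      -- coefficient of the pure power of `x`.
      monic : List K.Carrier → Carrier → Carrier → Carrier
      monic [] y x = 1#
      monic (a ∷ as) y x = ι a * pow comRing x (suc (length as)) + y * monic as y x

      monic-cong : ∀ as {y y′ x x′} → y ≈ y′ → x ≈ x′ → monic as y x ≈ monic as y′ x′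
      monic-cong [] e e′ = refl
      monic-cong (a ∷ as) e e′ = +-cong (*-congˡ (pow-cong (suc (length as)) e′)) (*-cong e (monic-cong as e e′))

    Root : Set (c ⊔ κ)
    Root = ∀ a as → ∃ λ ρ → monic base (a ∷ as) ρ K.1# K.≈ K.0#

    -- Synthetic division by `y - ρ x`; the remainder is `r` times a pure power of `x`.
    synthetic : ∀ ρ a as → ∃₂ λ bs r → length bs ≡.≡ length as × (∀ (A : Alg κ) y x →
      Alg._≈_ A (monic A (a ∷ as) y x) (Alg._+_ A (Alg._*_ A (Alg._-_ A y (Alg._*_ A (Alg.ι A ρ) x)) (monic A bs y x)) (Alg._*_ A (Alg.ι A r) (pow (Alg.comRing A) x (suc (length as))))))
    synthetic ρ a [] = [] , a K.+ ρ , ≡.refl , λ A y x → eq A y x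
      where
      eq : ∀ (A : Alg κ) y x → Alg._≈_ A (monic A (a ∷ []) y x) (Alg._+_ A (Alg._*_ A (Alg._-_ A y (Alg._*_ A (Alg.ι A ρ) x)) (Alg.1# A)) (Alg._*_ A (Alg.ι A (a K.+ ρ)) (pow (Alg.comRing A) x 1)))
      eq A y x = trans (solve 4 (λ a ρ y x → a :* (x :* :1) :+ y :* :1 := (y :- ρ :* x) :* :1 :+ (a :+ ρ) :* (x :* :1)) refl (ι a) (ι ρ) y x)
        (+-congˡ (*-congʳ (sym (ι-+ a ρ))))
        where
        open Alg A using (comRing; ι; ι-+; refl; sym; trans; +-congˡ; *-congʳ)
        open IntegerSolver comRing using (solve; _:=_; _:+_; _:*_; _:-_; :-_; :1)
    synthetic ρ a (b ∷ as) with synthetic ρ b as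
    ... | bs , r , len , e = r ∷ bs , a K.+ ρ K.* r , ≡.cong suc len , λ A y x → eq A y x
      where
      eq : ∀ (A : Alg κ) y x → Alg._≈_ A (monic A (a ∷ b ∷ as) y x) (Alg._+_ A (Alg._*_ A (Alg._-_ A y (Alg._*_ A (Alg.ι A ρ) x)) (monic A (r ∷ bs) y x)) (Alg._*_ A (Alg.ι A (a K.+ ρ K.* r)) (pow (Alg.comRing A) x (suc (length (b ∷ as))))))
      eq A y x = trans (+-congˡ (*-congˡ (e A y x)))
        (trans (solve 7 (λ a ρ r y x m p → a :* (x :* p) :+ y :* ((y :- ρ :* x) :* m :+ r :* p) :=
                   (y :- ρ :* x) :* (r :* p :+ y :* m) :+ (a :+ ρ :* r) :* (x :* p)) refl (ι a) (ι ρ) (ι r) y x (monic A bs y x) (pow comRing x (suc (length as))))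
          (+-cong (*-congˡ (+-congʳ (*-congˡ (reflexive (≡.cong (λ l → pow comRing x (suc l)) (≡.sym len))))))
            (*-congʳ (sym (trans (ι-+ a _) (+-congˡ (ι-* ρ r)))))))
        where
        open Alg A using (comRing; ι; ι-+; ι-*; refl; sym; trans; reflexive; +-cong; +-congˡ; +-congʳ; *-congˡ; *-congʳ)
        open IntegerSolver comRing using (solve; _:=_; _:+_; _:*_; _:-_; :-_)

    module _ {ℓ} (A : Alg ℓ) where
      open Alg A using (ι; Carrier; _*_; -_; _-_; 1#)
      roots-product : List K.Carrier → Carrier → Carrier → Carrier
      roots-product [] y x = 1#
      roots-product (ρ ∷ ρs) y x = (y - ι ρ * x) * roots-product ρs y x

    factor : Root → ∀ as → ∃ λ ρs → length ρs ≡.≡ length as × (∀ (A : Alg κ) y x → Alg._≈_ A (monic A as y x) (roots-product A ρs y x))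
    factor root as = go (length as) as ≡.refl
      where
      go : ∀ m as → length as ≡.≡ m → ∃ λ ρs → length ρs ≡.≡ length as × (∀ (A : Alg κ) y x → Alg._≈_ A (monic A as y x) (roots-product A ρs y x))
      go m [] _ = [] , ≡.refl , λ A y x → Alg.refl A
      go (suc m) (a ∷ as) eq with root a as
      ... | ρ , ρ-root with synthetic ρ a as
      ... | bs , r , len , e with go m bs (≡.trans len (ℕP.suc-injective eq))
      ... | ρs , len′ , e′ = ρ ∷ ρs , ≡.cong suc (≡.trans len′ len) , λ A y x → final A y x
        where
        -- Evaluation at `y = ρ`, `x = 1` isolates the remainder.
        r≈0 : r K.≈ K.0#
        r≈0 = K.trans (S.solve 3 (λ ρ m r → r S.:= (ρ S.:- ρ S.:* S.:1) S.:* m S.:+ r S.:* S.:1) K.refl ρ (monic base bs ρ K.1#) r)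
          (K.trans (K.+-congˡ (K.*-congˡ (K.sym (Powers.pow-1 K (suc (length as)))))) (K.trans (K.sym (e base ρ K.1#)) ρ-root))
          where module S = IntegerSolver K
        final : ∀ (A : Alg κ) y x → Alg._≈_ A (monic A (a ∷ as) y x) (roots-product A (ρ ∷ ρs) y x)
        final A y x = trans (e A y x) (trans (+-cong (*-congˡ (e′ A y x)) (trans (*-congʳ (trans (ι-cong r≈0) (Hom.⟦⟧-0 (ιHom A)))) (zeroˡ _))) (+-identityʳ _))
          where open Alg A

    module _ (A : Alg κ) where
      open Alg A using (comRing; ι; Carrier; _≈_; _+_; _*_; 1#; refl; sym; trans; +-cong; +-congˡ; *-congˡ; +-identityʳ; *-identityʳ)
      monomial : ∀ J → Carrier → Carrier → Fin (suc J) → Carrier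
      monomial zero x y _ = 1#
      monomial (suc J) x y zero = pow comRing x (suc J)
      monomial (suc J) x y (suc j) = y * monomial J x y j

      binary : ∀ J → Vectors.V K (suc J) → Carrier → Carrier → Carrier
      binary zero v x y = ι (v zero)
      binary (suc J) v x y = ι (v zero) * pow comRing x (suc J) + y * binary J (λ i → v (suc i)) x y

      binary-monomials : ∀ J v x y → Vectors.Σ comRing (λ j → ι (v j) * monomial J x y j) ≈ binary J v x y
      binary-monomials zero v x y = trans (Vectors.Σ-∷ comRing _) (trans (+-cong (*-identityʳ _) (Vectors.Σ-[] comRing _)) (+-identityʳ _))
      binary-monomials (suc J) v x y = trans (Vectors.Σ-∷ comRing _) (+-congˡ (trans (Vectors.Σ-cong comRing (λ j → solve 3 (λ a y m → a :* (y :* m) := y :* (a :* m)) refl _ _ _))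
          (trans (sym (Vectors.Σ-*ˡ comRing _ _)) (*-congˡ (binary-monomials J _ x y)))))
        where open IntegerSolver comRing

    private
      binary-drop : ∀ (A : Alg κ) J v → v (fromℕ (suc J)) K.≈ K.0# → ∀ x y →
        Alg._≈_ A (binary A (suc J) v x y) (Alg._*_ A x (binary A J (λ i → v (inject₁ i)) x y))
      binary-drop A zero v z x y = trans (+-congˡ (*-congˡ (trans (ι-cong z) (Hom.⟦⟧-0 (ιHom A)))))
          (solve 3 (λ y x v → v :* (x :* :1) :+ y :* :0 := x :* v) refl y x _)
        where
        open Alg A using (comRing; ι-cong; refl; trans; +-congˡ; *-congˡ)
        open IntegerSolver comRing using (solve; _:=_; _:+_; _:*_; :1; :0)
      binary-drop A (suc J) v z x y = trans (+-congˡ (*-congˡ (binary-drop A J (λ i → v (suc i)) z x y)))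
          (solve 5 (λ y x b v p → v :* (x :* p) :+ y :* (x :* b) := x :* (v :* p :+ y :* b)) refl y x _ _ _)
        where
        open Alg A using (comRing; refl; trans; +-congˡ; *-congˡ)
        open IntegerSolver comRing using (solve; _:=_; _:+_; _:*_)

      to-monic : ∀ J v c → v (fromℕ J) K.≈ c → (c⁻¹ : K.Carrier) → c K.* c⁻¹ K.≈ K.1# → ∃ λ as → length as ≡.≡ J ×
        (∀ (A : Alg κ) x y → Alg._≈_ A (binary A J v x y) (Alg._*_ A (Alg.ι A c) (monic A as y x)))
      to-monic zero v c e c⁻¹ inv = [] , ≡.refl , λ A x y → Alg.trans A (Alg.ι-cong A e) (Alg.sym A (Alg.*-identityʳ A _))
      to-monic (suc J) v c e c⁻¹ inv with to-monic J (λ i → v (suc i)) c e c⁻¹ inv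
      ... | as , len , eq = (c⁻¹ K.* v zero) ∷ as , ≡.cong suc len , λ A x y → final A x y
        where
        final : ∀ (A : Alg κ) x y → Alg._≈_ A (binary A (suc J) v x y) (Alg._*_ A (Alg.ι A c) (monic A ((c⁻¹ K.* v zero) ∷ as) y x))
        final A x y = trans (+-cong (*-cong (ι-cong (K.trans (K.sym (K.*-identityˡ _)) (K.trans (K.*-congʳ (K.sym inv)) (K.*-assoc _ _ _))))
              (reflexive (≡.cong (λ l → pow comRing x (suc l)) (≡.sym len)))) (*-congˡ (eq A x y)))
            (trans (+-congʳ (*-congʳ (ι-* c _))) (solve 5 (λ y c m w p → c :* w :* p :+ y :* (c :* m) := c :* (w :* p :+ y :* m)) refl y (ι c) _ _ _))
          where
          open Alg A using (comRing; ι; ι-cong; ι-*; refl; trans; reflexive; +-cong; +-congʳ; *-cong; *-congˡ; *-congʳ)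
          open IntegerSolver comRing using (solve; _:=_; _:+_; _:*_)

      by-last : ∀ {p} n (P : Fin (suc n) → Set p) → (∀ i → P (inject₁ i)) → P (fromℕ n) → ∀ i → P i
      by-last zero P h l zero = l
      by-last (suc n) P h l zero = h zero
      by-last (suc n) P h l (suc i) = by-last n (λ i → P (suc i)) (λ i → h (suc i)) l i

    Factored : ∀ J → Vectors.V K (suc J) → Set (lsuc c ⊔ lsuc κ)
    Factored J v = ∃₂ λ c e → ∃ λ ρs → ¬ (c K.≈ K.0#) × e ℕ.+ length ρs ≡.≡ J ×
      (∀ (A : Alg κ) x y → Alg._≈_ A (binary A J v x y) (Alg._*_ A (Alg.ι A c) (Alg._*_ A (pow (Alg.comRing A) x e) (roots-product A ρs y x))))

    -- If the coefficient of the top power of `y` is nonzero, the form is made monic and factored;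
    -- otherwise `x` splits off and the degree drops. The exponent `e` counts the factors `x`, the
    -- zeros at infinity.
    factor-binary : StableField K → Root → ∀ J (v : Vectors.V K (suc J)) → ¬ (∀ i → v i K.≈ K.0#) → ¬ ¬ Factored J v
    factor-binary F root J v nz n = lead (λ v0 → split J v nz v0 n)
      where
      open StableField F
      lead : ¬ ¬ (v (fromℕ J) K.≈ K.0#)
      lead h = n (top h)
        where
        top : ¬ (v (fromℕ J) K.≈ K.0#) → Factored J v
        top h with inverse _ h
        ... | c⁻¹ , inv with to-monic J v _ K.refl c⁻¹ inv
        ... | as , len , eq with factor root as
        ... | ρs , len′ , eq′ = v (fromℕ J) , 0 , ρs , h , ≡.trans len′ len ,
          λ A x y → Alg.trans A (eq A x y) (Alg.*-congˡ A (Alg.trans A (eq′ A y x) (Alg.sym A (Alg.*-identityˡ A _))))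
      split : ∀ J v → ¬ (∀ i → v i K.≈ K.0#) → v (fromℕ J) K.≈ K.0# → ¬ ¬ Factored J v
      split zero v nz v0 n = nz λ { zero → v0 }
      split (suc J) v nz v0 n = factor-binary F root J (λ i → v (inject₁ i)) (λ h → nz (by-last (suc J) (λ i → v i K.≈ K.0#) h v0)) λ
        { (c , e , ρs , c≉0 , len , eq) → n (c , suc e , ρs , c≉0 , ≡.cong suc len , λ A x y →
            Alg.trans A (binary-drop A J v v0 x y) (Alg.trans A (Alg.*-congˡ A (eq A x y)) (rearrange A x _ _ _))) }
        where
        rearrange : ∀ (A : Alg κ) x c p r → Alg._≈_ A (Alg._*_ A x (Alg._*_ A c (Alg._*_ A p r))) (Alg._*_ A c (Alg._*_ A (Alg._*_ A x p) r))
        rearrange A = solve 4 (λ x c p r → x :* (c :* (p :* r)) := c :* (x :* p :* r)) refl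
          where
          open Alg A using (comRing; refl)
          open IntegerSolver comRing using (solve; _:=_; _:*_)

  private module ℕS = ℕSolver.+-*-Solver

  module Nullstellensatz {c κ} (K : CommutativeRing c κ) (F : StableField K) where
    private module K = CommutativeRing K using (Carrier; _≈_; _*_; 0#; 1#; sym; trans; +-cong; +-identityʳ; *-identityˡ)
    open Algebras K
    open HomogeneousForms K
    open Monic K
    open StableField F

    -- A hyperplane z = 0 of affine (n+1)-space, parametrised by σ, with e spanning a complement of the image of σ.
    record Hyperplane (n : ℕ) : Set (lsuc c ⊔ lsuc κ) where
      field
        σ : Fin (suc n) → Law n
        τ : Fin n → Fin (suc n)
        z : Law (suc n)
        e : Fin (suc n) → K.Carrier
        form-σ : ∀ i → Form 1 (σ i)
        form-z : Form 1 z
        section : ∀ j → σ (τ j) ≋ coord j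
        split : ∀ i → coord i ≋ (λ A x → σ i A (λ j → x (τ j))) ⊞ z ⊠ const (e i)

    module _ {n} {ℓi} {Idx : Set ℓi} (deg : Idx → ℕ) (f : Idx → Law n) where
      open Family deg f
      full-suc : ∀ {N} → Full N → Full (suc N)
      full-suc full (p via eq) = in-resp (λ A x → Alg.sym A (eq A x)) (in-Σ (λ i → in-* (form-coord i) (full (_ via λ A x → Alg.refl A))))

      full-+ : ∀ j {N} → Full N → Full (j ℕ.+ N)
      full-+ zero h = h
      full-+ (suc j) h = full-suc (full-+ j h)

    module Restriction {n} {ℓi} {Idx : Set ℓi} (deg : Idx → ℕ) (f : Idx → Law (suc n)) (isForm : ∀ k → Form (suc (deg k)) (f k)) (H : Hyperplane n) where
      open Hyperplane H
      open Family deg f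
      g : Idx → Law n
      g k = f k ∘L σ
      module G = Family deg g
      g-isForm : ∀ k → Form (suc (deg k)) (g k)
      g-isForm k = form-subst (isForm k) form-σ

      g-noZeros : NoZeros → G.NoZeros
      g-noZeros nz y y≉0 h = nz (λ i → σ i base y) (λ s0 → y≉0 (λ j → K.trans (K.sym (section j base y)) (s0 (τ j)))) h

      private
        lift-term : ∀ {D} → G.Term D → Term D
        lift-term (G.term k h eq) = term k (form-subst h (λ j → form-coord (τ j))) eq

        lift-form : ∀ {D} (ts : List (Term D)) → Form D (total ts)
        lift-form [] = form-zero _
        lift-form (term k h eq ∷ ts) = form-+ (form-≡ eq (form-* h (isForm k))) (lift-form ts)

        restrict-total : ∀ {D} (ts : List (G.Term D)) → total (List.map lift-term ts) ∘L σ ≋ G.total ts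
        restrict-total [] A x = Alg.refl A
        restrict-total (G.term k h eq ∷ ts) A x = Alg.+-cong A (Alg.*-congʳ A (law-cong h A (λ j → section j A x))) (restrict-total ts A x)

      -- The cofactors on the hyperplane are pulled back to the whole space. The form minus the
      -- resulting combination vanishes on the hyperplane, so it is divisible by `z`.
      lift-membership : ∀ {D φ} → Form (suc D) φ → G.InI (suc D) (φ ∘L σ) → ∃ λ r → Form D r × InI (suc D) (φ ⊟ z ⊠ r)
      lift-membership {D} {φ} fφ (ts , e′) = r , proj₁ (proj₂ division) , us , λ A x → cancel A (φ A x) (total us A x) _ (Alg.trans A (proj₂ (proj₂ division) A x)
          (Alg.trans A (Alg.+-congʳ A (vanish A x)) (Alg.+-identityˡ A _)))
        where
        us = List.map lift-term ts
        ψ = φ ⊟ total us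
        vanish : ∀ A x → Alg._≈_ A (ψ A (λ i → σ i A (λ j → x (τ j)))) (Alg.0# A)
        vanish A x = Alg.trans A (Alg.+-cong A (e′ A _) (Alg.-‿cong A (restrict-total ts A _))) (Alg.-‿inverseʳ A _)
        division = divide (λ i A x → σ i A (λ j → x (τ j))) z e form-π form-z split D (form-minus fφ (lift-form us))
          where
          form-π : ∀ i → Form 1 (λ A x → σ i A (λ j → x (τ j)))
          form-π i = form-subst (form-σ i) (λ j → form-coord (τ j))
        r = proj₁ division
        cancel : ∀ A a b q → Alg._≈_ A (Alg._-_ A a b) q → Alg._≈_ A (Alg._-_ A a q) b
        cancel A a b q h = trans (+-congˡ (-‿cong (sym h))) (solve 2 (λ a b → a :- (a :- b) := b) refl a b)
          where
          open Alg A using (comRing; refl; sym; trans; +-congˡ; -‿cong)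
          open IntegerSolver comRing using (solve; _:=_; _:-_; :-_)

      -- `lift-membership` applied `j` times: as long as the degree exceeds `N`, another factor `z`
      -- can be split off modulo the ideal.
      power-reduction : ∀ {N} → G.Full (suc N) → ∀ j {φ} → Form (j ℕ.+ N) φ → ∃ λ r → Form N r × InI (j ℕ.+ N) (φ ⊟ powL z j ⊠ r)
      power-reduction full zero {φ} h = φ , h , in-resp (λ A x → zero-eq A (φ A x)) (in-0 _)
        where
        zero-eq : ∀ A a → Alg._≈_ A (Alg.0# A) (Alg._-_ A a (Alg._*_ A (Alg.1# A) a))
        zero-eq A = solve 1 (λ a → :0 := a :- :1 :* a) refl
          where
          open Alg A using (comRing; refl)
          open IntegerSolver comRing using (solve; _:=_; _:*_; _:-_; :-_; :1; :0)
      power-reduction {N} full (suc j) {φ} h = combine (lift-membership h (G.in-≡ (ℕP.+-suc j N) (full-+ deg g j full (form-≡ (≡.sym (ℕP.+-suc j N)) (form-subst h form-σ)))))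
        where
        combine : (∃ λ r → Form (j ℕ.+ N) r × InI (suc (j ℕ.+ N)) (φ ⊟ z ⊠ r)) → ∃ λ r → Form N r × InI (suc j ℕ.+ N) (φ ⊟ powL z (suc j) ⊠ r)
        combine (r , fr , i) = proj₁ rest , proj₁ (proj₂ rest) , in-resp (λ A x → telescope A _ _ _ _ _) (in-+ i (in-* form-z (proj₂ (proj₂ rest))))
          where
          rest = power-reduction full j fr
          telescope : ∀ A a z r p s → Alg._≈_ A (Alg._+_ A (Alg._-_ A a (Alg._*_ A z r)) (Alg._*_ A z (Alg._-_ A r (Alg._*_ A p s)))) (Alg._-_ A a (Alg._*_ A (Alg._*_ A z p) s))
          telescope A = solve 5 (λ a z r p s → (a :- z :* r) :+ z :* (r :- p :* s) := a :- z :* p :* s) refl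
            where
            open Alg A using (comRing; refl)
            open IntegerSolver comRing using (solve; _:=_; _:+_; _:*_; _:-_; :-_)

    form-coord-pow : ∀ {n} (i : Fin n) j → Form j (powL (coord i) j)
    form-coord-pow i j = form-≡ (ℕP.*-identityʳ j) (form-pow (form-coord i) j)

    coordinate-hyperplane : ∀ n → Hyperplane n
    coordinate-hyperplane n = record
      { σ = λ { zero A x → Alg.0# A ; (suc j) → coord j }
      ; τ = suc
      ; z = coord zero
      ; e = Vectors.δ K zero
      ; form-σ = λ { zero → form-zero 1 ; (suc j) → form-coord j }
      ; form-z = form-coord zero
      ; section = λ j A x → Alg.refl A
      ; split = λ { zero A x → eq₀ A (x zero) ; (suc j) A x → eq₁ A (x (suc j)) (x zero) } }
      where
      eq₀ : ∀ A a → Alg._≈_ A a (Alg._+_ A (Alg.0# A) (Alg._*_ A a (Alg.ι A K.1#)))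
      eq₀ A a = trans (solve 1 (λ a → a := :0 :+ a :* :1) refl a) (+-congˡ (*-congˡ (sym ι-1)))
        where
        open Alg A using (comRing; ι-1; refl; sym; trans; +-congˡ; *-congˡ)
        open IntegerSolver comRing using (solve; _:=_; _:+_; _:*_; :1; :0)
      eq₁ : ∀ A b a → Alg._≈_ A b (Alg._+_ A b (Alg._*_ A a (Alg.ι A K.0#)))
      eq₁ A b a = trans (solve 2 (λ b a → b := b :+ a :* :0) refl b a) (+-congˡ (*-congˡ (sym (Hom.⟦⟧-0 (ιHom A)))))
        where
        open Alg A using (comRing; refl; sym; trans; +-congˡ; *-congˡ)
        open IntegerSolver comRing using (solve; _:=_; _:+_; _:*_; :0)

    slope-hyperplane : ∀ n → K.Carrier → Hyperplane (suc n)
    slope-hyperplane n ρ = record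
      { σ = λ { zero → coord zero ; (suc zero) → const ρ ⊠ coord zero ; (suc (suc j)) → coord (suc j) }
      ; τ = λ { zero → zero ; (suc j) → suc (suc j) }
      ; z = coord (suc zero) ⊟ const ρ ⊠ coord zero
      ; e = Vectors.δ K (suc zero)
      ; form-σ = λ { zero → form-coord zero ; (suc zero) → form-scale ρ (form-coord zero) ; (suc (suc j)) → form-coord (suc j) }
      ; form-z = form-minus (form-coord (suc zero)) (form-scale ρ (form-coord zero))
      ; section = λ { zero A x → Alg.refl A ; (suc j) A x → Alg.refl A }
      ; split = λ { zero A x → eq₁ A (x zero) _ ; (suc zero) A x → eq₀ A _ _ ; (suc (suc j)) A x → eq₁ A _ _ } }
      where
      eq₀ : ∀ A a b → Alg._≈_ A a (Alg._+_ A b (Alg._*_ A (Alg._-_ A a b) (Alg.ι A K.1#)))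
      eq₀ A a b = trans (solve 2 (λ a b → a := b :+ (a :- b) :* :1) refl a b) (+-congˡ (*-congˡ (sym ι-1)))
        where
        open Alg A using (comRing; ι-1; refl; sym; trans; +-congˡ; *-congˡ)
        open IntegerSolver comRing using (solve; _:=_; _:+_; _:*_; _:-_; :-_; :1)
      eq₁ : ∀ A b a → Alg._≈_ A b (Alg._+_ A b (Alg._*_ A a (Alg.ι A K.0#)))
      eq₁ A b a = trans (solve 2 (λ b a → b := b :+ a :* :0) refl b a) (+-congˡ (*-congˡ (sym (Hom.⟦⟧-0 (ιHom A)))))
        where
        open Alg A using (comRing; refl; sym; trans; +-congˡ; *-congˡ)
        open IntegerSolver comRing using (solve; _:=_; _:+_; _:*_; :0)

    monomial-form : ∀ {n} J (x y : Fin n) j → Form J (λ A v → monomial A J (v x) (v y) j)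
    monomial-form zero x y j = form-resp (λ A v → Alg.ι-1 A) (form-const K.1#)
    monomial-form (suc J) x y zero = form-coord-pow x (suc J)
    monomial-form (suc J) x y (suc j) = form-* (form-coord y) (monomial-form J x y j)

    -- In `Setω` because the index type of the family may live in any universe.
    Theorem : ℕ → Setω
    Theorem n = ∀ {ℓi} {Idx : Set ℓi} (deg : Idx → ℕ) (f : Idx → Law n) → (∀ k → Form (suc (deg k)) (f k)) →
      Family.NoZeros deg f → ¬ ¬ (∃ λ N → Family.Full deg f N)

    -- Induction on the hyperplane `x₀ = 0` and a dimension argument put a binary form in `x₀`,
    -- `x₁`, times a power of `x₀`, into the ideal. It splits into linear factors, and induction on
    -- each hyperplane `x₁ = ρ x₀` trades a factor for a power of `x₀`. This takes the place of
    -- elimination by resultants.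
    module Step (root : Root) {n} (IH : Theorem (suc n)) {ℓi} {Idx : Set ℓi} (deg : Idx → ℕ) (f : Idx → Law (suc (suc n)))
        (isForm : ∀ k → Form (suc (deg k)) (f k)) (noZeros : Family.NoZeros deg f) where
      open Family deg f
      module R₀ = Restriction deg f isForm (coordinate-hyperplane (suc n))
      module Rρ ρ = Restriction deg f isForm (slope-hyperplane n ρ)
      x₀ : Law (suc (suc n))
      x₀ = coord zero

      module WithBound N (full : R₀.G.Full (suc N)) where
        private
          -- The number of words of length `N`, one less than the number of products `φ j`, so their
          -- remainders satisfy a linear relation.
          J = suc (suc n) ^ N
          x₁ : Fin (suc (suc n))
          x₁ = suc zero
          φ : Fin (suc J) → Law (suc (suc n))
          φ j = (λ A v → monomial A J (v zero) (v x₁) j) ⊠ powL x₀ N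
          reduced : ∀ j → ∃ λ r → Form N r × InI (J ℕ.+ N) (φ j ⊟ powL x₀ J ⊠ r)
          reduced j = R₀.power-reduction full J (form-* (monomial-form J zero x₁ j) (form-coord-pow zero N))
          p : Fin (suc J) → Words (suc (suc n))
          p j = Form.words (proj₁ (proj₂ (reduced j)))

        -- The J+1 remainders of the products x_0^j x_1^(J-j) x_0^N live in the space of forms of degree N, which is spanned by J words.
        binary-member : ¬ ¬ (∃ λ v → ¬ (∀ i → v i K.≈ K.0#) × InI (J ℕ.+ N) ((λ A x → binary A J v (x zero) (x x₁)) ⊠ powL x₀ N))
        binary-member k = LinearAlgebra.underdetermined K F (List.tabulate {n = J} (λ s j → word-vector N (p j) s))
          (s≤s (ℕP.≤-reflexive (length-tabulate _))) λ { (v , (i , vi) , al) → k (v , (λ h → vi (h i)) , member v (rows al)) }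
          where
          open import Data.List.Properties using (length-tabulate)
          rows : ∀ {q} {f : Fin q → Vectors.V K (suc J)} {v} → All (λ r → Vectors._·_ K r v K.≈ K.0#) (List.tabulate f) → ∀ s → Vectors._·_ K (f s) v K.≈ K.0#
          rows (h ∷ _) zero = h
          rows (_ ∷ hs) (suc s) = rows hs s
          member : ∀ v → (∀ s → Vectors._·_ K (λ j → word-vector N (p j) s) v K.≈ K.0#) → InI (J ℕ.+ N) ((λ A x → binary A J v (x zero) (x x₁)) ⊠ powL x₀ N)
          member v h = in-resp eq (in-Σ (λ j → in-scale (v j) (proj₂ (proj₂ (reduced j)))))
            where
            relation = word-vector-0 N p v (λ s → K.trans (Vectors.·-comm K v _) (h s))
            eq : ∀ A x → Alg._≈_ A (Vectors.Σ (Alg.comRing A) (λ j → Alg._*_ A (Alg.ι A (v j)) (Alg._-_ A (φ j A x) (Alg._*_ A (powL x₀ J A x) (proj₁ (reduced j) A x)))))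
                   (Alg._*_ A (binary A J v (x zero) (x x₁)) (powL x₀ N A x))
            eq A x = begin
              Σ (λ j → ι (v j) * (φ j A x - X * r j)) ≈⟨ Σ-cong (λ j → solve 5 (λ v m y X r → v :* (m :* y :- X :* r) := v :* m :* y :+ (:- X) :* (v :* r)) refl _ _ _ _ _) ⟩
              Σ (λ j → ι (v j) * monomial A J (x zero) (x x₁) j * Y + - X * (ι (v j) * r j)) ≈⟨ Σ-+ _ _ ⟩
              Σ (λ j → ι (v j) * monomial A J (x zero) (x x₁) j * Y) + Σ (λ j → - X * (ι (v j) * r j)) ≈⟨ +-cong (sym (Σ-*ʳ _ _)) (sym (Σ-*ˡ _ _)) ⟩
              Σ (λ j → ι (v j) * monomial A J (x zero) (x x₁) j) * Y + - X * Σ (λ j → ι (v j) * r j)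
                ≈⟨ +-cong (*-congʳ (binary-monomials A J v _ _)) (*-congˡ (trans (Σ-cong (λ j → *-congˡ (Form.agrees (proj₁ (proj₂ (reduced j))) A x))) (relation A x))) ⟩
              binary A J v (x zero) (x x₁) * Y + - X * 0# ≈⟨ solve 2 (λ b X → b :+ (:- X) :* :0 := b) refl _ _ ⟩
              binary A J v (x zero) (x x₁) * Y ∎
              where
              open Alg A using (comRing; ι; _+_; _*_; -_; _-_; 0#; refl; sym; trans; setoid; +-cong; *-congˡ; *-congʳ)
              open IntegerSolver comRing using (solve; _:=_; _:+_; _:*_; _:-_; :-_; :0)
              open Vectors comRing using (Σ; Σ-cong; Σ-+; Σ-*ˡ; Σ-*ʳ)
              open import Relation.Binary.Reasoning.Setoid setoid using (begin_; _∎; step-≈-⟩)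
              X = powL x₀ J A x
              Y = powL x₀ N A x
              r = λ j → proj₁ (reduced j) A x

        roots : List K.Carrier → Law (suc (suc n))
        roots ρs A x = roots-product A ρs (x x₁) (x zero)

        Divisible : List K.Carrier → Set _
        Divisible ρs = ∃ λ D → ∃ λ q → Form D q × InI (length ρs ℕ.+ D) (powL x₀ (length ρs ℕ.+ D) ⊟ roots ρs ⊠ q)

        -- On the hyperplane `x₁ = ρ x₀` a power of `x₀` lies in the restricted ideal, so in the
        -- full space it is congruent to a multiple of `x₁ - ρ x₀`. Multiplying over the roots makes
        -- a power of `x₀` congruent to a multiple of the whole product.
        by-roots : ∀ ρs → ¬ ¬ Divisible ρs
        by-roots [] k = k (0 , (λ A x → Alg.1# A) , form-resp (λ A x → Alg.ι-1 A) (form-const K.1#) , in-resp (λ A x → eq A) (in-0 0))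
          where
          eq : ∀ A → Alg._≈_ A (Alg.0# A) (Alg._-_ A (Alg.1# A) (Alg._*_ A (Alg.1# A) (Alg.1# A)))
          eq A = solve 0 (:0 := :1 :- :1 :* :1) refl
            where
            open Alg A using (comRing; refl)
            open IntegerSolver comRing using (solve; _:=_; _:*_; _:-_; :-_; :1; :0)
        by-roots (ρ ∷ ρs) k = by-roots ρs λ { (D , q , fq , i) → IH deg (Rρ.g ρ) (Rρ.g-isForm ρ) (Rρ.g-noZeros ρ noZeros) λ
          { (N₁ , full₁) → k (join D q fq i N₁ (Rρ.lift-membership ρ (form-coord-pow zero (suc N₁))
              (full-suc deg (Rρ.g ρ) full₁ (form-coord-pow zero (suc N₁))))) } }
          where
          join : ∀ D q → Form D q → InI (length ρs ℕ.+ D) (powL x₀ (length ρs ℕ.+ D) ⊟ roots ρs ⊠ q) → ∀ N₁ →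
            (∃ λ r → Form N₁ r × InI (suc N₁) (powL x₀ (suc N₁) ⊟ Hyperplane.z (slope-hyperplane n ρ) ⊠ r)) → Divisible (ρ ∷ ρs)
          join D q fq i N₁ (r , fr , i′) = N₁ ℕ.+ D , r ⊠ q , form-* fr fq , in-resp eq (in-+
              (in-≡ degrees (in-* (form-coord-pow zero (l ℕ.+ D)) i′))
              (in-≡ (≡.trans (≡.sym (ℕP.+-assoc 1 N₁ _)) (≡.trans (ℕP.+-comm (suc N₁) _) degrees)) (in-* z-form (in-* fr i))))
            where
            l = length ρs
            z-form = Hyperplane.form-z (slope-hyperplane n ρ)
            degrees : l ℕ.+ D ℕ.+ suc N₁ ≡.≡ suc l ℕ.+ (N₁ ℕ.+ D)
            degrees = ℕS.solve 3 (λ l D N → l ℕS.:+ D ℕS.:+ (ℕS.con 1 ℕS.:+ N) ℕS.:= ℕS.con 1 ℕS.:+ l ℕS.:+ (N ℕS.:+ D)) ≡.refl l D N₁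
            eq : ∀ A x → _
            eq A x = trans (solve 6 (λ X Y z r P q → X :* (Y :- z :* r) :+ z :* (r :* (X :- P :* q)) := X :* Y :- z :* P :* (r :* q)) refl
                (powL x₀ (l ℕ.+ D) A x) (powL x₀ (suc N₁) A x) _ _ _ _)
              (+-congʳ (trans (sym (Powers.pow-+ comRing _ (l ℕ.+ D) (suc N₁))) (reflexive (≡.cong (pow comRing (x zero)) degrees))))
              where
              open Alg A using (comRing; refl; sym; trans; reflexive; +-congʳ)
              open IntegerSolver comRing using (solve; _:=_; _:+_; _:*_; _:-_; :-_)

        -- The product over the roots times `x₀^(e+N)` is in the ideal by `binary-member` and the
        -- factorisation; by `by-roots` some power of `x₀` is congruent to a multiple of that
        -- product.
        power-member : ¬ ¬ (∃ λ T → InI T (powL x₀ T))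
        power-member k = binary-member λ { (v , nz , i) → factor-binary F root J v nz λ
          { (c , e , ρs , c≉0 , len , eq) → by-roots ρs λ { (D , q , fq , i′) → finish v i c e ρs len eq D q fq i′ (inverse c c≉0) } } }
          where
          finish : ∀ v → InI (J ℕ.+ N) ((λ A x → binary A J v (x zero) (x x₁)) ⊠ powL x₀ N) → ∀ c e ρs → e ℕ.+ length ρs ≡.≡ J →
            (∀ (A : Alg κ) x y → Alg._≈_ A (binary A J v x y) (Alg._*_ A (Alg.ι A c) (Alg._*_ A (pow (Alg.comRing A) x e) (roots-product A ρs y x)))) →
            ∀ D q → Form D q → InI (length ρs ℕ.+ D) (powL x₀ (length ρs ℕ.+ D) ⊟ roots ρs ⊠ q) → (∃ λ y → c K.* y K.≈ K.1#) → ⊥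
          finish v i c e ρs len eq D q fq i′ (c⁻¹ , inv) = k (e ℕ.+ N ℕ.+ (l ℕ.+ D) , in-resp identity (in-+
              (in-* (form-coord-pow zero (e ℕ.+ N)) i′)
              (in-≡ (≡.trans (≡.cong (λ j → D ℕ.+ (j ℕ.+ N)) (≡.sym len)) degrees) (in-* fq (in-scale c⁻¹ i)))))
            where
            l = length ρs
            degrees : D ℕ.+ (e ℕ.+ l ℕ.+ N) ≡.≡ e ℕ.+ N ℕ.+ (l ℕ.+ D)
            degrees = ℕS.solve 4 (λ D e l N → D ℕS.:+ (e ℕS.:+ l ℕS.:+ N) ℕS.:= e ℕS.:+ N ℕS.:+ (l ℕS.:+ D)) ≡.refl D e l N
            identity : ∀ A x → _
            identity A x = begin
              powL x₀ (e ℕ.+ N) A x * (X - P * Q) + Q * (ι c⁻¹ * (binary A J v (x zero) (x x₁) * Y))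
                ≈⟨ +-cong (*-congʳ (Powers.pow-+ comRing _ e N)) (*-congˡ (*-congˡ (*-congʳ (eq A _ _)))) ⟩
              E * Y * (X - P * Q) + Q * (ι c⁻¹ * (ι c * (E * P) * Y))
                ≈⟨ solve 7 (λ E Y X P Q c′ c → E :* Y :* (X :- P :* Q) :+ Q :* (c′ :* (c :* (E :* P) :* Y)) := E :* Y :* X :+ (c :* c′ :- :1) :* (E :* Y :* P :* Q)) refl E Y X P Q _ _ ⟩
              E * Y * X + (ι c * ι c⁻¹ - 1#) * (E * Y * P * Q) ≈⟨ +-congˡ (*-congʳ (+-congʳ (trans (sym (ι-* _ _)) (trans (ι-cong inv) ι-1)))) ⟩
              E * Y * X + (1# - 1#) * (E * Y * P * Q) ≈⟨ solve 2 (λ a b → a :+ (:1 :- :1) :* b := a) refl _ _ ⟩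
              E * Y * X ≈⟨ *-congʳ (sym (Powers.pow-+ comRing _ e N)) ⟩
              powL x₀ (e ℕ.+ N) A x * X ≈⟨ sym (Powers.pow-+ comRing _ (e ℕ.+ N) (l ℕ.+ D)) ⟩
              powL x₀ (e ℕ.+ N ℕ.+ (l ℕ.+ D)) A x ∎
              where
              open Alg A using (comRing; ι; ι-cong; ι-*; ι-1; _+_; _*_; -_; _-_; 1#; refl; sym; trans; setoid; +-cong; +-congˡ; +-congʳ; *-congˡ; *-congʳ)
              open IntegerSolver comRing using (solve; _:=_; _:+_; _:*_; _:-_; :-_; :1)
              open import Relation.Binary.Reasoning.Setoid setoid using (begin_; _∎; step-≈-⟩)
              X = powL x₀ (l ℕ.+ D) A x
              P = roots ρs A x
              Q = q A x
              Y = powL x₀ N A x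
              E = powL x₀ e A x

        -- Every form of degree `T + N` is congruent to a multiple of `x₀^T`, which is now itself in
        -- the ideal.
        full-degree : ¬ ¬ (∃ λ M → Full M)
        full-degree k = power-member λ { (T , i) → k (T ℕ.+ N , λ h → close T i (R₀.power-reduction full T h)) }
          where
          close : ∀ T → InI T (powL x₀ T) → ∀ {φ} → (∃ λ r → Form N r × InI (T ℕ.+ N) (φ ⊟ powL x₀ T ⊠ r)) → InI (T ℕ.+ N) φ
          close T i (r , fr , i′) = in-resp (λ A x → eq A _ _ _) (in-+ i′ (in-≡ (ℕP.+-comm N T) (in-* fr i)))
            where
            eq : ∀ A a X r → Alg._≈_ A (Alg._+_ A (Alg._-_ A a (Alg._*_ A X r)) (Alg._*_ A r X)) a
            eq A = solve 3 (λ a X r → a :- X :* r :+ r :* X := a) refl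
              where
              open Alg A using (comRing; refl)
              open IntegerSolver comRing using (solve; _:=_; _:+_; _:*_; _:-_; :-_)

      result : ¬ ¬ (∃ λ M → Full M)
      result k = IH deg R₀.g R₀.g-isForm (R₀.g-noZeros noZeros) λ { (N , full) → WithBound.full-degree N (full-suc deg R₀.g full) k }

    -- A form in one variable is its value at 1 times a power of the variable, so a generator that
    -- does not vanish at 1 yields all forms of its degree.
    one-variable : Theorem 1
    one-variable deg f isForm noZeros k = noZeros (λ _ → K.1#) (λ h → 1≉0 (h zero)) λ i → ¬¬-elim λ h → full i h (inverse _ h)
      where
      open Family deg f
      one : ∀ {d φ} → Form d φ → φ ≋ const (φ base (λ _ → K.1#)) ⊠ powL (coord zero) d
      one {d} {φ} (p via e) A x = trans (e A x) (trans (go d p) (*-congʳ (ι-cong (K.sym (e base _)))))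
        where
        open Alg A using (comRing; ι; ι-cong; _≈_; _*_; refl; sym; trans; +-cong; *-congˡ; *-congʳ; *-identityʳ)
        open IntegerSolver comRing using (solve; _:=_; _:+_; _:*_; :0)
        go : ∀ d p → form d p A x ≈ ι (form d p base (λ _ → K.1#)) * pow comRing (x zero) d
        go zero p = sym (*-identityʳ _)
        go (suc d) p = trans (Vectors.Σ-∷ comRing _) (trans (+-cong (*-congˡ (go d (∂ zero p))) (Vectors.Σ-[] comRing _))
          (trans (solve 3 (λ x c p → x :* (c :* p) :+ :0 := c :* (x :* p)) refl _ _ _)
            (*-congʳ (ι-cong (K.sym (K.trans (Vectors.Σ-∷ K _) (K.trans (K.+-cong (K.*-identityˡ _) (Vectors.Σ-[] K _)) (K.+-identityʳ _))))))))
      full : ∀ i → ¬ (f i base (λ _ → K.1#) K.≈ K.0#) → (∃ λ y → f i base (λ _ → K.1#) K.* y K.≈ K.1#) → ⊥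
      full i _ (y , inv) = k (suc (deg i) , λ {φ} h → in-resp (λ A x → Alg.trans A (Alg.*-congˡ A (one (isForm i) A x))
          (Alg.trans A (cancel A _ _) (Alg.sym A (one h A x)))) (in-scale (φ base (λ _ → K.1#) K.* y) (in-generator i)))
        where
        cancel : ∀ A a X → Alg._≈_ A (Alg._*_ A (Alg.ι A (a K.* y)) (Alg._*_ A (Alg.ι A (f i base (λ _ → K.1#))) X)) (Alg._*_ A (Alg.ι A a) X)
        cancel A a X = trans (*-congʳ (ι-* a y)) (trans (solve 4 (λ a y c X → a :* y :* (c :* X) := a :* (c :* y) :* X) refl _ _ _ _)
          (*-congʳ (trans (*-congˡ (trans (sym (ι-* _ y)) (trans (ι-cong inv) ι-1))) (*-identityʳ _))))
          where
          open Alg A using (comRing; ι-cong; ι-*; ι-1; refl; sym; trans; *-congˡ; *-congʳ; *-identityʳ)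
          open IntegerSolver comRing using (solve; _:=_; _:*_)

    nullstellensatz : Root → ∀ n → Theorem n
    -- Without variables a form of degree one is an empty sum.
    nullstellensatz root zero deg f isForm noZeros k = k (1 , λ { (p via e) → Family.in-resp deg f (λ A x → Alg.sym A (Alg.trans A (e A x) (Vectors.Σ-[] (Alg.comRing A) _))) (Family.in-0 deg f 1) })
    nullstellensatz root (suc zero) = one-variable
    nullstellensatz root (suc (suc n)) deg f isForm noZeros = Step.result root (nullstellensatz root (suc n)) deg f isForm noZeros

-- Approximate inverses and the codimension bound for families

module Deform where
  open RS
  open Lin
  open LA
  open KAlg
  open Link using (module Naturality)
  open Span
  open Order
  open Engine
  open Forms
  open import Defs using (pow)
  open import Level using (_⊔_)
  open import Algebra.Bundles using (CommutativeRing)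
  open import Data.Nat using (ℕ; zero; suc; _<_)
  open import Data.Fin using (Fin; zero; suc)
  open import Data.List using (List; []; _∷_; _++_; map; length)
  open import Data.List.Relation.Unary.All as All using (All; []; _∷_)
  open import Data.Product using (_×_; _,_; ∃; ∃₂; proj₁; proj₂)
  open import Relation.Nullary using (¬_)
  import Relation.Binary.PropositionalEquality as ≡

  module QuasiInverse {a ℓ ℓ′} (A : CommutativeRing a ℓ) (J : ℕ → Ideal A ℓ′)
      (J-0 : ∀ x → Ideal.Mem (J 0) x)
      (J-* : ∀ k {x y} → Ideal.Mem (J 1) x → Ideal.Mem (J k) y → Ideal.Mem (J (suc k)) (CommutativeRing._*_ A x y)) where
    open CommutativeRing A using (_≈_; _+_; _*_; -_; _-_; 1#; refl; sym; trans; setoid; +-cong; +-congʳ; *-congˡ; *-congʳ; *-assoc; distribʳ)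
    open IntegerSolver A using (solve; _:=_; _:+_; _:*_; _:-_; :-_; :1; :0)
    open Vectors A using (V; Σ; _+v_; _•_; 0v; _·_; δ; Σ-[]; Σ-∷; Σ-cong; Σ-+; δ-·; ·-+ʳ; ·-•ʳ; ·-0ʳ)
    open import Relation.Binary.Reasoning.Setoid setoid using (begin_; _∎; step-≈-⟩)
    module J k = Ideal (J k)

    J-neg : ∀ k {x} → J.Mem k x → J.Mem k (- x)
    J-neg k {x} h = J.resp k (solve 1 (λ x → (:- :1) :* x := :- x) refl x) (J.mulM k (- 1#) h)

    J-Σ : ∀ k {m} {f : V m} → (∀ i → J.Mem k (f i)) → J.Mem k (Σ f)
    J-Σ k {zero} h = J.resp k (sym (Σ-[] _)) (J.zeroM k)
    J-Σ k {suc m} h = J.resp k (sym (Σ-∷ _)) (J.addM k (h zero) (J-Σ k (λ i → h (suc i))))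

    -- Each step multiplies the error by the off-diagonal part, which has positive order.
    quasi-inverse : ∀ {p} (M X : Fin p → V p) (d d′ : V p) T → (∀ a b → M a b ≈ δ a b * d a + X a b) →
      (∀ a b → J.Mem 1 (X a b)) → (∀ a → d a * d′ a ≈ T) → ∀ k (y : V p) →
      ∃₂ λ (z r : V p) → (∀ a → M a · z + r a ≈ pow A T k * y a) × (∀ a → J.Mem k (r a))
    quasi-inverse M X d d′ T M≈ X∈ dd′ zero y = 0v , y , (λ a → trans (+-congʳ (·-0ʳ (M a) (λ _ → refl))) (solve 1 (λ y → :0 :+ y := :1 :* y) refl _)) , λ a → J-0 _
    quasi-inverse {p} M X d d′ T M≈ X∈ dd′ (suc k) y with quasi-inverse M X d d′ T M≈ X∈ dd′ k y
    ... | z , r , eq , r∈ = (T • z) +v w , (λ a → - (X a · w)) , eq′ , λ a → J-neg (suc k) (J-Σ (suc k) (λ b → J-* k (X∈ a b) (J.mulM k _ (r∈ b))))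
      where
      w : V p
      w b = d′ b * r b
      M·w : ∀ a → M a · w ≈ T * r a + X a · w
      M·w a = begin
        M a · w ≈⟨ Σ-cong (λ b → trans (*-congʳ (M≈ a b)) (trans (distribʳ _ _ _) (+-congʳ (*-assoc _ _ _)))) ⟩
        Σ (λ b → δ a b * (d a * w b) + X a b * w b) ≈⟨ Σ-+ _ _ ⟩
        δ a · (λ b → d a * w b) + X a · w ≈⟨ +-congʳ (trans (δ-· a _) (trans (sym (*-assoc _ _ _)) (*-congʳ (dd′ a)))) ⟩
        T * r a + X a · w ∎
      eq′ : ∀ a → M a · ((T • z) +v w) + - (X a · w) ≈ T * pow A T k * y a
      eq′ a = begin
        M a · ((T • z) +v w) + - (X a · w) ≈⟨ +-congʳ (trans (·-+ʳ _ _ _) (+-cong (·-•ʳ T _ z) (M·w a))) ⟩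
        T * (M a · z) + (T * r a + X a · w) + - (X a · w) ≈⟨ solve 4 (λ T m r x → T :* m :+ (T :* r :+ x) :+ (:- x) := T :* (m :+ r)) refl _ _ _ _ ⟩
        T * (M a · z + r a) ≈⟨ trans (*-congˡ (eq a)) (sym (*-assoc _ _ _)) ⟩
        T * pow A T k * y a ∎

  module Deformation {c ℓ} (K : CommutativeRing c (c ⊔ ℓ)) (F : StableField K) where
    private
      module K = CommutativeRing K using ()
      κ = c ⊔ ℓ
    open Algebras K
    open Spans K
    open Naturality K
    open OrderFiltration K
    open HeightEngine K F
    open HomogeneousForms K

    infixr 9 _∘h_
    _∘h_ : ∀ {ℓ₁ ℓ₂ ℓ₃} {A : Alg ℓ₁} {B : Alg ℓ₂} {C : Alg ℓ₃} → Hom B C → Hom A B → Hom A C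
    _∘h_ {C = C} g f = record
      { ⟦_⟧ = λ a → G.⟦ f.⟦ a ⟧ ⟧ ; ⟦⟧-cong = λ h → G.⟦⟧-cong (f.⟦⟧-cong h)
      ; ⟦⟧-+ = λ a b → C.trans (G.⟦⟧-cong (f.⟦⟧-+ a b)) (G.⟦⟧-+ _ _) ; ⟦⟧-* = λ a b → C.trans (G.⟦⟧-cong (f.⟦⟧-* a b)) (G.⟦⟧-* _ _)
      ; ⟦⟧-ι = λ a → C.trans (G.⟦⟧-cong (f.⟦⟧-ι a)) (G.⟦⟧-ι a) }
      where
      module C = Alg C using (trans)
      module G = Hom g using (⟦_⟧; ⟦⟧-cong; ⟦⟧-+; ⟦⟧-*; ⟦⟧-ι)
      module f = Hom f using (⟦_⟧; ⟦⟧-cong; ⟦⟧-+; ⟦⟧-*; ⟦⟧-ι)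

    -- `η` is a test homomorphism: it annihilates everything of order `k` and the equations `hs`.
    -- Testing with all such `η` replaces explicit membership computations by reasoning with
    -- equalities.
    Kills : ∀ n {C : Alg κ} → Hom (R n) C → ℕ → List (Alg.Carrier (R n)) → Set κ
    Kills n {C} η k hs = (∀ {y} → OrdR n k y → Alg._≈_ C (Hom.⟦_⟧ η y) (Alg.0# C)) × All (λ h → Alg._≈_ C (Hom.⟦_⟧ η h) (Alg.0# C)) hs

    -- The quotient by order `k` and by the `hs` is itself one of the test algebras, and vanishing
    -- there is the membership.
    generated : ∀ {n} k hs x → (∀ (C : Alg κ) (η : Hom (R n) C) → Kills n η k hs → Alg._≈_ C (Hom.⟦_⟧ η x) (Alg.0# C)) →
      InGen (Quot (R n) (ordIdeal n k)) hs x
    generated {n} k hs x h = Quotient.~0⇒mem (Alg.comRing Q) (genIdeal Q hs) (h (Quot Q (genIdeal Q hs)) (quotHom Q (genIdeal Q hs) ∘h quotHom (R n) (ordIdeal n k))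
        ((λ o → Hom.⟦⟧-cong (quotHom Q (genIdeal Q hs)) (Quotient.mem⇒~0 (Alg.comRing (R n)) (ordIdeal n k) o)) ,
         All.map (λ i → Quotient.mem⇒~0 (Alg.comRing Q) (genIdeal Q hs) i) (members hs)))
      where
      Q = Quot (R n) (ordIdeal n k)
      members : ∀ hs → All (InGen Q hs) hs
      members [] = []
      members (h ∷ hs) = gen-here Q h hs ∷ All.map (gen-skip Q h hs) (members hs)

    module _ n {Idx : Set c} (f̃ : Idx → Alg.Carrier (R n)) where
      private module R = Alg (R n) using (comRing; Carrier; _≈_; _+_; _*_; 0#; refl; sym; trans; +-cong; +-congˡ; *-congˡ; +-assoc; +-identityˡ; *-assoc; zeroʳ; distribˡ)
      combination : List (Idx × R.Carrier) → R.Carrier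
      combination [] = R.0#
      combination ((i , a) ∷ ts) = a R.* f̃ i R.+ combination ts

      familyIdeal : Ideal R.comRing κ
      familyIdeal = record
        { Mem = λ r → ∃ λ ts → combination ts R.≈ r
        ; resp = λ { e (ts , h) → ts , R.trans h e }
        ; zeroM = [] , R.refl
        ; addM = λ { (ts , h) (us , g) → ts ++ us , R.trans (append ts us) (R.+-cong h g) }
        ; mulM = λ { y (ts , h) → map (λ { (i , a) → i , y R.* a }) ts , R.trans (scale y ts) (R.*-congˡ h) } }
        where
        append : ∀ ts us → combination (ts ++ us) R.≈ combination ts R.+ combination us
        append [] us = R.sym (R.+-identityˡ _)
        append (t ∷ ts) us = R.trans (R.+-congˡ (append ts us)) (R.sym (R.+-assoc _ _ _))
        scale : ∀ y ts → combination (map (λ { (i , a) → i , y R.* a }) ts) R.≈ y R.* combination ts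
        scale y [] = R.sym (R.zeroʳ y)
        scale y (t ∷ ts) = R.trans (R.+-cong (R.*-assoc _ _ _) (scale y ts)) (R.sym (R.distribˡ _ _ _))

      gen-family : ∀ k hs T → (∀ i → InGen (Quot (R n) (ordIdeal n k)) hs (T R.* f̃ i)) →
        ∀ {r} → Ideal.Mem familyIdeal r → InGen (Quot (R n) (ordIdeal n k)) hs (T R.* r)
      gen-family k hs T h (ts , e) = gen-resp Q hs (Q.*-congˡ (Hom.⟦⟧-cong (quotHom (R n) (ordIdeal n k)) e)) (go ts)
        where
        Q = Quot (R n) (ordIdeal n k)
        module Q = Alg Q using (_≈_; _*_; sym; trans; *-congˡ; *-congʳ; *-assoc; *-comm; zeroʳ; distribˡ)
        exchange : ∀ T a x → a Q.* (T Q.* x) Q.≈ T Q.* (a Q.* x)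
        exchange T a x = Q.trans (Q.sym (Q.*-assoc _ _ _)) (Q.trans (Q.*-congʳ (Q.*-comm _ _)) (Q.*-assoc _ _ _))
        go : ∀ ts → InGen Q hs (T R.* combination ts)
        go [] = gen-resp Q hs (Q.sym (Q.zeroʳ T)) (gen-0 Q hs)
        go ((i , a) ∷ ts) = gen-resp Q hs (Q.sym (Q.distribˡ _ _ _)) (gen-+ Q hs (gen-resp Q hs (exchange T a (f̃ i)) (gen-* Q hs a (h i))) (go ts))

    -- The family f̃ over K[[x]][[t]] specialises at t = 0 to the homogeneous family f.
    family-bound : ∀ {n r} → r < n → {Idx : Set c} (deg : Idx → ℕ) (f : Idx → Law n) (f̃ : Idx → Alg.Carrier (R n)) →
      (∀ i → Alg._≈_ (B n) (f̃ i 0) (f i (B n) Xs)) → ∀ N → (∀ j → Family.InI deg f N (powL (coord j) N)) →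
      ¬ (∀ k → 0 < k → ∃₂ λ e hs → 0 < e × length hs ≡.≡ r × All (OrdR n 1) hs ×
          ∀ i (C : Alg κ) (η : Hom (R n) C) → Kills n η k hs → Alg._≈_ C (Hom.⟦_⟧ η (Alg._*_ (R n) (pow (Alg.comRing (R n)) (Xs {suc n} zero) e) (f̃ i))) (Alg.0# C))
    family-bound {n} {r} r<n {Idx} deg f f̃ head N powers local = height-bound {n} {r} r<n (familyIdeal n f̃) N atZero
      λ k 0<k → assemble k (local k 0<k)
      where
      module R = Alg (R n) using (comRing; Carrier; _*_; -_; _-_)
      open Family deg f
      t = Xs {suc n} zero
      assemble : ∀ k → (∃₂ λ e hs → 0 < e × length hs ≡.≡ r × All (OrdR n 1) hs ×
          ∀ i (C : Alg κ) (η : Hom (R n) C) → Kills n η k hs → Alg._≈_ C (Hom.⟦_⟧ η (pow R.comRing t e R.* f̃ i)) (Alg.0# C)) →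
        ∃₂ λ e hs → 0 < e × length hs ≡.≡ r × All (OrdR n 1) hs × (∀ {f} → Ideal.Mem (familyIdeal n f̃) f → InGen (Quot (R n) (ordIdeal n k)) hs (pow R.comRing t e R.* f))
      assemble k (e , hs , 0<e , len , ord , h) = e , hs , 0<e , len , ord , gen-family n f̃ k hs (pow R.comRing t e) (λ i → generated {n} k hs (pow R.comRing t e R.* f̃ i) (h i))
      lift-terms : List (Term N) → List (Idx × R.Carrier)
      lift-terms [] = []
      lift-terms (term i {cofactor = g} _ _ ∷ ts) = (i , PowerSeries.cst (Alg.comRing (B n)) (g (B n) Xs)) ∷ lift-terms ts
      lift-head : ∀ ts → Alg._≈_ (B n) (combination n f̃ (lift-terms ts) 0) (total ts (B n) Xs)
      lift-head [] = Alg.refl (B n)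
      lift-head (term i _ _ ∷ ts) = Alg.+-cong (B n) (Alg.*-congˡ (B n) (head i)) (lift-head ts)
      module _ (A : CommutativeRing c κ) where
        open CommutativeRing A using (_≈_; _+_; -_; _-_; 0#; refl; trans; +-congˡ; +-congʳ; -‿cong; +-identityˡ)
        open IntegerSolver A using (solve; _:=_; _:-_; :-_)
        difference : ∀ p q z w → p - q ≈ z + w → z ≈ 0# → q ≈ p - w
        difference p q z w e z≈0 = trans (solve 2 (λ p q → q := p :- (p :- q)) refl p q) (+-congˡ (-‿cong (trans e (trans (+-congʳ z≈0) (+-identityˡ _)))))
      -- Replacing each `f` by `f̃` in a representation of `x_j^N` does not change the constant term
      -- in `t`, so the difference is a multiple of `t`.
      atZero : PowersAtZero n (familyIdeal n f̃) N
      atZero j = tl u , ts′ , difference R.comRing p q (cst (u 0)) (t R.* tl u) (decompose u) (λ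
          { zero → B.trans (B.+-cong (hom-pow (headHom (B n)) (Xs {suc n} (suc j)) N) (B.-‿cong (B.trans (lift-head (proj₁ (powers j))) (B.sym (proj₂ (powers j) (B n) Xs))))) (B.-‿inverseʳ _)
          ; (suc _) → B.refl })
        where
        module B = Alg (B n) using (comRing; refl; sym; trans; +-cong; -‿cong; -‿inverseʳ)
        open PowerSeries B.comRing using (tl; cst; decompose)
        ts′ = lift-terms (proj₁ (powers j))
        p = pow R.comRing (Xs {suc n} (suc j)) N
        q = combination n f̃ ts′
        u = p R.- q

-- Normal form of the constant part under changes of bases

module Gauge where
  open Lin
  open LA
  open KAlg
  open Link using (module Naturality)
  open import Level using (_⊔_) renaming (suc to lsuc)
  open import Algebra.Bundles using (CommutativeRing)
  open import Data.Nat as ℕ using (ℕ; zero; suc)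
  import Data.Nat.Properties as ℕP
  open import Data.Fin using (Fin; zero; suc; _↑ˡ_; _↑ʳ_)
  open import Data.Vec using (Vec; []; lookup; _++_; map; tabulate)
  open import Data.Vec.Properties using (lookup-map; lookup∘tabulate; lookup-++ʳ; map-∘)
  open import Data.Product using (_×_; _,_; ∃₂)
  open import Data.Empty using (⊥)
  open import Relation.Nullary using (¬_)
  import Relation.Binary.PropositionalEquality as ≡

  Fin-case : ∀ {p} c {ρ} (P : Fin (c ℕ.+ ρ) → Set p) → (∀ i → P (i ↑ˡ ρ)) → (∀ j → P (c ↑ʳ j)) → ∀ b → P b
  Fin-case zero P l r b = r b
  Fin-case (suc c) P l r zero = l zero
  Fin-case (suc c) P l r (suc b) = Fin-case c (λ b → P (suc b)) (λ i → l (suc i)) r b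

  module Blocks {a ℓ} (A : CommutativeRing a ℓ) where
    open CommutativeRing A hiding (zero)
    open Vectors A
    open Alternating A

    -- The diagonal of the normalised constant part: `c` zeros followed by ones.
    block : ∀ c {ρ} → V (c ℕ.+ ρ)
    block zero _ = 1#
    block (suc c) zero = 0#
    block (suc c) (suc i) = block c i

    block-left : ∀ {c} ρ (i : Fin c) → block c (i ↑ˡ ρ) ≈ 0#
    block-left ρ zero = refl
    block-left ρ (suc i) = block-left ρ i

    block-right : ∀ c {ρ} (j : Fin ρ) → block c (c ↑ʳ j) ≈ 1#
    block-right zero j = refl
    block-right (suc c) j = block-right c j

    δ-right-left : ∀ {c ρ} (l : Fin ρ) (i : Fin c) → δ (c ↑ʳ l) (i ↑ˡ ρ) ≈ 0#
    δ-right-left {suc c} l zero = refl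
    δ-right-left {suc c} l (suc i) = δ-right-left l i

    δ-right-right : ∀ c {ρ} (l j : Fin ρ) → δ (c ↑ʳ l) (c ↑ʳ j) ≈ δ l j
    δ-right-right zero l j = refl
    δ-right-right (suc c) l j = δ-right-right c l j

    δ-left-right : ∀ {c ρ} (i : Fin c) (l : Fin ρ) → δ (i ↑ˡ ρ) (c ↑ʳ l) ≈ 0#
    δ-left-right i l = trans (δ-sym (i ↑ˡ _) _) (δ-right-left l i)

    δ-left-left : ∀ {c} ρ (i j : Fin c) → δ (i ↑ˡ ρ) (j ↑ˡ ρ) ≈ δ i j
    δ-left-left ρ zero zero = refl
    δ-left-left ρ zero (suc j) = refl
    δ-left-left ρ (suc i) zero = refl
    δ-left-left ρ (suc i) (suc j) = δ-left-left ρ i j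

    lookup-I : ∀ {m} (j : Fin m) → lookup (I m) j ≈v δ j
    lookup-I zero i = refl
    lookup-I {suc m} (suc j) i = trans (reflexive (≡.cong (λ (v : V (suc m)) → v i) (lookup-map j pad (I m)))) (go i)
      where
      go : ∀ i → pad (lookup (I m) j) i ≈ δ (suc j) i
      go zero = refl
      go (suc i) = lookup-I j i

    rows-linear : ∀ {k m} (G : Fin k → V m) → Linear (λ v a → G a · v)
    rows-linear G = record { l-cong = λ h a → ·-cong (λ _ → refl) h ; l-+ = λ u v a → ·-+ʳ (G a) u v ; l-• = λ t v a → ·-•ʳ t (G a) v }

    -- Combined with `det-unique`, this shows that the determinants of dual bases are inverse to
    -- each other, hence nonzero.
    dual-det : ∀ {m p} (G : Fin m → V p) (C : Vec (V p) m) → (∀ a b → G a · lookup C b ≈ δ a b) → det (map (λ v a → G a · v) C) ≈ 1#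
    dual-det {m} G C D = trans (alt-cong det-alt (λ b a → trans (reflexive (≡.cong (λ (v : V m) → v a) (lookup-map b (λ v a → G a · v) C)))
      (trans (D a b) (trans (δ-sym a b) (sym (lookup-I b a)))))) (det-I m)

    -- `det-unique` is applied twice: to the composite map of columns, which splits off `H`, and to
    -- multiplication by `G`.
    det-sandwich : ∀ {m} (G W : Fin m → V m) (H : Vec (V m) m) →
      det (map (λ h a → G a · (λ i → W i · h)) H) ≈ (det H * det (map (λ v a → G a · v) (I m))) * det (tabulate (λ j i → W i j))
    det-sandwich {m} G W H = begin
      det (map (λ h a → G a · (λ i → W i · h)) H) ≈⟨ det-unique (alt-map comp det-alt) H ⟩
      det H * det (map (λ h a → G a · (λ i → W i · h)) (I m)) ≈⟨ *-congˡ (reflexive (≡.cong det (map-∘ (λ v a → G a · v) (λ h i → W i · h) (I m)))) ⟩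
      det H * det (map (λ v a → G a · v) (map (λ h i → W i · h) (I m))) ≈⟨ *-congˡ (det-unique (alt-map (rows-linear G) det-alt) _) ⟩
      det H * (det (map (λ h i → W i · h) (I m)) * det (map (λ v a → G a · v) (I m))) ≈⟨ *-congˡ (trans (*-comm _ _) (*-congˡ (alt-cong det-alt col))) ⟩
      det H * (det (map (λ v a → G a · v) (I m)) * det (tabulate (λ j i → W i j))) ≈⟨ sym (*-assoc _ _ _) ⟩
      (det H * det (map (λ v a → G a · v) (I m))) * det (tabulate (λ j i → W i j)) ∎
      where
      open import Relation.Binary.Reasoning.Setoid setoid using (begin_; _∎; step-≈-⟩)
      comp : Linear (λ h a → G a · (λ i → W i · h))
      comp = record
        { l-cong = λ h a → ·-cong (λ _ → refl) (λ i → ·-cong (λ _ → refl) h)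
        ; l-+ = λ u v a → trans (·-cong (λ _ → refl) (λ i → ·-+ʳ (W i) u v)) (·-+ʳ (G a) _ _)
        ; l-• = λ t v a → trans (·-cong (λ _ → refl) (λ i → ·-•ʳ t (W i) v)) (·-•ʳ t (G a) _) }
      col : ∀ j i → lookup (map (λ h i → W i · h) (I m)) j i ≈ lookup (tabulate (λ j i → W i j)) j i
      col j i = trans (reflexive (≡.cong (λ (v : V m) → v i) (lookup-map j (λ h i → W i · h) (I m))))
        (trans (·-cong (λ _ → refl) (lookup-I j)) (trans (·-δ (W i) j) (reflexive (≡.cong (λ (v : V m) → v i) (≡.sym (lookup∘tabulate (λ j i → W i j) j))))))

    affine-sandwich : ∀ {m n} (g h : V m) (M₀ : Fin m → V m) (L : Fin m → Fin m → V n) (x : V n) →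
      g · (λ i → (λ j → M₀ i j + L i j · x) · h) ≈ g · (λ i → M₀ i · h) + (λ k → g · (λ i → (λ j → L i j k) · h)) · x
    affine-sandwich g h M₀ L x = begin
      g · (λ i → (λ j → M₀ i j + L i j · x) · h) ≈⟨ ·-cong (λ _ → refl) (λ i → trans (·-+ˡ _ _ h) (+-congˡ
           (trans (·-cong (λ j → ·-comm (L i j) x) (λ _ → refl)) (trans (comb-· x (λ k j → L i j k) h) (·-comm x _))))) ⟩
      g · (λ i → M₀ i · h + (λ k → (λ j → L i j k) · h) · x) ≈⟨ ·-+ʳ g _ _ ⟩
      g · (λ i → M₀ i · h) + g · (λ i → (λ k → (λ j → L i j k) · h) · x)
        ≈⟨ +-congˡ (trans (·-cong (λ _ → refl) (λ i → ·-comm _ x)) (trans (·-comb g x (λ k i → (λ j → L i j k) · h)) (·-comm x _))) ⟩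
      g · (λ i → M₀ i · h) + (λ k → g · (λ i → (λ j → L i j k) · h)) · x ∎
      where open import Relation.Binary.Reasoning.Setoid setoid

  module NormalForms {c κ} (K : CommutativeRing c κ) (F : StableField K) where
    private module K = CommutativeRing K using (Carrier; _≈_; _*_; 0#; 1#; refl; sym; trans; reflexive; *-congʳ; *-comm; *-identityˡ; zeroˡ)
    open Algebras K
    open StableField F
    open Naturality K
    open Vectors K using (V; _·_; δ; ·-cong; ·-δ; ·-0ʳ)
    open Blocks K using (block; block-left; block-right; δ-right-left; lookup-I; rows-linear; dual-det)
    module LF = LinearAlgebra K F

    affineCols : ∀ {m n} → (Fin m → V m) → (Fin m → Fin m → V n) → (A : Alg κ) → (Fin n → Alg.Carrier A) → Vec (Vectors.V (Alg.comRing A) m) m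
    affineCols M₀ L A x = tabulate (λ j i → Alg._+_ A (Alg.ι A (M₀ i j)) (Vectors._·_ (Alg.comRing A) (λ k → Alg.ι A (L i j k)) x))

    -- The constant `a` absorbs the determinants of the changes of bases.
    Represents : ∀ {m n} → (Fin m → V m) → (Fin m → Fin m → V n) → K.Carrier → (P : ∀ (A : Alg κ) → (Fin n → Alg.Carrier A) → Alg.Carrier A) → Set (lsuc c ⊔ lsuc κ)
    Represents M₀ L a P = ∀ A x → Alg._≈_ A (Alternating.det (Alg.comRing A) (affineCols M₀ L A x)) (Alg._*_ A (Alg.ι A a) (P A x))

    NormalForm : ∀ (m n : ℕ) → (P : ∀ (A : Alg κ) → (Fin n → Alg.Carrier A) → Alg.Carrier A) → Set (lsuc c ⊔ lsuc κ)
    NormalForm m n P = ∃₂ λ s ρ → ∃₂ λ (T : Fin (s ℕ.+ ρ) → Fin (s ℕ.+ ρ) → V n) a →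
      s ℕ.+ ρ ≡.≡ m × ¬ (a K.≈ K.0#) × Represents (λ i j → block s j K.* δ i j) T a P

    private
      -- `G` and `H` change bases on the two sides; their dual bases `C` and `R` certify that the
      -- determinants of both, and so `a`, are nonzero.
      gauge : ∀ {m n P} M₀ (L : Fin m → Fin m → V n) → Represents M₀ L K.1# P → (G C H R : Vec (V m) m) (B : Fin m → V m) →
        LF.Dual G C → LF.Dual R H → (∀ a b → lookup G a · (λ i → M₀ i · lookup H b) K.≈ B a b) →
        ∃₂ λ T a → ¬ (a K.≈ K.0#) × Represents {m} B T a P
      gauge {m} {n} {P} M₀ L rep G C H R B GC RH GMH = T , a , a≉0 , represents
        where
        open Alternating K using (alt-map; det; I; det-alt; det-unique)
        T : Fin m → Fin m → V n
        T i j k = lookup G i · (λ i′ → (λ j′ → L i′ j′ k) · lookup H j)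
        a = det H K.* det (map (λ v a → lookup G a · v) (I m))
        factor≉0 : ∀ {x y} → x K.* y K.≈ K.1# → ¬ (x K.≈ K.0#)
        factor≉0 e z = 1≉0 (K.trans (K.sym e) (K.trans (K.*-congʳ z) (K.zeroˡ _)))
        a≉0 : ¬ (a K.≈ K.0#)
        a≉0 = LF.nonzero-*
          (factor≉0 (K.trans (K.sym (det-unique (alt-map (rows-linear (lookup R)) det-alt) H)) (dual-det (lookup R) H RH)))
          (factor≉0 (K.trans (K.*-comm _ _) (K.trans (K.sym (det-unique (alt-map (rows-linear (lookup G)) det-alt) C)) (dual-det (lookup G) C GC))))
        represents : Represents B T a P
        represents A x = begin
          A′.det (affineCols B T A x) ≈⟨ A′.alt-cong A′.det-alt entry ⟩
          A′.det (map (λ h a → g a V′.· (λ i → W i V′.· h)) H′) ≈⟨ Bl.det-sandwich g W H′ ⟩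
          (A′.det H′ * A′.det (map (λ v a → g a V′.· v) (A′.I m))) * A′.det (affineCols M₀ L A x)
            ≈⟨ *-cong (*-cong (sym (hom-det (ιHom A) H)) (trans (A′.alt-cong A′.det-alt unit) (sym (hom-det (ιHom A) (map (λ v a → lookup G a · v) (I m)))))) (rep A x) ⟩
          (ι (det H) * ι (det (map (λ v a → lookup G a · v) (I m)))) * (ι K.1# * P A x) ≈⟨ *-cong (sym (ι-* _ _)) (trans (*-congʳ ι-1) (*-identityˡ _)) ⟩
          ι a * P A x ∎
          where
          open Alg A using (comRing; ι; ι-cong; ι-*; ι-1; _≈_; _+_; _*_; refl; sym; trans; reflexive; setoid; +-cong; *-cong; *-congʳ; *-identityˡ)
          module A′ = Alternating comRing using (det; I; det-alt; alt-cong)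
          module V′ = Vectors comRing using (V; _·_; ·-cong; ·-δ)
          module Bl = Blocks comRing using (lookup-I; det-sandwich; affine-sandwich)
          open import Relation.Binary.Reasoning.Setoid setoid using (begin_; _∎; step-≈-⟩)
          H′ = map (λ v i → ι (v i)) H
          g = λ a i → ι (lookup G a i)
          W : Fin m → V′.V m
          W i j = ι (M₀ i j) + (λ k → ι (L i j k)) V′.· x
          unit : ∀ j i → lookup (map (λ v a → g a V′.· v) (A′.I m)) j i ≈ lookup (map (λ v i → ι (v i)) (map (λ v a → lookup G a · v) (I m))) j i
          unit j i = trans (reflexive (≡.cong (λ (v : V′.V m) → v i) (lookup-map j (λ v a → g a V′.· v) (A′.I m))))
            (trans (V′.·-cong (λ _ → refl) (Bl.lookup-I j)) (trans (V′.·-δ _ j) (trans (ι-cong (K.sym (K.trans (·-cong (λ _ → K.refl) (lookup-I j)) (·-δ _ j))))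
              (reflexive (≡.cong (λ (v : V′.V m) → v i) (≡.sym (≡.trans (lookup-map j (λ v i → ι (v i)) (map (λ v a → lookup G a · v) (I m))) (≡.cong (λ v i → ι (v i)) (lookup-map j (λ v a → lookup G a · v) (I m))))))))))
          entry : ∀ b a → lookup (affineCols B T A x) b a ≈ lookup (map (λ h a → g a V′.· (λ i → W i V′.· h)) H′) b a
          entry b a = trans (reflexive (≡.cong (λ (v : V′.V m) → v a) (lookup∘tabulate _ b)))
            (trans (+-cong (trans (ι-cong (K.sym (GMH a b))) (trans (hom-· (ιHom A) (lookup G a) _) (V′.·-cong (λ _ → refl) (λ i → hom-· (ιHom A) (M₀ i) (lookup H b)))))
                (V′.·-cong (λ k → trans (hom-· (ιHom A) (lookup G a) _) (V′.·-cong (λ _ → refl) (λ i → hom-· (ιHom A) (λ j → L i j k) (lookup H b)))) (λ _ → refl)))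
            (trans (sym (Bl.affine-sandwich (g a) (λ j → ι (lookup H b j)) (λ i j → ι (M₀ i j)) (λ i j k → ι (L i j k)) x))
              (reflexive (≡.sym (≡.cong (λ (v : V′.V m) → v a) (≡.trans (lookup-map b (λ h a → g a V′.· (λ i → W i V′.· h)) H′)
                (≡.cong (λ h a → g a V′.· (λ i → W i V′.· h)) (lookup-map b (λ v i → ι (v i)) H))))))))

      -- On `Y` the matrix `M₀` takes values that are dual to `Λ`. The added vectors `Y⁺` are
      -- orthogonal to all rows `Λ M₀`, so the rank factorisation sends them to zero. In the two
      -- frames `M₀` is thus the diagonal matrix `block`.
      from-frames : ∀ {m n P s s′ ρ} M₀ (L : Fin m → Fin m → V n) → Represents M₀ L K.1# P →
        (Λ⁺ C⁺ : Vec (V m) s) (R⁺ Y⁺ : Vec (V m) s′) (Λ Y : Vec (V m) ρ) →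
        LF.Frame (Λ⁺ ++ Λ) (C⁺ ++ map (λ y i → M₀ i · y) Y) → LF.Frame (R⁺ ++ map (λ λ′ t → LF.Pairing.β M₀ λ′ (δ t)) Λ) (Y⁺ ++ Y) →
        (∀ i t → M₀ i t K.≈ (λ l → M₀ i · lookup Y l) · (λ l → LF.Pairing.β M₀ (lookup Λ l) (δ t))) →
        s ℕ.+ ρ ≡.≡ m → s′ ℕ.+ ρ ≡.≡ m → s ≡.≡ s′ → NormalForm m n P
      from-frames {n = n} {P} {s} {_} {ρ} M₀ L rep Λ⁺ C⁺ R⁺ Y⁺ Λ Y F₁ F₂ res ≡.refl _ ≡.refl =
        finish (gauge M₀ L rep (Λ⁺ ++ Λ) (C⁺ ++ map (λ y i → M₀ i · y) Y) (Y⁺ ++ Y) (R⁺ ++ map (λ λ′ t → LF.Pairing.β M₀ λ′ (δ t)) Λ)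
          (λ i j → block s j K.* δ i j) (LF.Frame.dual F₁) (LF.Frame.dual F₂)
          (λ a → Fin-case s (λ b → G a · (λ i → M₀ i · lookup (Y⁺ ++ Y) b) K.≈ block s b K.* δ a b) (left a) (right a)))
        where
        G = lookup (Λ⁺ ++ Λ)
        finish : (∃₂ λ T a → ¬ (a K.≈ K.0#) × Represents (λ i j → block s j K.* δ i j) T a P) → NormalForm _ n P
        finish (T , a , nz , r) = s , ρ , T , a , ≡.refl , nz , r
        right : ∀ a j → G a · (λ i → M₀ i · lookup (Y⁺ ++ Y) (s ↑ʳ j)) K.≈ block s (s ↑ʳ j) K.* δ a (s ↑ʳ j)
        right a j = K.trans (·-cong (λ _ → K.refl) (λ i → K.reflexive (≡.trans (≡.cong (M₀ i ·_) (lookup-++ʳ Y⁺ Y j))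
            (≡.cong (λ (v : V (s ℕ.+ ρ)) → v i) (≡.sym (≡.trans (lookup-++ʳ C⁺ (map (λ y i → M₀ i · y) Y) j) (lookup-map j (λ y i → M₀ i · y) Y)))))))
          (K.trans (LF.Frame.dual F₁ a (s ↑ʳ j)) (K.sym (K.trans (K.*-congʳ (block-right s j)) (K.*-identityˡ _))))
        left : ∀ a b → G a · (λ i → M₀ i · lookup (Y⁺ ++ Y) (b ↑ˡ ρ)) K.≈ block s (b ↑ˡ ρ) K.* δ a (b ↑ˡ ρ)
        left a b = K.trans (·-0ʳ (G a) (λ i → K.trans (·-cong (res i) (λ _ → K.refl))
            (K.trans (Vectors.comb-· K (λ l → M₀ i · lookup Y l) (λ l t → LF.Pairing.β M₀ (lookup Λ l) (δ t)) (lookup (Y⁺ ++ Y) (b ↑ˡ ρ))) (·-0ʳ _ λ l → K.trans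
              (·-cong (λ t → K.reflexive (≡.cong (λ (v : V (s ℕ.+ ρ)) → v t) (≡.sym (≡.trans (lookup-++ʳ R⁺ (map (λ λ′ t → LF.Pairing.β M₀ λ′ (δ t)) Λ) l) (lookup-map l _ Λ))))) (λ _ → K.refl))
              (K.trans (LF.Frame.dual F₂ (s ↑ʳ l) (b ↑ˡ ρ)) (δ-right-left l b))))))
          (K.sym (K.trans (K.*-congʳ (block-left ρ b)) (K.zeroˡ _)))

    -- The size of a maximal dual system is the rank of `M₀`; completing it to frames of the source
    -- and of the target gives the same corank on both sides.
    normal-form : ∀ {m n P} M₀ (L : Fin m → Fin m → V n) → Represents M₀ L K.1# P → ¬ ¬ NormalForm m n P
    normal-form {m} {n} {P} M₀ L rep k = maximal-dual {Λ = []} {[]} (λ ()) λ { (_ , Λ , Y , D , r) → go (Λ ++ []) (Y ++ []) D r }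
      where
      open LF.Pairing M₀
      go : ∀ {ρ} (Λ Y : Vec (V m) ρ) → Dual Λ Y → (∀ s t → residual Λ Y s t K.≈ K.0#) → ⊥
      go Λ Y D r = LF.complete-frame {Λ = Λ} {map (λ y i → M₀ i · y) Y} (λ i j → K.trans (K.reflexive (≡.cong (lookup Λ i ·_) (lookup-map j _ Y))) (D i j)) λ
        { (_ , Λ⁺ , C⁺ , F₁) → LF.complete-frame {Λ = map (λ λ′ t → β λ′ (δ t)) Λ} {Y}
            (λ i j → K.trans (K.reflexive (≡.cong (_· lookup Y j) (lookup-map i _ Λ))) (K.trans (K.trans (Vectors.·-comm K _ _) (K.sym (β-combʳ (lookup Λ i) (lookup Y j) δ)))
              (K.trans (·-cong (λ _ → K.refl) (λ s → ·-cong (λ _ → K.refl) (λ t → K.trans (·-cong (λ _ → K.refl) (λ l → Vectors.δ-sym K l t)) (·-δ (lookup Y j) t)))) (D i j)))) λ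
        { (_ , R⁺ , Y⁺ , F₂) → k (from-frames M₀ L rep Λ⁺ C⁺ R⁺ Y⁺ Λ Y F₁ F₂ (residual-0 {Λ = Λ} {Y} r) (LF.frame-size {Λ = Λ⁺ ++ Λ} F₁) (LF.frame-size {Y = Y⁺ ++ Y} F₂)
              (ℕP.+-cancelʳ-≡ _ _ _ (≡.trans (LF.frame-size {Λ = Λ⁺ ++ Λ} F₁) (≡.sym (LF.frame-size {Y = Y⁺ ++ Y} F₂))))) } }

-- Moments of a pencil and the gradient argument

module Chain where
  open RS
  open Lin
  open LA
  open KAlg
  open Link using (module Naturality)
  open Span
  open Forms
  open Gauge
  open import Defs using (pow; natCast)
  open import Level using (_⊔_) renaming (suc to lsuc)
  open import Algebra.Bundles using (CommutativeRing)
  open import Data.Nat as ℕ using (ℕ; zero; suc; _<_; _≤_; s≤s)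
  import Data.Nat.Properties as ℕP
  open import Data.Fin using (Fin; zero; suc)
  open import Data.Vec using (Vec; []; _∷_; lookup; map; tabulate)
  open import Data.Vec.Properties using (lookup-map; lookup∘tabulate)
  open import Data.Product using (_×_; _,_; ∃; proj₁; proj₂)
  open import Relation.Nullary using (¬_)
  import Relation.Binary.PropositionalEquality as ≡

  module Series {a ℓ} (A : CommutativeRing a ℓ) where
    open CommutativeRing A using (_≈_; _*_; 0#; 1#; refl; sym; trans; +-cong; +-congˡ; +-congʳ; *-congˡ; *-congʳ; +-identityˡ; *-identityˡ; *-identityʳ; zeroˡ)
    open IntegerSolver A using (solve; _:=_; _:+_; _:*_; :1; :0)
    open Vectors A using (Σ; Σ-[]; Σ-∷)
    open PowerSeries A using (Series; _≈s_; tl; conv; X; conv-X-suc; seriesRing)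
    private module S = CommutativeRing seriesRing using (*-assoc)

    coefficient-Σ : ∀ {m} (f : Fin m → Series) k → Vectors.Σ seriesRing f k ≈ Σ (λ i → f i k)
    coefficient-Σ {zero} f k = trans (Vectors.Σ-[] seriesRing f k) (sym (Σ-[] _))
    coefficient-Σ {suc m} f k = trans (Vectors.Σ-∷ seriesRing f k) (trans (+-congˡ (coefficient-Σ (λ i → f (suc i)) k)) (sym (Σ-∷ _)))

    pow-head : ∀ p k → pow seriesRing p k 0 ≈ pow A (p 0) k
    pow-head p zero = refl
    pow-head p (suc k) = *-congˡ (pow-head p k)

    pow-derivative : ∀ p k → pow seriesRing p (suc k) 1 ≈ natCast A (suc k) * pow A (p 0) k * p 1
    pow-derivative p zero = solve 2 (λ a b → a :* :0 :+ b :* :1 := (:1 :+ :0) :* :1 :* b) refl (p 0) (p 1)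
    pow-derivative p (suc k) = trans (+-cong (*-congˡ (pow-derivative p k)) (*-congˡ (*-congˡ (pow-head p k))))
      (solve 4 (λ a b q n → a :* (n :* q :* b) :+ b :* (a :* q) := (:1 :+ n) :* (a :* q) :* b) refl (p 0) (p 1) (pow A (p 0) k) (natCast A (suc k)))

    -- `Δ` has constant term one, so `q` has the same lowest term as the product `q Δ`.
    leading : ∀ n q Δ g → Δ 0 ≈ 1# → conv q Δ ≈s conv (pow seriesRing X n) g → (∀ j → j < n → q j ≈ 0#) × q n ≈ g 0
    leading zero q Δ g d h = (λ _ ()) , trans (sym (*-identityʳ _)) (trans (*-congˡ (sym d)) (trans (h 0) (*-identityˡ _)))
    leading (suc n) q Δ g d h = below , proj₂ rest
      where
      q₀ : q 0 ≈ 0#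
      q₀ = trans (sym (*-identityʳ _)) (trans (*-congˡ (sym d)) (trans (h 0) (trans (*-congʳ (zeroˡ _)) (zeroˡ _))))
      shift : conv (tl q) Δ ≈s conv (pow seriesRing X n) g
      shift k = trans (sym (trans (+-congʳ (trans (*-congʳ q₀) (zeroˡ _))) (+-identityˡ _)))
        (trans (h (suc k)) (trans (S.*-assoc X (pow seriesRing X n) g (suc k)) (conv-X-suc (conv (pow seriesRing X n) g) k)))
      rest = leading n (tl q) Δ g d shift
      below : ∀ j → j < suc n → q j ≈ 0#
      below zero _ = q₀
      below (suc j) (s≤s lt) = proj₁ rest j lt

  module Arithmetic {a ℓ} (A : CommutativeRing a ℓ) where
    open CommutativeRing A using (_≈_; _+_; _*_; -_; _-_; 0#; refl; trans; +-cong; +-congˡ; +-congʳ; -‿cong; +-identityˡ; +-identityʳ)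
    open IntegerSolver A using (solve; _:=_; _:+_; _:*_; _:-_; :-_; :0)
    open Vectors A using (V; _·_; Σ-cong; Σ-neg; Σ-+; ·-+ʳ; ·-•ʳ)
    eliminated-row : ∀ {ρ} X e₀ v (w e n : V ρ) → e₀ ≈ 0# →
      (e₀ + X * v) + w · (λ b → e b + X * n b) ≈ w · e + X * (v + w · n)
    eliminated-row X e₀ v w e n z = trans (+-cong (trans (+-congʳ z) (+-identityˡ _)) (trans (·-+ʳ w _ _) (+-congˡ (·-•ʳ X w n))))
      (solve 4 (λ X v a b → X :* v :+ (a :+ X :* b) := a :+ X :* (v :+ b)) refl _ _ _ _)

    ·-minusˡ : ∀ {m} (a b c : V m) → (λ i → a i - b i) · c ≈ a · c - b · c
    ·-minusˡ a b c = trans (Σ-cong (λ i → solve 3 (λ a b c → (a :- b) :* c := a :* c :+ (:- (b :* c))) refl _ _ _)) (trans (Σ-+ _ _) (+-congˡ (Σ-neg _)))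

    minus-zero : ∀ {x y} → y ≈ 0# → x - y ≈ x
    minus-zero h = trans (+-congˡ (trans (-‿cong h) (solve 0 (:- :0 := :0) refl))) (+-identityʳ _)

  module Pencils {c κ} (K : CommutativeRing c κ) (F : StableField K) where
    private module K = CommutativeRing K using (Carrier; _≈_; _*_; -_; _-_; 0#; 1#; refl; sym; trans; +-cong; +-congˡ; *-cong; *-congˡ; *-congʳ; -‿cong; +-identityˡ; +-identityʳ; *-identityˡ; zeroˡ; zeroʳ; -‿inverseʳ)
    open Algebras K
    open StableField F
    open Naturality K
    open HomogeneousForms K
    open NormalForms K F
    open Vectors K using (V)

    lin : ∀ {n} → V n → Law n
    lin s A x = Vectors._·_ (Alg.comRing A) (λ k → Alg.ι A (s k)) x

    form-lin : ∀ {n} (s : V n) → Form 1 (lin s)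
    form-lin s = form-resp (λ A x → Vectors.·-comm (Alg.comRing A) x _) (form-linear s)

    lin-hom : ∀ {n} (s : V n) {A A′ : Alg κ} (φ : Hom A A′) x → Alg._≈_ A′ (Hom.⟦_⟧ φ (lin s A x)) (lin s A′ (λ k → Hom.⟦_⟧ φ (x k)))
    lin-hom s {A} {A′} φ x = Alg.trans A′ (hom-· φ _ x) (Vectors.·-cong (Alg.comRing A′) (λ k → Hom.⟦⟧-ι φ (s k)) (λ _ → Alg.refl A′))

    module _ {n ρ} (u : Fin ρ → V n) (N : Fin ρ → Fin ρ → V n) (A : Alg κ) (x : Fin n → Alg.Carrier A) where
      open Alg A using (comRing; Carrier)
      open Vectors comRing using (_·_)
      -- The row vector `u N^k` at the point `x`. `chain` lists the newest row first, so that
      -- extending the chain is a `∷`.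
      row : ℕ → Fin ρ → Carrier
      row zero b = lin (u b) A x
      row (suc k) b = row k · (λ a → lin (N a b) A x)

      chain : ∀ k → Vec (Fin ρ → Carrier) k
      chain zero = []
      chain (suc k) = row k ∷ chain k

    row-hom : ∀ {n ρ} (u : Fin ρ → V n) N {A A′ : Alg κ} (φ : Hom A A′) x k b →
      Alg._≈_ A′ (Hom.⟦_⟧ φ (row u N A x k b)) (row u N A′ (λ i → Hom.⟦_⟧ φ (x i)) k b)
    row-hom u N φ x zero b = lin-hom (u b) φ x
    row-hom u N {A} {A′} φ x (suc k) b = Alg.trans A′ (hom-· φ _ _) (Vectors.·-cong (Alg.comRing A′) (row-hom u N φ x k) (λ a → lin-hom (N a b) φ x))

    form-row : ∀ {n ρ} (u : Fin ρ → V n) N k b → Form (suc k) (λ A x → row u N A x k b)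
    form-row u N zero b = form-lin (u b)
    form-row u N (suc k) b = form-≡ (ℕP.+-comm (suc k) 1) (form-Σ (λ a → form-* (form-row u N k a) (form-lin (N a b))))

    transpose : ∀ {n ρ} → (Fin ρ → Fin ρ → V n) → Fin ρ → Fin ρ → V n
    transpose N a b = N b a

    module _ {n ρ} (u : Fin ρ → V n) (N : Fin ρ → Fin ρ → V n) (v : Fin ρ → V n) where
      moment : ℕ → Law n
      moment k A x = Vectors._·_ (Alg.comRing A) (row u N A x k) (λ a → lin (v a) A x)

      -- The factors `N` are moved across the dot product one at a time, from the column to the row.
      row-column : ∀ A x k l → Alg._≈_ A (Vectors._·_ (Alg.comRing A) (row u N A x k) (row v (transpose N) A x l)) (moment (l ℕ.+ k) A x)
      row-column A x k zero = Alg.refl A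
      row-column A x k (suc l) = begin
        row u N A x k · (λ b → row v (transpose N) A x l · (λ a → lin (N b a) A x)) ≈⟨ ·-cong (λ _ → refl) (λ b → ·-comm _ _) ⟩
        row u N A x k · (λ b → (λ a → lin (N b a) A x) · row v (transpose N) A x l) ≈⟨ sym (comb-· (row u N A x k) (λ b a → lin (N b a) A x) _) ⟩
        row u N A x (suc k) · row v (transpose N) A x l ≈⟨ row-column A x (suc k) l ⟩
        moment (l ℕ.+ suc k) A x ≡⟨ ≡.cong (λ j → moment j A x) (ℕP.+-suc l k) ⟩
        moment (suc l ℕ.+ k) A x ∎
        where
        open Alg A using (comRing; refl; sym; setoid)
        open Vectors comRing using (_·_; ·-cong; ·-comm; comb-·)
        open import Relation.Binary.Reasoning.Setoid setoid using (begin_; _∎; step-≈-⟩; step-≡-⟩)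

    powerSumLaw : ∀ n → Law n
    powerSumLaw n A x = Vectors.Σ (Alg.comRing A) (λ i → pow (Alg.comRing A) (x i) n)

    -- The blocks of a matrix [[l, u], [v, I + N]] of linear forms whose determinant is a nonzero multiple of the power sum.
    record Pencil (n ρ : ℕ) : Set (lsuc c ⊔ lsuc κ) where
      field
        u v : Fin ρ → V (suc (suc n))
        N : Fin ρ → Fin ρ → V (suc (suc n))
        σ a : K.Carrier
        a≉0 : ¬ (a K.≈ K.0#)
        vanishing : ∀ k → k < n → ∀ A x → Alg._≈_ A (moment u N v k A x) (Alg.0# A)
        top : ∀ A x → Alg._≈_ A (Alg._*_ A (Alg.ι A a) (powerSumLaw (suc (suc n)) A x)) (Alg._*_ A (Alg.ι A σ) (moment u N v n A x))

    module FromNormalForm {n ρ} (T : Fin (1 ℕ.+ ρ) → Fin (1 ℕ.+ ρ) → V (suc (suc n))) a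
        (rep : Represents (λ i j → Blocks.block K 1 j K.* Vectors.δ K i j) T a (powerSumLaw (suc (suc n)))) where
      private
        u v : Fin ρ → V (suc (suc n))
        u b = T zero (suc b)
        v b = T (suc b) zero
        N : Fin ρ → Fin ρ → V (suc (suc n))
        N a b = T (suc a) (suc b)
        sign : ℕ → K.Carrier
        -- The expansion of `- s (I + s N)^-1 v` begins with a minus sign.
        sign zero = K.- K.1#
        sign (suc k) = K.- sign k

        sign² : ∀ k → sign k K.* sign k K.≈ K.1#
        sign² zero = solve 0 ((:- :1) :* (:- :1) := :1) K.refl
          where open IntegerSolver K
        sign² (suc k) = K.trans (solve 1 (λ s → (:- s) :* (:- s) := s :* s) K.refl _) (sign² k)
          where open IntegerSolver K

      module _ (A : Alg κ) (x : Fin (suc (suc n)) → Alg.Carrier A) where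
        open Alg A using (comRing; ι; ι-cong; ι-*; ι-1; Carrier; _≈_; _+_; _*_; -_; _-_; 0#; 1#; refl; sym; trans; reflexive; +-cong; +-congˡ; +-congʳ; *-congˡ; *-congʳ; -‿cong; +-comm; +-identityˡ; +-identityʳ; *-assoc; *-comm; *-identityˡ; zeroʳ)
        open IntegerSolver comRing using (solve; _:=_; _:+_; _:*_; _:-_; :-_; :1; :0)
        open Vectors comRing hiding (V)
        open PowerSeries comRing using (X; cst; conv; conv-X-zero; conv-X-suc; conv-cst)
        open Series comRing using (coefficient-Σ; leading)
        private
          module S = Alg (PS A) using (comRing; ι; ι-cong; Carrier; _≈_; _+_; _*_; 0#; refl; sym; trans; reflexive; +-cong; +-congˡ; +-congʳ; *-congˡ; *-congʳ; *-assoc; *-comm; *-identityʳ; zeroʳ)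
          module VS = Vectors S.comRing using (_·_; δ; Σ-cong; Σ-*ˡ; ·-cong; ·-δ; ·-•ʳ; ·-0ʳ; comb)
          module DS = Alternating S.comRing using (head-cong; head-•; add-tail; det; det-alt)
          col : ℕ → Fin ρ → Carrier
          col = row v (transpose N) A x
          y : Fin (suc (suc n)) → S.Carrier
          y k = X S.* cst (x k)
          -- w = - s (I + s N)^-1 v, so that adding the combination w of the last columns clears the first one.
          w : Fin ρ → S.Carrier
          w b zero = 0#
          w b (suc k) = ι (sign k) * col k b

          -- The coefficient of degree `k + 1` in `s v + s N w + w = 0`, the equation that
          -- characterises `w`.
          w-step : ∀ a k → (cst (lin (v a) A x) k + (λ b → w b k) · (λ b → lin (N a b) A x)) + w a (suc k) ≈ 0#
          w-step a zero = trans (+-cong (+-congˡ (·-0ˡ _ (λ _ → refl))) (*-congʳ (trans (Hom.⟦⟧-neg (ιHom A) K.1#) (-‿cong ι-1))))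
            (solve 1 (λ v → (v :+ :0) :+ (:- :1) :* v := :0) refl _)
          w-step a (suc k) = trans (+-cong (trans (+-identityˡ _) (·-•ˡ _ (col k) _)) (*-congʳ (Hom.⟦⟧-neg (ιHom A) (sign k))))
            (solve 2 (λ s v → s :* v :+ (:- s) :* v := :0) refl _ _)

          scaled : ∀ s → lin s (PS A) y S.≈ X S.* cst (lin s A x)
          scaled s = S.trans (VS.·-•ʳ X (λ k → S.ι (s k)) (λ k → cst (x k))) (S.*-congˡ (S.sym (hom-· (cstHom A) (λ k → ι (s k)) x)))

          entry : Fin (1 ℕ.+ ρ) → Fin (1 ℕ.+ ρ) → S.Carrier
          entry i j = S.ι (Blocks.block K 1 j K.* Vectors.δ K i j) S.+ lin (T i j) (PS A) y

          eliminated : Fin (1 ℕ.+ ρ) → S.Carrier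
          eliminated i = entry i zero S.+ w VS.· (λ b → entry i (suc b))

          ι-0* : ∀ k → S.ι (K.0# K.* k) S.≈ S.0#
          ι-0* k = S.trans (S.ι-cong (K.zeroˡ k)) (Hom.⟦⟧-0 (ιHom (PS A)))

          eliminated-form : ∀ i → eliminated i S.≈ w VS.· (λ b → S.ι (K.1# K.* Vectors.δ K i (suc b))) S.+
            X S.* (cst (lin (T i zero) A x) S.+ w VS.· (λ b → cst (lin (T i (suc b)) A x)))
          eliminated-form i = S.trans (S.+-cong (S.+-congˡ (scaled (T i zero))) (VS.·-cong (λ _ → S.refl) (λ b → S.+-congˡ (scaled (T i (suc b))))))
            (Arithmetic.eliminated-row S.comRing X (S.ι (K.0# K.* Vectors.δ K i zero)) (cst (lin (T i zero) A x)) w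
              (λ b → S.ι (K.1# K.* Vectors.δ K i (suc b))) (λ b → cst (lin (T i (suc b)) A x)) (ι-0* _))

          coefficient : ∀ (f : Fin ρ → Carrier) k → (w VS.· (λ b → cst (f b))) k ≈ (λ b → w b k) · f
          coefficient f k = trans (coefficient-Σ (λ b → w b S.* cst (f b)) k) (Σ-cong (λ b → trans (S.*-comm (w b) (cst (f b)) k) (trans (conv-cst (f b) (w b) k) (*-comm _ _))))

          ι-δ : ∀ {m} (i j : Fin m) → S.ι (K.1# K.* Vectors.δ K i j) S.≈ VS.δ i j
          ι-δ i j = S.trans (S.ι-cong (K.*-identityˡ _)) (hom-δ (ιHom (PS A)) i j)

          cleared : ∀ a → eliminated (suc a) S.≈ S.0#
          cleared a = S.trans (eliminated-form (suc a)) (S.trans (S.+-congʳ (S.trans (VS.·-cong (λ _ → S.refl) (ι-δ a)) (VS.·-δ w a))) λ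
            { zero → trans (+-congˡ (conv-X-zero (cst (lin (T (suc a) zero) A x) S.+ w VS.· (λ b → cst (lin (T (suc a) (suc b)) A x))))) (+-identityˡ _)
            ; (suc k) → trans (+-comm _ _) (trans (+-congʳ (trans (conv-X-suc _ k) (+-congˡ (coefficient (λ b → lin (N a b) A x) k)))) (w-step a k)) })

          q : S.Carrier
          q = eliminated zero

          -- The corner entry reaches only degree one, so from degree two on the pivot is
          -- `s (u · w)`, and `w` contributes its coefficient of degree `k + 1`.
          q-coefficient : ∀ k → q (suc (suc k)) ≈ ι (sign k) * moment u N v k A x
          q-coefficient k = trans (eliminated-form zero (suc (suc k))) (trans (+-cong (trans (coefficient-0 (suc (suc k))) refl) (trans (conv-X-suc _ (suc k)) (+-cong refl (coefficient (λ b → lin (u b) A x) (suc k)))))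
            (trans (+-identityˡ _) (trans (+-identityˡ _) (trans (·-•ˡ _ (col k) _) (*-congˡ (trans (·-comm _ _) (trans (row-column u N v A x 0 k) (reflexive (≡.cong (λ j → moment u N v j A x) (ℕP.+-identityʳ k))))))))))
            where
            coefficient-0 : ∀ k → (w VS.· (λ b → S.ι (K.1# K.* Vectors.δ K {suc ρ} zero (suc b)))) k ≈ 0#
            coefficient-0 = VS.·-0ʳ w (λ b → S.trans (ι-δ zero (suc b)) S.refl)

          cs : Vec (Fin (suc ρ) → S.Carrier) ρ
          cs = tabulate (λ b i → entry i (suc b))

          Δ : S.Carrier
          Δ = DS.det (VS.δ zero ∷ cs)

          Δ-head : Δ 0 ≈ 1#
          Δ-head = trans (hom-det (headHom A) (VS.δ zero ∷ cs)) (trans (Alternating.alt-cong comRing (Alternating.det-alt comRing) same) (Alternating.det-I comRing (suc ρ)))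
            where
            same : ∀ b i → lookup (map (λ v i → v i 0) (VS.δ zero ∷ cs)) b i ≈ lookup (Alternating.I comRing (suc ρ)) b i
            same zero i = trans (hom-δ (headHom A) zero i) (sym (Blocks.lookup-I comRing zero i))
            same (suc b) i = trans (reflexive (≡.cong (λ (v : Fin (suc ρ) → Carrier) → v i) (≡.trans (lookup-map b (λ v i → v i 0) cs) (≡.cong (λ v i → v i 0) (lookup∘tabulate (λ b i → entry i (suc b)) b)))))
              (trans (+-cong (trans (ι-δ i (suc b) 0) (hom-δ (headHom A) i (suc b))) (trans (scaled (T i (suc b)) 0) (conv-X-zero (cst (lin (T i (suc b)) A x)))))
                (trans (+-identityʳ _) (trans (δ-sym i (suc b)) (sym (Blocks.lookup-I comRing (suc b) i)))))

          -- Adding the combination `w` of the other columns turns the first column into `q` times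
          -- `δ zero`. On the other side, homogeneity of the power sum at `s x` brings out
          -- `s^(n+2)`.
          determinant : q S.* Δ S.≈ pow S.comRing X (suc (suc n)) S.* (cst (ι a * powerSumLaw (suc (suc n)) A x))
          determinant = S.trans (S.sym (DS.head-• DS.det-alt q (VS.δ zero) cs)) (S.trans (DS.head-cong DS.det-alt cs reduce)
            (S.trans (DS.add-tail DS.det-alt (λ i → entry i zero) w cs) (S.trans (rep (PS A) y) power)))
            where
            reduce : ∀ i → q S.* VS.δ zero i S.≈ entry i zero S.+ VS.comb w (lookup cs) i
            reduce i = S.trans (pivot i) (S.+-congˡ (VS.·-cong (λ _ → S.refl) (λ b → S.reflexive (≡.cong (λ (v : Fin (suc ρ) → S.Carrier) → v i) (≡.sym (lookup∘tabulate (λ b i → entry i (suc b)) b))))))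
              where
              pivot : ∀ i → q S.* VS.δ zero i S.≈ eliminated i
              pivot zero = S.*-identityʳ q
              pivot (suc a) = S.trans (S.zeroʳ q) (S.sym (cleared a))
            power : S.ι a S.* powerSumLaw (suc (suc n)) (PS A) y S.≈ pow S.comRing X (suc (suc n)) S.* (cst (ι a * powerSumLaw (suc (suc n)) A x))
            power = S.trans (S.*-congˡ (S.trans (VS.Σ-cong (λ i → S.trans (Powers.pow-distrib S.comRing X (cst (x i)) (suc (suc n))) (S.*-congˡ (S.sym (hom-pow (cstHom A) (x i) (suc (suc n)))))))
                (S.trans (S.sym (VS.Σ-*ˡ (pow S.comRing X (suc (suc n))) (λ i → cst (pow comRing (x i) (suc (suc n)))))) (S.*-congˡ (S.sym (hom-Σ (cstHom A) (λ i → pow comRing (x i) (suc (suc n)))))))))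
              (S.trans (S.sym (S.*-assoc _ _ _)) (S.trans (S.*-congʳ (S.*-comm _ _)) (S.trans (S.*-assoc _ _ _) (S.*-congˡ (S.sym (Hom.⟦⟧-* (cstHom A) (ι a) (powerSumLaw (suc (suc n)) A x)))))))

          solution = leading (suc (suc n)) q Δ (cst (ι a * powerSumLaw (suc (suc n)) A x)) Δ-head determinant

        low-moment : ∀ k → k < n → moment u N v k A x ≈ 0#
        low-moment k k<n = trans (sym (*-identityˡ _)) (trans (*-congʳ (trans (sym ι-1) (trans (ι-cong (K.sym (sign² k))) (ι-* _ _))))
          (trans (*-assoc _ _ _) (trans (*-congˡ (trans (sym (q-coefficient k)) (proj₁ solution (suc (suc k)) (s≤s (s≤s k<n))))) (zeroʳ _))))

        top-moment : ι a * powerSumLaw (suc (suc n)) A x ≈ ι (sign n) * moment u N v n A x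
        top-moment = trans (sym (proj₂ solution)) (q-coefficient n)

      pencil : ¬ (a K.≈ K.0#) → Pencil n ρ
      pencil a≉0 = record { u = u ; v = v ; N = N ; σ = sign n ; a = a ; a≉0 = a≉0 ; vanishing = λ k lt A x → low-moment A x k lt ; top = top-moment }

    module Independence (char0 : ∀ k → ¬ (natCast K (suc k) K.≈ K.0#)) {n ρ} (Π : Pencil n ρ) where
      open Pencil Π

      -- Since `chain` runs downwards, its entry `i` is the row with number `position α i`.
      position : ∀ α → Fin α → ℕ
      position (suc α) zero = α
      position (suc α) (suc i) = position α i

      position-< : ∀ α i → position α i < α
      position-< (suc α) zero = ℕP.≤-refl
      position-< (suc α) (suc i) = ℕP.m≤n⇒m≤1+n (position-< α i)

      lookup-chain : ∀ {n ρ} (u : Fin ρ → V n) N A x α i → lookup (chain u N A x α) i ≡.≡ row u N A x (position α i)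
      lookup-chain u N A x (suc α) zero = ≡.refl
      lookup-chain u N A x (suc α) (suc i) = lookup-chain u N A x α i

      Dependent : ∀ {n ρ} (u : Fin ρ → V n) (N : Fin ρ → Fin ρ → V n) (x : V n) → ℕ → Set (c ⊔ κ)
      Dependent u N x α = ∃ λ z → ∀ b → row u N base x α b K.≈ Vectors.comb K z (λ i → row u N base x (position α i)) b

      module _ (x : V (suc (suc n))) (α γ : ℕ) (le : α ℕ.+ γ ≤ n) where
        private
          j : ℕ
          -- The slack is filled with extra factors `N` on the column side, so that the product of
          -- the two combinations contains exactly the top moment.
          j = n ℕ.∸ (α ℕ.+ γ)
          degree : (j ℕ.+ γ) ℕ.+ α ≡.≡ n
          degree = ≡.trans (ℕP.+-assoc j γ α) (≡.trans (≡.cong (j ℕ.+_) (ℕP.+-comm γ α)) (ℕP.m∸n+n≡m le))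
          S = PS base
          module S = Alg S using (comRing; Carrier; _≈_; _+_; _*_; -_; _-_; 0#; trans; reflexive; +-cong; -‿cong)
          module VS = Vectors S.comRing using (_·_; ·-comm; ·-0ʳ; comb; comb-·; ·-comb)
          open PowerSeries K using (X; cst; conv-X-suc; conv-X-zero)
          open Arithmetic S.comRing using (·-minusˡ; minus-zero)

        shift : ∀ (y : V γ) → (∀ b → row v (transpose N) base x γ b K.≈ Vectors.comb K y (λ i → row v (transpose N) base x (position γ i)) b) →
          ∀ j b → row v (transpose N) base x (j ℕ.+ γ) b K.≈ Vectors.comb K y (λ i → row v (transpose N) base x (j ℕ.+ position γ i)) b
        shift y h zero b = h b
        shift y h (suc j) b = K.trans (Vectors.·-cong K (shift y h j) (λ _ → K.refl)) (Vectors.comb-· K y (λ i → row v (transpose N) base x (j ℕ.+ position γ i)) _)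

        -- Along the line x + s d both combinations vanish at s = 0, so their product, which is the top moment, has no linear term.
        module Line (d : V (suc (suc n))) (z : V α) (y : V γ)
            (hz : ∀ b → row u N base x α b K.≈ Vectors.comb K z (λ i → row u N base x (position α i)) b)
            (hy : ∀ b → row v (transpose N) base x γ b K.≈ Vectors.comb K y (λ i → row v (transpose N) base x (position γ i)) b) where
          p : Fin (suc (suc n)) → S.Carrier
          p i = cst (x i) S.+ X S.* cst (d i)
          r cl : ℕ → Fin ρ → S.Carrier
          r = row u N S p
          cl = row v (transpose N) S p
          z′ : Fin α → S.Carrier
          z′ i = cst (z i)
          y′ : Fin γ → S.Carrier
          y′ i = cst (y i)
          r̂ ĉ : Fin ρ → S.Carrier
          r̂ b = r α b S.- VS.comb z′ (λ i → r (position α i)) b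
          ĉ b = cl (j ℕ.+ γ) b S.- VS.comb y′ (λ i → cl (j ℕ.+ position γ i)) b

          p-head : ∀ i → p i 0 K.≈ x i
          p-head i = K.trans (K.+-congˡ (conv-X-zero (cst (d i)))) (K.+-identityʳ _)

          row-cong : ∀ {n ρ} (u : Fin ρ → V n) N {x y : V n} → (∀ i → x i K.≈ y i) → ∀ k b → row u N base x k b K.≈ row u N base y k b
          row-cong u N h k b = law-cong (form-row u N k b) base h

          head : ∀ {ρ} (u : Fin ρ → V (suc (suc n))) N k b → row u N S p k b 0 K.≈ row u N base x k b
          head u N k b = K.trans (row-hom u N (headHom base) p k b) (row-cong u N p-head k b)

          difference-head : ∀ {q} (f : Fin q → Fin ρ → S.Carrier) (g : Fin q → V ρ) (w : V q) (a : S.Carrier) b → (∀ i → f i b 0 K.≈ g i b) → a 0 K.≈ Vectors.comb K w g b →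
            (a S.- VS.comb (λ i → cst (w i)) f b) 0 K.≈ K.0#
          difference-head f g w a b hf ha = K.trans (K.+-cong ha (K.-‿cong (K.trans (hom-Σ (headHom base) (λ i → cst (w i) S.* f i b)) (Vectors.Σ-cong K (λ i → K.*-congˡ (hf i)))))) (K.-‿inverseʳ _)

          r̂-head : ∀ b → r̂ b 0 K.≈ K.0#
          r̂-head b = difference-head (λ i → r (position α i)) (λ i → row u N base x (position α i)) z (r α b) b (λ i → head u N (position α i) b) (K.trans (head u N α b) (hz b))

          ĉ-head : ∀ b → ĉ b 0 K.≈ K.0#
          ĉ-head b = difference-head (λ i → cl (j ℕ.+ position γ i)) (λ i → row v (transpose N) base x (j ℕ.+ position γ i)) y (cl (j ℕ.+ γ) b) b
            (λ i → head v (transpose N) (j ℕ.+ position γ i) b) (K.trans (head v (transpose N) (j ℕ.+ γ) b) (shift y hy j b))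

          -- Subtracting earlier rows and columns changes the product only by moments of index below
          -- `n`, which vanish identically.
          product : r̂ VS.· ĉ S.≈ moment u N v n S p
          product = S.trans (·-minusˡ (r α) (VS.comb z′ (λ i → r (position α i))) ĉ)
            (S.trans (minus-zero (S.trans (VS.comb-· z′ (λ i → r (position α i)) ĉ) (VS.·-0ʳ z′ (λ i → S.trans (against (position α i))
              (S.trans (minus-zero (lower (position α i) (ℕP.<⇒≤ (position-< α i)))) (vanish (j ℕ.+ γ) (position α i) (ℕP.<-≤-trans (ℕP.+-monoʳ-< (j ℕ.+ γ) (position-< α i)) (ℕP.≤-reflexive degree))))))))
            (S.trans (against α) (S.trans (minus-zero (lower α ℕP.≤-refl))
              (S.trans (row-column u N v S p α (j ℕ.+ γ)) (S.reflexive (≡.cong (λ k → moment u N v k S p) degree))))))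
            where
            vanish : ∀ l k → l ℕ.+ k < n → r k VS.· cl l S.≈ S.0#
            vanish l k lt = S.trans (row-column u N v S p k l) (vanishing (l ℕ.+ k) lt S p)
            against : ∀ k → r k VS.· ĉ S.≈ r k VS.· cl (j ℕ.+ γ) S.- r k VS.· VS.comb y′ (λ i → cl (j ℕ.+ position γ i))
            against k = S.trans (VS.·-comm (r k) ĉ) (S.trans (·-minusˡ (cl (j ℕ.+ γ)) (VS.comb y′ (λ i → cl (j ℕ.+ position γ i))) (r k))
              (S.+-cong (VS.·-comm _ (r k)) (S.-‿cong (VS.·-comm _ (r k)))))
            lower : ∀ k → k ≤ α → r k VS.· VS.comb y′ (λ i → cl (j ℕ.+ position γ i)) S.≈ S.0#
            lower k le = S.trans (VS.·-comb (r k) y′ (λ i → cl (j ℕ.+ position γ i))) (VS.·-0ʳ y′ (λ i → vanish (j ℕ.+ position γ i) k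
              (ℕP.<-≤-trans (ℕP.+-mono-<-≤ (ℕP.+-monoʳ-< j (position-< γ i)) le) (ℕP.≤-reflexive degree))))

          no-linear-term : moment u N v n S p 1 K.≈ K.0#
          no-linear-term = K.trans (K.sym (product 1)) (K.trans (Series.coefficient-Σ K (λ b → r̂ b S.* ĉ b) 1)
            (Vectors.Σ-0 K (λ b → K.trans (K.+-cong (K.trans (K.*-congʳ (r̂-head b)) (K.zeroˡ _)) (K.trans (K.*-congˡ (ĉ-head b)) (K.zeroʳ _))) (K.+-identityˡ _))))

          gradient : Vectors._·_ K (λ i → natCast K (suc (suc n)) K.* pow K (x i) (suc n)) d K.≈ K.0#
          gradient = ¬¬-elim λ h → LinearAlgebra.nonzero-* K F a≉0 h (K.trans (K.*-congˡ (K.sym derivative)) (K.trans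
              (K.sym (PowerSeries.conv-cst K a (powerSumLaw (suc (suc n)) S p) 1)) (K.trans (top S p 1) (K.trans (PowerSeries.conv-cst K σ (moment u N v n S p) 1)
                (K.trans (K.*-congˡ no-linear-term) (K.zeroʳ _))))))
            where
            derivative : powerSumLaw (suc (suc n)) S p 1 K.≈ Vectors._·_ K (λ i → natCast K (suc (suc n)) K.* pow K (x i) (suc n)) d
            derivative = K.trans (Series.coefficient-Σ K (λ i → pow S.comRing (p i) (suc (suc n))) 1) (Vectors.Σ-cong K (λ i → K.trans (Series.pow-derivative K (p i) (suc n))
              (K.*-cong (K.*-congˡ (Powers.pow-cong K (suc n) (p-head i))) (K.trans (K.+-congˡ (conv-X-suc (cst (d i)) 0)) (K.+-identityˡ _)))))

        -- With `d` along each coordinate axis the gradient condition reads `(n+2) x_i^(n+1) = 0`,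
        -- and the characteristic is zero.
        dependency-bound : Dependent u N x α → Dependent v (transpose N) x γ → ∀ i → x i K.≈ K.0#
        dependency-bound (z , hz) (y , hy) i = ¬¬-elim λ h → LinearAlgebra.nonzero-* K F (char0 (suc n)) (power (suc n) h)
          (K.trans (K.sym (Vectors.·-δ K _ i)) (Line.gradient (Vectors.δ K i) z y hz hy))
          where
          power : ∀ k → ¬ (x i K.≈ K.0#) → ¬ (pow K (x i) k K.≈ K.0#)
          power zero h = 1≉0
          power (suc k) h = LinearAlgebra.nonzero-* K F h (power k h)

-- Few local equations for the vanishing of maximal minors

module Local where
  open RS
  open Lin
  open LA
  open KAlg
  open Link using (module Naturality)
  open Span
  open Order
  open Forms
  open Deform
  open import Defs using (pow)
  open import Level using (Level; _⊔_)
  open import Algebra.Bundles using (CommutativeRing)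
  open import Data.Nat as ℕ using (ℕ; zero; suc; _<_; s≤s; z≤n)
  open import Data.Fin using (Fin; zero; suc)
  open import Data.Vec using (Vec; []; _∷_; lookup; map; _++_)
  open import Data.Vec.Properties using (lookup-map)
  open import Data.List as List using (List; length)
  open import Data.List.Properties using (length-tabulate)
  open import Data.List.Relation.Unary.All using (All; []; _∷_)
  import Data.List.Relation.Unary.All.Properties as AllP
  open import Data.Product using (_×_; _,_; ∃; ∃₂; proj₁; proj₂)
  open import Data.Unit using (⊤; tt)
  import Relation.Binary.PropositionalEquality as ≡

  join : ∀ {x} {X : Set x} {m n} → (Fin m → X) → (Fin n → X) → Fin (m ℕ.+ n) → X
  join {m = zero} f g b = g b
  join {m = suc m} f g zero = f zero
  join {m = suc m} f g (suc b) = join (λ i → f (suc i)) g b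

  join-∀ : ∀ {x p} {X : Set x} (P : X → Set p) {m n} (f : Fin m → X) (g : Fin n → X) → (∀ i → P (f i)) → (∀ j → P (g j)) → ∀ b → P (join f g b)
  join-∀ P {zero} f g hf hg b = hg b
  join-∀ P {suc m} f g hf hg zero = hf zero
  join-∀ P {suc m} f g hf hg (suc b) = join-∀ P (λ i → f (suc i)) g (λ i → hf (suc i)) hg b

  join-lookup : ∀ {x y} {X : Set x} {Y : Set y} (h : X → Y) {m n} (f : Fin m → X) (g : Fin n → X) (xs : Vec Y m) (ys : Vec Y n) →
    (∀ i → h (f i) ≡.≡ lookup xs i) → (∀ j → h (g j) ≡.≡ lookup ys j) → ∀ b → h (join f g b) ≡.≡ lookup (xs ++ ys) b
  join-lookup h f g [] ys hf hg b = hg b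
  join-lookup h f g (x ∷ xs) ys hf hg zero = hf zero
  join-lookup h f g (x ∷ xs) ys hf hg (suc b) = join-lookup h (λ i → f (suc i)) g xs ys (λ i → hf (suc i)) hg b

  module Inversion {a ℓ ℓ′} (A : CommutativeRing a ℓ) (J : ℕ → Ideal A ℓ′)
      (J-0 : ∀ x → Ideal.Mem (J 0) x)
      (J-* : ∀ k {x y} → Ideal.Mem (J 1) x → Ideal.Mem (J k) y → Ideal.Mem (J (suc k)) (CommutativeRing._*_ A x y)) where
    open CommutativeRing A using (_≈_; _+_; _*_; -_; _-_; 0#; refl; sym; trans; setoid; +-cong; +-congʳ; *-congˡ; -‿cong; +-identityˡ; *-comm; zeroˡ; zeroʳ)
    open IntegerSolver A using (solve; _:=_; _:+_; _:*_; _:-_; :-_)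
    open Vectors A using (V; Σ; _+v_; _•_; _·_; δ; δ-sym; Σ-cong; Σ-neg; Σ-+; Σ-*ˡ; ·-cong; ·-comm; δ-·; ·-δ; ·-+ʳ; ·-•ʳ; ·-0ʳ; comb; comb-·; ·-comb)
    open QuasiInverse A J J-0 J-* public
    open import Relation.Binary.Reasoning.Setoid setoid using (begin_; _∎; step-≈-⟩)

    δ-swap : ∀ {m} (i j : Fin m) (e : V m) → e j * δ i j ≈ δ i j * e i
    δ-swap zero zero e = *-comm _ _
    δ-swap zero (suc j) e = trans (zeroʳ _) (sym (zeroˡ _))
    δ-swap (suc i) zero e = trans (zeroʳ _) (sym (zeroˡ _))
    δ-swap (suc i) (suc j) e = δ-swap i j (λ i → e (suc i))

    J-· : ∀ k {m} (u : V m) {v : V m} → (∀ i → J.Mem k (v i)) → J.Mem k (u · v)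
    J-· k u h = J-Σ k (λ i → J.mulM k (u i) (h i))

    J-minus : ∀ k {x y} → J.Mem k x → J.Mem k y → J.Mem k (x - y)
    J-minus k h g = J.addM k h (J-neg k g)

    regroup : ∀ x y → x ≈ y + (x - y)
    regroup = solve 2 (λ x y → x := y :+ (x :- y)) refl

    module _ {p ρ} (g y 𝓑 : Fin p → V ρ) (dual : ∀ a b → g a · y b ≈ δ a b) (complete : ∀ s t → (λ l → y l s) · (λ l → g l t) ≈ δ s t)
        (e e′ : V p) T (near : ∀ b s → J.Mem 1 (𝓑 b s - e b * y b s)) (ee′ : ∀ b → e b * e′ b ≈ T) where
      private
        X : Fin p → V p
        X a b = g a · (λ s → 𝓑 b s - e b * y b s)
        M : Fin p → V p
        M a b = g a · 𝓑 b
        M≈ : ∀ a b → M a b ≈ δ a b * e a + X a b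
        M≈ a b = begin
          g a · 𝓑 b ≈⟨ ·-cong (λ _ → refl) (λ s → regroup (𝓑 b s) (e b * y b s)) ⟩
          g a · (e b • y b +v (λ s → 𝓑 b s - e b * y b s)) ≈⟨ ·-+ʳ (g a) (e b • y b) _ ⟩
          g a · (e b • y b) + X a b ≈⟨ +-congʳ (trans (·-•ʳ (e b) (g a) (y b)) (trans (*-congˡ (dual a b)) (δ-swap a b e))) ⟩
          δ a b * e a + X a b ∎

        rebuild : ∀ s (v : V ρ) → (λ a → y a s) · (λ a → g a · v) ≈ v s
        rebuild s v = trans (sym (comb-· (λ a → y a s) g v)) (trans (·-cong (complete s) (λ _ → refl)) (δ-· s v))

      -- The vectors `𝓑 b` are multiples `e b` of a basis up to order one, so quasi-inversion
      -- expresses `T^k ω` through the products `ω · 𝓑 b` with an error of order `k`. Where all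
      -- these products vanish, `T^k ω` vanishes up to the error.
      invert-columns : ∀ k s → ∃₂ λ (z : V p) (err : V ρ) → (∀ (ω : V ρ) → pow A T k * ω s ≈ z · (λ b → ω · 𝓑 b) + ω · err) × (∀ t → J.Mem k (err t))
      invert-columns k s with quasi-inverse M X e e′ T M≈ (λ a b → J-· 1 (g a) (near b)) ee′ k (λ a → g a s)
      ... | z , r , eq , r∈ = z , err , expand , λ t → J-· k (λ a → y a t) r∈
        where
        err : V ρ
        err t = (λ a → y a t) · r
        solved : ∀ t → pow A T k * δ t s ≈ comb z 𝓑 t + err t
        solved t = begin
          pow A T k * δ t s ≈⟨ *-congˡ (sym (complete t s)) ⟩
          pow A T k * ((λ a → y a t) · (λ a → g a s)) ≈⟨ sym (·-•ʳ (pow A T k) (λ a → y a t) _) ⟩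
          (λ a → y a t) · (λ a → pow A T k * g a s) ≈⟨ ·-cong (λ _ → refl) (λ a → sym (eq a)) ⟩
          (λ a → y a t) · (λ a → M a · z + r a) ≈⟨ ·-+ʳ (λ a → y a t) _ r ⟩
          (λ a → y a t) · (λ a → M a · z) + err t ≈⟨ +-congʳ (trans (·-cong (λ _ → refl) (λ a → trans (·-comm (M a) z) (sym (·-comb (g a) z 𝓑)))) (rebuild t (comb z 𝓑))) ⟩
          comb z 𝓑 t + err t ∎
        expand : ∀ (ω : V ρ) → pow A T k * ω s ≈ z · (λ b → ω · 𝓑 b) + ω · err
        expand ω = begin
          pow A T k * ω s ≈⟨ *-congˡ (sym (·-δ ω s)) ⟩
          pow A T k * (ω · δ s) ≈⟨ sym (·-•ʳ (pow A T k) ω (δ s)) ⟩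
          ω · (λ t → pow A T k * δ s t) ≈⟨ ·-cong (λ _ → refl) (λ t → trans (*-congˡ (δ-sym s t)) (solved t)) ⟩
          ω · (comb z 𝓑 +v err) ≈⟨ ·-+ʳ ω (comb z 𝓑) err ⟩
          ω · comb z 𝓑 + ω · err ≈⟨ +-congʳ (·-comb ω z 𝓑) ⟩
          z · (λ b → ω · 𝓑 b) + ω · err ∎

    module _ {α ρ} (W c : Fin α → V ρ) (w : V ρ) (d d′ : V α) T (near : ∀ b l → J.Mem 1 (W l · c b - δ b l * d b)) (dd′ : ∀ b → d b * d′ b ≈ T) where
      -- Solves for the coefficients with which the rows `W` cancel `T^k w` against the vectors `c`,
      -- to which they are nearly dual up to scaling.
      eliminate : ∀ k → ∃ λ (z : V α) → ∀ b → J.Mem k ((λ s → pow A T k * w s - comb z W s) · c b)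
      eliminate k with quasi-inverse (λ b l → W l · c b) (λ b l → W l · c b - δ b l * d b) d d′ T (λ b l → regroup _ _) near dd′ k (λ b → w · c b)
      ... | z , r , eq , r∈ = z , λ b → J.resp k (sym (error b)) (r∈ b)
        where
        error : ∀ b → (λ s → pow A T k * w s - comb z W s) · c b ≈ r b
        error b = begin
          (λ s → pow A T k * w s - comb z W s) · c b ≈⟨ Σ-cong (λ s → solve 4 (λ T w z c → (T :* w :- z) :* c := T :* (w :* c) :+ (:- (z :* c))) refl _ _ _ _) ⟩
          Σ (λ s → pow A T k * (w s * c b s) + - (comb z W s * c b s)) ≈⟨ trans (Σ-+ _ _) (+-cong (sym (Σ-*ˡ _ _)) (Σ-neg _)) ⟩
          pow A T k * (w · c b) - comb z W · c b ≈⟨ +-cong (sym (eq b)) (-‿cong (trans (comb-· z W (c b)) (·-comm z _))) ⟩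
          ((λ l → W l · c b) · z + r b) - (λ l → W l · c b) · z ≈⟨ solve 2 (λ m r → (m :+ r) :- m := r) refl _ _ ⟩
          r b ∎

    combination-· : ∀ {α ρ} T (w : V ρ) (z : V α) (W : Fin α → V ρ) (y : V ρ) →
      (λ s → T * w s - comb z W s) · y ≈ T * (w · y) - z · (λ l → W l · y)
    combination-· T w z W y = trans (Σ-cong (λ s → solve 4 (λ T w z c → (T :* w :- z) :* c := T :* (w :* c) :+ (:- (z :* c))) refl _ _ _ _))
      (trans (Σ-+ _ _) (+-cong (sym (Σ-*ˡ _ _)) (trans (Σ-neg _) (-‿cong (comb-· z W y)))))

    module _ {m k} {f : Alternating.Form A m (suc k)} (alt : Alternating.Alt A (suc k) f) where
      open Alternating A hiding (I)
      -- By linearity the scalars move into the first slot, where the relation turns it into a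
      -- combination of the later arguments.
      dependent-vanishes : ∀ S T w (z : V k) W → (∀ s → S * (T * w s - comb z (lookup W) s) ≈ 0#) → (S * T) * f (w ∷ W) ≈ 0#
      dependent-vanishes S T w z W h = begin
        (S * T) * f (w ∷ W) ≈⟨ sym (head-• alt (S * T) w W) ⟩
        f (((S * T) • w) ∷ W) ≈⟨ head-cong alt W (λ s → trans (solve 4 (λ S T w c → S :* T :* w := S :* (T :* w :- c) :+ S :* c) refl S T (w s) (comb z (lookup W) s)) (trans (+-congʳ (h s)) (+-identityˡ _))) ⟩
        f ((S • comb z (lookup W)) ∷ W) ≈⟨ head-• alt S _ W ⟩
        S * f (comb z (lookup W) ∷ W) ≈⟨ *-congˡ (trans (head-Σ alt z (lookup W) W) (·-0ʳ z (repeated alt W))) ⟩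
        S * 0# ≈⟨ zeroʳ S ⟩
        0# ∎

  module LocalVanishing {c ℓ} (K : CommutativeRing c (c ⊔ ℓ)) (F : StableField K) where
    private
      module K = CommutativeRing K using (Carrier; sym)
      κ = c ⊔ ℓ
    open Algebras K
    open Naturality K
    open OrderFiltration K
    open Deformation {c} {ℓ} K F
    open HomogeneousForms K
    module LF = LinearAlgebra K F

    against : ∀ (A : Alg κ) {ρ q} → Vec (Fin ρ → K.Carrier) q → (Fin ρ → Alg.Carrier A) → Fin q → Alg.Carrier A
    against A C v b = Vectors._·_ (Alg.comRing A) v (λ s → Alg.ι A (lookup C b s))

    -- Arbitrary test vectors `C` replace a selection of columns. A dual system of the rows is then
    -- an admissible `C`, and for it the minor equals one.
    minor : ∀ (A : Alg κ) {ρ q} → Vec (Fin ρ → K.Carrier) q → Vec (Fin ρ → Alg.Carrier A) q → Alg.Carrier A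
    minor A C W = Alternating.det (Alg.comRing A) (map (against A C) W)

    minor-alt : ∀ (A : Alg κ) {ρ q} (C : Vec (Fin ρ → K.Carrier) q) → Alternating.Alt (Alg.comRing A) q (minor A C)
    minor-alt A {ρ} {q} C = alt-map lin det-alt
      where
      open Alg A
      open Vectors comRing
      open Alternating comRing
      lin : Linear (against A C)
      lin = record { l-cong = λ h b → ·-cong h (λ _ → refl) ; l-+ = λ u v b → ·-+ˡ u v _ ; l-• = λ t v b → ·-•ˡ t v _ }

    minor-cong : ∀ (A : Alg κ) {ρ q} (C : Vec (Fin ρ → K.Carrier) q) {W W′ : Vec (Fin ρ → Alg.Carrier A) q} →
      (∀ l s → Alg._≈_ A (lookup W l s) (lookup W′ l s)) → Alg._≈_ A (minor A C W) (minor A C W′)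
    minor-cong A C h = Alternating.alt-cong (Alg.comRing A) (minor-alt A C) h

    minor-hom : ∀ {A A′ : Alg κ} (φ : Hom A A′) {ρ q} (C : Vec (Fin ρ → K.Carrier) q) W →
      Alg._≈_ A′ (Hom.⟦_⟧ φ (minor A C W)) (minor A′ C (map (λ v s → Hom.⟦_⟧ φ (v s)) W))
    minor-hom {A} {A′} φ {ρ} {q} C W = A′.trans (hom-det φ (map (against A C) W)) (Alternating.alt-cong A′.comRing (Alternating.det-alt A′.comRing) entry)
      where
      module A′ = Alg A′ using (comRing; Carrier; _≈_; refl; trans; reflexive)
      entry : ∀ l b → lookup (map (λ v s → Hom.⟦_⟧ φ (v s)) (map (against A C) W)) l b A′.≈ lookup (map (against A′ C) (map (λ v s → Hom.⟦_⟧ φ (v s)) W)) l b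
      entry l b = A′.trans (A′.reflexive (≡.cong (λ (v : Fin q → A′.Carrier) → v b) (≡.trans (lookup-map l _ (map (against A C) W)) (≡.cong (λ v s → Hom.⟦_⟧ φ (v s)) (lookup-map l (against A C) W)))))
        (A′.trans (hom-· φ (lookup W l) _) (A′.trans (Vectors.·-cong A′.comRing (λ _ → A′.refl) (λ s → Hom.⟦⟧-ι φ _))
          (A′.reflexive (≡.sym (≡.cong (λ (v : Fin q → A′.Carrier) → v b) (≡.trans (lookup-map l (against A′ C) (map (λ v s → Hom.⟦_⟧ φ (v s)) W)) (≡.cong (against A′ C) (lookup-map l _ W))))))))

    module _ n {ρ α ν r : ℕ} (W : Vec (Fin ρ → Alg.Carrier (R n)) α) (w : Fin ρ → Alg.Carrier (R n)) (V : Fin ν → Fin ρ → Alg.Carrier (R n))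
        (C₀ : Vec (Fin ρ → K.Carrier) α) (V₀ : Vec (Fin ρ → K.Carrier) ν) (Ψ : Vec (Fin ρ → K.Carrier) r) (Λ : Vec (Fin ρ → K.Carrier) (r ℕ.+ (α ℕ.+ ν)))
        (frame : LF.Frame Λ (Ψ ++ (C₀ ++ V₀))) where
      private
        module R = Alg (R n) using (comRing; ι; ι-cong; Carrier; _≈_; _*_; -_; _-_; 0#; 1#; refl; sym; trans; reflexive; +-cong; +-congˡ; *-cong; *-congˡ; *-congʳ; -‿cong; *-assoc; *-identityˡ; zeroʳ; -‿inverseʳ)
        module VR = Vectors R.comRing using (_·_; δ; ·-cong; ·-0ʳ; comb)
        t : R.Carrier
        t = Xs {suc n} zero
        open module Inv = Inversion R.comRing (ordIdeal n) (λ x j → ord-0 n (x j)) (λ k → ordR-* n 1 k) using (J-·; J-minus; invert-columns; eliminate; combination-·)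
        ιv : (Fin ρ → K.Carrier) → Fin ρ → R.Carrier
        ιv y s = R.ι (y s)
        -- A vector near a frame vector, that frame vector, the scaling factor between them, and its
        -- cofactor up to `T₂`.
        Column : Set c
        Column = (Fin ρ → R.Carrier) × (Fin ρ → K.Carrier) × R.Carrier × R.Carrier

      -- Let `ω` be `T₁^k w` minus the combination of `W` found by `eliminate`. Against `C₀` it has
      -- order `k`, against `V` it vanishes exactly, and its products with the `r` remaining frame
      -- vectors `Ψ` are the equations `hs`. Where these vanish, `T₂^k ω` vanishes, a multiple of
      -- `w` is a combination of `W`, and that multiple of every minor is zero.
      local-vanishing : (d d′ : Fin α → R.Carrier) (e e′ : Fin ν → R.Carrier) (E₁ E₂ : ℕ) →
        (∀ b → d b R.* d′ b R.≈ pow R.comRing t E₁) → (∀ b → e b R.* e′ b R.≈ pow R.comRing t E₂) →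
        (∀ b l → OrdR n 1 (lookup W l VR.· ιv (lookup C₀ b) R.- VR.δ b l R.* d b)) →
        (∀ l a → OrdR n 1 (lookup W l VR.· ιv (lookup Ψ a))) → (∀ a → OrdR n 1 (w VR.· ιv (lookup Ψ a))) →
        (∀ b s → OrdR n 1 (V b s R.- e b R.* ιv (lookup V₀ b) s)) →
        (∀ l b → lookup W l VR.· V b R.≈ R.0#) → (∀ b → w VR.· V b R.≈ R.0#) →
        ∀ k → ∃₂ λ E hs → 0 < E × length hs ≡.≡ r × All (OrdR n 1) hs ×
          ∀ (A : Alg κ) (η : Hom (R n) A) → Kills n η k hs → ∀ C → Alg._≈_ A (Hom.⟦_⟧ η (pow R.comRing t E R.* minor (R n) C (w ∷ W))) (Alg.0# A)
      local-vanishing d d′ e e′ E₁ E₂ dd′ ee′ WC WΨ wΨ VV₀ WV wV k =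
        -- The additional factor `t` makes the exponent positive in every case.
        suc (k ℕ.* E₂ ℕ.+ k ℕ.* E₁) , hs , s≤s z≤n , length-tabulate h , AllP.tabulate⁺ (λ a → h-ord a) , vanish
        where
        T₁ T₂ : R.Carrier
        T₁ = pow R.comRing t E₁
        T₂ = pow R.comRing t E₂
        elimination = eliminate (lookup W) (λ b → ιv (lookup C₀ b)) w d d′ T₁ WC dd′ k
        z = proj₁ elimination
        ω : Fin ρ → R.Carrier
        ω s = pow R.comRing T₁ k R.* w s R.- VR.comb z (lookup W) s
        h : Fin r → R.Carrier
        h a = ω VR.· ιv (lookup Ψ a)
        hs = List.tabulate h
        h-ord : ∀ a → OrdR n 1 (h a)
        h-ord a = Inv.J.resp 1 (R.sym (combination-· (pow R.comRing T₁ k) w z (lookup W) (ιv (lookup Ψ a))))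
          (J-minus 1 (Inv.J.mulM 1 _ (wΨ a)) (J-· 1 z (λ l → WΨ l a)))
        ΨT : Fin r → Column
        ΨT a = ιv (lookup Ψ a) , lookup Ψ a , R.1# , T₂
        CT : Fin α → Column
        CT a = ιv (lookup C₀ a) , lookup C₀ a , R.1# , T₂
        VT : Fin ν → Column
        VT b = V b , lookup V₀ b , e b , e′ b
        columns : Fin (r ℕ.+ (α ℕ.+ ν)) → Column
        columns = join ΨT (join CT VT)
        everywhere : ∀ {p} (P : Column → Set p) → (∀ a → P (ΨT a)) → (∀ a → P (CT a)) → (∀ b → P (VT b)) → ∀ b → P (columns b)
        everywhere P p₁ p₂ p₃ = join-∀ P ΨT (join CT VT) p₁ (join-∀ P CT VT p₂ p₃)
        𝓑 : Fin (r ℕ.+ (α ℕ.+ ν)) → Fin ρ → R.Carrier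
        𝓑 b = proj₁ (columns b)
        Y : Fin (r ℕ.+ (α ℕ.+ ν)) → Fin ρ → K.Carrier
        Y b = proj₁ (proj₂ (columns b))
        ê ê′ : Fin (r ℕ.+ (α ℕ.+ ν)) → R.Carrier
        ê b = proj₁ (proj₂ (proj₂ (columns b)))
        ê′ b = proj₂ (proj₂ (proj₂ (columns b)))
        Y≡ : ∀ b → Y b ≡.≡ lookup (Ψ ++ (C₀ ++ V₀)) b
        Y≡ = join-lookup (λ q → proj₁ (proj₂ q)) ΨT (join CT VT) Ψ (C₀ ++ V₀) (λ _ → ≡.refl) (join-lookup (λ q → proj₁ (proj₂ q)) CT VT C₀ V₀ (λ _ → ≡.refl) (λ _ → ≡.refl))
        Near : Column → Set κ
        Near (b , y , e , _) = ∀ s → OrdR n 1 (b s R.- e R.* ιv y s)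
        exact : ∀ (y : Fin ρ → K.Carrier) s → OrdR n 1 (ιv y s R.- R.1# R.* ιv y s)
        exact y s = Inv.J.resp 1 (R.sym (R.trans (R.+-congˡ (R.-‿cong (R.*-identityˡ _))) (R.-‿inverseʳ _))) (Inv.J.zeroM 1)
        dual : ∀ a b → ιv (lookup Λ a) VR.· ιv (Y b) R.≈ VR.δ a b
        dual a b = R.trans (R.reflexive (≡.cong (λ y → ιv (lookup Λ a) VR.· ιv y) (Y≡ b))) (R.trans (R.sym (hom-· (ιHom (R n)) (lookup Λ a) _)) (R.trans (R.ι-cong (LF.Frame.dual frame a b)) (hom-δ (ιHom (R n)) a b)))
        complete : ∀ s s′ → (λ l → ιv (Y l) s) VR.· (λ l → ιv (lookup Λ l) s′) R.≈ VR.δ s s′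
        complete s s′ = R.trans (VR.·-cong (λ l → R.reflexive (≡.cong (λ y → ιv y s) (Y≡ l))) (λ _ → R.refl))
          (R.trans (R.sym (hom-· (ιHom (R n)) (λ l → lookup (Ψ ++ (C₀ ++ V₀)) l s) (λ l → lookup Λ l s′))) (R.trans (R.ι-cong (K.sym (LF.Frame.complete frame s s′))) (hom-δ (ιHom (R n)) s s′)))
        inversion = invert-columns (λ a → ιv (lookup Λ a)) (λ b → ιv (Y b)) 𝓑 dual complete ê ê′ T₂
          (everywhere Near (λ a → exact (lookup Ψ a)) (λ a → exact (lookup C₀ a)) VV₀)
          (everywhere (λ q → proj₁ (proj₂ (proj₂ q)) R.* proj₂ (proj₂ (proj₂ q)) R.≈ T₂) (λ _ → R.*-identityˡ _) (λ _ → R.*-identityˡ _) ee′) k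
        vanish : ∀ (A : Alg κ) (η : Hom (R n) A) → Kills n η k hs → ∀ C →
          Alg._≈_ A (Hom.⟦_⟧ η (pow R.comRing t (suc (k ℕ.* E₂ ℕ.+ k ℕ.* E₁)) R.* minor (R n) C (w ∷ W))) (Alg.0# A)
        vanish A η (kills , kills-h) C = A.trans (⟦⟧-cong (R.trans (R.*-assoc t _ _) (R.*-congˡ (R.*-congʳ (R.trans (Powers.pow-+ R.comRing t (k ℕ.* E₂) (k ℕ.* E₁))
              (R.*-cong (R.sym (Powers.pow-* R.comRing t E₂ k)) (R.sym (Powers.pow-* R.comRing t E₁ k))))))))
          (A.trans (⟦⟧-* t _) (A.trans (A.*-congˡ (A.trans (⟦⟧-* _ _) (A.trans (A.*-cong (⟦⟧-* _ _) (minor-hom η C (w ∷ W)))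
            (InvA.dependent-vanishes (minor-alt A C) ⟦ pow R.comRing T₂ k ⟧ ⟦ pow R.comRing T₁ k ⟧ (λ s → ⟦ w s ⟧) (λ l → ⟦ z l ⟧) (map (λ v s → ⟦ v s ⟧) W) relation)))) (A.zeroʳ _)))
          where
          module A = Alg A using (comRing; Carrier; _≈_; _*_; -_; _-_; 0#; sym; trans; reflexive; +-cong; *-cong; *-congˡ; -‿cong; +-identityˡ; zeroʳ)
          open Hom η using (⟦_⟧; ⟦⟧-cong; ⟦⟧-+; ⟦⟧-*; ⟦⟧-0; ⟦⟧-minus)
          module VA = Vectors A.comRing using (Σ-cong; ·-0ʳ; comb)
          trivialIdeal : ℕ → Ideal A.comRing κ
          trivialIdeal _ = record { Mem = λ _ → Level.Lift κ ⊤ ; resp = λ _ x → x ; zeroM = Level.lift tt ; addM = λ _ x → x ; mulM = λ _ x → x }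
          module InvA = Inversion A.comRing trivialIdeal (λ _ → Level.lift tt) (λ _ x _ → x) using (dependent-vanishes)
          killed : ∀ b → ⟦ ω VR.· 𝓑 b ⟧ A.≈ A.0#
          killed = everywhere (λ q → ⟦ ω VR.· proj₁ q ⟧ A.≈ A.0#) (AllP.tabulate⁻ kills-h) (λ b → kills (proj₂ elimination b))
            (λ b → A.trans (⟦⟧-cong (R.trans (combination-· (pow R.comRing T₁ k) w z (lookup W) (V b))
              (R.trans (R.+-cong (R.trans (R.*-congˡ (wV b)) (R.zeroʳ _)) (R.-‿cong (VR.·-0ʳ z (λ l → WV l b)))) (R.-‿inverseʳ R.0#)))) ⟦⟧-0)
          ω-killed : ∀ s → ⟦ pow R.comRing T₂ k R.* ω s ⟧ A.≈ A.0#
          ω-killed s = A.trans (⟦⟧-cong (proj₁ (proj₂ (proj₂ (inversion s))) ω)) (A.trans (⟦⟧-+ _ _)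
            (A.trans (A.+-cong (A.trans (hom-· η _ (λ b → ω VR.· 𝓑 b)) (VA.·-0ʳ _ killed)) (A.trans (hom-· η ω _) (VA.·-0ʳ _ (λ t → kills (proj₂ (proj₂ (proj₂ (inversion s))) t))))) (A.+-identityˡ _)))
          relation : ∀ s → ⟦ pow R.comRing T₂ k ⟧ A.* (⟦ pow R.comRing T₁ k ⟧ A.* ⟦ w s ⟧ A.- VA.comb (λ l → ⟦ z l ⟧) (lookup (map (λ v s → ⟦ v s ⟧) W)) s) A.≈ A.0#
          relation s = A.trans (A.*-congˡ (A.sym (A.trans (⟦⟧-minus _ _) (A.+-cong (⟦⟧-* _ _) (A.-‿cong (A.trans (hom-Σ η (λ l → z l R.* lookup W l s))
              (VA.Σ-cong (λ l → A.trans (⟦⟧-* (z l) (lookup W l s)) (A.*-congˡ (A.reflexive (≡.cong (λ (v : Fin ρ → A.Carrier) → v s) (≡.sym (lookup-map l (λ v s → ⟦ v s ⟧) W)))))))))))))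
            (A.trans (A.sym (⟦⟧-* _ _)) (ω-killed s))

-- No pencil of the forbidden size: two translated determinantal cones

module Bound where
  open RS
  open Lin
  open LA
  open KAlg
  open Link using (module Naturality)
  open Span
  open Order
  open Forms
  open NS
  open Deform
  open Gauge
  open Chain
  open Local
  open import Defs using (pow; natCast)
  open import Level using (_⊔_) renaming (suc to lsuc)
  open import Algebra.Bundles using (CommutativeRing)
  open import Data.Nat as ℕ using (ℕ; zero; suc; _<_; _≤_; s≤s)
  import Data.Nat.Properties as ℕP
  open import Data.Fin using (Fin; zero; suc; _↑ˡ_; _↑ʳ_; inject≤)
  open import Data.Vec using (Vec; []; _∷_; lookup; map; _++_; tabulate; sum)
  open import Data.Vec.Properties using (lookup-map; lookup∘tabulate; lookup-++ˡ; lookup-++ʳ)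
  open import Data.List as List using (List; length)
  open import Data.List.Properties using (length-++)
  open import Data.List.Relation.Unary.All using (All; []; _∷_)
  import Data.List.Relation.Unary.All.Properties as AllP
  open import Data.Sum using (_⊎_; inj₁; inj₂)
  open import Data.Product using (_×_; _,_; ∃; ∃₂; proj₂)
  open import Data.Empty using (⊥)
  open import Relation.Nullary using (¬_)
  import Relation.Binary.PropositionalEquality as ≡

  module DeterminantForms {c κ} (K : CommutativeRing c κ) where
    open Algebras K
    open HomogeneousForms K

    module _ {n : ℕ} where
      LawVec : ℕ → ℕ → Set _
      LawVec m k = Vec (Fin m → Law n) k

      evaluate : ∀ {m k} (A : Alg κ) → (Fin n → Alg.Carrier A) → LawVec m k → Vec (Fin m → Alg.Carrier A) k
      evaluate A x = map (λ f i → f i A x)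

      data AllForms {m} : ∀ {k} → Vec ℕ k → LawVec m k → Set (lsuc c ⊔ lsuc κ) where
        [] : AllForms [] []
        _∷_ : ∀ {k d f} {ds : Vec ℕ k} {fs} → (∀ i → Form d (f i)) → AllForms ds fs → AllForms (d ∷ ds) (f ∷ fs)

      -- The offset `o` is the degree contributed by the columns that the Laplace expansion has
      -- already consumed.
      Homogeneous : ∀ {m} o k → (∀ (A : Alg κ) → (Fin n → Alg.Carrier A) → Vec (Fin m → Alg.Carrier A) k → Alg.Carrier A) → Set (lsuc c ⊔ lsuc κ)
      Homogeneous {m} o k H = ∀ {ds} {fs : LawVec m k} → AllForms ds fs → Form (o ℕ.+ sum ds) (λ A x → H A x (evaluate A x fs))

      private
        swap-left : ∀ o d s → d ℕ.+ (o ℕ.+ s) ≡.≡ o ℕ.+ (d ℕ.+ s)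
        swap-left o d s = ≡.trans (≡.sym (ℕP.+-assoc d o s)) (≡.trans (≡.cong (ℕ._+ s) (ℕP.+-comm d o)) (ℕP.+-assoc o d s))

      wedge-homogeneous : ∀ {m} o k {H} → Homogeneous {m} o k H → ∀ j →
        Homogeneous o (suc k) (λ A x → Alternating.wedge (Alg.comRing A) (λ v → v j) (H A x))
      wedge-homogeneous o zero h j (_∷_ {d = d} f []) = form-≡ (swap-left o d 0) (form-* (f j) (h []))
      wedge-homogeneous o (suc k) h j (_∷_ {d = d} {ds = ds} f fs) = form-minus (form-≡ (swap-left o d _) (form-* (f j) (h fs)))
        (form-≡ (ℕP.+-assoc o d _) (wedge-homogeneous (o ℕ.+ d) k (λ gs → form-≡ (≡.sym (ℕP.+-assoc o d _)) (h (f ∷ gs))) j fs))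

      det-homogeneous : ∀ m → Homogeneous {m} 0 m (λ A x → Alternating.det (Alg.comRing A))
      det-homogeneous zero [] = form-resp (λ A x → Alg.ι-1 A) (form-const _)
      det-homogeneous (suc m) = wedge-homogeneous 0 m step zero
        where
        step : Homogeneous {suc m} 0 m (λ A x ds → Alternating.det (Alg.comRing A) (map (Alternating.drop (Alg.comRing A)) ds))
        dropped : ∀ {k} {ds : Vec ℕ k} {fs : LawVec (suc m) k} → AllForms ds fs → AllForms {m} ds (map (λ f i → f (suc i)) fs)
        dropped [] = []
        dropped (f ∷ fs) = (λ i → f (suc i)) ∷ dropped fs
        commute : ∀ A x {k} (fs : LawVec (suc m) k) → evaluate A x (map (λ f i → f (suc i)) fs) ≡.≡ map (Alternating.drop (Alg.comRing A)) (evaluate A x fs)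
        commute A x [] = ≡.refl
        commute A x (f ∷ fs) = ≡.cong ((λ i → f (suc i) A x) ∷_) (commute A x fs)
        step {fs = fs} h = form-resp (λ A x → Alg.reflexive A (≡.cong (Alternating.det (Alg.comRing A)) (commute A x fs))) (det-homogeneous m (dropped h))

  module Bounds {c ℓ} (K : CommutativeRing c (c ⊔ ℓ)) (F : StableField K) (root : Monic.Root K) (char0 : ∀ k → ¬ (CommutativeRing._≈_ K (natCast K (suc k)) (CommutativeRing.0# K)))
      {n₀ ρ : ℕ} (Π : Pencils.Pencil K F n₀ ρ) where
    private
      module K = CommutativeRing K using (_≈_; -_; _-_; 0#; refl; sym; trans; reflexive; +-congˡ; *-congˡ; *-congʳ; -‿cong; zeroˡ; -‿inverseʳ)
      κ = c ⊔ ℓ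
      n : ℕ
      n = suc (suc n₀)
    open Algebras K
    open Naturality K
    open OrderFiltration K
    open Deformation {c} {ℓ} K F
    open HomogeneousForms K
    open DeterminantForms K
    open LocalVanishing {c} {ℓ} K F
    open Pencils K F
    open Independence char0 Π
    open Nullstellensatz K F
    open Vectors K using (V; _·_; δ)
    open Blocks K
    open StableField F
    open Pencil Π

    private
      module R = Alg (R n) using (comRing; ι; ι-cong; Carrier; _≈_; _+_; _*_; -_; _-_; 1#; refl; sym; trans; reflexive; +-cong; +-congˡ; +-congʳ; *-congˡ; *-congʳ; -‿cong; *-assoc; *-comm; zeroʳ)
      module VR = Vectors R.comRing using (_·_; δ; ·-comm; ·-+ˡ; ·-•ˡ)
      t : R.Carrier
      t = Xs {suc n} zero
      open module Inv = Inversion R.comRing (ordIdeal n) (λ x j → ord-0 n (x j)) (λ k → ordR-* n 1 k)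
      ιv : V ρ → Fin ρ → R.Carrier
      ιv y s = R.ι (y s)

    form-at-multiple : ∀ {n d} {φ : Law n} → Form d φ → ∀ A t x → Alg._≈_ A (φ A (λ i → Alg._*_ A t (x i))) (Alg._*_ A (pow (Alg.comRing A) t d) (φ A x))
    form-at-multiple {n} {d} (p via e) A t x = trans (e A _) (trans (go d p) (*-congˡ (sym (e A x))))
      where
      open Alg A using (comRing; _≈_; _*_; refl; sym; trans; *-congˡ; *-identityˡ)
      open IntegerSolver comRing using (solve; _:=_; _:*_)
      open Vectors comRing using (Σ-cong; Σ-*ˡ)
      go : ∀ d p → form d p A (λ i → t * x i) ≈ pow comRing t d * form d p A x
      go zero p = sym (*-identityˡ _)
      go (suc d) p = trans (Σ-cong (λ i → trans (*-congˡ (go d (∂ i p))) (solve 4 (λ t x q y → t :* x :* (q :* y) := t :* q :* (x :* y)) refl _ _ _ _))) (sym (Σ-*ˡ _ _))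

    -- Translation of the generic point by `t x`: the local origin sits at `t x`, and the
    -- translation disappears at `t = 0`.
    around : V n → Fin n → R.Carrier
    around x i = t R.* R.ι (x i) R.+ Xs {suc n} (suc i)

    module _ (u : Fin ρ → V n) (N : Fin ρ → Fin ρ → V n) where
      -- Modulo the variables only the constant point `t x` is left, where the row, a form of degree
      -- `k + 1`, scales by `t^(k+1)`.
      row-around : ∀ x k s → OrdR n 1 (row u N (R n) (around x) k s R.- pow R.comRing t (suc k) R.* R.ι (row u N base x k s))
      row-around x k s = Quotient.difference congruent
        where
        Q = Quot (R n) (ordIdeal n 1)
        module Q = Alg Q using (_≈_; sym; trans; +-congˡ; *-congˡ; *-congʳ; +-identityʳ)
        small : ∀ i → OrdR n 1 (Xs {suc n} (suc i))
        small i zero = ord-Xs n i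
        small i (suc j) = ord-zero n 1
        congruent : row u N (R n) (around x) k s Q.≈ pow R.comRing t (suc k) R.* R.ι (row u N base x k s)
        congruent = Q.trans (row-hom u N (quotHom (R n) (ordIdeal n 1)) (around x) k s)
          (Q.trans (law-cong (form-row u N k s) Q (λ i → Q.trans (Q.+-congˡ (Quotient.mem⇒~0 R.comRing (ordIdeal n 1) (small i))) (Q.+-identityʳ (t R.* R.ι (x i)))))
          (Q.trans (form-at-multiple (form-row u N k s) Q t (λ i → R.ι (x i)))
          (Q.trans (Q.*-congʳ (Q.sym (hom-pow (quotHom (R n) (ordIdeal n 1)) t (suc k))))
            (Q.*-congˡ {pow R.comRing t (suc k)} (Q.sym (row-hom u N (ιHom Q) x k s))))))

      row-around-· : ∀ x k y → OrdR n 1 (row u N (R n) (around x) k VR.· ιv y R.- pow R.comRing t (suc k) R.* R.ι (row u N base x k · y))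
      row-around-· x k y = Inv.J.resp 1 (R.trans (Arithmetic.·-minusˡ R.comRing (row u N (R n) (around x) k) (λ s → pow R.comRing t (suc k) R.* R.ι (row u N base x k s)) (ιv y))
          (R.+-congˡ (R.-‿cong (R.trans (VR.·-•ˡ (pow R.comRing t (suc k)) (ιv (row u N base x k)) (ιv y)) (R.*-congˡ (R.sym (hom-· (ιHom (R n)) (row u N base x k) y)))))))
        (Inv.J.resp 1 (VR.·-comm (ιv y) _) (J-· 1 (ιv y) (row-around x k)))

      row-around-0 : ∀ x k y → row u N base x k · y K.≈ K.0# → OrdR n 1 (row u N (R n) (around x) k VR.· ιv y)
      row-around-0 x k y h = Inv.J.resp 1 (Arithmetic.minus-zero R.comRing (R.trans (R.*-congˡ (R.trans (R.ι-cong h) (Hom.⟦⟧-0 (ιHom (R n))))) (R.zeroʳ _))) (row-around-· x k y)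

      row-head : ∀ x k s → Alg._≈_ (B n) (row u N (R n) (around x) k s 0) (row u N (B n) Xs k s)
      row-head x k s = Alg.trans (B n) (row-hom u N (headHom (B n)) (around x) k s) (law-cong (form-row u N k s) (B n)
        (λ i → Alg.trans (B n) (Alg.+-congʳ (B n) (Alg.zeroˡ (B n) _)) (Alg.+-identityˡ (B n) _)))

      -- The degree of a minor of the first `q` rows, whose entries have degrees `1` to `q`.
      triangular : ℕ → ℕ
      triangular zero = 0
      triangular (suc q) = suc q ℕ.+ triangular q

      minorLaw : ∀ q → Vec (V ρ) q → Law n
      minorLaw q C A x = minor A C (chain u N A x q)

      form-minor : ∀ q C → Form (triangular q) (minorLaw q C)
      form-minor q C = form-resp (λ A x → Alg.reflexive A (≡.cong (Alternating.det (Alg.comRing A)) (same A x q))) (form-≡ (total q) (det-homogeneous q (forms q)))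
        where
        laws : ∀ k → LawVec q k
        laws zero = []
        laws (suc k) = (λ b A x → against A C (row u N A x k) b) ∷ laws k
        degrees : ∀ k → Vec ℕ k
        degrees zero = []
        degrees (suc k) = (suc k ℕ.+ 0) ∷ degrees k
        total : ∀ k → sum (degrees k) ≡.≡ triangular k
        total zero = ≡.refl
        total (suc k) = ≡.cong₂ ℕ._+_ (ℕP.+-identityʳ (suc k)) (total k)
        forms : ∀ k → AllForms (degrees k) (laws k)
        forms zero = []
        forms (suc k) = (λ b → form-Σ (λ s → form-* (form-row u N k s) (form-const (lookup C b s)))) ∷ forms k
        same : ∀ A x k → evaluate A x (laws k) ≡.≡ map (against A C) (chain u N A x k)
        same A x zero = ≡.refl
        same A x (suc k) = ≡.cong (against A C (row u N A x k) ∷_) (same A x k)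

      -- `α` is the number of the first dependent row; the dual system records that the earlier rows
      -- are independent.
      Start : V n → ℕ → Set (c ⊔ κ)
      Start x α = (∃ λ C → LF.Dual (chain u N base x α) C) × Dependent u N x α

      independent-or-dependent : ∀ x j → ¬ ¬ ((∃ λ C → LF.Dual (chain u N base x j) C) ⊎ (∃ λ α → α < j × Start x α))
      independent-or-dependent x zero k = k (inj₁ ([] , λ ()))
      independent-or-dependent x (suc j) k = independent-or-dependent x j λ
        { (inj₂ (α , lt , s)) → k (inj₂ (α , ℕP.m≤n⇒m≤1+n lt , s))
        ; (inj₁ (C , D)) → LF.grow {Z = chain u N base x j} {C} D (row u N base x j) λ
          { (inj₁ more) → k (inj₁ more)
          ; (inj₂ eq) → k (inj₂ (j , ℕP.≤-refl , (C , D) , (λ l → row u N base x j · lookup C l) , λ b →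
              K.trans (eq b) (Vectors.Σ-cong K (λ l → K.*-congˡ (K.reflexive (≡.cong (λ (v : V ρ) → v b) (lookup-chain u N base x j l))))))) } }

      -- If the rows up to `j` were independent, their dual system used as test vectors would give a
      -- minor equal to one.
      vanishing-minors : ∀ x j → (∀ C → minorLaw (suc j) C base x K.≈ K.0#) → ¬ ¬ (∃ λ α → α ≤ j × Start x α)
      vanishing-minors x j h k = independent-or-dependent x (suc j) λ
        { (inj₁ (C , D)) → 1≉0 (K.trans (K.sym (K.trans (Alternating.alt-cong K (Alternating.det-alt K) (λ l b → K.trans (K.reflexive (≡.cong (λ (v : V (suc j)) → v b) (lookup-map l (against base C) (chain u N base x (suc j)))))
            (K.trans (D l b) (K.sym (lookup-I l b))))) (Alternating.det-I K (suc j)))) (h C))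
        ; (inj₂ (α , s≤s le , s)) → k (α , le , s) }

      minor-head : ∀ q C W → (∀ l s → Alg._≈_ (B n) (lookup W l s 0) (row u N (B n) Xs (position q l) s)) →
        Alg._≈_ (B n) (minor (R n) C W 0) (minorLaw q C (B n) Xs)
      minor-head q C W h = Alg.trans (B n) (minor-hom (headHom (B n)) C W) (minor-cong (B n) C (λ l s →
        Alg.trans (B n) (Alg.reflexive (B n) (≡.cong (λ (v : Fin ρ → Alg.Carrier (B n)) → v s) (lookup-map l (λ v s → v s 0) W)))
          (Alg.trans (B n) (h l s) (Alg.reflexive (B n) (≡.cong (λ (v : Fin ρ → Alg.Carrier (B n)) → v s) (≡.sym (lookup-chain u N (B n) Xs q l)))))))

      -- Otherwise the maximal minors of the chain would define the origin; perturbing all rows but the newest to the standard basis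
      -- leaves only ρ - j equations.
      dependent-point : ∀ j → (∃ λ r → r ℕ.+ j ≡.≡ ρ × r < n) → ¬ ¬ (∃ λ (x : V n) → ¬ (∀ i → x i K.≈ K.0#) × ∃ λ α → α ≤ j × Start x α)
      dependent-point j (r₀ , r₀+j , r₀<n) none = LF.complete-frame {Λ = E ++ []} {E ++ []} (λ a b → standard-dual a b) λ
        { (r , Ψr , Ψ , frame) → nullstellensatz root n deg f (λ C → form-minor (suc j) C)
            (λ x x≉0 h → vanishing-minors x j h λ { (α , le , s) → none (x , x≉0 , α , le , s) }) λ
        { (M , full) → family-bound {n} {r} (ℕP.≤-trans (ℕP.≤-reflexive (≡.cong suc (r≡ r {Ψr} {Ψ} frame))) r₀<n) deg f f̃ head M (λ i → full (form-coord-pow i M)) (local r Ψr Ψ frame) } }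
        where
        j≤ρ : j ≤ ρ
        j≤ρ = ℕP.≤-trans (ℕP.m≤n+m j r₀) (ℕP.≤-reflexive r₀+j)
        E : Vec (V ρ) j
        E = tabulate (λ l → δ (inject≤ l j≤ρ))
        δ-inject : ∀ {j m} (le : j ≤ m) (a b : Fin j) → δ (inject≤ a le) (inject≤ b le) K.≈ δ a b
        δ-inject (s≤s le) zero zero = K.refl
        δ-inject (s≤s le) zero (suc b) = K.refl
        δ-inject (s≤s le) (suc a) zero = K.refl
        δ-inject (s≤s le) (suc a) (suc b) = δ-inject le a b
        E-dual : ∀ a b → lookup E a · lookup E b K.≈ δ a b
        E-dual a b = K.trans (K.reflexive (≡.cong₂ _·_ (lookup∘tabulate (λ l → δ (inject≤ l j≤ρ)) a) (lookup∘tabulate (λ l → δ (inject≤ l j≤ρ)) b)))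
          (K.trans (Vectors.·-δ K _ (inject≤ b j≤ρ)) (δ-inject j≤ρ a b))
        standard-dual : LF.Dual (E ++ []) (E ++ [])
        standard-dual = Fin-case j _ (λ a → Fin-case j _ (λ b → K.trans (K.reflexive (≡.cong₂ _·_ (lookup-++ˡ E [] a) (lookup-++ˡ E [] b))) (K.trans (E-dual a b) (K.sym (δ-left-left 0 a b)))) (λ ())) (λ ())
        r≡ : ∀ r {Ψr Ψ : Vec (V ρ) r} → LF.Frame (Ψr ++ (E ++ [])) (Ψ ++ (E ++ [])) → r ≡.≡ r₀
        r≡ r {Ψr} {Ψ} frame = ℕP.+-cancelʳ-≡ j r r₀ (≡.trans (≡.cong (r ℕ.+_) (≡.sym (ℕP.+-identityʳ j))) (≡.trans (LF.frame-size {Λ = Ψr ++ (E ++ [])} {Ψ ++ (E ++ [])} frame) (≡.sym r₀+j)))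
        deg : Vec (V ρ) (suc j) → ℕ
        deg _ = j ℕ.+ triangular j
        f : Vec (V ρ) (suc j) → Law n
        f = minorLaw (suc j)
        origin : V n
        origin _ = K.0#
        w : Fin ρ → R.Carrier
        w = row u N (R n) (around origin) j
        W′ : Fin j → Fin ρ → R.Carrier
        W′ l s = row u N (R n) (around origin) (position j l) s R.+ t R.* R.ι (lookup E l s)
        W : Vec (Fin ρ → R.Carrier) j
        W = tabulate W′
        f̃ : Vec (V ρ) (suc j) → R.Carrier
        f̃ C = minor (R n) C (w ∷ W)
        head : ∀ C → Alg._≈_ (B n) (f̃ C 0) (f C (B n) Xs)
        head C = minor-head (suc j) C (w ∷ W) λ
          { zero s → row-head origin j s
          ; (suc l) s → B.trans (B.reflexive (≡.cong (λ (v : Fin ρ → R.Carrier) → v s 0) (lookup∘tabulate W′ l)))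
              (B.trans (B.+-cong (row-head origin (position j l) s) (B.zeroˡ _)) (B.+-identityʳ _)) }
          where module B = Alg (B n)
        row-origin : ∀ k y → row u N base origin k · y K.≈ K.0#
        row-origin k y = Vectors.·-0ˡ K y (λ s → K.trans (law-cong (form-row u N k s) base (λ i → K.sym (K.zeroˡ _)))
          (K.trans (form-at-multiple (form-row u N k s) base K.0# origin) (K.trans (K.*-congʳ (K.zeroˡ _)) (K.zeroˡ _))))
        W-· : ∀ l y → lookup W l VR.· ιv y R.≈ row u N (R n) (around origin) (position j l) VR.· ιv y R.+ t R.* R.ι (lookup E l · y)
        W-· l y = R.trans (R.reflexive (≡.cong (VR._· ιv y) (lookup∘tabulate W′ l))) (R.trans (VR.·-+ˡ (row u N (R n) (around origin) (position j l)) (λ s → t R.* R.ι (lookup E l s)) (ιv y))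
          (R.+-congˡ (R.trans (VR.·-•ˡ t (ιv (lookup E l)) (ιv y)) (R.*-congˡ (R.sym (hom-· (ιHom (R n)) (lookup E l) y))))))
        module _ (A : CommutativeRing c κ) where
          open CommutativeRing A using (_≈_; _+_; -_; _-_; refl; trans; +-congˡ; -‿cong)
          open IntegerSolver A using (solve; _:=_; _:+_; _:-_; :-_)
          cancel : ∀ a b q → b ≈ q → a ≈ (a + b) - q
          cancel a b q h = trans (solve 2 (λ a b → a := (a :+ b) :- b) refl a b) (+-congˡ (-‿cong h))
        local : ∀ r Ψr Ψ → LF.Frame {k = r ℕ.+ (j ℕ.+ 0)} (Ψr ++ (E ++ [])) (Ψ ++ (E ++ [])) → ∀ k → 0 < k → ∃₂ λ e hs → 0 < e × length hs ≡.≡ r × All (OrdR n 1) hs ×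
          ∀ C (A : Alg κ) (η : Hom (R n) A) → Kills n η k hs → Alg._≈_ A (Hom.⟦_⟧ η (pow R.comRing t e R.* f̃ C)) (Alg.0# A)
        -- At the origin no orthogonal vectors are available, so `V` is empty and the second
        -- exponent is zero; the perturbed rows are `t E` modulo the variables, hence `d = t`.
        local r Ψr Ψ frame k _ = reorder (local-vanishing n W w (λ ()) E [] Ψ (Ψr ++ (E ++ [])) frame (λ _ → t) (λ _ → R.1#) (λ ()) (λ ()) 1 0 (λ _ → R.refl) (λ ())
            (λ b l → Inv.J.resp 1 (R.trans (cancel R.comRing _ (t R.* R.ι (lookup E l · lookup E b)) (VR.δ b l R.* t)
                (R.trans (R.*-congˡ (R.trans (R.ι-cong (K.trans (E-dual l b) (Vectors.δ-sym K l b))) (hom-δ (ιHom (R n)) b l))) (R.*-comm _ _))) (R.+-congʳ (R.sym (W-· l (lookup E b)))))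
              (row-around-0 origin (position j l) (lookup E b) (row-origin (position j l) (lookup E b))))
            (λ l a → Inv.J.resp 1 (R.sym (W-· l (lookup Ψ a))) (Inv.J.addM 1 (row-around-0 origin (position j l) (lookup Ψ a) (row-origin (position j l) (lookup Ψ a)))
              (Inv.J.resp 1 (R.sym (R.trans (R.*-congˡ (R.trans (R.ι-cong (E-Ψ l a)) (Hom.⟦⟧-0 (ιHom (R n))))) (R.zeroʳ t))) (Inv.J.zeroM 1))))
            (λ a → row-around-0 origin j (lookup Ψ a) (row-origin j (lookup Ψ a)))
            (λ ()) (λ _ ()) (λ ()) k)
          where
          E-Ψ : ∀ l a → lookup E l · lookup Ψ a K.≈ K.0#
          E-Ψ l a = K.trans (K.reflexive (≡.cong₂ _·_ (≡.sym (≡.trans (lookup-++ʳ Ψr (E ++ []) (l ↑ˡ 0)) (lookup-++ˡ E [] l))) (≡.sym (lookup-++ˡ Ψ (E ++ []) a))))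
            (K.trans (LF.Frame.dual frame (r ↑ʳ (l ↑ˡ 0)) (a ↑ˡ (j ℕ.+ 0))) (δ-right-left (l ↑ˡ 0) a))
          reorder : (∃₂ λ e hs → 0 < e × length hs ≡.≡ r × All (OrdR n 1) hs × ∀ (A : Alg κ) (η : Hom (R n) A) → Kills n η k hs → ∀ C → Alg._≈_ A (Hom.⟦_⟧ η (pow R.comRing t e R.* minor (R n) C (w ∷ W))) (Alg.0# A)) →
            ∃₂ λ e hs → 0 < e × length hs ≡.≡ r × All (OrdR n 1) hs × ∀ C (A : Alg κ) (η : Hom (R n) A) → Kills n η k hs → Alg._≈_ A (Hom.⟦_⟧ η (pow R.comRing t e R.* f̃ C)) (Alg.0# A)
          reorder (e , hs , p , q , o , h) = e , hs , p , q , o , λ C A η ks → h A η ks C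

    -- A dependency of the first chain at x makes the rows orthogonal to an independent piece of the second chain;
    -- together they leave only ρ - n₀ equations near t x.
    module Side (u : Fin ρ → V n) (N : Fin ρ → Fin ρ → V n) (v : Fin ρ → V n)
        (moments : ∀ k → k < n₀ → ∀ A x → Alg._≈_ A (moment u N v k A x) (Alg.0# A)) where
      LocallyVanishing : V n → ℕ → ℕ → Set (lsuc c ⊔ lsuc κ)
      LocallyVanishing x α r = ∀ k → ∃₂ λ E hs → 0 < E × length hs ≡.≡ r × All (OrdR n 1) hs ×
        ∀ (A : Alg κ) (η : Hom (R n) A) → Kills n η k hs → ∀ C → Alg._≈_ A (Hom.⟦_⟧ η (pow R.comRing t E R.* minorLaw u N (suc α) C (R n) (around x))) (Alg.0# A)

      -- The `α` rows and the first `n₀ - α` vectors `N^i v` are mutually orthogonal, since their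
      -- products are moments of index below `n₀`. Both families therefore fit into one frame, which
      -- leaves `ρ - n₀` vectors `Ψ`.
      side : ∀ x α → α ≤ n₀ → Start u N x α → (∀ γ → α ℕ.+ γ ≤ n₀ → ¬ Dependent v (transpose N) x γ) →
        ¬ ¬ (∃ λ r → r ℕ.+ n₀ ≡.≡ ρ × LocallyVanishing x α r)
      side x α α≤n ((C₀ , D) , (z₀ , dep)) nodep k = independent-or-dependent v (transpose N) x ν λ
        { (inj₂ (γ , γ<ν , _ , dep′)) → nodep γ (ℕP.≤-trans (ℕP.+-monoʳ-≤ α (ℕP.<⇒≤ γ<ν)) (ℕP.≤-reflexive α+ν)) dep′
        ; (inj₁ (Z , DZ)) → LF.complete-frame {Λ = Us ++ Z′ Z} {C₀ ++ Vs} (dual₀ Z DZ) λ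
          { (r , Ψr , Ψ , frame) → k (r , ≡.trans (≡.cong (r ℕ.+_) (≡.sym α+ν)) (LF.frame-size {Λ = Ψr ++ (Us ++ Z′ Z)} {Ψ ++ (C₀ ++ Vs)} frame) , local Z r Ψr Ψ frame) } }
        where
        ν : ℕ
        ν = n₀ ℕ.∸ α
        α+ν : α ℕ.+ ν ≡.≡ n₀
        α+ν = ℕP.m+[n∸m]≡n α≤n
        Us : Vec (V ρ) α
        Us = chain u N base x α
        Vs : Vec (V ρ) ν
        Vs = chain v (transpose N) base x ν
        orthogonal : ∀ A y a b → a ℕ.+ b < n₀ → Alg._≈_ A (Vectors._·_ (Alg.comRing A) (row u N A y a) (row v (transpose N) A y b)) (Alg.0# A)
        orthogonal A y a b lt = Alg.trans A (row-column u N v A y a b) (moments (b ℕ.+ a) (ℕP.≤-trans (ℕP.≤-reflexive (≡.cong suc (ℕP.+-comm b a))) lt) A y)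
        below : ∀ {a} b → a ≤ α → a ℕ.+ position ν b < n₀
        below b le = ℕP.<-≤-trans (ℕP.+-mono-≤-< le (position-< ν b)) (ℕP.≤-reflexive α+ν)
        UV : ∀ a b → lookup Us a · lookup Vs b K.≈ K.0#
        UV a b = K.trans (K.reflexive (≡.cong₂ _·_ (lookup-chain u N base x α a) (lookup-chain v (transpose N) base x ν b)))
          (orthogonal base x (position α a) (position ν b) (below b (ℕP.<⇒≤ (position-< α a))))
        -- Dual vectors of the columns `Vs`, corrected by the rows so that they annihilate `C₀`;
        -- orthogonality of rows and columns keeps them dual to `Vs`.
        ζ : Vec (V ρ) ν → Fin ν → V ρ
        ζ Z i s = lookup Z i s K.- Vectors.comb K (λ l → lookup Z i · lookup C₀ l) (lookup Us) s
        Z′ : Vec (V ρ) ν → Vec (V ρ) ν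
        Z′ Z = tabulate (ζ Z)
        ζ-· : ∀ Z i y → lookup (Z′ Z) i · y K.≈ lookup Z i · y K.- (λ l → lookup Z i · lookup C₀ l) · (λ l → lookup Us l · y)
        ζ-· Z i y = K.trans (K.reflexive (≡.cong (_· y) (lookup∘tabulate (ζ Z) i))) (K.trans (Arithmetic.·-minusˡ K (lookup Z i) _ y)
          (K.+-congˡ (K.-‿cong (Vectors.comb-· K (λ l → lookup Z i · lookup C₀ l) (lookup Us) y))))
        dual₀ : ∀ Z → LF.Dual Vs Z → LF.Dual (Us ++ Z′ Z) (C₀ ++ Vs)
        dual₀ Z DZ = Fin-case α _
          (λ a → Fin-case α _
            (λ b → K.trans (K.reflexive (≡.cong₂ _·_ (lookup-++ˡ Us (Z′ Z) a) (lookup-++ˡ C₀ Vs b))) (K.trans (D a b) (K.sym (δ-left-left ν a b))))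
            (λ b → K.trans (K.reflexive (≡.cong₂ _·_ (lookup-++ˡ Us (Z′ Z) a) (lookup-++ʳ C₀ Vs b))) (K.trans (UV a b) (K.sym (δ-left-right a b)))))
          (λ a → Fin-case α _
            (λ b → K.trans (K.reflexive (≡.cong₂ _·_ (lookup-++ʳ Us (Z′ Z) a) (lookup-++ˡ C₀ Vs b))) (K.trans (ζ-· Z a (lookup C₀ b))
              (K.trans (K.+-congˡ (K.-‿cong (K.trans (Vectors.·-cong K (λ _ → K.refl) (λ l → K.trans (D l b) (Vectors.δ-sym K l b))) (Vectors.·-δ K _ b))))
                (K.trans (K.-‿inverseʳ _) (K.sym (δ-right-left a b))))))
            (λ b → K.trans (K.reflexive (≡.cong₂ _·_ (lookup-++ʳ Us (Z′ Z) a) (lookup-++ʳ C₀ Vs b))) (K.trans (ζ-· Z a (lookup Vs b))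
              (K.trans (Arithmetic.minus-zero K (Vectors.·-0ʳ K _ (λ l → UV l b)))
                (K.trans (Vectors.·-comm K _ _) (K.trans (DZ b a) (K.trans (Vectors.δ-sym K b a) (K.sym (δ-right-right α a b)))))))))
        -- The scaling of the rows at `t x`, completed by `d′` to the common power `t^α`; `e` and
        -- `e′` do the same for the columns.
        d d′ : Fin α → R.Carrier
        d b = pow R.comRing t (suc (position α b))
        d′ b = pow R.comRing t (α ℕ.∸ suc (position α b))
        e e′ : Fin ν → R.Carrier
        e b = pow R.comRing t (suc (position ν b))
        e′ b = pow R.comRing t (ν ℕ.∸ suc (position ν b))
        complementary : ∀ a b → a ≤ b → pow R.comRing t a R.* pow R.comRing t (b ℕ.∸ a) R.≈ pow R.comRing t b
        complementary a b le = R.trans (R.sym (Powers.pow-+ R.comRing t a (b ℕ.∸ a))) (R.reflexive (≡.cong (pow R.comRing t) (ℕP.m+[n∸m]≡n le)))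
        W : Vec (Fin ρ → R.Carrier) α
        W = chain u N (R n) (around x) α
        W≡ : ∀ l → lookup W l ≡.≡ row u N (R n) (around x) (position α l)
        W≡ = lookup-chain u N (R n) (around x) α
        local : ∀ Z r Ψr Ψ → LF.Frame {k = r ℕ.+ (α ℕ.+ ν)} (Ψr ++ (Us ++ Z′ Z)) (Ψ ++ (C₀ ++ Vs)) → LocallyVanishing x α r
        local Z r Ψr Ψ frame = local-vanishing n W (row u N (R n) (around x) α) (λ b → row v (transpose N) (R n) (around x) (position ν b)) C₀ Vs Ψ (Ψr ++ (Us ++ Z′ Z)) frame
            d d′ e e′ α ν (λ b → complementary (suc (position α b)) α (position-< α b)) (λ b → complementary (suc (position ν b)) ν (position-< ν b))
            (λ b l → Inv.J.resp 1 (R.+-cong (R.reflexive (≡.cong (VR._· ιv (lookup C₀ b)) (≡.sym (W≡ l)))) (R.-‿cong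
                (R.trans (R.*-congˡ (R.trans (R.ι-cong (K.trans (K.reflexive (≡.cong (_· lookup C₀ b) (≡.sym (lookup-chain u N base x α l)))) (K.trans (D l b) (Vectors.δ-sym K l b)))) (hom-δ (ιHom (R n)) b l))) (δ-swap b l d))))
              (row-around-· u N x (position α l) (lookup C₀ b)))
            (λ l a → Inv.J.resp 1 (R.reflexive (≡.cong (VR._· ιv (lookup Ψ a)) (≡.sym (W≡ l)))) (row-around-0 u N x (position α l) (lookup Ψ a) (UΨ l a)))
            (λ a → row-around-0 u N x α (lookup Ψ a) (K.trans (Vectors.·-cong K dep (λ _ → K.refl)) (K.trans (Vectors.comb-· K z₀ _ (lookup Ψ a)) (Vectors.·-0ʳ K z₀ (λ l → UΨ l a)))))
            (λ b s → Inv.J.resp 1 (R.+-congˡ (R.-‿cong (R.*-congˡ (R.ι-cong (K.reflexive (≡.cong (λ (v : V ρ) → v s) (≡.sym (lookup-chain v (transpose N) base x ν b))))))))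
              (row-around v (transpose N) x (position ν b) s))
            (λ l b → R.trans (R.reflexive (≡.cong (VR._· row v (transpose N) (R n) (around x) (position ν b)) (W≡ l))) (orthogonal (R n) (around x) (position α l) (position ν b) (below b (ℕP.<⇒≤ (position-< α l)))))
            (λ b → orthogonal (R n) (around x) α (position ν b) (below b ℕP.≤-refl))
          where
          UΨ : ∀ l a → row u N base x (position α l) · lookup Ψ a K.≈ K.0#
          UΨ l a = K.trans (K.reflexive (≡.cong₂ _·_ (≡.sym (≡.trans (lookup-++ʳ Ψr (Us ++ Z′ Z) (l ↑ˡ ν)) (≡.trans (lookup-++ˡ Us (Z′ Z) l) (lookup-chain u N base x α l)))) (≡.sym (lookup-++ˡ Ψ (C₀ ++ Vs) a))))
            (K.trans (LF.Frame.dual frame (r ↑ʳ (l ↑ˡ ν)) (a ↑ˡ (α ℕ.+ ν))) (δ-right-left (l ↑ˡ ν) a))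

    vanishingᵗ : ∀ k → k < n₀ → ∀ A x → Alg._≈_ A (moment v (transpose N) u k A x) (Alg.0# A)
    vanishingᵗ k lt A x = Alg.trans A (Vectors.·-comm (Alg.comRing A) _ _) (Alg.trans A (row-column u N v A x 0 k) (vanishing (k ℕ.+ 0) (ℕP.≤-trans (ℕP.≤-reflexive (≡.cong suc (ℕP.+-identityʳ k))) lt) A x))

    module _ (x₁ x₂ : V n) (α γ : ℕ) (α+γ : α ℕ.+ γ ≤ n₀) (x₁≉0 : ¬ (∀ i → x₁ i K.≈ K.0#)) (x₂≉0 : ¬ (∀ i → x₂ i K.≈ K.0#))
        (start₁ : Start u N x₁ α) (start₂ : Start v (transpose N) x₂ γ) (small : ∀ r → r ℕ.+ n₀ ≡.≡ ρ → r ℕ.+ r < n) where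
      private
        module S₁ = Side u N v vanishing
        module S₂ = Side v (transpose N) u vanishingᵗ
        Idx : Set c
        Idx = Vec (V ρ) (suc α) ⊎ Vec (V ρ) (suc γ)
        deg : Idx → ℕ
        deg (inj₁ _) = α ℕ.+ triangular u N α
        deg (inj₂ _) = γ ℕ.+ triangular u N γ
        f : Idx → Law n
        f (inj₁ C) = minorLaw u N (suc α) C
        f (inj₂ C) = minorLaw v (transpose N) (suc γ) C
        f̃ : Idx → R.Carrier
        f̃ (inj₁ C) = minorLaw u N (suc α) C (R n) (around x₁)
        f̃ (inj₂ C) = minorLaw v (transpose N) (suc γ) C (R n) (around x₂)
        chain-head : ∀ (u : Fin ρ → V n) N x q l s → Alg._≈_ (B n) (lookup (chain u N (R n) (around x) q) l s 0) (row u N (B n) Xs (position q l) s)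
        chain-head u N x q l s = Alg.trans (B n) (Alg.reflexive (B n) (≡.cong (λ (v : Fin ρ → R.Carrier) → v s 0) (lookup-chain u N (R n) (around x) q l))) (row-head u N x (position q l) s)
        head : ∀ i → Alg._≈_ (B n) (f̃ i 0) (f i (B n) Xs)
        head (inj₁ C) = minor-head u N (suc α) C (chain u N (R n) (around x₁) (suc α)) (chain-head u N x₁ (suc α))
        head (inj₂ C) = minor-head v (transpose N) (suc γ) C (chain v (transpose N) (R n) (around x₂) (suc γ)) (chain-head v (transpose N) x₂ (suc γ))
        isForm : ∀ i → Form (suc (deg i)) (f i)
        isForm (inj₁ C) = form-minor u N (suc α) C
        isForm (inj₂ C) = form-≡ (≡.cong (suc γ ℕ.+_) (same γ)) (form-minor v (transpose N) (suc γ) C)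
          where
          same : ∀ q → triangular v (transpose N) q ≡.≡ triangular u N q
          same zero = ≡.refl
          same (suc q) = ≡.cong (suc q ℕ.+_) (same q)
        noZeros : Family.NoZeros deg f
        noZeros x x≉0 h = vanishing-minors u N x α (λ C → h (inj₁ C)) λ { (α′ , le , _ , dep) →
          vanishing-minors v (transpose N) x γ (λ C → h (inj₂ C)) λ { (γ′ , le′ , _ , dep′) →
            x≉0 (dependency-bound x α′ γ′ (ℕP.≤-trans (ℕP.+-mono-≤ le le′) α+γ) dep dep′) } }

      -- Both translated systems are considered at the same local origin. For general `t` they are
      -- cut out there by `2 (ρ - n₀) < n` equations, while at `t = 0` `dependency-bound` leaves
      -- only the origin as a common zero.
      two-points : ⊥
      two-points = S₁.side x₁ α (ℕP.≤-trans (ℕP.m≤m+n α γ) α+γ) start₁ (λ γ′ le dep → x₁≉0 (dependency-bound x₁ α γ′ le (proj₂ start₁) dep)) λ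
        { (r₁ , r₁+n , local₁) → S₂.side x₂ γ (ℕP.≤-trans (ℕP.m≤n+m γ α) α+γ) start₂
            (λ α′ le dep → x₂≉0 (dependency-bound x₂ α′ γ (ℕP.≤-trans (ℕP.≤-reflexive (ℕP.+-comm α′ γ)) le) dep (proj₂ start₂))) λ
        { (r₂ , r₂+n , local₂) → nullstellensatz root n deg f isForm noZeros λ
        { (M , full) → family-bound {n} {r₁ ℕ.+ r₂} (ℕP.≤-trans (ℕP.≤-reflexive (≡.cong (λ r → suc (r₁ ℕ.+ r)) (ℕP.+-cancelʳ-≡ n₀ r₂ r₁ (≡.trans r₂+n (≡.sym r₁+n))))) (small r₁ r₁+n))
            deg f f̃ head M (λ i → full (form-coord-pow i M)) (λ k _ → both k r₁ r₂ (local₁ k) (local₂ k)) } } }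
        where
        both : ∀ k r₁ r₂ → _ → _ → ∃₂ λ e hs → 0 < e × length hs ≡.≡ r₁ ℕ.+ r₂ × All (OrdR n 1) hs ×
          ∀ i (A : Alg κ) (η : Hom (R n) A) → Kills n η k hs → Alg._≈_ A (Hom.⟦_⟧ η (pow R.comRing t e R.* f̃ i)) (Alg.0# A)
        both k r₁ r₂ (E₁ , hs₁ , p₁ , len₁ , o₁ , h₁) (E₂ , hs₂ , p₂ , len₂ , o₂ , h₂) = E₁ ℕ.+ E₂ , hs₁ List.++ hs₂ , ℕP.≤-trans p₁ (ℕP.m≤m+n E₁ E₂) ,
            ≡.trans (length-++ hs₁) (≡.cong₂ ℕ._+_ len₁ len₂) , AllP.++⁺ o₁ o₂ , λ
            { (inj₁ C) A η (ks , kh) → absorb A η E₂ E₁ _ (R.reflexive (≡.cong (pow R.comRing t) (ℕP.+-comm E₁ E₂))) (h₁ A η (ks , AllP.++⁻ˡ hs₁ kh) C)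
            ; (inj₂ C) A η (ks , kh) → absorb A η E₁ E₂ _ R.refl (h₂ A η (ks , AllP.++⁻ʳ hs₁ kh) C) }
          where
          absorb : ∀ (A : Alg κ) (η : Hom (R n) A) E E′ y {T} → T R.≈ pow R.comRing t (E ℕ.+ E′) → Alg._≈_ A (Hom.⟦_⟧ η (pow R.comRing t E′ R.* y)) (Alg.0# A) → Alg._≈_ A (Hom.⟦_⟧ η (T R.* y)) (Alg.0# A)
          absorb A η E E′ y eq h = Alg.trans A (Hom.⟦⟧-cong η (R.trans (R.*-congʳ (R.trans eq (Powers.pow-+ R.comRing t E E′))) (R.*-assoc _ _ _)))
            (Alg.trans A (Hom.⟦⟧-* η _ _) (Alg.trans A (Alg.*-congˡ A h) (Alg.zeroʳ A _)))

    -- `j` has to be small enough for two chains of length at most `j` to satisfy `α + γ ≤ n₀`, and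
    -- large enough for loci of codimension `ρ - j` to contain a nonzero point.
    no-pencil : ∀ j → j ℕ.+ j ≤ n₀ → (∃ λ r → r ℕ.+ j ≡.≡ ρ × r < n) → (∀ r → r ℕ.+ n₀ ≡.≡ ρ → r ℕ.+ r < n) → ⊥
    no-pencil j 2j≤n few small = dependent-point u N j few λ { (x₁ , x₁≉0 , α , α≤j , s₁) → dependent-point v (transpose N) j few λ { (x₂ , x₂≉0 , γ , γ≤j , s₂) →
      two-points x₁ x₂ α γ (ℕP.≤-trans (ℕP.+-mono-≤ α≤j γ≤j) 2j≤n) x₁≉0 x₂≉0 s₁ s₂ small } }

-- Excluding a constant part of corank at least two

module Corank where
  open RS
  open Lin
  open LA
  open KAlg
  open Link using (module Naturality)
  open Span
  open Order
  open Forms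
  open Deform
  open Gauge
  open Chain
  open Local
  open import Defs using (pow; natCast)
  open import Level using (_⊔_; Lift; lift; lower)
  open import Algebra.Bundles using (CommutativeRing)
  open import Data.Nat as ℕ using (ℕ; zero; suc; _<_)
  import Data.Nat.Properties as ℕP
  open import Data.Fin using (Fin; zero; suc)
  open import Data.Vec using (Vec; []; _∷_; lookup; tabulate)
  open import Data.Vec.Properties using (lookup∘tabulate; tabulate-∘)
  open import Data.List using ([]; _∷_; length)
  open import Data.List.Relation.Unary.All using (All; []; _∷_)
  open import Data.Product using (_×_; _,_; ∃; ∃₂; proj₁; proj₂)
  open import Data.Empty using (⊥)
  open import Relation.Nullary using (¬_)
  import Relation.Binary.PropositionalEquality as ≡

  module TwoColumns {a ℓ} (A : CommutativeRing a ℓ) where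
    open CommutativeRing A using (_≈_; _+_; _*_; -_; _-_; 0#; refl; sym; trans; setoid; +-congˡ; +-congʳ; *-congˡ; +-identityˡ; *-assoc; zeroˡ)
    open IntegerSolver A using (solve; _:=_; _:+_; _:*_; _:-_; :-_)
    open Vectors A using (V; _+v_; _•_; _·_; Σ-∷; ·-+ʳ; ·-•ʳ; comb)
    open Alternating A hiding (I)
    open import Relation.Binary.Reasoning.Setoid setoid using (begin_; _∎; step-≈-⟩)

    -- Modulo the other columns the first two are replaced by multiples of `X`, which gives a factor
    -- `X²`. A determinant along a line then has no linear coefficient, up to `T²`.
    divisible-columns : ∀ {m k} {f : Form m (suc (suc k))} → Alt (suc (suc k)) f → ∀ T X (c₀ c₁ d₀ d₁ : V m) (z₀ z₁ : V k) cs →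
      (∀ i → T * c₀ i ≈ X * d₀ i + comb z₀ (lookup cs) i) → (∀ i → T * c₁ i ≈ X * d₁ i + comb z₁ (lookup cs) i) →
      (T * T) * f (c₀ ∷ c₁ ∷ cs) ≈ X * (X * f (d₀ ∷ d₁ ∷ cs))
    divisible-columns {f = f} alt T X c₀ c₁ d₀ d₁ z₀ z₁ cs h₀ h₁ = begin
      (T * T) * f (c₀ ∷ c₁ ∷ cs) ≈⟨ trans (*-assoc _ _ _) (*-congˡ (sym (head-• alt T c₀ _))) ⟩
      T * f ((T • c₀) ∷ c₁ ∷ cs) ≈⟨ *-congˡ (head-cong alt _ (λ i → trans (h₀ i) (+-congˡ (sym (trans (Σ-∷ _) (trans (+-congʳ (zeroˡ _)) (+-identityˡ _))))))) ⟩
      T * f ((X • d₀ +v comb (extend z₀) (lookup (c₁ ∷ cs))) ∷ c₁ ∷ cs) ≈⟨ *-congˡ (add-tail alt (X • d₀) (extend z₀) (c₁ ∷ cs)) ⟩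
      T * f ((X • d₀) ∷ c₁ ∷ cs) ≈⟨ *-congˡ (head-• alt X d₀ _) ⟩
      T * (X * f (d₀ ∷ c₁ ∷ cs)) ≈⟨ solve 3 (λ T X y → T :* (X :* y) := X :* (T :* y)) refl _ _ _ ⟩
      X * (T * f (d₀ ∷ c₁ ∷ cs)) ≈⟨ *-congˡ (sym (head-• (tail-alt alt d₀) T c₁ cs)) ⟩
      X * f (d₀ ∷ (T • c₁) ∷ cs) ≈⟨ *-congˡ (trans (head-cong (tail-alt alt d₀) cs h₁) (add-tail (tail-alt alt d₀) (X • d₁) z₁ cs)) ⟩
      X * f (d₀ ∷ (X • d₁) ∷ cs) ≈⟨ *-congˡ (head-• (tail-alt alt d₀) X d₁ cs) ⟩
      X * (X * f (d₀ ∷ d₁ ∷ cs)) ∎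
      where
      extend : ∀ {k} → V k → V (suc k)
      extend z zero = 0#
      extend z (suc i) = z i

    -- A relation among the entries at the base point of the line continues along the line with an
    -- error divisible by `X`.
    along-line : ∀ {k} T X c g (z cs gs : V k) → T * c ≈ z · cs →
      T * (c + X * g) ≈ X * (T * g - z · gs) + z · (λ b → cs b + X * gs b)
    along-line T X c g z cs gs h = trans (solve 4 (λ T X c g → T :* (c :+ X :* g) := T :* c :+ X :* (T :* g)) refl T X c g) (trans (+-congʳ h)
      (trans (solve 4 (λ X g w v → v :+ X :* g := X :* (g :- w) :+ (v :+ X :* w)) refl X (T * g) (z · gs) (z · cs))
        (+-congˡ (sym (trans (·-+ʳ z cs (λ b → X * gs b)) (+-congˡ (·-•ʳ X z gs)))))))

  module Singular {c ℓ} (K : CommutativeRing c (c ⊔ ℓ)) (F : StableField K) (char0 : ∀ k → ¬ (CommutativeRing._≈_ K (natCast K (suc k)) (CommutativeRing.0# K))) where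
    private
      module K = CommutativeRing K using (Carrier; _≈_; _*_; -_; _-_; 0#; 1#; sym; trans; *-congˡ; *-identityʳ; zeroˡ; zeroʳ)
      κ = c ⊔ ℓ
    open Algebras K
    open Naturality K
    open OrderFiltration K
    open Deformation {c} {ℓ} K F
    open HomogeneousForms K
    open Pencils K F
    open NormalForms K F
    open Vectors K using (V; _·_; δ)
    open Blocks K using (block; block-left; block-right)
    open StableField F

    seriesMap : ∀ {A A′ : Alg κ} → Hom A A′ → Hom (PS A) (PS A′)
    seriesMap {A} {A′} φ = record
      { ⟦_⟧ = λ p k → ⟦ p k ⟧ ; ⟦⟧-cong = λ h k → ⟦⟧-cong (h k) ; ⟦⟧-+ = λ _ _ k → ⟦⟧-+ _ _ ; ⟦⟧-* = conv-map
      ; ⟦⟧-ι = λ { a zero → ⟦⟧-ι a ; a (suc k) → ⟦⟧-0 } }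
      where
      open Hom φ using (⟦_⟧; ⟦⟧-cong; ⟦⟧-+; ⟦⟧-*; ⟦⟧-ι; ⟦⟧-0)
      module A′ = Alg A′ using (comRing; _≈_; trans; +-cong)
      conv-map : ∀ p q k → ⟦ PowerSeries.conv (Alg.comRing A) p q k ⟧ A′.≈ PowerSeries.conv A′.comRing (λ j → ⟦ p j ⟧) (λ j → ⟦ q j ⟧) k
      conv-map p q zero = ⟦⟧-* _ _
      conv-map p q (suc k) = A′.trans (⟦⟧-+ _ _) (A′.+-cong (⟦⟧-* _ _) (conv-map (λ j → p (suc j)) q k))

    natCast-ι : ∀ (A : Alg κ) k → Alg._≈_ A (Alg.ι A (natCast K k)) (natCast (Alg.comRing A) k)
    natCast-ι A zero = Hom.⟦⟧-0 (ιHom A)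
    natCast-ι A (suc k) = Alg.trans A (Alg.ι-+ A _ _) (Alg.+-cong A (Alg.ι-1 A) (natCast-ι A k))

    module _ {n₀ s ρ : ℕ} (T : Fin (suc (suc s) ℕ.+ ρ) → Fin (suc (suc s) ℕ.+ ρ) → V (suc (suc n₀))) (a : K.Carrier) (a≉0 : ¬ (a K.≈ K.0#))
        (rep : Represents (λ i j → block (suc (suc s)) j K.* δ i j) T a (powerSumLaw (suc (suc n₀)))) where
      private
        n q m : ℕ
        n = suc (suc n₀)
        q = s ℕ.+ ρ
        m = suc (suc q)
        D : Fin m → Fin m → K.Carrier
        D i j = block (suc (suc s)) j K.* δ i j
        filler : V m
        filler zero = K.0#
        filler (suc zero) = K.0#
        filler (suc (suc b)) = K.1# K.- block s b

        -- The zeros of the constant part beyond the first two are replaced by t.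
        mat : (A : Alg κ) → Alg.Carrier A → (Fin n → Alg.Carrier A) → Fin m → Fin m → Alg.Carrier A
        mat A t x i j = Alg._+_ A (Alg._+_ A (Alg.ι A (D i j)) (Alg._*_ A t (Alg.ι A (filler j K.* δ i j)))) (lin (T i j) A x)

        mat-hom : ∀ {A A′ : Alg κ} (φ : Hom A A′) t x i j → Alg._≈_ A′ (Hom.⟦_⟧ φ (mat A t x i j)) (mat A′ (Hom.⟦_⟧ φ t) (λ k → Hom.⟦_⟧ φ (x k)) i j)
        mat-hom {A} {A′} φ t x i j = A′.trans (⟦⟧-+ _ _) (A′.+-cong (A′.trans (⟦⟧-+ _ _) (A′.+-cong (⟦⟧-ι _) (A′.trans (⟦⟧-* t _) (A′.*-congˡ (⟦⟧-ι _))))) (lin-hom (T i j) φ x))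
          where
          open Hom φ using (⟦⟧-+; ⟦⟧-*; ⟦⟧-ι)
          module A′ = Alg A′ using (trans; +-cong; *-congˡ)

        mat-cong : ∀ (A : Alg κ) {t t′ x x′} i j → Alg._≈_ A t t′ → (∀ k → Alg._≈_ A (x k) (x′ k)) → Alg._≈_ A (mat A t x i j) (mat A t′ x′ i j)
        mat-cong A i j h g = Alg.+-cong A (Alg.+-congˡ A (Alg.*-congʳ A h)) (law-cong (form-lin (T i j)) A g)

        cols : ∀ (A : Alg κ) → Alg.Carrier A → (Fin n → Alg.Carrier A) → Vec (Fin m → Alg.Carrier A) m
        cols A t x = tabulate (λ j i → mat A t x i j)

        detLaw : ∀ (A : Alg κ) → Alg.Carrier A → (Fin n → Alg.Carrier A) → Alg.Carrier A
        detLaw A t x = Alternating.det (Alg.comRing A) (cols A t x)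

        det-entries : ∀ (A : Alg κ) (M M′ : Fin m → Fin m → Alg.Carrier A) → (∀ i j → Alg._≈_ A (M i j) (M′ i j)) →
          Alg._≈_ A (Alternating.det (Alg.comRing A) (tabulate (λ j i → M i j))) (Alternating.det (Alg.comRing A) (tabulate (λ j i → M′ i j)))
        det-entries A M M′ h = Alternating.alt-cong (Alg.comRing A) (Alternating.det-alt (Alg.comRing A)) {tabulate (λ j i → M i j)} {tabulate (λ j i → M′ i j)} (λ j i →
          Alg.trans A (Alg.reflexive A (≡.cong (λ (v : Fin m → Alg.Carrier A) → v i) (lookup∘tabulate (λ j i → M i j) j)))
            (Alg.trans A (h i j) (Alg.reflexive A (≡.cong (λ (v : Fin m → Alg.Carrier A) → v i) (≡.sym (lookup∘tabulate (λ j i → M′ i j) j))))))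

        detLaw-hom : ∀ {A A′ : Alg κ} (φ : Hom A A′) t x → Alg._≈_ A′ (Hom.⟦_⟧ φ (detLaw A t x)) (detLaw A′ (Hom.⟦_⟧ φ t) (λ k → Hom.⟦_⟧ φ (x k)))
        detLaw-hom {A} {A′} φ t x = Alg.trans A′ (hom-det φ (cols A t x)) (Alg.trans A′ (Alg.reflexive A′ (≡.cong (Alternating.det (Alg.comRing A′)) (≡.sym (tabulate-∘ (λ v i → Hom.⟦_⟧ φ (v i)) (λ j i → mat A t x i j)))))
          (det-entries A′ (λ i j → Hom.⟦_⟧ φ (mat A t x i j)) (mat A′ (Hom.⟦_⟧ φ t) (λ k → Hom.⟦_⟧ φ (x k))) (λ i j → mat-hom φ t x i j)))

        detLaw-cong : ∀ (A : Alg κ) {t t′ x x′} → Alg._≈_ A t t′ → (∀ k → Alg._≈_ A (x k) (x′ k)) → Alg._≈_ A (detLaw A t x) (detLaw A t′ x′)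
        detLaw-cong A {t} {t′} {x} {x′} h g = det-entries A (mat A t x) (mat A t′ x′) (λ i j → mat-cong A i j h g)

        line : ∀ (A : Alg κ) → Fin n → (Fin n → Alg.Carrier A) → Fin n → Alg.Carrier (PS A)
        line A k x i = Alg._+_ (PS A) (PowerSeries.cst (Alg.comRing A) (x i)) (Alg._*_ (PS A) (PowerSeries.X (Alg.comRing A)) (PowerSeries.cst (Alg.comRing A) (Alg.ι A (δ k i))))

        -- The partial derivative of the perturbed determinant, read off as the linear coefficient
        -- along a coordinate line; it makes sense in every algebra.
        derivative : Fin n → ∀ (A : Alg κ) → Alg.Carrier A → (Fin n → Alg.Carrier A) → Alg.Carrier A
        derivative k A t x = detLaw (PS A) (PowerSeries.cst (Alg.comRing A) t) (line A k x) 1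

        derivative-hom : ∀ k {A A′ : Alg κ} (φ : Hom A A′) t x → Alg._≈_ A′ (Hom.⟦_⟧ φ (derivative k A t x)) (derivative k A′ (Hom.⟦_⟧ φ t) (λ i → Hom.⟦_⟧ φ (x i)))
        derivative-hom k {A} {A′} φ t x = Alg.trans A′ (detLaw-hom (seriesMap φ) (cst t) (line A k x) 1)
          (detLaw-cong (PS A′) (map-cst t) (λ i → S.trans (Hom.⟦⟧-+ (seriesMap φ) (cst (x i)) (Alg._*_ (PS A) X (cst (Alg.ι A (δ k i))))) (S.+-cong (map-cst (x i))
            (S.trans (Hom.⟦⟧-* (seriesMap φ) X (cst (Alg.ι A (δ k i)))) (S.*-cong map-X (S.trans (map-cst (Alg.ι A (δ k i))) (PowerSeries.cst-cong A′.comRing (⟦⟧-ι (δ k i)))))))) 1)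
          where
          open Hom φ using (⟦_⟧; ⟦⟧-ι; ⟦⟧-1; ⟦⟧-0)
          module A′ = Alg A′ using (comRing; refl)
          module S = Alg (PS A′) using (_≈_; trans; +-cong; *-cong)
          open PowerSeries (Alg.comRing A) using (cst; X)
          map-cst : ∀ y → Hom.⟦_⟧ (seriesMap φ) (cst y) S.≈ PowerSeries.cst A′.comRing ⟦ y ⟧
          map-cst y zero = A′.refl
          map-cst y (suc j) = ⟦⟧-0
          map-X : Hom.⟦_⟧ (seriesMap φ) X S.≈ PowerSeries.X A′.comRing
          map-X zero = ⟦⟧-0
          map-X (suc zero) = ⟦⟧-1
          map-X (suc (suc j)) = ⟦⟧-0

        derivative-at-0 : ∀ k (A : Alg κ) x → Alg._≈_ A (derivative k A (Alg.0# A) x) (Alg._*_ A (Alg.ι A (a K.* natCast K n)) (pow (Alg.comRing A) (x k) (suc n₀)))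
        derivative-at-0 k A x = trans (det-entries (PS A) (mat (PS A) (cst 0#) y) (λ i j → S.ι (D i j) S.+ lin (T i j) (PS A) y)
              (λ i j → S.+-congʳ (S.trans (S.+-congˡ (S.trans (S.*-congʳ cst-0) (S.zeroˡ _))) (S.+-identityʳ _))) 1)
            (trans (rep (PS A) y 1) (trans (conv-cst (ι a) (powerSumLaw n (PS A) y) 1) (trans (*-congˡ power)
              (trans (sym (*-assoc _ _ _)) (*-congʳ (trans (*-congˡ (sym (natCast-ι A n))) (sym (ι-* _ _))))))))
          where
          open Alg A using (comRing; ι; ι-*; _≈_; _*_; 0#; refl; sym; trans; +-congˡ; *-cong; *-congˡ; *-congʳ; +-identityˡ; +-identityʳ; *-assoc)
          module S = Alg (PS A) using (comRing; ι; _≈_; _+_; 0#; trans; +-congˡ; +-congʳ; *-congʳ; +-identityʳ; zeroˡ)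
          open Vectors comRing using (Σ-cong) renaming (_·_ to _∙_; ·-δ to ∙-δ)
          open PowerSeries comRing using (cst; X; conv-cst; conv-X-zero; conv-X-suc)
          open Series comRing using (coefficient-Σ; pow-derivative)
          y = line A k x
          cst-0 : cst 0# S.≈ S.0#
          cst-0 zero = refl
          cst-0 (suc j) = refl
          power : powerSumLaw n (PS A) y 1 ≈ natCast comRing n * pow comRing (x k) (suc n₀)
          power = trans (coefficient-Σ (λ i → pow S.comRing (y i) n) 1) (trans (Σ-cong (λ i → trans (pow-derivative (y i) (suc n₀))
              (*-cong (*-congˡ (Powers.pow-cong comRing (suc n₀) (trans (+-congˡ (conv-X-zero (cst (ι (δ k i))))) (+-identityʳ _))))
                (trans (+-identityˡ _) (trans (conv-X-suc (cst (ι (δ k i))) 0) (hom-δ (ιHom A) k i))))))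
            (∙-δ (λ i → natCast comRing n * pow comRing (x i) (suc n₀)) k))

        module _ (A : Alg κ) (t : Alg.Carrier A) (x : Fin n → Alg.Carrier A) (τ : Alg.Carrier A) (z₀ z₁ : Fin q → Alg.Carrier A) where
          open Alg A using (comRing; ι; Carrier; _≈_; _*_; 0#; sym; trans)
          open Vectors comRing using () renaming (_·_ to _∙_)
          derivative-vanishes : (∀ i → τ * mat A t x i zero ≈ z₀ ∙ (λ b → mat A t x i (suc (suc b)))) → (∀ i → τ * mat A t x i (suc zero) ≈ z₁ ∙ (λ b → mat A t x i (suc (suc b)))) →
            ∀ k → (τ * τ) * derivative k A t x ≈ 0#
          derivative-vanishes h₀ h₁ k = trans (sym (conv-cst (τ * τ) (detLaw (PS A) (cst t) y) 1)) (trans (S.*-congʳ {detLaw (PS A) (cst t) y} (cst-* τ τ) 1)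
              (trans (divisible-columns det-alt (cst τ) X (λ i → mat (PS A) (cst t) y i zero) (λ i → mat (PS A) (cst t) y i (suc zero)) (d z₀ zero) (d z₁ (suc zero)) (λ b → cst (z₀ b)) (λ b → cst (z₁ b)) cs
                  (column z₀ zero h₀) (column z₁ (suc zero) h₁) 1)
                (trans (conv-X-suc (X S.* det (d z₀ zero ∷ d z₁ (suc zero) ∷ cs)) 0) (conv-X-zero (det (d z₀ zero ∷ d z₁ (suc zero) ∷ cs))))))
            where
            module S = Alg (PS A) using (comRing; ι; Carrier; _≈_; _+_; _*_; -_; _-_; sym; trans; reflexive; +-cong; +-congˡ; +-congʳ; *-congˡ; *-congʳ; +-assoc)
            module VS = Vectors S.comRing using (_·_; Σ-cong; ·-+ʳ; ·-•ʳ; comb)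
            open Alternating S.comRing using (det; det-alt)
            open PowerSeries comRing using (cst; X; cst-*; cst-cong; conv-cst; conv-X-zero; conv-X-suc)
            open TwoColumns S.comRing using (divisible-columns; along-line)
            y = line A k x
            g : Fin m → Fin m → S.Carrier
            g i j = cst (lin (T i j) A (λ l → ι (δ k l)))
            cs : Vec (Fin m → S.Carrier) q
            cs = tabulate (λ b i → mat (PS A) (cst t) y i (suc (suc b)))
            d : (Fin q → Carrier) → Fin m → Fin m → S.Carrier
            d z j i = cst τ S.* g i j S.- (λ b → cst (z b)) VS.· (λ b → g i (suc (suc b)))
            entry : ∀ i j → mat (PS A) (cst t) y i j S.≈ cst (mat A t x i j) S.+ X S.* g i j
            entry i j = S.trans (S.+-congˡ (S.trans (VS.·-+ʳ (λ l → S.ι (T i j l)) (λ l → cst (x l)) _) (S.+-cong (S.sym (hom-· (cstHom A) (λ l → ι (T i j l)) x))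
                (S.trans (VS.·-•ʳ X (λ l → S.ι (T i j l)) (λ l → cst (ι (δ k l)))) (S.*-congˡ (S.sym (hom-· (cstHom A) (λ l → ι (T i j l)) (λ l → ι (δ k l)))))))))
              (S.trans (S.sym (S.+-assoc _ _ _)) (S.+-congʳ (S.sym (S.trans (Hom.⟦⟧-+ (cstHom A) _ _) (S.+-congʳ (S.trans (Hom.⟦⟧-+ (cstHom A) _ _) (S.+-congˡ (Hom.⟦⟧-* (cstHom A) t _))))))))
            column : ∀ z j → (∀ i → τ * mat A t x i j ≈ z ∙ (λ b → mat A t x i (suc (suc b)))) → ∀ i →
              cst τ S.* mat (PS A) (cst t) y i j S.≈ X S.* d z j i S.+ VS.comb (λ b → cst (z b)) (lookup cs) i
            column z j h i = S.trans (S.*-congˡ (entry i j)) (S.trans (along-line (cst τ) X (cst (mat A t x i j)) (g i j) (λ b → cst (z b)) (λ b → cst (mat A t x i (suc (suc b)))) (λ b → g i (suc (suc b)))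
                (S.trans (S.sym (Hom.⟦⟧-* (cstHom A) τ _)) (S.trans (cst-cong (h i)) (hom-· (cstHom A) z _))))
              (S.+-congˡ (VS.Σ-cong (λ b → S.*-congˡ {cst (z b)} (S.trans (S.sym (entry i (suc (suc b)))) (S.reflexive (≡.cong (λ (v : Fin m → S.Carrier) → v i) (≡.sym (lookup∘tabulate (λ b i → mat (PS A) (cst t) y i (suc (suc b))) b)))))))))

        module R = Alg (R n) using (comRing; ι; ι-cong; ι-*; Carrier; _≈_; _+_; _*_; -_; _-_; sym; trans; +-cong; +-congʳ; *-cong; *-congˡ; +-identityˡ; *-assoc; *-identityʳ; zeroʳ; distribʳ)
        module VR = Vectors R.comRing using (_·_; δ)
        t : R.Carrier
        t = Xs {suc n} zero
        xs : Fin n → R.Carrier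
        xs i = Xs {suc n} (suc i)
        open module Inv = Inversion R.comRing (ordIdeal n) (λ x j → ord-0 n (x j)) (λ k → ordR-* n 1 k) using (δ-swap; J-·; J-minus; quasi-inverse)
        M : Fin m → Fin m → R.Carrier
        M = mat (R n) t xs

        lin-small : ∀ (s : V n) → OrdR n 1 (lin s (R n) xs)
        lin-small s = J-· 1 (λ k → R.ι (s k)) small
          where
          small : ∀ i → OrdR n 1 (xs i)
          small i zero = ord-Xs n i
          small i (suc j) = ord-zero n 1

        -- Entries of `block` are 0 or 1, so one of the two functions takes the value `t` and the
        -- other the value `1` at each index.
        diagonal diagonal′ : Fin q → R.Carrier
        diagonal b = R.ι (block s b) R.+ t R.* R.ι (K.1# K.- block s b)
        diagonal′ b = t R.* R.ι (block s b) R.+ R.ι (K.1# K.- block s b)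

        diagonal-product : ∀ b → diagonal b R.* diagonal′ b R.≈ t
        diagonal-product b = abstractly (R n) (block s b) t (Fin-case s (λ b → block s b K.* block s b K.≈ block s b)
            (λ i → K.trans (K.*-congˡ (block-left ρ i)) (K.trans (K.zeroʳ _) (K.sym (block-left ρ i))))
            (λ j → K.trans (K.*-congˡ (block-right s j)) (K.*-identityʳ _)) b)
          where
          abstractly : ∀ (A : Alg κ) β t → β K.* β K.≈ β → Alg._≈_ A (Alg._*_ A (Alg._+_ A (Alg.ι A β) (Alg._*_ A t (Alg.ι A (K.1# K.- β)))) (Alg._+_ A (Alg._*_ A t (Alg.ι A β)) (Alg.ι A (K.1# K.- β)))) t
          abstractly A β t idem = begin
            (ι β + t * ι (K.1# K.- β)) * (t * ι β + ι (K.1# K.- β)) ≈⟨ *-cong (+-congˡ (*-congˡ co)) (+-congˡ co) ⟩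
            (ι β + t * (1# - ι β)) * (t * ι β + (1# - ι β)) ≈⟨ solve 2 (λ b t → (b :+ t :* (:1 :- b)) :* (t :* b :+ (:1 :- b)) := t :+ (b :* b :- b) :* (t :+ t :- t :* t :- :1)) refl (ι β) t ⟩
            t + (ι β * ι β - ι β) * (t + t - t * t - 1#) ≈⟨ +-congˡ (trans (*-congʳ (trans (+-congʳ (trans (sym (ι-* β β)) (ι-cong idem))) (-‿inverseʳ _))) (zeroˡ _)) ⟩
            t + 0# ≈⟨ +-identityʳ _ ⟩
            t ∎
            where
            open Alg A using (comRing; ι; ι-cong; ι-*; ι-1; _≈_; _+_; _*_; -_; _-_; 0#; 1#; refl; sym; trans; setoid; +-congˡ; +-congʳ; *-cong; *-congˡ; *-congʳ; +-identityʳ; zeroˡ; -‿inverseʳ)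
            open IntegerSolver comRing using (solve; _:=_; _:+_; _:*_; _:-_; :-_; :1)
            open import Relation.Binary.Reasoning.Setoid setoid using (begin_; _∎; step-≈-⟩)
            co : ι (K.1# K.- β) ≈ 1# - ι β
            co = trans (Hom.⟦⟧-minus (ιHom A) K.1# β) (+-congʳ ι-1)


        inner : ∀ i j → M (suc (suc i)) (suc (suc j)) R.≈ VR.δ i j R.* diagonal i R.+ lin (T (suc (suc i)) (suc (suc j))) (R n) xs
        inner i j = R.+-congʳ (R.trans (R.+-cong (R.trans (R.ι-* _ _) (R.*-congˡ (hom-δ (ιHom (R n)) i j))) (R.trans (R.*-congˡ (R.trans (R.ι-* _ _) (R.*-congˡ (hom-δ (ιHom (R n)) i j)))) (R.sym (R.*-assoc _ _ _))))
          (R.trans (R.sym (R.distribʳ _ _ _)) (δ-swap i j diagonal)))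

        off-block : ∀ i j → D i j K.≈ K.0# → filler j K.* δ i j K.≈ K.0# → OrdR n 1 (M i j)
        off-block i j h g = Inv.J.resp 1 (R.sym (R.trans (R.+-congʳ (R.trans (R.+-cong (R.trans (R.ι-cong h) (Hom.⟦⟧-0 (ιHom (R n)))) (R.trans (R.*-congˡ (R.trans (R.ι-cong g) (Hom.⟦⟧-0 (ιHom (R n))))) (R.zeroʳ t))) (R.+-identityˡ _)))
          (R.+-identityˡ _))) (lin-small (T i j))

        top : Fin 2 → Fin m
        top zero = zero
        top (suc zero) = suc zero

        top-left : ∀ i j → OrdR n 1 (M (top i) (top j))
        top-left i zero = off-block (top i) zero (K.zeroˡ _) (K.zeroˡ _)
        top-left i (suc zero) = off-block (top i) (suc zero) (K.zeroˡ _) (K.zeroˡ _)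

        top-right : ∀ i b → OrdR n 1 (M (top i) (suc (suc b)))
        top-right zero b = off-block zero (suc (suc b)) (K.zeroʳ _) (K.zeroʳ _)
        top-right (suc zero) b = off-block (suc zero) (suc (suc b)) (K.zeroʳ _) (K.zeroʳ _)

        module _ (k : ℕ) where
          private
            solved : ∀ j → ∃₂ λ (z r : Fin q → R.Carrier) → (∀ b → (λ b′ → M (suc (suc b)) (suc (suc b′))) VR.· z R.+ r b R.≈ pow R.comRing (pow R.comRing t 1) k R.* M (suc (suc b)) (top j)) × (∀ b → OrdR n k (r b))
            solved j = quasi-inverse (λ b b′ → M (suc (suc b)) (suc (suc b′))) (λ b b′ → lin (T (suc (suc b)) (suc (suc b′))) (R n) xs) diagonal diagonal′ (pow R.comRing t 1)
              inner (λ b b′ → lin-small _) (λ b → R.trans (diagonal-product b) (R.sym (R.*-identityʳ t))) k (λ b → M (suc (suc b)) (top j))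
            z : Fin 2 → Fin q → R.Carrier
            z j = proj₁ (solved j)
            τ : R.Carrier
            τ = pow R.comRing (pow R.comRing t 1) k
            -- Up to the factor `τ` and an error of order `k`, the 2 by 2 Schur complement of the
            -- inner block; its entries are the four equations.
            h : Fin 2 → Fin 2 → R.Carrier
            h i j = τ R.* M (top i) (top j) R.- z j VR.· (λ b → M (top i) (suc (suc b)))
            h-small : ∀ i j → OrdR n 1 (h i j)
            h-small i j = J-minus 1 (Inv.J.mulM 1 τ (top-left i j)) (J-· 1 (z j) (top-right i))

          -- Where the four equations vanish, `τ` times each of the first two columns is a
          -- combination of the others, so `τ²` annihilates every partial derivative.
          local : 0 < k → ∃₂ λ E hs → 0 < E × length hs ≡.≡ 4 × All (OrdR n 1) hs ×
            ∀ (i : Lift c (Fin n)) (A : Alg κ) (η : Hom (R n) A) → Kills n η k hs → Alg._≈_ A (Hom.⟦_⟧ η (pow R.comRing t E R.* derivative (lower i) (R n) t xs)) (Alg.0# A)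
          local 0<k = k ℕ.* 1 ℕ.+ k ℕ.* 1 , h zero zero ∷ h zero (suc zero) ∷ h (suc zero) zero ∷ h (suc zero) (suc zero) ∷ [] ,
            ℕP.≤-trans (ℕP.≤-trans 0<k (ℕP.≤-reflexive (≡.sym (ℕP.*-identityʳ k)))) (ℕP.m≤m+n _ _) , ≡.refl ,
            h-small zero zero ∷ h-small zero (suc zero) ∷ h-small (suc zero) zero ∷ h-small (suc zero) (suc zero) ∷ [] ,
            λ i A η ks → vanish (lower i) A η ks
            where
            vanish : ∀ i (A : Alg κ) (η : Hom (R n) A) → Kills n η k (h zero zero ∷ h zero (suc zero) ∷ h (suc zero) zero ∷ h (suc zero) (suc zero) ∷ []) →
              Alg._≈_ A (Hom.⟦_⟧ η (pow R.comRing t (k ℕ.* 1 ℕ.+ k ℕ.* 1) R.* derivative i (R n) t xs)) (Alg.0# A)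
            vanish i A η (kills , h₀₀ ∷ h₀₁ ∷ h₁₀ ∷ h₁₁ ∷ []) = A.trans (⟦⟧-* _ _) (A.trans (A.*-cong
                (A.trans (⟦⟧-cong (R.trans (Powers.pow-+ R.comRing t (k ℕ.* 1) (k ℕ.* 1)) (R.*-cong (R.sym (Powers.pow-* R.comRing t 1 k)) (R.sym (Powers.pow-* R.comRing t 1 k))))) (⟦⟧-* τ τ))
                (derivative-hom i η t xs))
              (derivative-vanishes A ⟦ t ⟧ (λ l → ⟦ xs l ⟧) ⟦ τ ⟧ (λ b → ⟦ z zero b ⟧) (λ b → ⟦ z (suc zero) b ⟧) (relation zero h₀₀ h₁₀) (relation (suc zero) h₀₁ h₁₁) i))
              where
              module A = Alg A using (comRing; _≈_; _*_; -_; _-_; 0#; refl; sym; trans; +-cong; +-congʳ; *-cong; *-congˡ; -‿cong; +-identityˡ; +-identityʳ)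
              open Hom η using (⟦_⟧; ⟦⟧-cong; ⟦⟧-+; ⟦⟧-*; ⟦⟧-minus)
              module VA = Vectors A.comRing using (_·_; ·-cong; ·-comm)
              from-difference : ∀ x y → x A.- y A.≈ A.0# → x A.≈ y
              from-difference x y e = A.trans (solve 2 (λ x y → x := (x :- y) :+ y) A.refl x y) (A.trans (A.+-congʳ e) (A.+-identityˡ _))
                where open IntegerSolver A.comRing
              upper : ∀ i j → ⟦ h i j ⟧ A.≈ A.0# → ⟦ τ ⟧ A.* mat A ⟦ t ⟧ (λ l → ⟦ xs l ⟧) (top i) (top j) A.≈ (λ b → ⟦ z j b ⟧) VA.· (λ b → mat A ⟦ t ⟧ (λ l → ⟦ xs l ⟧) (top i) (suc (suc b)))
              upper i j e = from-difference _ _ (A.trans (A.sym (A.trans (⟦⟧-minus _ _) (A.+-cong (A.trans (⟦⟧-* _ _) (A.*-congˡ (mat-hom η t xs (top i) (top j))))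
                (A.-‿cong (A.trans (hom-· η (z j) _) (VA.·-cong (λ _ → A.refl) (λ b → mat-hom η t xs (top i) (suc (suc b))))))))) e)
              lower′ : ∀ b j → ⟦ τ ⟧ A.* mat A ⟦ t ⟧ (λ l → ⟦ xs l ⟧) (suc (suc b)) (top j) A.≈ (λ b → ⟦ z j b ⟧) VA.· (λ b′ → mat A ⟦ t ⟧ (λ l → ⟦ xs l ⟧) (suc (suc b)) (suc (suc b′)))
              lower′ b j = A.trans (A.*-congˡ (A.sym (mat-hom η t xs (suc (suc b)) (top j)))) (A.trans (A.sym (⟦⟧-* τ _)) (A.trans (⟦⟧-cong (R.sym (proj₁ (proj₂ (proj₂ (solved j))) b)))
                (A.trans (⟦⟧-+ _ _) (A.trans (A.+-cong (A.trans (hom-· η _ (z j)) (A.trans (VA.·-comm _ _) (VA.·-cong (λ _ → A.refl) (λ b′ → mat-hom η t xs (suc (suc b)) (suc (suc b′)))))) (kills (proj₂ (proj₂ (proj₂ (solved j))) b))) (A.+-identityʳ _)))))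
              relation : ∀ j → ⟦ h zero j ⟧ A.≈ A.0# → ⟦ h (suc zero) j ⟧ A.≈ A.0# → ∀ i → ⟦ τ ⟧ A.* mat A ⟦ t ⟧ (λ l → ⟦ xs l ⟧) i (top j) A.≈ (λ b → ⟦ z j b ⟧) VA.· (λ b → mat A ⟦ t ⟧ (λ l → ⟦ xs l ⟧) i (suc (suc b)))
              relation j e₀ e₁ zero = upper zero j e₀
              relation j e₀ e₁ (suc zero) = upper (suc zero) j e₁
              relation j e₀ e₁ (suc (suc b)) = lower′ b j

      -- At `t = 0` the partial derivatives are nonzero multiples of `x_k^(n-1)`, so the powers of
      -- the variables are in the ideal directly, without the Nullstellensatz.
      corank-bound : 4 < suc (suc n₀) → ⊥
      corank-bound 4<n = invert (inverse coefficient (LinearAlgebra.nonzero-* K F a≉0 (char0 (suc n₀))))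
        where
        coefficient : K.Carrier
        coefficient = a K.* natCast K n
        f : Lift c (Fin n) → Law n
        f (lift k) = const coefficient ⊠ powL (coord k) (suc n₀)
        open Family (λ _ → n₀) f
        head : ∀ i → Alg._≈_ (B n) (derivative (lower i) (R n) t xs 0) (f i (B n) Xs)
        head (lift k) = Alg.trans (B n) (derivative-hom k (headHom (B n)) t xs) (derivative-at-0 k (B n) Xs)
        invert : (∃ λ y → coefficient K.* y K.≈ K.1#) → ⊥
        invert (y , e) = family-bound {n} {4} 4<n (λ _ → n₀) f (λ i → derivative (lower i) (R n) t xs) head (suc n₀)
          (λ j → in-resp (λ A x → cancel A (powL (coord j) (suc n₀) A x)) (in-scale y (in-generator (lift j)))) local
          where
          cancel : ∀ A X → Alg._≈_ A (Alg._*_ A (Alg.ι A y) (Alg._*_ A (Alg.ι A coefficient) X)) X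
          cancel A X = trans (sym (*-assoc _ _ _)) (trans (*-congʳ (trans (*-comm _ _) (trans (sym (ι-* _ _)) (trans (ι-cong e) ι-1)))) (*-identityˡ X))
            where open Alg A

-- Horner form of the monic polynomials in the closure hypothesis

module Horner where
  open RS
  open import Defs
  open import Algebra.Bundles using (CommutativeRing)
  open import Data.Nat using (zero; suc)
  import Relation.Binary.PropositionalEquality as ≡
  open import Data.List using (List; []; _∷_)

  module _ {c ℓ} (R : CommutativeRing c ℓ) where
    open CommutativeRing R using (Carrier; _≈_; _+_; _*_; 1#; refl; sym; trans; reflexive; +-cong; +-congˡ; *-congʳ; *-identityʳ)
    open IntegerSolver R using (solve; _:=_; _:+_; _:*_)

    horner : List Carrier → Carrier → Carrier
    horner [] x = 1#
    horner (a ∷ as) x = a + x * horner as x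

    mutual
      -- The left-hand side is the recursion local to evalMonic; it is found by unification in the next lemma.
      shifted-horner : ∀ ps x i as → _ ≈ pow R x i * horner as x

      evalMonic-horner : ∀ a as x → evalMonic R (a ∷ as) x ≈ a + x * horner as x
      -- Abstracting the list and the index turns the arguments of the hidden recursion into
      -- variables, so that the metavariable in `shifted-horner` is determined by unification.
      evalMonic-horner a as x with a ∷ as | suc zero in eq
      ... | ps | i = +-cong (*-identityʳ a) (trans (shifted-horner ps x i as)
        (*-congʳ (trans (reflexive (≡.cong (pow R x) (≡.sym eq))) (*-identityʳ x))))

      shifted-horner ps x i [] = sym (*-identityʳ _)
      shifted-horner ps x i (a ∷ as) = trans (+-congˡ (shifted-horner ps x (suc i) as))
        (solve 4 (λ a p x h → a :* p :+ x :* p :* h := p :* (a :+ x :* h)) refl a (pow R x i) x (horner as x))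

-- Assembly over the given field

module Final where
  open Lin
  open LA
  open KAlg
  open Link
  open NS using (module Monic)
  open Gauge
  open Chain
  open Bound
  open Corank
  open Horner
  open Span
  open import Defs
  open import Level using (lift; lower)
  open import Algebra.Bundles using (CommutativeRing)
  open import Data.Nat as ℕ using (ℕ; zero; suc; _<_; _≤_; s≤s; z≤n; _≤?_)
  import Data.Nat.Properties as ℕP
  import Data.Nat.Solver
  open import Data.Fin using (Fin; zero; suc)
  open import Data.Vec using (lookup)
  open import Data.Vec.Properties using (lookup∘tabulate)
  open import Data.List using ([]; _∷_; length)
  open import Data.Sum using (_⊎_; inj₁; inj₂)
  open import Data.Product using (_,_; ∃)
  open import Data.Empty using (⊥; ⊥-elim)
  open import Relation.Nullary using (¬_; yes; no)
  import Relation.Binary.PropositionalEquality as ≡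

  private module NSolver = Data.Nat.Solver.+-*-Solver

  module _ {c ℓ} (K₀ : CommutativeRing c ℓ) (closed : IsAlgClosedFieldChar0 K₀) where
    open Link.Link K₀ using (K; embed; det-columns; zeroMono)
    private
      module K₀ = CommutativeRing K₀
      module K = CommutativeRing K
    open IsAlgClosedFieldChar0 closed

    stableField : StableField K
    stableField = record
      { ¬¬-elim = λ h → lift (λ n → h (λ e → lower e n))
      ; 1≉0 = λ h → lower h nontrivial
      ; inverse = λ x x≉0 → invert x (inverse x (λ e → x≉0 (embed e))) }
      where
      invert : ∀ x → (∃ λ y → x K₀.* y K₀.≈ K₀.1#) → ∃ λ y → x K.* y K.≈ K.1#
      invert x (y , e) = y , embed e

    stable-char0 : ∀ k → ¬ (natCast K (suc k) K.≈ K.0#)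
    stable-char0 k h = lower h (λ e → char0 k (K₀.trans (K₀.reflexive (same (suc k))) e))
      where
      same : ∀ k → natCast K₀ k ≡.≡ natCast K k
      same zero = ≡.refl
      same (suc k) = ≡.cong (K₀.1# K₀.+_) (same k)

    open Algebras K
    open Monic K
    open StableField stableField

    root : Root
    root a as = convert (algClosed a as)
      where
      monic-at-1 : ∀ as ρ → horner K₀ as ρ K.≈ monic base as ρ K.1#
      monic-at-1 [] ρ = K.refl
      monic-at-1 (a ∷ as) ρ = K.+-cong (K.trans (K.sym (K.*-identityʳ a)) (K.*-congˡ (K.sym (Span.Powers.pow-1 K (suc (length as)))))) (K.*-congˡ (monic-at-1 as ρ))
      convert : (∃ λ x → evalMonic K₀ (a ∷ as) x K₀.≈ K₀.0#) → ∃ λ ρ → monic base (a ∷ as) ρ K.1# K.≈ K.0#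
      convert (ρ , e) = ρ , K.trans (K.sym (monic-at-1 (a ∷ as) ρ)) (embed (K₀.trans (K₀.sym (evalMonic-horner K₀ a as ρ)) e))

    open Pencils K stableField
    open NormalForms K stableField
    open Vectors K using (V; δ)
    open Blocks K using (block)

    module _ {n₀ m : ℕ} (4<n : 4 < suc (suc n₀)) (small : 2 ℕ.* m ℕ.+ 6 < 3 ℕ.* suc (suc n₀)) where
      private
        n : ℕ
        n = suc (suc n₀)

      -- If the constant part is the identity, the determinant is one at the origin, but the power
      -- sum vanishes there.
      invertible-at-origin : ∀ {ρ} (T : Fin ρ → Fin ρ → V n) a → ¬ Represents (λ i j → block zero j K.* δ i j) T a (powerSumLaw n)
      invertible-at-origin {ρ} T a rep = 1≉0 (K.trans (K.sym (Alternating.det-I K ρ)) (K.trans (Alternating.alt-cong K (Alternating.det-alt K)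
          {Alternating.I K ρ} {affineCols (λ i j → block zero j K.* δ i j) T base (λ _ → K.0#)} entry)
        (K.trans (rep base (λ _ → K.0#)) (K.trans (K.*-congˡ (Vectors.Σ-0 K (λ i → K.zeroˡ _))) (K.zeroʳ a)))))
        where
        entry : ∀ j i → lookup (Alternating.I K ρ) j i K.≈ lookup (affineCols (λ i j → block zero j K.* δ i j) T base (λ _ → K.0#)) j i
        entry j i = K.trans (Blocks.lookup-I K j i) (K.trans (Vectors.δ-sym K j i) (K.trans (K.sym (K.trans (K.+-cong (K.*-identityˡ _) (Vectors.·-0ʳ K _ (λ _ → K.refl))) (K.+-identityʳ _)))
          (K.reflexive (≡.cong (λ (v : V ρ) → v i) (≡.sym (lookup∘tabulate (λ j i → block zero j K.* δ i j K.+ Vectors._·_ K (T i j) (λ _ → K.0#)) j))))))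

      pencil-impossible : ∀ {ρ} → suc ρ ≡.≡ m → Pencil n₀ ρ → ⊥
      pencil-impossible {ρ} ≡.refl Π = split (ℕP.≤-total (suc ρ) n)
        where
        -- The negated bound `2m + 7 ≤ 3n`, rewritten with `m = ρ + 1` and `n = n₀ + 2`.
        2ρ+3≤3n₀ : 2 ℕ.* ρ ℕ.+ 3 ≤ 3 ℕ.* n₀
        2ρ+3≤3n₀ = ℕP.+-cancelˡ-≤ 6 _ _ (ℕP.≤-trans (ℕP.≤-reflexive (NSolver.solve 1 (λ ρ → NSolver.con 6 NSolver.:+ (NSolver.con 2 NSolver.:* ρ NSolver.:+ NSolver.con 3)
            NSolver.:= NSolver.con 1 NSolver.:+ (NSolver.con 2 NSolver.:* (NSolver.con 1 NSolver.:+ ρ) NSolver.:+ NSolver.con 6)) ≡.refl ρ))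
          (ℕP.≤-trans small (ℕP.≤-reflexive (NSolver.solve 1 (λ n → NSolver.con 3 NSolver.:* (NSolver.con 2 NSolver.:+ n) NSolver.:= NSolver.con 6 NSolver.:+ NSolver.con 3 NSolver.:* n) ≡.refl n₀))))
        few : ∀ r → r ℕ.+ n₀ ≡.≡ ρ → r ℕ.+ r < n
        few r eq = s≤s (ℕP.m≤n⇒m≤1+n (ℕP.+-cancelʳ-≤ (2 ℕ.* n₀) (r ℕ.+ r) n₀ (ℕP.≤-trans (ℕP.≤-reflexive
            (≡.trans (NSolver.solve 2 (λ r n → r NSolver.:+ r NSolver.:+ NSolver.con 2 NSolver.:* n NSolver.:= NSolver.con 2 NSolver.:* (r NSolver.:+ n)) ≡.refl r n₀) (≡.cong (2 ℕ.*_) eq)))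
          (ℕP.≤-trans (ℕP.m≤m+n _ 3) 2ρ+3≤3n₀))))
        split : suc ρ ≤ n ⊎ n ≤ suc ρ → ⊥
        -- Here the `ρ < n` equations `u = 0` already have a nonzero solution, so `j = 0` suffices.
        split (inj₁ ρ<n) = Bounds.no-pencil {c} {ℓ} K stableField root stable-char0 Π 0 z≤n (ρ , ℕP.+-identityʳ ρ , ρ<n) few
        split (inj₂ (s≤s n≤ρ)) = Bounds.no-pencil {c} {ℓ} K stableField root stable-char0 Π j
            (ℕP.+-cancelʳ-≤ (2 ℕ.* n₀) (j ℕ.+ j) n₀ (ℕP.≤-trans (ℕP.m≤m+n _ 5) (ℕP.≤-trans (ℕP.≤-reflexive
              (≡.trans (NSolver.solve 2 (λ j n → j NSolver.:+ j NSolver.:+ NSolver.con 2 NSolver.:* n NSolver.:+ NSolver.con 5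
                NSolver.:= NSolver.con 2 NSolver.:* (NSolver.con 1 NSolver.:+ n NSolver.:+ j) NSolver.:+ NSolver.con 3) ≡.refl j n₀) (≡.cong (λ l → 2 ℕ.* l ℕ.+ 3) j-eq))) 2ρ+3≤3n₀)))
            (suc n₀ , j-eq , ℕP.≤-refl) few
          where
          j : ℕ
          -- The smallest `j` for which the expected codimension `ρ - j` is less than `n`.
          j = ρ ℕ.∸ suc n₀
          j-eq : suc n₀ ℕ.+ j ≡.≡ ρ
          j-eq = ℕP.m+[n∸m]≡n n≤ρ

      -- The number of zeros on the normalised diagonal is the corank of the constant part; the
      -- values 0, 1 and at least 2 are excluded by three different arguments.
      no-normal-form : NormalForm m n (powerSumLaw n) → ⊥
      no-normal-form (zero , ρ , T , a , _ , _ , rep) = invertible-at-origin T a rep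
      no-normal-form (suc zero , ρ , T , a , size , a≉0 , rep) = pencil-impossible size (FromNormalForm.pencil T a rep a≉0)
      no-normal-form (suc (suc s) , ρ , T , a , _ , a≉0 , rep) = Singular.corank-bound {c} {ℓ} K stableField stable-char0 {n₀} {s} {ρ} T a a≉0 rep 4<n

    lower-bound : ∀ n → 6 ≤ n → ∀ m (M : Matrix K₀ n m) → (∀ i j → DegLe1 K₀ (M i j)) → _≈P_ K₀ (Det K₀ M) (powerSum K₀ n) → 3 ℕ.* n ≤ 2 ℕ.* m ℕ.+ 6
    lower-bound (suc (suc n₀)) (s≤s (s≤s 4≤n₀)) m M affine-entries determinant with 3 ℕ.* suc (suc n₀) ≤? 2 ℕ.* m ℕ.+ 6
    ... | yes bound = bound
    ... | no large = ⊥-elim (normal-form (λ i j → M i j (zeroMono n)) (λ i j k → M i j (unitMono K₀ k)) represents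
            (no-normal-form (s≤s (ℕP.m≤n⇒m≤1+n 4≤n₀)) (ℕP.≰⇒> large)))
      where
      n : ℕ
      n = suc (suc n₀)
      represents : Represents (λ i j → M i j (zeroMono n)) (λ i j k → M i j (unitMono K₀ k)) K.1# (powerSumLaw n)
      represents A x = Alg.trans A (det-columns M affine-entries determinant A x) (Alg.sym A (Alg.trans A (Alg.*-congʳ A (Alg.ι-1 A)) (Alg.*-identityˡ A _)))

open import Defs
open import Level using (Level)
open import Algebra.Bundles using (CommutativeRing)
open import Data.Nat using (ℕ; _≤_; _+_; _*_)

theorem1p1 : ∀ {c ℓ : Level} (K : CommutativeRing c ℓ) → IsAlgClosedFieldChar0 K →
  (n : ℕ) → 6 ≤ n → (m : ℕ) → (M : Matrix K n m) →
  (∀ i j → DegLe1 K (M i j)) →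
  _≈P_ K (Det K M) (powerSum K n) →
  3 * n ≤ 2 * m + 6
theorem1p1 K closed = Final.lower-bound K closed
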